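{- For every signed permutation $w$ and every $n\in\mathbb{N}$, $$|\mathcal{H}_n(w)|=\sum_{\lambda\ \text{strict},\ |\lambda|\le n} a^C_w(\lambda)\cdot|\mathrm{ShSet}_n(\lambda)|.$$
   Context: $\mathbb{N}=\{0,1,2,\dots\}$. $W_m$ is the group of bijections $w$ of $\{ -m,\dots,-1,1,\dots,m\}$ with $w(-i)=-w(i)$ (signed permutations), with Coxeter generators $s_0=(-1\ 1)$ and $s_i=(-i{ - }1\ \,{ - }i)(i\ \,i{+}1)$, $1\le i\le m-1$; $W_m\subset W_{m+1}$ naturally. The 0-Hecke product $\circ$ is the monoid structure on $W_m$ generated by the $s_i$ with relations $s_i\circ s_i=s_i$, $s_i\circ s_j=s_j\circ s_i$ ($|i-j|\ge2$), $s_i\circ s_{i+1}\circ s_i=s_{i+1}\circ s_i\circ s_{i+1}$ ($i>0$), $s_1\circ s_0\circ s_1\circ s_0=s_0\circ s_1\circ s_0\circ s_1$. $\mathcal{H}_n(w)$ is the set of words $(a_1,\dots,a_n)\in\mathbb{N}^n$ with $w=s_{a_1}\circ\cdots\circ s_{a_n}$ (0-Hecke expressions of length $n$). A strict partition is $\lambda=(\lambda_1>\dots>\lambda_k>0)$, $|\lambda|=\sum\lambda_i$, with shifted diagram $D_\lambda=\{(i,j):1\le i\le k,\ i\le j\le\lambda_i+i-1\}$ (row $i$, column $j$, rows numbered downward). $\mathrm{ShSet}_n(\lambda)$ is the set of fillings $T$ of $D_\lambda$ by nonempty sets that partition $\{1,\dots,n\}$ with $\max T_{ij}<\min T_{i+1,j}$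 and $\max T_{ij}<\min T_{i,j+1}$ whenever those cells exist. A sequence $r_1\dots r_k$ in $\mathbb{N}$ is unimodal if $r_1>\dots>r_j<\dots<r_k$ for some $j$. A strict decomposition tableau of shape $\lambda$ is a filling $T:D_\lambda\to\mathbb{N}$ with every row unimodal such that for any two consecutive rows $i,i+1$, writing $r_j=T_{i,j}$, $s_j=T_{i+1,j}$, none of the following occurs (for cells that exist): (i) $s_j\ge r_i$ for some $j$ ($r_i$ is the first entry of row $i$); (ii) $r_j\le s_{j'}<s_j$ with $j<j'$; (iii) $r_{j-1}<r_j$ and $s_j<s_{j'}\le r_j$ with $j<j'$; (iv)/(v) $s_j<r_{j'}\le r_j$ with $j'<j$. The reading word of a tableau with rows $R_1,\dots,R_k$ (top to bottom, each read left to right) is the concatenation $R_kR_{k-1}\cdots R_1$. $a^C_w(\lambda)$ is the number of strict decomposition tableaux of shape $\lambda$ whose reading word is a 0-Hecke expression for $w$.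
   Formalization: With (iv)/(v) read as the single pattern given, the identity fails (w = s_0 s_3 s_1 s_2, n = 5: 17 versus 19); (i)–(iii) and (iv) s_j < r_{j'} ≤ r_j (j' < j) are kept, and the pattern (v) s_j ≤ r_{j-1} < r_j is forbidden in addition. -}

module Defs where

open import Data.Fin as Fin using (Fin)
open import Data.Fin.Subset using (Subset; Nonempty) renaming (_∈_ to _∈ˢ_)
open import Data.Integer as ℤ using (ℤ; +_; -_; ∣_∣)
open import Data.List using (List; []; _∷_; _++_; length; lookup; map; filter; concat; reverse; tabulate; sum)
open import Data.List.Membership.Propositional using (_∈_)
open import Data.List.Membership.Propositional.Properties
open import Data.List.Properties using (∷-injectiveʳ)
open import Data.List.Relation.Unary.All as All using (All; []; _∷_)
open import Data.List.Relation.Unary.AllPairs using (AllPairs; []; _∷_)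
open import Data.List.Relation.Unary.Any using (here)
open import Data.List.Relation.Unary.Linked using (Linked)
open import Data.List.Relation.Unary.Linked.Properties using (AllPairs⇒Linked; Linked⇒AllPairs)
open import Data.List.Relation.Unary.Unique.Propositional using (Unique)
import Data.List.Relation.Unary.Unique.Propositional.Properties as Unique
open import Data.Nat using (ℕ; zero; suc; pred; _+_; _≤_; _<_; _>_; _≥_; _≤?_; z≤n; s≤s; s≤s⁻¹) renaming (∣_-_∣ to dist)
open import Data.Nat.Properties
open import Data.Product using (Σ; ∃; ∃-syntax; _×_; _,_; proj₁; proj₂)
open import Data.Sum using (inj₁; inj₂)
open import Data.Vec using (Vec; toList)
open import Function using (_∘_; id; _⇔_; mk⇔; Inverse; _↔_)
open import Level using (0ℓ)
open import Relation.Binary using (Setoid)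
import Relation.Binary.Construct.On as On
open import Relation.Binary.PropositionalEquality using (_≡_; refl; cong; setoid; _→-setoid_)
open import Relation.Nullary using (¬_; yes; no; contradiction)

------------------------------------------------------------------------
-- Cardinality

-- The members of S satisfying P, compared without their proofs of P.
Restrict : (S : Setoid 0ℓ 0ℓ) → (Setoid.Carrier S → Set) → Setoid 0ℓ 0ℓ
Restrict S P = On.setoid {B = Σ (Setoid.Carrier S) P} S proj₁

HasCard : Setoid 0ℓ 0ℓ → ℕ → Set
HasCard S k = Inverse S (setoid (Fin k))

------------------------------------------------------------------------
-- Signed permutations

-- Elements of W_m are extended to ℤ by the identity outside
-- {-m,…,-1,1,…,m}, so that the inclusions W_m ⊂ W_{m+1} do not change the
-- underlying function.  Oddness forces 0 ↦ 0.
record SignedPermutation (m : ℕ) : Set where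
  field
    bijection : ℤ ↔ ℤ

  open Inverse bijection public using () renaming (to to apply)

  field
    odd   : ∀ x → apply (- x) ≡ - apply x
    fixes : ∀ x → m < ∣ x ∣ → apply x ≡ x

open SignedPermutation public using (apply)

swap : ℤ → ℤ → ℤ → ℤ
swap a b x with x ℤ.≟ a | x ℤ.≟ b
... | yes _ | _     = b
... | no  _ | yes _ = a
... | no  _ | no  _ = x

s : ℕ → ℤ → ℤ
s zero      = swap (- + 1) (+ 1)
s i@(suc _) = swap (- + suc i) (- + i) ∘ swap (+ i) (+ suc i)

-- The product of a word in the Coxeter group, with (uv)(x) = u(v(x)).
groupProduct : List ℕ → ℤ → ℤ
groupProduct []       = id
groupProduct (a ∷ as) = s a ∘ groupProduct as

Expresses : ∀ {m} → SignedPermutation m → List ℕ → Set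
Expresses w as = ∀ x → groupProduct as x ≡ apply w x

Reduced : ∀ {m} → SignedPermutation m → List ℕ → Set
Reduced w as = Expresses w as × (∀ bs → Expresses w bs → length as ≤ length bs)

------------------------------------------------------------------------
-- 0-Hecke expressions

infix 4 _≈_

-- The congruence on words presenting the 0-Hecke monoid.
data _≈_ : List ℕ → List ℕ → Set where
  ≈-refl  : ∀ {as} → as ≈ as
  ≈-sym   : ∀ {as bs} → as ≈ bs → bs ≈ as
  ≈-trans : ∀ {as bs cs} → as ≈ bs → bs ≈ cs → as ≈ cs
  ++-cong : ∀ {as as′ bs bs′} → as ≈ as′ → bs ≈ bs′ → as ++ bs ≈ as′ ++ bs′
  idem    : ∀ i → i ∷ i ∷ [] ≈ i ∷ []
  comm    : ∀ i j → dist i j ≥ 2 → i ∷ j ∷ [] ≈ j ∷ i ∷ []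
  braid   : ∀ i → i > 0 → i ∷ suc i ∷ i ∷ [] ≈ suc i ∷ i ∷ suc i ∷ []
  braid₀  : 1 ∷ 0 ∷ 1 ∷ 0 ∷ [] ≈ 0 ∷ 1 ∷ 0 ∷ 1 ∷ []

-- The 0-Hecke monoid is carried by the signed permutations: w corresponds to
-- the class of its reduced words, that is, ∘ agrees with the group product
-- along reduced words.
HeckeExpression : ∀ {m} → SignedPermutation m → List ℕ → Set
HeckeExpression w as = ∃[ bs ] Reduced w bs × as ≈ bs

𝓗 : ∀ {m} → ℕ → SignedPermutation m → Setoid 0ℓ 0ℓ
𝓗 n w = Restrict (setoid (Vec ℕ n)) (HeckeExpression w ∘ toList)

------------------------------------------------------------------------
-- Strict partitions and shifted diagrams

Strict : List ℕ → Set
Strict μ = Linked _>_ μ × All (_> 0) μ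

-- Cells are numbered from 1: row i has columns i, …, μ_i + i - 1.
record Cell (μ : List ℕ) : Set where
  constructor cell
  field
    rowIndex : Fin (length μ)
    offset   : Fin (lookup μ rowIndex)

  row col : ℕ
  row = suc (Fin.toℕ rowIndex)
  col = row + Fin.toℕ offset

open Cell public using (row; col)

Filling : Set → List ℕ → Set
Filling A μ = Cell μ → A

-- T [ i , j ]= x : the cell (i , j) exists, and T has entry x there.
_[_,_]=_ : ∀ {A μ} → Filling A μ → ℕ → ℕ → A → Set
T [ i , j ]= x = ∃[ c ] row c ≡ i × col c ≡ j × T c ≡ x

------------------------------------------------------------------------
-- Standard shifted set-valued tableaux

-- For nonempty sets, max A < min B.
_≺_ : ∀ {n} → Subset n → Subset n → Set
A ≺ B = ∀ {x y} → x ∈ˢ A → y ∈ˢ B → x Fin.< y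

-- The set {1,…,n} is represented by Fin n, in the same order.
record IsShSet (n : ℕ) (μ : List ℕ) (T : Filling (Subset n) μ) : Set where
  field
    nonempty : ∀ c → Nonempty (T c)
    covers   : ∀ x → ∃[ c ] x ∈ˢ T c
    disjoint : ∀ {x c d} → x ∈ˢ T c → x ∈ˢ T d → c ≡ d
    columns  : ∀ {i j A B} → T [ i , j ]= A → T [ suc i , j ]= B → A ≺ B
    rows     : ∀ {i j A B} → T [ i , j ]= A → T [ i , suc j ]= B → A ≺ B

ShSet : ℕ → List ℕ → Setoid 0ℓ 0ℓ
ShSet n μ = Restrict (Cell μ →-setoid Subset n) (IsShSet n μ)

------------------------------------------------------------------------
-- Strict decomposition tableaux

Unimodal : ∀ {k} → (Fin k → ℕ) → Set
Unimodal {k} r = Σ (Fin k) λ j →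
    (∀ {a b} → a Fin.< b → b Fin.≤ j → r a > r b)
  × (∀ {a b} → j Fin.≤ a → a Fin.< b → r a < r b)

record IsSDT (μ : List ℕ) (T : Filling ℕ μ) : Set where
  field
    unimodal : ∀ i → Unimodal (λ p → T (cell i p))

    avoids-i : ∀ {i j rᵢ sⱼ} →
      T [ i , i ]= rᵢ → T [ suc i , j ]= sⱼ →
      ¬ (sⱼ ≥ rᵢ)

    avoids-ii : ∀ {i j j′ rⱼ sⱼ sⱼ′} → j < j′ →
      T [ i , j ]= rⱼ → T [ suc i , j ]= sⱼ → T [ suc i , j′ ]= sⱼ′ →
      ¬ (rⱼ ≤ sⱼ′ × sⱼ′ < sⱼ)

    avoids-iii : ∀ {i j j′ rⱼ₋₁ rⱼ sⱼ sⱼ′} → j < j′ →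
      T [ i , pred j ]= rⱼ₋₁ → T [ i , j ]= rⱼ →
      T [ suc i , j ]= sⱼ → T [ suc i , j′ ]= sⱼ′ →
      ¬ (rⱼ₋₁ < rⱼ × sⱼ < sⱼ′ × sⱼ′ ≤ rⱼ)

    avoids-iv : ∀ {i j j′ rⱼ rⱼ′ sⱼ} → j′ < j →
      T [ i , j′ ]= rⱼ′ → T [ i , j ]= rⱼ → T [ suc i , j ]= sⱼ →
      ¬ (sⱼ < rⱼ′ × rⱼ′ ≤ rⱼ)

    -- Beyond avoids-iv this excludes exactly sⱼ ≡ rⱼ₋₁ < rⱼ, as in the rows
    -- 3 1 2 over 0 1.  Without it the expansion of |𝓗_n(w)| already fails for
    -- w = s₀s₃s₁s₂ and n = 5, where it would give 19 instead of 17.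
    avoids-v : ∀ {i j rⱼ₋₁ rⱼ sⱼ} →
      T [ i , pred j ]= rⱼ₋₁ → T [ i , j ]= rⱼ → T [ suc i , j ]= sⱼ →
      ¬ (sⱼ ≤ rⱼ₋₁ × rⱼ₋₁ < rⱼ)

readingWord : ∀ {μ} → Filling ℕ μ → List ℕ
readingWord T = concat (reverse (tabulate λ i → tabulate λ p → T (cell i p)))

SDT : ∀ {m} → SignedPermutation m → List ℕ → Setoid 0ℓ 0ℓ
SDT w μ = Restrict (Cell μ →-setoid ℕ)
                   (λ T → IsSDT μ T × HeckeExpression w (readingWord T))

------------------------------------------------------------------------
-- The strict partitions of size at most n

strictWithParts≤ : ℕ → List (List ℕ)
strictWithParts≤ zero    = [] ∷ []
strictWithParts≤ (suc m) = map (suc m ∷_) (strictWithParts≤ m) ++ strictWithParts≤ m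

strictPartitions≤ : ℕ → List (List ℕ)
strictPartitions≤ n = filter (λ μ → sum μ ≤? n) (strictWithParts≤ n)

private
  Bounded : ℕ → List ℕ → Set
  Bounded m μ = AllPairs _>_ μ × All (_> 0) μ × All (_≤ m) μ

  sound : ∀ m {μ} → μ ∈ strictWithParts≤ m → Bounded m μ
  sound zero (here refl) = [] , [] , []
  sound (suc m) μ∈ with ∈-++⁻ (map (suc m ∷_) (strictWithParts≤ m)) μ∈
  ... | inj₂ μ∈′ = let d , p , b = sound m μ∈′ in d , p , All.map m≤n⇒m≤1+n b
  ... | inj₁ μ∈′ with ∈-map⁻ (suc m ∷_) μ∈′
  ...   | ν , ν∈ , refl = let d , p , b = sound m ν∈ in
          All.map s≤s b ∷ d , s≤s z≤n ∷ p , ≤-refl ∷ All.map m≤n⇒m≤1+n b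

  complete : ∀ m {μ} → Bounded m μ → μ ∈ strictWithParts≤ m
  complete zero    {[]} _ = here refl
  complete zero    {x ∷ μ} (_ , x>0 ∷ _ , x≤0 ∷ _) = contradiction x≤0 (<⇒≱ x>0)
  complete (suc m) {[]} _ = ∈-++⁺ʳ _ (complete m ([] , [] , []))
  complete (suc m) {x ∷ μ} (d ∷ ds , p ∷ ps , b ∷ bs) with m≤n⇒m<n∨m≡n b
  ... | inj₂ refl = ∈-++⁺ˡ (∈-map⁺ _ (complete m (ds , ps , All.map s≤s⁻¹ d)))
  ... | inj₁ x<1+m = ∈-++⁺ʳ _ (complete m
        (d ∷ ds , p ∷ ps , s≤s⁻¹ x<1+m ∷ All.map (λ y<x → s≤s⁻¹ (<-trans y<x x<1+m)) d))

  unique : ∀ m → Unique (strictWithParts≤ m)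
  unique zero    = [] ∷ []
  unique (suc m) = Unique.++⁺ (Unique.map⁺ ∷-injectiveʳ (unique m)) (unique m) disj
    where
    disj : ∀ {μ} → ¬ (μ ∈ map (suc m ∷_) (strictWithParts≤ m) × μ ∈ strictWithParts≤ m)
    disj (p , q) with ∈-map⁻ (suc m ∷_) p
    ... | _ , _ , refl with sound m q
    ...   | _ , _ , 1+m≤m ∷ _ = 1+n≰n 1+m≤m

  parts≤sum : ∀ μ → All (_≤ sum μ) μ
  parts≤sum []      = []
  parts≤sum (x ∷ μ) = m≤m+n x (sum μ) ∷ All.map (λ y≤ → ≤-trans y≤ (m≤n+m (sum μ) x)) (parts≤sum μ)

∈-strictPartitions≤ : ∀ n μ → μ ∈ strictPartitions≤ n ⇔ (Strict μ × sum μ ≤ n)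
∈-strictPartitions≤ n μ = mk⇔
  (λ μ∈ → let μ∈′ , ∣μ∣≤n = ∈-filter⁻ (λ ν → sum ν ≤? n) μ∈
              d , p , _   = sound n μ∈′
          in (AllPairs⇒Linked d , p) , ∣μ∣≤n)
  (λ { ((d , p) , ∣μ∣≤n) → ∈-filter⁺ (λ ν → sum ν ≤? n)
         (complete n ( Linked⇒AllPairs (λ x>y y>z → <-trans y>z x>y) d , p
                     , All.map (λ y≤ → ≤-trans y≤ ∣μ∣≤n) (parts≤sum μ)))
         ∣μ∣≤n })

strictPartitions≤-unique : ∀ n → Unique (strictPartitions≤ n)
strictPartitions≤-unique n = Unique.filter⁺ (λ μ → sum μ ≤? n) (unique n)

module Submission where

-- A letter a is inserted into a tableau row by row.  In a row it either is
-- appended, or stays at the end of the row, or changes the row and sends a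
-- letter y into the next one.  A step leaves the 0-Hecke class of the reading
-- word unchanged, and, for a fixed next row S, it is a bijection between the
-- pairs (R , a) that do not end in R and the pairs (R′ , y) with y admissible for
-- R′ over S.  Admissibility is exactly the condition under which R′ remains
-- compatible with the row that the insertion of y makes out of S, so the row
-- bijections compose: inserting a letter is a bijection onto the tableaux with a
-- marked corner, which was either added or only met.  The marked corners of the
-- successive letters form a set-valued standard tableau of the same shape.
--
-- Compatibility is expressed by counting: in a row D > m < I write g for the
-- number of letters of the decreasing part above s, and h for the length of the
-- decreasing part plus the number of letters of the increasing part below v.
--
-- Finiteness of the sets rests on Matsumoto's theorem: 0-Hecke expressions of w are
-- recognized by their action on windows, where s_i sorts two adjacent entries.

open import Defs
open import Data.List using (List; []; _∷_; map; sum)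
open import Data.Nat using (ℕ; _*_)
open import Data.Empty using (⊥; ⊥-elim)
open import Data.List.Membership.Propositional using (_∈_)
open import Data.List.Relation.Unary.All as All using (All; []; _∷_)
import Data.List.Relation.Unary.All.Properties as All
open import Data.List.Relation.Unary.AllPairs as AllPairs using (AllPairs; []; _∷_)
import Data.List.Relation.Unary.AllPairs.Properties as AllPairs
open import Data.Product using (Σ; ∃; ∃-syntax; _×_; _,_; proj₁; proj₂)
open import Data.Sum using (_⊎_; inj₁; inj₂; [_,_]′)
open import Function using (_∘_; id; _⇔_; mk⇔; Equivalence)
open import Relation.Binary.Definitions using (Tri; tri<; tri≈; tri>)
open import Relation.Binary.PropositionalEquality hiding ([_]; J)
open import Relation.Nullary

-- The step is defined in the reverse direction. Given the row R′ and the letter y coming back from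
-- the next row, c is the least letter of the decreasing part above y, and a is the greatest letter
-- of `m ∷ I` below c. Normally y takes the place of c, c takes the place of a, and a leaves. The
-- obstacle is that either exchange can be blocked: the letter is already in the row, or the changed
-- row would violate compatibility with S. A blocked letter leaves its part of the row as it is,
-- while the next letter still moves on. This gives four modes, all read off from R′, y and S.
-- Forwards, a blocked c or y may have left no trace in the row and has to be recovered as an
-- extremal solution of the blocking conditions; much of the case analysis comes from there. The
-- minimum is the second difficulty: it can be counted with either part of the row and can change
-- during a step, so the conditions are stated for a word cut in two rather than for a row. Within
-- the step, the relation of length four between s_0 and s_1 is needed only where y and a both equal
-- the minimum of R′.

module Hyperoctahedral where

 open import Data.Integer as ℤ using (ℤ; +_; -[1+_]; -_; ∣_∣; _⊔_; _⊓_; +<+; -<+; -≤+; +≤+)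
 import Data.Integer.Properties as ℤ
 open import Data.List using (_++_; _∷ʳ_; length; foldl)
 open import Data.List.Properties using (length-++; ++-assoc; ++-identityʳ; foldl-++; map-++; length-map; ≡-dec; ∷-injectiveˡ; ∷-injectiveʳ)
 open import Data.List.Relation.Unary.Linked using (Linked; []; [-]; _∷_)
 open import Data.Nat using (zero; suc; _+_; _≤_; _<_; _<?_; z≤n; s≤s; s≤s⁻¹; z<s; s<s; _≟_) renaming (∣_-_∣ to dist)
 open import Data.Nat.Properties hiding (⊓-comm; ⊔-comm)
 open import Data.Nat.Tactic.RingSolver using (solve-∀)
 open import Data.Bool using (Bool; true; false)
 open import Function using (Inverse)
 open import Relation.Nullary.Decidable using (_×-dec_; map′; dec-true; dec-false)

 ≈-reflexive : ∀ {u v} → u ≡ v → u ≈ v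
 ≈-reflexive refl = ≈-refl

 -- Windows of signed permutations and their right descents

 pos : ℕ → ℤ
 pos n = + n

 swapAt : ℕ → List ℤ → List ℤ
 swapAt zero (x ∷ y ∷ xs) = y ∷ x ∷ xs
 swapAt (suc i) (x ∷ xs) = x ∷ swapAt i xs
 swapAt _ xs = xs

 sw : ℕ → List ℤ → List ℤ
 sw zero [] = []
 sw zero (x ∷ xs) = - x ∷ xs
 sw (suc i) xs = swapAt i xs

 -- Down a f g: the window f of v has the right descent s_a, and g is the window of v s_a.
 data Down : ℕ → List ℤ → List ℤ → Set where
   neg : ∀ {n xs} → Down 0 (-[1+ n ] ∷ xs) (+ suc n ∷ xs)
   here : ∀ {x y xs} → y ℤ.< x → Down 1 (x ∷ y ∷ xs) (y ∷ x ∷ xs)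
   there : ∀ {a x xs ys} → Down (suc a) xs ys → Down (suc (suc a)) (x ∷ xs) (x ∷ ys)

 down-sw : ∀ {a f g} → Down a f g → sw a g ≡ f
 down-sw neg = refl
 down-sw (here _) = refl
 down-sw (there {x = x} d) = cong (x ∷_) (down-sw d)

 down-functional : ∀ {a f g g′} → Down a f g → Down a f g′ → g ≡ g′
 down-functional neg neg = refl
 down-functional (here _) (here _) = refl
 down-functional (there {x = x} d) (there d′) = cong (x ∷_) (down-functional d d′)

 down-< : ∀ {a f g} → Down a f g → a < length f
 down-< neg = z<s
 down-< (here _) = s<s z<s
 down-< (there d) = s<s (down-< d)

 down-++ : ∀ {a f g} t → Down a f g → Down a (f ++ t) (g ++ t)
 down-++ t neg = neg
 down-++ t (here p) = here p
 down-++ t (there d) = there (down-++ t d)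

 -- A symmetric weakening of `Down`, by which `Proper` passes along a descent in both directions.
 data Sim : List ℤ → List ℤ → Set where
   sign : ∀ {x y xs} → ∣ x ∣ ≡ ∣ y ∣ → Sim (x ∷ xs) (y ∷ xs)
   flip : ∀ {x y xs} → Sim (x ∷ y ∷ xs) (y ∷ x ∷ xs)
   there : ∀ {x xs ys} → Sim xs ys → Sim (x ∷ xs) (x ∷ ys)

 sim-sym : ∀ {f g} → Sim f g → Sim g f
 sim-sym (sign e) = sign (sym e)
 sim-sym flip = flip
 sim-sym (there s) = there (sim-sym s)

 down-sim : ∀ {a f g} → Down a f g → Sim f g
 down-sim neg = sign refl
 down-sim (here _) = flip
 down-sim (there d) = there (down-sim d)

 sim-all : ∀ {P : ℕ → Set} {f g} → Sim f g → All (P ∘ ∣_∣) f → All (P ∘ ∣_∣) g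
 sim-all {P} (sign e) (p ∷ ps) = subst P e p ∷ ps
 sim-all flip (p ∷ q ∷ ps) = q ∷ p ∷ ps
 sim-all {P} (there s) (p ∷ ps) = p ∷ sim-all {P} s ps

 Distinct : ℤ → ℤ → Set
 Distinct x y = ¬ ∣ x ∣ ≡ ∣ y ∣

 sim-distinct : ∀ {f g} → Sim f g → AllPairs Distinct f → AllPairs Distinct g
 sim-distinct (sign e) (p ∷ ps) = All.map (λ q r → q (trans e r)) p ∷ ps
 sim-distinct flip ((n ∷ p) ∷ q ∷ ps) = ((n ∘ sym) ∷ q) ∷ p ∷ ps
 sim-distinct (there {x} s) (p ∷ ps) = sim-all {λ k → ¬ ∣ x ∣ ≡ k} s p ∷ sim-distinct s ps

 sim-length : ∀ {f g} → Sim f g → length f ≡ length g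
 sim-length (sign _) = refl
 sim-length flip = refl
 sim-length (there s) = cong suc (sim-length s)

 record Proper (n : ℕ) (f : List ℤ) : Set where
   constructor proper
   field
     size : length f ≡ n
     bounds : All ((λ k → 0 < k × k ≤ n) ∘ ∣_∣) f
     distinct : AllPairs Distinct f

 open Proper

 sim-proper : ∀ {n f g} → Sim f g → Proper n f → Proper n g
 sim-proper {n} s (proper l b d) = proper (trans (sym (sim-length s)) l) (sim-all {λ k → 0 < k × k ≤ n} s b) (sim-distinct s d)

 down-proper : ∀ {n a f g} → Down a f g → Proper n f → Proper n g
 down-proper = sim-proper ∘ down-sim

 -- Nonzero entries of distinct absolute value leave no ties, so every position is either a descent
 -- or an ascent.
 direction : ∀ a f → All ((0 <_) ∘ ∣_∣) f → AllPairs Distinct f → a < length f → Down a f (sw a f) ⊎ Down a (sw a f) f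
 direction zero (+ suc n ∷ xs) _ _ _ = inj₂ neg
 direction zero (-[1+ n ] ∷ xs) _ _ _ = inj₁ neg
 direction zero (+ zero ∷ xs) (() ∷ _) _ _
 direction (suc zero) (x ∷ y ∷ xs) _ ((x≢y ∷ _) ∷ _) _ with ℤ.<-cmp x y
 ... | tri< p _ _ = inj₂ (here p)
 ... | tri≈ _ refl _ = ⊥-elim (x≢y refl)
 ... | tri> _ _ p = inj₁ (here p)
 direction (suc zero) (x ∷ []) _ _ (s≤s ())
 direction (suc (suc a)) (x ∷ xs) (_ ∷ p) (_ ∷ d) (s≤s l) with direction (suc a) xs p d l
 ... | inj₁ q = inj₁ (there q)
 ... | inj₂ q = inj₂ (there q)

 direction′ : ∀ {n f} a → Proper n f → a < n → Down a f (sw a f) ⊎ Down a (sw a f) f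
 direction′ {f = f} a (proper refl b d) = direction a f (All.map proj₁ b) d

 -- Inversions: the Coxeter length of type B

 bit : Bool → ℕ
 bit true = 1
 bit false = 0

 less : ℤ → ℤ → ℕ
 less y x = bit (does (y ℤ.<? x))

 less-yes : ∀ {x y} → y ℤ.< x → less y x ≡ 1
 less-yes {x} {y} p = cong bit (dec-true (y ℤ.<? x) p)

 less-no : ∀ {x y} → ¬ y ℤ.< x → less y x ≡ 0
 less-no {x} {y} p = cong bit (dec-false (y ℤ.<? x) p)

 less-cong : ∀ {x y u v} → (y ℤ.< x → v ℤ.< u) → (v ℤ.< u → y ℤ.< x) → less y x ≡ less v u
 less-cong {x} {y} f g with y ℤ.<? x
 ... | yes p = sym (less-yes (f p))
 ... | no p = sym (less-no (p ∘ g))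

 count : ℤ → List ℤ → ℕ
 count x [] = 0
 count x (y ∷ ys) = (less y x + less y (- x)) + count x ys

 sgn : ℤ → ℕ
 sgn (+ _) = 0
 sgn -[1+ _ ] = 1

 -- The length function of type B: the negative entries, the pairs x before y with y < x, and the
 -- pairs with y < - x, that is, with negative sum.
 inv : List ℤ → ℕ
 inv [] = 0
 inv (x ∷ xs) = sgn x + (count x xs + inv xs)

 count-neg : ∀ x ys → count x ys ≡ count (- x) ys
 count-neg x [] = refl
 count-neg x (y ∷ ys) = cong₂ _+_ (trans (+-comm (less y x) (less y (- x))) (cong (λ w → less y (- x) + less y w) (sym (ℤ.neg-involutive x)))) (count-neg x ys)

 count-down : ∀ {a f g} x → Down (suc a) f g → count x f ≡ count x g
 count-down x (here {u} {v} {xs} _) = lemma (less u x + less u (- x)) (less v x + less v (- x)) (count x xs)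
   where
   lemma : ∀ p q r → p + (q + r) ≡ q + (p + r)
   lemma = solve-∀
 count-down x (there {x = y} d) = cong (λ w → (less y x + less y (- x)) + w) (count-down x d)

 <-neg-swap : ∀ {x y} → y ℤ.< - x → x ℤ.< - y
 <-neg-swap {x} p = subst (ℤ._< _) (ℤ.neg-involutive x) (ℤ.neg-mono-< p)

 -- For s_0 only the sign counts, because `count` is invariant under negating its first argument.
 -- For s_i with i > 0 only the exchanged pair matters, and its test y < - x is symmetric in x and
 -- y.
 inv-down : ∀ {a f g} → Down a f g → inv f ≡ suc (inv g)
 inv-down (neg {n} {xs}) = cong (λ w → suc (w + inv xs)) (count-neg -[1+ n ] xs)
 inv-down (here {x} {y} {xs} y<x) = trans
     (cong₂ (λ u w → sgn x + ((u + w + count x xs) + (sgn y + (count y xs + inv xs)))) (less-yes y<x) (less-cong {y = y} (<-neg-swap {x} {y}) (<-neg-swap {y} {x})))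
     (trans (lemma (sgn x) (sgn y) (less x (- y)) (count x xs) (count y xs) (inv xs))
       (cong (λ u → suc (sgn y + ((u + less x (- y) + count y xs) + (sgn x + (count x xs + inv xs))))) (sym (less-no {y} {x} (ℤ.<-asym y<x)))))
   where
   lemma : ∀ sx sy l cx cy i → sx + ((1 + l + cx) + (sy + (cy + i))) ≡ suc (sy + ((0 + l + cy) + (sx + (cx + i))))
   lemma = solve-∀
 inv-down (there {x = x} {xs} {ys} d) = trans (cong₂ (λ u w → sgn x + (u + w)) (count-down x d) (inv-down d)) (lemma (sgn x) (count x ys) (inv ys))
   where
   lemma : ∀ p q r → p + (q + suc r) ≡ suc (p + (q + r))
   lemma = solve-∀

 -- The identity window and reduced words

 range : ℕ → ℕ → List ℕ
 range k zero = []
 range k (suc n) = k ∷ range (suc k) n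

 idw : ℕ → List ℤ
 idw n = map pos (range 1 n)

 range-++ : ∀ k n l → range k (n + l) ≡ range k n ++ range (k + n) l
 range-++ k zero l = cong (λ w → range w l) (sym (+-identityʳ k))
 range-++ k (suc n) l = cong (k ∷_) (trans (range-++ (suc k) n l) (cong (λ w → range (suc k) n ++ range w l) (sym (+-suc k n))))

 no-down : ∀ {a} k n {g} → ¬ Down a (map pos (range k n)) g
 no-down k (suc (suc n)) (here (+<+ p)) = <⇒≱ p (n≤1+n k)
 no-down k (suc n) (there d) = no-down (suc k) n d

 scan : ∀ j xs → AllPairs Distinct (+ j ∷ xs) → (∃[ a ] ∃[ g ] Down (suc a) (+ j ∷ xs) g) ⊎ ∃[ ns ] xs ≡ map pos ns × Linked _<_ (j ∷ ns)
 scan j [] _ = inj₂ ([] , refl , [-])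
 scan j (-[1+ n ] ∷ xs) _ = inj₁ (_ , _ , here -<+)
 scan j (+ k ∷ xs) ((j≢k ∷ _) ∷ d) with <-cmp j k
 ... | tri≈ _ e _ = ⊥-elim (j≢k e)
 ... | tri> _ _ p = inj₁ (_ , _ , here (+<+ p))
 ... | tri< p _ _ with scan k xs d
 ... | inj₁ (a , g , q) = inj₁ (_ , _ , there q)
 ... | inj₂ (ns , refl , q) = inj₂ (k ∷ ns , refl , p ∷ q)

 -- Strictly increasing entries that start at k or later and stay below k plus their number leave no
 -- room for a gap.
 increasing-range : ∀ k j ns → Linked _<_ (j ∷ ns) → k ≤ j → All (_< k + length (j ∷ ns)) (j ∷ ns) → j ∷ ns ≡ range k (length (j ∷ ns))
 increasing-range k j [] _ k≤j (j< ∷ []) = cong (_∷ []) (≤-antisym (s≤s⁻¹ (subst (j <_) (+-comm k 1) j<)) k≤j)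
 increasing-range k j (i ∷ ns) (j<i ∷ l) k≤j (j< ∷ b)
   with increasing-range (suc k) i ns l (≤-<-trans k≤j j<i) (subst (λ w → All (_< w) (i ∷ ns)) (+-suc k (length (i ∷ ns))) b)
 ... | e = cong₂ _∷_ (≤-antisym (s≤s⁻¹ (subst (j <_) (∷-injectiveˡ e) j<i)) k≤j) e

 descent-or-id : ∀ {n f} → Proper n f → (∃[ a ] ∃[ g ] Down a f g) ⊎ f ≡ idw n
 descent-or-id {f = []} (proper refl _ _) = inj₂ refl
 descent-or-id {f = -[1+ _ ] ∷ xs} _ = inj₁ (_ , _ , neg)
 descent-or-id {f = + zero ∷ xs} (proper _ ((() , _) ∷ _) _)
 descent-or-id {f = + suc j ∷ xs} (proper refl b d) with scan (suc j) xs d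
 ... | inj₁ (a , g , q) = inj₁ (_ , _ , q)
 ... | inj₂ (ns , refl , l) = inj₂ (trans (cong (map pos) (increasing-range 1 (suc j) ns l (s≤s z≤n)
         (All.map (λ { (_ , p) → s≤s (≤-trans p (≤-reflexive (cong suc (length-map pos ns)))) }) (All.map⁻ b)))) (cong (λ w → map pos (range 1 (suc w))) (sym (length-map pos ns))))

 -- Red n f as: as is a reduced word of the element with window f.
 data Red (n : ℕ) : List ℤ → List ℕ → Set where
   nil : Red n (idw n) []
   snoc : ∀ {a f g as} → Down a f g → Red n g as → Red n f (as ∷ʳ a)

 red-exists : ∀ {n} k f → inv f ≡ k → Proper n f → ∃[ as ] Red n f as
 red-exists k f e p with descent-or-id p
 ... | inj₂ refl = [] , nil
 red-exists zero f e p | inj₁ (a , g , d) = contradiction (trans (sym (inv-down d)) e) λ ()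
 red-exists (suc k) f e p | inj₁ (a , g , d) with red-exists k g (suc-injective (trans (sym (inv-down d)) e)) (down-proper d p)
 ... | as , r = as ∷ʳ a , snoc d r

 -- Two descents of one window lead down to a common window e. The constructors correspond to the
 -- orders 2, 3 and 4 of the product of s_a and s_b.
 data Diamond (a b : ℕ) (g g′ : List ℤ) : Set where
   square : ∀ {e} → 2 ≤ dist a b → Down b g e → Down a g′ e → Diamond a b g g′
   hexagon : ∀ {h h′ e} → 0 < a → b ≡ suc a → Down b g h → Down a h e → Down a g′ h′ → Down b h′ e → Diamond a b g g′
   octagon : ∀ {h h₁ h′ h₁′ e} → a ≡ 0 → b ≡ 1 → Down b g h → Down a h h₁ → Down b h₁ e → Down a g′ h′ → Down b h′ h₁′ → Down a h₁′ e → Diamond a b g g′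

 diamond : ∀ {a b f g g′} → Down a f g → Down b f g′ → a < b → Diamond a b g g′
 diamond neg (there d) _ = square (s≤s (s≤s z≤n)) (there d) neg
 diamond (neg {n}) (here {y = + m} ()) _
 diamond (neg {n}) (here {y = -[1+ m ]} p) _ = octagon refl refl (here (ℤ.<-trans p -<+)) neg (here (ℤ.neg-mono-< p)) neg (here -<+) neg
 diamond (here p) (there (here q)) _ = hexagon z<s refl (there (here (ℤ.<-trans q p))) (here q) (here (ℤ.<-trans q p)) (there (here p))
 diamond (here p) (there (there d)) _ = square (s≤s (s≤s z≤n)) (there (there d)) (here p)
 diamond (here p) (here q) (s≤s ())
 diamond (there d) (there d′) (s≤s l) with diamond d d′ l
 ... | square p x y = square p (there x) (there y)
 ... | hexagon p refl x y z u = hexagon z<s refl (there x) (there y) (there z) (there u)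

 respects : ∀ {a b as bs cs} p q → as ≈ cs ++ p → bs ≈ cs ++ q → p ∷ʳ a ≈ q ∷ʳ b → as ∷ʳ a ≈ bs ∷ʳ b
 respects {a} {b} {cs = cs} p q e f g = ≈-trans (++-cong e ≈-refl) (≈-trans (≈-reflexive (++-assoc cs p (a ∷ [])))
   (≈-trans (++-cong {as = cs} ≈-refl g) (≈-trans (≈-reflexive (sym (++-assoc cs q (b ∷ [])))) (++-cong (≈-sym f) ≈-refl))))

 -- Induction on the length. If the last letters differ, a reduced word of the bottom e of the
 -- diamond is extended up both sides; each extension agrees with the given word by induction, and
 -- the two differ by one commutation or braid relation.
 matsumoto : ∀ {n} k {f as bs} → inv f ≡ k → Proper n f → Red n f as → Red n f bs → as ≈ bs
 matsumoto k e p nil nil = ≈-refl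
 matsumoto {n} k e p nil (snoc d _) = ⊥-elim (no-down 1 n d)
 matsumoto {n} k e p (snoc d _) nil = ⊥-elim (no-down 1 n d)
 matsumoto zero e p (snoc d _) (snoc _ _) = contradiction (trans (sym (inv-down d)) e) λ ()
 matsumoto {n} (suc k) {f} e p (snoc {a} d r) (snoc {b} d′ r′) = by (<-cmp a b)
   where
   descend : ∀ {a g} → Down a f g → inv g ≡ k
   descend d = suc-injective (trans (sym (inv-down d)) e)
   ih : ∀ {a g as bs} → Down a f g → Red n g as → Red n g bs → as ≈ bs
   ih d = matsumoto k (descend d) (down-proper d p)
   close : ∀ {a b g g′ as bs} → Down a f g → Red n g as → Down b f g′ → Red n g′ bs → Diamond a b g g′ → as ∷ʳ a ≈ bs ∷ʳ b
   close {a} {b} d r d′ r′ (square {h} l x y) with red-exists (inv h) h refl (down-proper x (down-proper d p))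
   ... | cs , c = respects {cs = cs} (b ∷ []) (a ∷ []) (ih d r (snoc x c)) (ih d′ r′ (snoc y c)) (≈-sym (comm a b l))
   close {a} d r d′ r′ (hexagon {e = h} l refl x y z u) with red-exists (inv h) h refl (down-proper y (down-proper x (down-proper d p)))
   ... | cs , c = respects {cs = cs} (a ∷ suc a ∷ []) (suc a ∷ a ∷ [])
           (≈-trans (ih d r (snoc x (snoc y c))) (≈-reflexive (++-assoc cs (a ∷ []) (suc a ∷ []))))
           (≈-trans (ih d′ r′ (snoc z (snoc u c))) (≈-reflexive (++-assoc cs (suc a ∷ []) (a ∷ []))))
           (braid a l)
   close d r d′ r′ (octagon {e = h} refl refl x y z u v t) with red-exists (inv h) h refl (down-proper z (down-proper y (down-proper x (down-proper d p))))
   ... | cs , c = respects {cs = cs} (1 ∷ 0 ∷ 1 ∷ []) (0 ∷ 1 ∷ 0 ∷ [])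
           (≈-trans (ih d r (snoc x (snoc y (snoc z c)))) (≈-reflexive (trans (++-assoc (cs ∷ʳ 1) (0 ∷ []) (1 ∷ [])) (++-assoc cs (1 ∷ []) (0 ∷ 1 ∷ [])))))
           (≈-trans (ih d′ r′ (snoc u (snoc v (snoc t c)))) (≈-reflexive (trans (++-assoc (cs ∷ʳ 0) (1 ∷ []) (0 ∷ [])) (++-assoc cs (0 ∷ []) (1 ∷ 0 ∷ [])))))
           braid₀
   by : Tri (a < b) (a ≡ b) (b < a) → _ ∷ʳ a ≈ _ ∷ʳ b
   by (tri< l _ _) = close d r d′ r′ (diamond d d′ l)
   by (tri> _ _ l) = ≈-sym (close d′ r′ d r (diamond d′ d l))
   by (tri≈ _ refl _) with down-functional d d′
   ... | refl = ++-cong (ih d r r′) ≈-refl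

 -- The 0-Hecke action: s_a sorts positions a and a + 1 decreasingly, and s_0 makes the first entry nonpositive.
 N : ℤ → ℤ
 N x = - (+ ∣ x ∣)

 sortAt : ℕ → List ℤ → List ℤ
 sortAt zero (x ∷ y ∷ xs) = x ⊔ y ∷ x ⊓ y ∷ xs
 sortAt (suc i) (x ∷ xs) = x ∷ sortAt i xs
 sortAt _ xs = xs

 act₀ : ℕ → List ℤ → List ℤ
 act₀ zero [] = []
 act₀ zero (x ∷ xs) = N x ∷ xs
 act₀ (suc i) xs = sortAt i xs

 demazure : List ℕ → List ℤ → List ℤ
 demazure as f = foldl (λ g a → act₀ a g) f as

 N-pos : ∀ {x} → + 0 ℤ.≤ x → N x ≡ - x
 N-pos (+≤+ _) = refl

 N-neg : ∀ {x} → x ℤ.≤ + 0 → N x ≡ x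
 N-neg {+ zero} _ = refl
 N-neg { -[1+ _ ]} _ = refl
 N-neg {+ suc _} (+≤+ ())

 N≤0 : ∀ x → N x ℤ.≤ + 0
 N≤0 (+ zero) = +≤+ z≤n
 N≤0 (+ suc n) = -≤+
 N≤0 -[1+ n ] = -≤+

 pair : ℤ → ℤ → List ℤ → List ℤ
 pair x y xs = x ⊔ y ∷ x ⊓ y ∷ xs

 pair-comm : ∀ x y xs → pair x y xs ≡ pair y x xs
 pair-comm x y xs = cong₂ (λ u w → u ∷ w ∷ xs) (ℤ.⊔-comm x y) (ℤ.⊓-comm x y)

 pair-sorted : ∀ {x y} xs → y ℤ.≤ x → pair x y xs ≡ x ∷ y ∷ xs
 pair-sorted xs p = cong₂ (λ u w → u ∷ w ∷ xs) (ℤ.i≥j⇒i⊔j≡i p) (ℤ.i≥j⇒i⊓j≡j p)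

 pair-idem : ∀ x y xs → pair (x ⊔ y) (x ⊓ y) xs ≡ pair x y xs
 pair-idem x y xs with ℤ.≤-total x y
 ... | inj₁ p = trans (cong₂ (λ u w → pair u w xs) (ℤ.i≤j⇒i⊔j≡j p) (ℤ.i≤j⇒i⊓j≡i p)) (pair-comm y x xs)
 ... | inj₂ p = cong₂ (λ u w → pair u w xs) (ℤ.i≥j⇒i⊔j≡i p) (ℤ.i≥j⇒i⊓j≡j p)

 act-idem : ∀ a f → act₀ a (act₀ a f) ≡ act₀ a f
 act-idem zero [] = refl
 act-idem zero (x ∷ xs) = cong (_∷ xs) (N-neg (N≤0 x))
 act-idem (suc a) f = go a f
   where
   go : ∀ a f → sortAt a (sortAt a f) ≡ sortAt a f
   go zero [] = refl
   go zero (x ∷ []) = refl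
   go zero (x ∷ y ∷ xs) = pair-idem x y xs
   go (suc a) [] = refl
   go (suc a) (x ∷ xs) = cong (x ∷_) (go a xs)

 sort-comm : ∀ a b f → 2 ≤ dist a b → sortAt a (sortAt b f) ≡ sortAt b (sortAt a f)
 sort-comm zero (suc (suc b)) [] _ = refl
 sort-comm zero (suc (suc b)) (x ∷ []) _ = refl
 sort-comm zero (suc (suc b)) (x ∷ y ∷ xs) _ = refl
 sort-comm (suc (suc a)) zero [] _ = refl
 sort-comm (suc (suc a)) zero (x ∷ []) _ = refl
 sort-comm (suc (suc a)) zero (x ∷ y ∷ xs) _ = refl
 sort-comm zero (suc zero) _ (s≤s ())
 sort-comm (suc zero) zero _ (s≤s ())
 sort-comm (suc a) (suc b) [] p = refl
 sort-comm (suc a) (suc b) (x ∷ xs) p = cong (x ∷_) (sort-comm a b xs p)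

 act-comm : ∀ a b f → 2 ≤ dist a b → act₀ a (act₀ b f) ≡ act₀ b (act₀ a f)
 act-comm zero (suc (suc b)) [] _ = refl
 act-comm zero (suc (suc b)) (x ∷ xs) _ = refl
 act-comm (suc (suc a)) zero [] _ = refl
 act-comm (suc (suc a)) zero (x ∷ xs) _ = refl
 act-comm zero (suc zero) _ (s≤s ())
 act-comm (suc zero) zero _ (s≤s ())
 act-comm (suc a) (suc b) f p = sort-comm a b f p

 -- Both sides sort three consecutive entries decreasingly; the cases are their six orders.
 sort-braid : ∀ a f → sortAt a (sortAt (suc a) (sortAt a f)) ≡ sortAt (suc a) (sortAt a (sortAt (suc a) f))
 sort-braid zero [] = refl
 sort-braid zero (x ∷ []) = refl
 sort-braid zero (x ∷ y ∷ []) = pair-idem x y []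
 sort-braid zero (x ∷ y ∷ z ∷ xs) with ℤ.≤-total x y | ℤ.≤-total y z
 ... | inj₁ xy | inj₁ yz
       rewrite ℤ.i≤j⇒i⊔j≡j xy | ℤ.i≤j⇒i⊓j≡i xy | ℤ.i≤j⇒i⊔j≡j yz | ℤ.i≤j⇒i⊓j≡i yz
             | ℤ.i≤j⇒i⊔j≡j (ℤ.≤-trans xy yz) | ℤ.i≤j⇒i⊓j≡i (ℤ.≤-trans xy yz)
             | ℤ.i≤j⇒i⊔j≡j yz | ℤ.i≤j⇒i⊓j≡i yz | ℤ.i≤j⇒i⊔j≡j xy | ℤ.i≤j⇒i⊓j≡i xy = refl
 ... | inj₂ yx | inj₂ zy
       rewrite ℤ.i≥j⇒i⊔j≡i yx | ℤ.i≥j⇒i⊓j≡j yx | ℤ.i≥j⇒i⊔j≡i zy | ℤ.i≥j⇒i⊓j≡j zy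
             | ℤ.i≥j⇒i⊔j≡i yx | ℤ.i≥j⇒i⊓j≡j yx | ℤ.i≥j⇒i⊔j≡i zy | ℤ.i≥j⇒i⊓j≡j zy = refl
 ... | inj₁ xy | inj₂ zy with ℤ.≤-total x z
 ... | inj₁ xz
       rewrite ℤ.i≤j⇒i⊔j≡j xy | ℤ.i≤j⇒i⊓j≡i xy | ℤ.i≥j⇒i⊔j≡i zy | ℤ.i≥j⇒i⊓j≡j zy
             | ℤ.i≤j⇒i⊔j≡j xz | ℤ.i≤j⇒i⊓j≡i xz | ℤ.i≤j⇒i⊔j≡j xy | ℤ.i≤j⇒i⊓j≡i xy
             | ℤ.i≥j⇒i⊔j≡i zy | ℤ.i≥j⇒i⊓j≡j zy | ℤ.i≤j⇒i⊔j≡j xz | ℤ.i≤j⇒i⊓j≡i xz = refl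
 ... | inj₂ zx
       rewrite ℤ.i≤j⇒i⊔j≡j xy | ℤ.i≤j⇒i⊓j≡i xy | ℤ.i≥j⇒i⊔j≡i zy | ℤ.i≥j⇒i⊓j≡j zy
             | ℤ.i≥j⇒i⊔j≡i zx | ℤ.i≥j⇒i⊓j≡j zx | ℤ.i≤j⇒i⊔j≡j xy | ℤ.i≤j⇒i⊓j≡i xy
             | ℤ.i≥j⇒i⊔j≡i xy | ℤ.i≥j⇒i⊓j≡j xy | ℤ.i≥j⇒i⊔j≡i zx | ℤ.i≥j⇒i⊓j≡j zx = refl
 sort-braid zero (x ∷ y ∷ z ∷ xs) | inj₂ yx | inj₁ yz with ℤ.≤-total x z
 ... | inj₁ xz
       rewrite ℤ.i≥j⇒i⊔j≡i yx | ℤ.i≥j⇒i⊓j≡j yx | ℤ.i≤j⇒i⊔j≡j yz | ℤ.i≤j⇒i⊓j≡i yz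
             | ℤ.i≤j⇒i⊔j≡j xz | ℤ.i≤j⇒i⊓j≡i xz | ℤ.i≥j⇒i⊔j≡i yx | ℤ.i≥j⇒i⊓j≡j yx = refl
 ... | inj₂ zx
       rewrite ℤ.i≥j⇒i⊔j≡i yx | ℤ.i≥j⇒i⊓j≡j yx | ℤ.i≤j⇒i⊔j≡j yz | ℤ.i≤j⇒i⊓j≡i yz
             | ℤ.i≥j⇒i⊔j≡i zx | ℤ.i≥j⇒i⊓j≡j zx | ℤ.i≥j⇒i⊔j≡i yz | ℤ.i≥j⇒i⊓j≡j yz = refl
 sort-braid (suc a) [] = refl
 sort-braid (suc a) (x ∷ xs) = cong (x ∷_) (sort-braid a xs)

 -- Both sides replace the first two entries x and y by `N x` and `N y` in decreasing order. `left`
 -- and `right` reduce each of them to this form.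
 act-braid₀ : ∀ f → act₀ 0 (act₀ 1 (act₀ 0 (act₀ 1 f))) ≡ act₀ 1 (act₀ 0 (act₀ 1 (act₀ 0 f)))
 act-braid₀ [] = refl
 act-braid₀ (x ∷ []) = refl
 act-braid₀ (x ∷ y ∷ xs) = trans left (sym right)
   where
   sorted : ∀ {M k} → k ℤ.≤ M → N (N M ⊔ k) ∷ N M ⊓ k ∷ xs ≡ pair (N M) (N k) xs
   sorted {M} {k} k≤M with ℤ.≤-total k (+ 0)
   ... | inj₁ k≤0 = cong₂ (λ u w → u ∷ w ∷ xs) (trans (N-neg (ℤ.⊔-lub (N≤0 M) k≤0)) (cong (N M ⊔_) (sym (N-neg k≤0)))) (cong (N M ⊓_) (sym (N-neg k≤0)))
   ... | inj₂ 0≤k = cong₂ (λ u w → u ∷ w ∷ xs)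
           (trans (cong N (ℤ.i≤j⇒i⊔j≡j (ℤ.≤-trans (N≤0 M) 0≤k))) (sym (ℤ.i≤j⇒i⊔j≡j NM≤)))
           (trans (ℤ.i≤j⇒i⊓j≡i (ℤ.≤-trans (N≤0 M) 0≤k)) (sym (ℤ.i≤j⇒i⊓j≡i NM≤)))
     where
     NM≤ : N M ℤ.≤ N k
     NM≤ = subst₂ ℤ._≤_ (sym (N-pos (ℤ.≤-trans 0≤k k≤M))) (sym (N-pos 0≤k)) (ℤ.neg-mono-≤ k≤M)
   left : N (N (x ⊔ y) ⊔ (x ⊓ y)) ∷ N (x ⊔ y) ⊓ (x ⊓ y) ∷ xs ≡ pair (N x) (N y) xs
   left with ℤ.≤-total x y
   ... | inj₁ p = trans (cong₂ (λ u w → N (N u ⊔ w) ∷ N u ⊓ w ∷ xs) (ℤ.i≤j⇒i⊔j≡j p) (ℤ.i≤j⇒i⊓j≡i p)) (trans (sorted p) (pair-comm (N y) (N x) xs))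
   ... | inj₂ p = trans (cong₂ (λ u w → N (N u ⊔ w) ∷ N u ⊓ w ∷ xs) (ℤ.i≥j⇒i⊔j≡i p) (ℤ.i≥j⇒i⊓j≡j p)) (sorted p)
   right : pair (N (N x ⊔ y)) (N x ⊓ y) xs ≡ pair (N x) (N y) xs
   right with ℤ.≤-total y (+ 0)
   ... | inj₁ p = trans (cong (λ u → pair u (N x ⊓ y) xs) (N-neg (ℤ.⊔-lub (N≤0 x) p))) (trans (pair-idem (N x) y xs) (cong (λ u → pair (N x) u xs) (sym (N-neg p))))
   ... | inj₂ p = trans (cong₂ (λ u w → pair (N u) w xs) (ℤ.i≤j⇒i⊔j≡j (ℤ.≤-trans (N≤0 x) p)) (ℤ.i≤j⇒i⊓j≡i (ℤ.≤-trans (N≤0 x) p))) (pair-comm (N y) (N x) xs)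

 demazure-≈ : ∀ {as bs} → as ≈ bs → ∀ f → demazure as f ≡ demazure bs f
 demazure-≈ ≈-refl f = refl
 demazure-≈ (≈-sym e) f = sym (demazure-≈ e f)
 demazure-≈ (≈-trans e e′) f = trans (demazure-≈ e f) (demazure-≈ e′ f)
 demazure-≈ (++-cong {as} {as′} {bs} {bs′} e e′) f = trans (foldl-++ _ f as bs) (trans (cong (demazure bs) (demazure-≈ e f)) (trans (demazure-≈ e′ (demazure as′ f)) (sym (foldl-++ _ f as′ bs′))))
 demazure-≈ (idem i) f = act-idem i f
 demazure-≈ (comm i j p) f = sym (act-comm i j f p)
 demazure-≈ (braid (suc i) _) f = sort-braid i f
 demazure-≈ braid₀ f = act-braid₀ f

 -- In every relation the same letters occur on both sides. Hence all 0-Hecke expressions of one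
 -- element use the same letters, which makes their number of a given length finite.
 letters-≈ : ∀ {P : ℕ → Set} {as bs} → as ≈ bs → All P as ⇔ All P bs
 letters-≈ ≈-refl = mk⇔ id id
 letters-≈ (≈-sym e) = let open Equivalence (letters-≈ e) in mk⇔ from to
 letters-≈ (≈-trans e e′) = mk⇔ (Equivalence.to (letters-≈ e′) ∘ Equivalence.to (letters-≈ e)) (Equivalence.from (letters-≈ e) ∘ Equivalence.from (letters-≈ e′))
 letters-≈ (++-cong {as} {as′} e e′) = mk⇔
   (λ p → All.++⁺ (Equivalence.to (letters-≈ e) (All.++⁻ˡ as p)) (Equivalence.to (letters-≈ e′) (All.++⁻ʳ as p)))
   (λ p → All.++⁺ (Equivalence.from (letters-≈ e) (All.++⁻ˡ as′ p)) (Equivalence.from (letters-≈ e′) (All.++⁻ʳ as′ p)))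
 letters-≈ (idem i) = mk⇔ (λ { (p ∷ _) → p ∷ [] }) (λ { (p ∷ []) → p ∷ p ∷ [] })
 letters-≈ (comm i j _) = mk⇔ (λ { (p ∷ q ∷ []) → q ∷ p ∷ [] }) (λ { (p ∷ q ∷ []) → q ∷ p ∷ [] })
 letters-≈ (braid i _) = mk⇔ (λ { (p ∷ q ∷ _) → q ∷ p ∷ q ∷ [] }) (λ { (p ∷ q ∷ _) → q ∷ p ∷ q ∷ [] })
 letters-≈ braid₀ = mk⇔ (λ { (p ∷ q ∷ _) → q ∷ p ∷ q ∷ p ∷ [] }) (λ { (p ∷ q ∷ _) → q ∷ p ∷ q ∷ p ∷ [] })

 act-down : ∀ {a f g} → Down a f g → act₀ a f ≡ f × act₀ a g ≡ f
 act-down (neg {n}) = refl , refl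
 act-down (here {x} {y} {xs} p) = pair-sorted xs (ℤ.<⇒≤ p) , trans (pair-comm y x xs) (pair-sorted xs (ℤ.<⇒≤ p))
 act-down (there {x = x} d) = let p , q = act-down d in cong (x ∷_) p , cong (x ∷_) q

 -- A letter that is an ascent extends the reduced word. For a descent a, the reduced word can be
 -- rewritten by `matsumoto` to end in a, and `idem` then swallows the new a; this is exactly what
 -- `act₀` does to the window.
 absorb : ∀ {n f cs} → Proper n f → Red n f cs → ∀ as → All (_< n) as → ∃[ ds ] Red n (demazure as f) ds × cs ++ as ≈ ds
 absorb {cs = cs} p r [] [] = cs , r , ≈-reflexive (++-identityʳ cs)
 absorb {n} {f} {cs} p r (a ∷ as) (a<n ∷ as<n) with direction′ a p a<n
 ... | inj₂ d = let ds , r′ , e = absorb (sim-proper (sim-sym (down-sim d)) p) (snoc d r) as as<n in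
       ds , subst (λ w → Red n (demazure as w) ds) (sym (proj₂ (act-down d))) r′ , ≈-trans (≈-reflexive (sym (++-assoc cs (a ∷ []) as))) e
 ... | inj₁ d with absorb p r as as<n | red-exists (inv (sw a f)) (sw a f) refl (down-proper d p)
 ... | ds , r′ , e | bs , r″ = ds , subst (λ w → Red n (demazure as w) ds) (sym (proj₁ (act-down d))) r′ ,
         ≈-trans (≈-reflexive (sym (++-assoc cs (a ∷ []) as))) (≈-trans (++-cong {bs = as} (≈-trans (++-cong cs≈ ≈-refl)
           (≈-trans (≈-reflexive (++-assoc bs (a ∷ []) (a ∷ []))) (≈-trans (++-cong {as = bs} ≈-refl (idem a)) (≈-sym cs≈)))) ≈-refl) e)
   where
   cs≈ : cs ≈ bs ∷ʳ a
   cs≈ = matsumoto (inv f) refl p r (snoc d r″)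

 multiply : List ℕ → List ℤ → List ℤ
 multiply as f = foldl (λ g a → sw a g) f as

 red-multiply : ∀ {n f cs} → Red n f cs → multiply cs (idw n) ≡ f
 red-multiply nil = refl
 red-multiply {n} (snoc {a} {as = as} d r) = trans (foldl-++ _ (idw n) as (a ∷ [])) (trans (cong (sw a) (red-multiply r)) (down-sw d))

 red-demazure : ∀ {n f cs} → Red n f cs → demazure cs (idw n) ≡ f
 red-demazure nil = refl
 red-demazure {n} (snoc {a} {as = as} d r) = trans (foldl-++ _ (idw n) as (a ∷ [])) (trans (cong (act₀ a) (red-demazure r)) (proj₂ (act-down d)))

 range-bounds : ∀ k n → All (λ j → k ≤ j × j < k + n) (range k n)
 range-bounds k zero = []
 range-bounds k (suc n) = (≤-refl , m<m+n k z<s) ∷ All.map (λ { {j} (p , q) → <⇒≤ p , subst (j <_) (sym (+-suc k n)) q }) (range-bounds (suc k) n)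

 range-length : ∀ k n → length (range k n) ≡ n
 range-length k zero = refl
 range-length k (suc n) = cong suc (range-length (suc k) n)

 idw-proper : ∀ n → Proper n (idw n)
 idw-proper n = proper (trans (length-map pos (range 1 n)) (range-length 1 n)) (All.map⁺ (All.map (λ { (p , q) → p , s≤s⁻¹ q }) (range-bounds 1 n))) (pairs 1 n)
   where
   pairs : ∀ k n → AllPairs Distinct (map pos (range k n))
   pairs k zero = []
   pairs k (suc n) = All.map⁺ (All.map (λ { (p , _) e → <-irrefl e p }) (range-bounds (suc k) n)) ∷ pairs (suc k) n

 inv-idw : ∀ n → inv (idw n) ≡ 0
 inv-idw n = zero-inv 1 n
  where
   zero-count : ∀ j k n → j < k → count (+ j) (map pos (range k n)) ≡ 0
   zero-count j k zero _ = refl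
   zero-count j k (suc n) p = cong₂ _+_ (cong₂ _+_ (less-no {+ j} {+ k} (λ { (+<+ q) → <-asym p q }))
     (less-no { - (+ j)} {+ k} (λ q → ℤ.<⇒≱ q (ℤ.≤-trans (ℤ.neg-mono-≤ (+≤+ (z≤n {j}))) (+≤+ z≤n))))) (zero-count j (suc k) n (m<n⇒m<1+n p))
   zero-inv : ∀ k n → inv (map pos (range k n)) ≡ 0
   zero-inv k zero = refl
   zero-inv k (suc n) = cong₂ _+_ (zero-count k (suc k) n ≤-refl) (zero-inv (suc k) n)

 red-length : ∀ {n f cs} → Red n f cs → inv f ≡ length cs
 red-length {n} nil = inv-idw n
 red-length (snoc {as = as} d r) = trans (inv-down d) (trans (cong suc (red-length r)) (sym (trans (length-++ as) (+-comm _ 1))))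

 red-letters : ∀ {n f cs} → Proper n f → Red n f cs → All (_< n) cs
 red-letters p nil = []
 red-letters {n} p (snoc {a} d r) = All.∷ʳ⁺ (red-letters (down-proper d p) r) (subst (a <_) (size p) (down-< d))

 multiply-inv : ∀ {n f} → Proper n f → ∀ bs → All (_< n) bs → inv (multiply bs f) ≤ inv f + length bs
 multiply-inv {f = f} p [] _ = m≤m+n _ _
 multiply-inv {f = f} p (a ∷ bs) (a<n ∷ bs<n) with direction′ a p a<n
 ... | inj₁ d = ≤-trans (multiply-inv (down-proper d p) bs bs<n) (+-mono-≤ (≤-trans (n≤1+n _) (≤-reflexive (sym (inv-down d)))) (n≤1+n _))
 ... | inj₂ d = ≤-trans (multiply-inv (sim-proper (sim-sym (down-sim d)) p) bs bs<n) (≤-reflexive (trans (cong (_+ length bs) (inv-down d)) (sym (+-suc _ _))))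

 -- Each letter changes the length by one, so the greatest possible growth forces every letter to be
 -- an ascent.
 multiply-red : ∀ {n f cs} → Proper n f → Red n f cs → ∀ bs → All (_< n) bs → inv f + length bs ≤ inv (multiply bs f) → Red n (multiply bs f) (cs ++ bs)
 multiply-red {n} {f} {cs} p r [] _ _ = subst (Red n f) (sym (++-identityʳ cs)) r
 multiply-red {n} {f} {cs} p r (a ∷ bs) (a<n ∷ bs<n) q with direction′ a p a<n
 ... | inj₁ d = ⊥-elim (<⇒≱ (s≤s (multiply-inv (down-proper d p) bs bs<n)) (≤-trans (≤-trans (s≤s (+-monoˡ-≤ (length bs) (≤-trans (n≤1+n _) (≤-reflexive (sym (inv-down d)))))) (≤-reflexive (sym (+-suc _ _)))) q))
 ... | inj₂ d = subst (Red n (multiply bs (sw a f))) (++-assoc cs (a ∷ []) bs)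
       (multiply-red (sim-proper (sim-sym (down-sim d)) p) (snoc d r) bs bs<n (≤-trans (≤-reflexive (trans (cong (_+ length bs) (inv-down d)) (sym (+-suc _ _)))) q))

 red-++ : ∀ {n f cs} k → Red n f cs → Red (n + k) (f ++ map pos (range (suc n) k)) cs
 red-++ {n} k nil = subst (λ w → Red (n + k) w []) (trans (cong (map pos) (range-++ 1 n k)) (map-++ pos (range 1 n) (range (suc n) k))) nil
 red-++ {n} k (snoc d r) = snoc (down-++ (map pos (range (suc n) k)) d) (red-++ k r)

 -- Group products as functions on the integers

 swap-l : ∀ a b → swap a b a ≡ b
 swap-l a b with a ℤ.≟ a
 ... | yes _ = refl
 ... | no n = ⊥-elim (n refl)

 swap-r : ∀ a b → ¬ a ≡ b → swap a b b ≡ a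
 swap-r a b a≢b with b ℤ.≟ a | b ℤ.≟ b
 ... | yes e | _ = ⊥-elim (a≢b (sym e))
 ... | no _ | yes _ = refl
 ... | no _ | no n = ⊥-elim (n refl)

 swap-o : ∀ a b x → ¬ x ≡ a → ¬ x ≡ b → swap a b x ≡ x
 swap-o a b x x≢a x≢b with x ℤ.≟ a | x ℤ.≟ b
 ... | yes e | _ = ⊥-elim (x≢a e)
 ... | no _ | yes e = ⊥-elim (x≢b e)
 ... | no _ | no _ = refl

 module _ (i : ℕ) where
   private
     neg-fix : ∀ x → ¬ x ≡ + suc i → ¬ x ≡ + suc (suc i) → s (suc i) x ≡ swap -[1+ suc i ] -[1+ i ] x
     neg-fix x p q = cong (swap -[1+ suc i ] -[1+ i ]) (swap-o (+ suc i) (+ suc (suc i)) x p q)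

   s-pos-l : s (suc i) (+ suc i) ≡ + suc (suc i)
   s-pos-l = trans (cong (swap -[1+ suc i ] -[1+ i ]) (swap-l (+ suc i) (+ suc (suc i)))) (swap-o -[1+ suc i ] -[1+ i ] (+ suc (suc i)) (λ ()) (λ ()))

   s-pos-r : s (suc i) (+ suc (suc i)) ≡ + suc i
   s-pos-r = trans (cong (swap -[1+ suc i ] -[1+ i ]) (swap-r (+ suc i) (+ suc (suc i)) (λ e → 1+n≢n (sym (ℤ.+-injective e))))) (swap-o -[1+ suc i ] -[1+ i ] (+ suc i) (λ ()) (λ ()))

   s-pos-o : ∀ k → ¬ k ≡ suc i → ¬ k ≡ suc (suc i) → s (suc i) (+ k) ≡ + k
   s-pos-o k p q = trans (neg-fix (+ k) (p ∘ ℤ.+-injective) (q ∘ ℤ.+-injective)) (swap-o -[1+ suc i ] -[1+ i ] (+ k) (λ ()) (λ ()))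

   s-neg-l : s (suc i) -[1+ i ] ≡ -[1+ suc i ]
   s-neg-l = trans (neg-fix -[1+ i ] (λ ()) (λ ())) (swap-r -[1+ suc i ] -[1+ i ] (λ e → 1+n≢n (ℤ.-[1+-injective e)))

   s-neg-r : s (suc i) -[1+ suc i ] ≡ -[1+ i ]
   s-neg-r = trans (neg-fix -[1+ suc i ] (λ ()) (λ ())) (swap-l -[1+ suc i ] -[1+ i ])

   s-neg-o : ∀ k → ¬ k ≡ i → ¬ k ≡ suc i → s (suc i) -[1+ k ] ≡ -[1+ k ]
   s-neg-o k p q = trans (neg-fix -[1+ k ] (λ ()) (λ ())) (swap-o -[1+ suc i ] -[1+ i ] -[1+ k ] (q ∘ ℤ.-[1+-injective) (p ∘ ℤ.-[1+-injective))

 Odd : (ℤ → ℤ) → Set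
 Odd F = ∀ x → F (- x) ≡ - F x

 s-odd : ∀ a → Odd (s a)
 s-odd zero (+ zero) = refl
 s-odd zero (+ suc zero) = refl
 s-odd zero (+ suc (suc n)) = refl
 s-odd zero -[1+ zero ] = refl
 s-odd zero -[1+ suc n ] = refl
 s-odd (suc i) (+ zero) = trans (s-pos-o i 0 (λ ()) (λ ())) (cong -_ (sym (s-pos-o i 0 (λ ()) (λ ()))))
 s-odd (suc i) (+ suc k) = by (k ≟ i) (k ≟ suc i)
   where
   by : Dec (k ≡ i) → Dec (k ≡ suc i) → s (suc i) -[1+ k ] ≡ - s (suc i) (+ suc k)
   by (yes refl) _ = trans (s-neg-l i) (cong -_ (sym (s-pos-l i)))
   by (no _) (yes refl) = trans (s-neg-r i) (cong -_ (sym (s-pos-r i)))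
   by (no p) (no q) = trans (s-neg-o i k p q) (cong -_ (sym (s-pos-o i (suc k) (p ∘ suc-injective) (q ∘ suc-injective))))
 s-odd (suc i) -[1+ k ] = by (k ≟ i) (k ≟ suc i)
   where
   by : Dec (k ≡ i) → Dec (k ≡ suc i) → s (suc i) (+ suc k) ≡ - s (suc i) -[1+ k ]
   by (yes refl) _ = trans (s-pos-l i) (cong -_ (sym (s-neg-l i)))
   by (no _) (yes refl) = trans (s-pos-r i) (cong -_ (sym (s-neg-r i)))
   by (no p) (no q) = trans (s-pos-o i (suc k) (p ∘ suc-injective) (q ∘ suc-injective)) (cong -_ (sym (s-neg-o i k p q)))

 s-fixes : ∀ a k → suc a < k → s a (+ k) ≡ + k
 s-fixes zero (suc (suc k)) _ = refl
 s-fixes zero (suc zero) (s≤s ())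
 s-fixes (suc i) k p = s-pos-o i k (λ { refl → <-asym p ≤-refl }) (λ { refl → <-irrefl refl p })

 odd-∘ : ∀ {F G} → Odd F → Odd G → Odd (F ∘ G)
 odd-∘ {F} {G} oF oG x = trans (cong F (oG x)) (oF (G x))

 product-odd : ∀ as → Odd (groupProduct as)
 product-odd [] x = refl
 product-odd (a ∷ as) = odd-∘ {s a} {groupProduct as} (s-odd a) (product-odd as)

 product-fixes : ∀ n as → All (_< n) as → ∀ k → n < k → groupProduct as (+ k) ≡ + k
 product-fixes n [] _ k _ = refl
 product-fixes n (a ∷ as) (p ∷ ps) k n<k = trans (cong (s a) (product-fixes n as ps k n<k)) (s-fixes a k (≤-<-trans p n<k))

 win : (ℤ → ℤ) → ℕ → ℕ → List ℤ
 win F k n = map (F ∘ pos) (range k n)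

 win-cong : ∀ (F G : ℤ → ℤ) k n → (∀ j → k ≤ j → F (+ j) ≡ G (+ j)) → win F k n ≡ win G k n
 win-cong F G k zero e = refl
 win-cong F G k (suc n) e = cong₂ _∷_ (e k ≤-refl) (win-cong F G (suc k) n λ j p → e j (<⇒≤ p))

 win-injective : ∀ (F G : ℤ → ℤ) k n → win F k n ≡ win G k n → ∀ j → k ≤ j → j < k + n → F (+ j) ≡ G (+ j)
 win-injective F G k zero e j p q = ⊥-elim (<⇒≱ q (≤-trans (≤-reflexive (+-identityʳ k)) p))
 win-injective F G k (suc n) e j p q with m≤n⇒m<n∨m≡n p
 ... | inj₂ refl = ∷-injectiveˡ e
 ... | inj₁ k<j = win-injective F G (suc k) n (∷-injectiveʳ e) j k<j (subst (j <_) (+-suc k n) q)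

 win-s : ∀ F a n → Odd F → a < n → win (F ∘ s a) 1 n ≡ sw a (win F 1 n)
 win-s F zero (suc n) oF _ = cong₂ _∷_ (oF (+ 1)) (win-cong (F ∘ s 0) F 2 n λ { (suc (suc j)) _ → refl ; (suc zero) (s≤s ()) })
 win-s F (suc i) n _ p = go 1 i n refl p
   where
   go : ∀ k l n → k + l ≡ suc i → suc l < n → win (F ∘ s (suc i)) k n ≡ swapAt l (win F k n)
   go k zero (suc (suc n)) e _ with trans (sym (+-identityʳ k)) e
   ... | refl = cong₂ _∷_ (cong F (s-pos-l i)) (cong₂ _∷_ (cong F (s-pos-r i))
                  (win-cong (F ∘ s (suc i)) F (suc (suc k)) n λ j q → cong F (s-pos-o i j (λ { refl → <-asym q ≤-refl }) (λ { refl → <-irrefl refl q }))))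
   go k zero (suc zero) e (s≤s ())
   go k (suc l) (suc n) e (s≤s q) = cong₂ _∷_ (cong F (s-pos-o i k (<⇒≢ k<) (<⇒≢ (<-trans k< ≤-refl)))) (go (suc k) l n (trans (sym (+-suc k l)) e) q)
     where
     k< : k < suc i
     k< = subst (k <_) e (m<m+n k z<s)

 -- Composing with s_a on the right permutes positions, so the word acts on the window from left to
 -- right. The function F is arbitrary so that the first letter can be moved into it.
 product-window : ∀ n as → All (_< n) as → ∀ F → Odd F → win (F ∘ groupProduct as) 1 n ≡ multiply as (win F 1 n)
 product-window n [] _ F _ = refl
 product-window n (a ∷ as) (p ∷ ps) F oF = trans (product-window n as ps (F ∘ s a) (odd-∘ {F} {s a} oF (s-odd a))) (cong (multiply as) (win-s F a n oF p))

 odd-zero : ∀ F → Odd F → F (+ 0) ≡ + 0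
 odd-zero F oF = self (F (+ 0)) (oF (+ 0))
   where
   self : ∀ z → z ≡ - z → z ≡ + 0
   self (+ zero) _ = refl
   self (+ suc n) ()
   self -[1+ n ] ()

 odd-ext : ∀ {F G} → Odd F → Odd G → (∀ j → F (+ suc j) ≡ G (+ suc j)) → ∀ x → F x ≡ G x
 odd-ext {F} {G} oF oG e (+ zero) = trans (odd-zero F oF) (sym (odd-zero G oG))
 odd-ext oF oG e (+ suc n) = e n
 odd-ext oF oG e -[1+ n ] = trans (oF (+ suc n)) (trans (cong -_ (e n)) (sym (oG (+ suc n))))

 abs-± : ∀ x y → ∣ x ∣ ≡ ∣ y ∣ → x ≡ y ⊎ x ≡ - y
 abs-± (+ a) (+ .a) refl = inj₁ refl
 abs-± (+ .(suc b)) -[1+ b ] refl = inj₂ refl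
 abs-± -[1+ a ] (+ .(suc a)) refl = inj₂ refl
 abs-± -[1+ a ] -[1+ .a ] refl = inj₁ refl

 -- The 0-Hecke expressions of a fixed signed permutation

 module Element {m : ℕ} (w : SignedPermutation m) where
   open SignedPermutation w using (bijection; odd; fixes)

   F : ℤ → ℤ
   F = apply w

   window : List ℤ
   window = win F 1 m

   injective : ∀ {x y} → F x ≡ F y → x ≡ y
   injective {x} {y} e = trans (sym (Inverse.strictlyInverseʳ bijection x)) (trans (cong (Inverse.from bijection) e) (Inverse.strictlyInverseʳ bijection y))

   fixes⁺ : ∀ j → m < j → F (+ j) ≡ + j
   fixes⁺ j = fixes (+ j)

   window-proper : Proper m window
   window-proper = proper (trans (length-map (F ∘ pos) (range 1 m)) (range-length 1 m)) (All.map⁺ (All.map bound (range-bounds 1 m))) (pairs 1 m (s≤s z≤n))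
     where
     bound : ∀ {j} → 1 ≤ j × j < 1 + m → 0 < ∣ F (+ j) ∣ × ∣ F (+ j) ∣ ≤ m
     bound {j} (p , q) = n≢0⇒n>0 (λ e → <⇒≢ p (sym (ℤ.+-injective (injective (trans (ℤ.∣i∣≡0⇒i≡0 e) (sym (odd-zero F odd))))))) ,
       -- An image of absolute value beyond m would be fixed by F, hence equal to j by injectivity,
       -- and j is at most m.
       ≮⇒≥ λ r → <⇒≱ r (subst (λ z → ∣ z ∣ ≤ m) (sym (injective (fixes (F (+ j)) r))) (s≤s⁻¹ q))
     dis : ∀ {i j} → 0 < i → i < j → Distinct (F (+ i)) (F (+ j))
     dis {suc i} {j} _ i<j e with abs-± (F (+ suc i)) (F (+ j)) e
     ... | inj₁ f = <⇒≢ i<j (ℤ.+-injective (injective f))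
     ... | inj₂ f = clash j i<j (injective (trans f (sym (odd (+ j)))))
       where
       clash : ∀ j → suc i < j → ¬ + suc i ≡ - (+ j)
       clash (suc j) _ ()
     pairs : ∀ k n → 0 < k → AllPairs Distinct (map (F ∘ pos) (range k n))
     pairs k zero _ = []
     pairs k (suc n) p = All.map⁺ (All.map (λ { (q , _) → dis p q }) (range-bounds (suc k) n)) ∷ pairs (suc k) n z<s

   canonical : ∃[ ds ] Red m window ds
   canonical = red-exists (inv window) window refl window-proper

   ds : List ℕ
   ds = proj₁ canonical

   ds-letters : All (_< m) ds
   ds-letters = red-letters window-proper (proj₂ canonical)

   ds-expresses : Expresses w ds
   ds-expresses = odd-ext {groupProduct ds} {F} (product-odd ds) odd agree
     where
     windows : win (groupProduct ds) 1 m ≡ window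
     windows = trans (product-window m ds ds-letters id (λ _ → refl)) (red-multiply (proj₂ canonical))
     agree : ∀ j → groupProduct ds (+ suc j) ≡ F (+ suc j)
     agree j with m <? suc j
     ... | yes p = trans (product-fixes m ds ds-letters (suc j) p) (sym (fixes⁺ (suc j) p))
     ... | no p = win-injective (groupProduct ds) F 1 m windows (suc j) (s≤s z≤n) (s≤s (≮⇒≥ p))

   -- `Reduced` compares with words in arbitrary letters. So w is viewed in W_{m+k}, with k large
   -- enough for the word at hand.
   wide : ℕ → List ℤ
   wide k = window ++ map pos (range (suc m) k)

   wide-window : ∀ k → win F 1 (m + k) ≡ wide k
   wide-window k = trans (cong (map (F ∘ pos)) (range-++ 1 m k)) (trans (map-++ (F ∘ pos) (range 1 m) (range (suc m) k))
     (cong (window ++_) (win-cong F id (suc m) k fixes⁺)))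

   ds-wide : ∀ k → Red (m + k) (wide k) ds
   ds-wide k = red-++ k (proj₂ canonical)

   bound-of : ∀ bs → ∃[ k ] All (_< m + k) bs
   bound-of [] = 0 , []
   bound-of (b ∷ bs) with bound-of bs
   ... | k , p = suc b + k , <-≤-trans (s≤s (m≤m+n b k)) (m≤n+m _ m) ∷ All.map (λ q → <-≤-trans q (+-monoʳ-≤ m (m≤n+m k (suc b)))) p

   expresses-wide : ∀ bs → Expresses w bs → ∀ k → All (_< m + k) bs → multiply bs (idw (m + k)) ≡ wide k
   expresses-wide bs e k p = trans (sym (product-window (m + k) bs p id (λ _ → refl))) (trans (win-cong (groupProduct bs) F 1 (m + k) λ j _ → e (+ j)) (wide-window k))

   ds-reduced : Reduced w ds
   ds-reduced = ds-expresses , λ bs e → let k , p = bound-of bs in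
     ≤-trans (≤-reflexive (sym (red-length (ds-wide k)))) (≤-trans (≤-reflexive (cong inv (sym (expresses-wide bs e k p))))
       (≤-trans (multiply-inv (idw-proper (m + k)) bs p) (≤-reflexive (cong (_+ length bs) (inv-idw (m + k))))))

   reduced≈ds : ∀ bs → Reduced w bs → bs ≈ ds
   reduced≈ds bs (e , minimal) = let k , p = bound-of bs
                                     r = multiply-red (idw-proper (m + k)) nil bs p
                                           (≤-trans (≤-reflexive (cong (_+ length bs) (inv-idw (m + k)))) (≤-trans (minimal ds ds-expresses)
                                             (≤-reflexive (trans (sym (red-length (ds-wide k))) (cong inv (sym (expresses-wide bs e k p)))))))
                                     P = wide-proper k
                                 in matsumoto (inv (wide k)) refl P (subst (λ z → Red (m + k) z bs) (expresses-wide bs e k p) r) (ds-wide k)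
     where
     red-proper : ∀ {n f cs} → Red n f cs → Proper n f
     red-proper {n} nil = idw-proper n
     red-proper (snoc d r) = sim-proper (sim-sym (down-sim d)) (red-proper r)
     wide-proper : ∀ k → Proper (m + k) (wide k)
     wide-proper k = red-proper (ds-wide k)

   -- The right side is decidable. A class determines its letters and its action on the identity
   -- window; conversely, `absorb` started at the identity turns the word into a reduced word of the
   -- window reached, which `matsumoto` identifies with `ds`.
   hecke⇔ : ∀ as → HeckeExpression w as ⇔ (All (_< m) as × demazure as (idw m) ≡ window)
   hecke⇔ as = mk⇔ to from
     where
     to : HeckeExpression w as → All (_< m) as × demazure as (idw m) ≡ window
     to (bs , r , e) = let f = ≈-trans e (reduced≈ds bs r) in
       Equivalence.from (letters-≈ f) ds-letters , trans (demazure-≈ f (idw m)) (red-demazure (proj₂ canonical))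
     from : All (_< m) as × demazure as (idw m) ≡ window → HeckeExpression w as
     from (l , e) with absorb (idw-proper m) nil as l
     ... | cs , r , f = ds , ds-reduced , ≈-trans f (matsumoto (inv window) refl window-proper (subst (λ z → Red m z cs) e r) (proj₂ canonical))

   hecke-letters : ∀ {as} → HeckeExpression w as → All (_< m) as
   hecke-letters {as} h = proj₁ (Equivalence.to (hecke⇔ as) h)

   hecke? : ∀ as → Dec (HeckeExpression w as)
   hecke? as = map′ (Equivalence.from (hecke⇔ as)) (Equivalence.to (hecke⇔ as)) (All.all? (_<? m) as ×-dec ≡-dec ℤ._≟_ (demazure as (idw m)) window)

-- Counting by duplicate-free lists

module Cardinality where

 open import Data.Fin as Fin using (Fin; zero; suc)
 open import Data.Fin.Properties using (injective⇒≤)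
 open import Data.List using (length; lookup; concat; cartesianProduct; cartesianProductWith)
 open import Data.List.Properties using (length-++; length-map; ∷-injective)
 open import Data.List.Membership.Propositional.Properties using (∈-lookup; ∈-map⁻; ∈-map⁺; ∈-concat⁺′; ∈-concat⁻′; ∈-cartesianProductWith⁺; ∈-cartesianProductWith⁻; ∈-cartesianProduct⁺; ∈-cartesianProduct⁻)
 open import Data.List.Relation.Unary.Any as Any using (here)
 open import Data.List.Relation.Unary.Any.Properties using (lookup-index)
 open import Data.List.Relation.Unary.Unique.Propositional using (Unique)
 import Data.List.Relation.Unary.Unique.Propositional.Properties as Unique
 open import Data.Nat using (zero; suc; _+_; _≤_)
 open import Data.Nat.Properties using (≤-antisym)
 open import Level using (0ℓ)
 open import Relation.Binary using (Setoid)

 module _ {A : Set} where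

   lookup-injective : ∀ {xs : List A} → Unique xs → ∀ i j → lookup xs i ≡ lookup xs j → i ≡ j
   lookup-injective (_ ∷ _) zero zero _ = refl
   lookup-injective {x ∷ xs} (n ∷ _) zero (suc j) e = ⊥-elim (All.lookup n (∈-lookup {xs = xs} j) e)
   lookup-injective {x ∷ xs} (n ∷ _) (suc i) zero e = ⊥-elim (All.lookup n (∈-lookup {xs = xs} i) (sym e))
   lookup-injective (_ ∷ u) (suc i) (suc j) e = cong suc (lookup-injective u i j e)

 module _ {A B : Set} (ρ : A → B → Set) where

   length-≤ : ∀ {xs ys} → Unique xs → (∀ {x} → x ∈ xs → ∃[ y ] y ∈ ys × ρ x y) → (∀ {x x′ y} → ρ x y → ρ x′ y → x ≡ x′) → length xs ≤ length ys
   length-≤ {xs} {ys} u total inj = injective⇒≤ {f = f} λ {i} {j} e → lookup-injective u i j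
     (inj (proj₂ (proj₂ (img i))) (subst (ρ (lookup xs j)) (trans (lookup-index (proj₁ (proj₂ (img j)))) (trans (cong (lookup ys) (sym e)) (sym (lookup-index (proj₁ (proj₂ (img i))))))) (proj₂ (proj₂ (img j)))))
     where
     img : ∀ i → ∃[ y ] y ∈ ys × ρ (lookup xs i) y
     img i = total (∈-lookup {xs = xs} i)
     f : Fin (length xs) → Fin (length ys)
     f i = Any.index (proj₁ (proj₂ (img i)))

 -- The bijection is given as a relation, since insertion is an inductive relation and its inverse
 -- is obtained by a separate construction.
 length-≡ : ∀ {A B : Set} (ρ : A → B → Set) {xs ys} → Unique xs → Unique ys →
   (∀ {x} → x ∈ xs → ∃[ y ] y ∈ ys × ρ x y) → (∀ {y} → y ∈ ys → ∃[ x ] x ∈ xs × ρ x y) →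
   (∀ {x x′ y} → ρ x y → ρ x′ y → x ≡ x′) → (∀ {x y y′} → ρ x y → ρ x y′ → y ≡ y′) → length xs ≡ length ys
 length-≡ ρ u v total onto inj fun = ≤-antisym (length-≤ ρ u total inj) (length-≤ (λ y x → ρ x y) v onto fun)

 -- φ is a complete invariant of the setoid, so the proofs and functions inside its elements never
 -- have to be compared; only their codes are.
 hasCard : (S : Setoid 0ℓ 0ℓ) {A : Set} (φ : Setoid.Carrier S → A) (xs : List A) → Unique xs →
   (∀ {x y} → Setoid._≈_ S x y → φ x ≡ φ y) → (∀ {x y} → φ x ≡ φ y → Setoid._≈_ S x y) →
   (∀ x → φ x ∈ xs) → (∀ {a} → a ∈ xs → ∃[ x ] φ x ≡ a) → HasCard S (length xs)
 hasCard S φ xs u cg inj mem onto = record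
   { to = to ; from = from
   ; to-cong = λ {x} {y} e → lookup-injective u (to x) (to y) (trans (sym (lookup-to x)) (trans (cg e) (lookup-to y)))
   ; from-cong = λ { refl → Setoid.refl S }
   ; inverse = (λ {i} {x} e → lookup-injective u (to x) i (trans (sym (lookup-to x)) (trans (cg e) (φ-from i)))) ,
               (λ {x} {i} e → inj (trans (φ-from i) (trans (cong (lookup xs) e) (sym (lookup-to x)))))
   }
   where
   to : Setoid.Carrier S → Fin (length xs)
   to x = Any.index (mem x)
   from : Fin (length xs) → Setoid.Carrier S
   from i = proj₁ (onto (∈-lookup {xs = xs} i))
   lookup-to : ∀ x → φ x ≡ lookup xs (to x)
   lookup-to x = lookup-index (mem x)
   φ-from : ∀ i → φ (from i) ≡ lookup xs i
   φ-from i = proj₂ (onto (∈-lookup {xs = xs} i))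

 words : {A : Set} → List A → ℕ → List (List A)
 words xs zero = [] ∷ []
 words xs (suc n) = cartesianProductWith _∷_ xs (words xs n)

 module _ {A : Set} {xs : List A} where

   words-unique : Unique xs → ∀ n → Unique (words xs n)
   words-unique u zero = [] ∷ []
   words-unique u (suc n) = Unique.cartesianProductWith⁺ _∷_ ∷-injective u (words-unique u n)

   ∈-words⁺ : ∀ {w} → All (_∈ xs) w → w ∈ words xs (length w)
   ∈-words⁺ [] = here refl
   ∈-words⁺ (p ∷ ps) = ∈-cartesianProductWith⁺ _∷_ p (∈-words⁺ ps)

   ∈-words⁻ : ∀ n {w} → w ∈ words xs n → length w ≡ n
   ∈-words⁻ zero (here refl) = refl
   ∈-words⁻ (suc n) p with ∈-cartesianProductWith⁻ _∷_ xs (words xs n) p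
   ... | _ , _ , _ , q , refl = cong suc (∈-words⁻ n q)

 length-cartesianProduct : ∀ {A B : Set} (xs : List A) (ys : List B) → length (cartesianProduct xs ys) ≡ length xs * length ys
 length-cartesianProduct [] ys = refl
 length-cartesianProduct (x ∷ xs) ys = trans (length-++ (map (x ,_) ys)) (cong₂ _+_ (length-map (x ,_) ys) (length-cartesianProduct xs ys))

 module _ {I A B : Set} (P : I → List A) (Q : I → List B) where

   pairs : List I → List (A × B)
   pairs is = concat (map (λ i → cartesianProduct (P i) (Q i)) is)

   length-pairs : ∀ is → length (pairs is) ≡ sum (map (λ i → length (P i) * length (Q i)) is)
   length-pairs [] = refl
   length-pairs (i ∷ is) = trans (length-++ (cartesianProduct (P i) (Q i))) (cong₂ _+_ (length-cartesianProduct (P i) (Q i)) (length-pairs is))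

   ∈-pairs⁺ : ∀ {i is a b} → i ∈ is → a ∈ P i → b ∈ Q i → (a , b) ∈ pairs is
   ∈-pairs⁺ i∈ a∈ b∈ = ∈-concat⁺′ (∈-cartesianProduct⁺ a∈ b∈) (∈-map⁺ _ i∈)

   ∈-pairs⁻ : ∀ is {a b} → (a , b) ∈ pairs is → ∃[ i ] i ∈ is × a ∈ P i × b ∈ Q i
   ∈-pairs⁻ is p with ∈-concat⁻′ (map (λ i → cartesianProduct (P i) (Q i)) is) p
   ... | _ , q , r with ∈-map⁻ (λ i → cartesianProduct (P i) (Q i)) r
   ... | i , i∈ , refl = let a∈ , b∈ = ∈-cartesianProduct⁻ (P i) (Q i) q in i , i∈ , a∈ , b∈

   pairs-unique : (∀ i → Unique (P i)) → (∀ i → Unique (Q i)) → (∀ {i j a} → a ∈ P i → a ∈ P j → i ≡ j) → ∀ {is} → Unique is → Unique (pairs is)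
   pairs-unique uP uQ dis {is} u = Unique.concat⁺ (All.map⁺ (All.tabulate λ {i} _ → Unique.cartesianProduct⁺ (uP i) (uQ i)))
     (AllPairs.map⁺ (AllPairs.map (λ i≢j → λ { {a , b} (p , q) → i≢j (dis (proj₁ (∈-cartesianProduct⁻ (P _) (Q _) p)) (proj₁ (∈-cartesianProduct⁻ (P _) (Q _) q))) }) u))

import Data.List.Membership.DecPropositional as DecMem
open import Data.List.Relation.Unary.Any using (here; there)
open import Data.Maybe using (Maybe; just; nothing)
open import Data.Nat
open import Data.Nat.Properties
open import Data.List.Membership.Propositional.Properties using (∈-++⁻; ∈-++⁺ˡ; ∈-++⁺ʳ; ∈-∃++)
open import Data.List.Properties using (length-++; ++-assoc; ∷-injectiveˡ; ∷-injectiveʳ)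
open import Data.List using (_++_; _∷ʳ_; length)

-- Unimodal rows and the counting functions on them

module Rows where

 open import Data.List using (filter)
 open import Data.List.Properties using (filter-++; filter-accept; filter-reject; filter-all; filter-none; length-filter)
 open import Data.Unit using (⊤)

 Desc Asc : List ℕ → Set
 Desc = AllPairs _>_
 Asc = AllPairs _<_

 gt lt : ℕ → List ℕ → ℕ
 gt s xs = length (filter (s <?_) xs)
 lt v xs = length (filter (_<? v) xs)

 AllPairs-++⁻ : ∀ {R : ℕ → ℕ → Set} xs {ys} → AllPairs R (xs ++ ys) →
                AllPairs R xs × AllPairs R ys × All (λ x → All (R x) ys) xs
 AllPairs-++⁻ [] p = [] , p , []
 AllPairs-++⁻ (x ∷ xs) (h ∷ p) =
   let a , b , c = AllPairs-++⁻ xs p ; h₁ , h₂ = All.++⁻ xs h in h₁ ∷ a , b , h₂ ∷ c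

 module _ (s : ℕ) where

   gt-++ : ∀ xs ys → gt s (xs ++ ys) ≡ gt s xs + gt s ys
   gt-++ xs ys = trans (cong length (filter-++ (s <?_) xs ys)) (length-++ (filter (s <?_) xs))

   lt-++ : ∀ xs ys → lt s (xs ++ ys) ≡ lt s xs + lt s ys
   lt-++ xs ys = trans (cong length (filter-++ (_<? s) xs ys)) (length-++ (filter (_<? s) xs))

   gt-yes : ∀ {x} xs → s < x → gt s (x ∷ xs) ≡ suc (gt s xs)
   gt-yes xs p = cong length (filter-accept (s <?_) p)

   gt-no : ∀ {x} xs → x ≤ s → gt s (x ∷ xs) ≡ gt s xs
   gt-no xs p = cong length (filter-reject (s <?_) (≤⇒≯ p))

   lt-yes : ∀ {x} xs → x < s → lt s (x ∷ xs) ≡ suc (lt s xs)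
   lt-yes xs p = cong length (filter-accept (_<? s) p)

   lt-no : ∀ {x} xs → s ≤ x → lt s (x ∷ xs) ≡ lt s xs
   lt-no xs p = cong length (filter-reject (_<? s) (≤⇒≯ p))

   gt-all : ∀ {xs} → All (s <_) xs → gt s xs ≡ length xs
   gt-all p = cong length (filter-all (s <?_) p)

   gt-none : ∀ {xs} → All (_≤ s) xs → gt s xs ≡ 0
   gt-none p = cong length (filter-none (s <?_) (All.map ≤⇒≯ p))

   lt-all : ∀ {xs} → All (_< s) xs → lt s xs ≡ length xs
   lt-all p = cong length (filter-all (_<? s) p)

   lt-none : ∀ {xs} → All (s ≤_) xs → lt s xs ≡ 0
   lt-none p = cong length (filter-none (_<? s) (All.map ≤⇒≯ p))

   gt-len : ∀ xs → gt s xs ≤ length xs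
   gt-len xs = length-filter (s <?_) xs

   lt-len : ∀ xs → lt s xs ≤ length xs
   lt-len xs = length-filter (_<? s) xs

 gt-view : ∀ s x xs → (s < x × gt s (x ∷ xs) ≡ suc (gt s xs)) ⊎ (x ≤ s × gt s (x ∷ xs) ≡ gt s xs)
 gt-view s x xs with s <? x
 ... | yes p = inj₁ (p , gt-yes s xs p)
 ... | no p = inj₂ (≮⇒≥ p , gt-no s xs (≮⇒≥ p))

 lt-view : ∀ v x xs → (x < v × lt v (x ∷ xs) ≡ suc (lt v xs)) ⊎ (v ≤ x × lt v (x ∷ xs) ≡ lt v xs)
 lt-view v x xs with x <? v
 ... | yes p = inj₁ (p , lt-yes v xs p)
 ... | no p = inj₂ (≮⇒≥ p , lt-no v xs (≮⇒≥ p))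

 gt-anti : ∀ {s t} xs → s ≤ t → gt t xs ≤ gt s xs
 gt-anti [] p = z≤n
 gt-anti {s} {t} (x ∷ xs) p with gt-view t x xs | gt-view s x xs
 ... | inj₁ (_ , e) | inj₁ (_ , f) rewrite e | f = s≤s (gt-anti xs p)
 ... | inj₁ (t<x , _) | inj₂ (x≤s , _) = contradiction (≤-<-trans p t<x) (≤⇒≯ x≤s)
 ... | inj₂ (_ , e) | inj₁ (_ , f) rewrite e | f = m≤n⇒m≤1+n (gt-anti xs p)
 ... | inj₂ (_ , e) | inj₂ (_ , f) rewrite e | f = gt-anti xs p

 lt-mono : ∀ {u v} xs → u ≤ v → lt u xs ≤ lt v xs
 lt-mono [] p = z≤n
 lt-mono {u} {v} (x ∷ xs) p with lt-view u x xs | lt-view v x xs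
 ... | inj₁ (_ , e) | inj₁ (_ , f) rewrite e | f = s≤s (lt-mono xs p)
 ... | inj₁ (x<u , _) | inj₂ (v≤x , _) = contradiction (<-≤-trans x<u p) (≤⇒≯ v≤x)
 ... | inj₂ (_ , e) | inj₁ (_ , f) rewrite e | f = m≤n⇒m≤1+n (lt-mono xs p)
 ... | inj₂ (_ , e) | inj₂ (_ , f) rewrite e | f = lt-mono xs p

 gt-mem : ∀ {s t a} {xs} → a ∈ xs → t < a → a ≤ s → gt s xs < gt t xs
 gt-mem {s} {t} {a} {x ∷ xs} (here refl) t<a a≤s =
   subst₂ _<_ (sym (gt-no s xs a≤s)) (sym (gt-yes t xs t<a)) (s≤s (gt-anti xs (≤-trans (<⇒≤ t<a) a≤s)))
 gt-mem {s} {t} {a} {x ∷ xs} (there p) t<a a≤s with gt-view s x xs | gt-view t x xs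
 ... | inj₁ (_ , e) | inj₁ (_ , f) rewrite e | f = s≤s (gt-mem p t<a a≤s)
 ... | inj₁ (s<x , _) | inj₂ (x≤t , _) = contradiction (<-trans (<-≤-trans t<a a≤s) s<x) (≤⇒≯ x≤t)
 ... | inj₂ (_ , e) | inj₁ (_ , f) rewrite e | f = m≤n⇒m≤1+n (gt-mem p t<a a≤s)
 ... | inj₂ (_ , e) | inj₂ (_ , f) rewrite e | f = gt-mem p t<a a≤s

 lt-mem : ∀ {u v b} {xs} → b ∈ xs → u ≤ b → b < v → lt u xs < lt v xs
 lt-mem {u} {v} {b} {x ∷ xs} (here refl) u≤b b<v =
   subst₂ _<_ (sym (lt-no u xs u≤b)) (sym (lt-yes v xs b<v)) (s≤s (lt-mono xs (≤-trans u≤b (<⇒≤ b<v))))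
 lt-mem {u} {v} {b} {x ∷ xs} (there p) u≤b b<v with lt-view u x xs | lt-view v x xs
 ... | inj₁ (_ , e) | inj₁ (_ , f) rewrite e | f = s≤s (lt-mem p u≤b b<v)
 ... | inj₁ (x<u , _) | inj₂ (v≤x , _) = contradiction (<-trans (<-≤-trans x<u u≤b) b<v) (≤⇒≯ v≤x)
 ... | inj₂ (_ , e) | inj₁ (_ , f) rewrite e | f = m≤n⇒m≤1+n (lt-mem p u≤b b<v)
 ... | inj₂ (_ , e) | inj₂ (_ , f) rewrite e | f = lt-mem p u≤b b<v

 lt-gap : ∀ {u v} xs → lt u xs < lt v xs → ∃[ b ] b ∈ xs × u ≤ b × b < v
 lt-gap {u} {v} (x ∷ xs) p with lt-view u x xs | lt-view v x xs
 ... | inj₂ (u≤x , _) | inj₁ (x<v , _) = x , here refl , u≤x , x<v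
 ... | inj₁ (_ , e) | inj₁ (_ , f) rewrite e | f = let b , q , r = lt-gap xs (s≤s⁻¹ p) in b , there q , r
 ... | inj₁ (_ , e) | inj₂ (_ , f) rewrite e | f = let b , q , r = lt-gap xs (<-trans (n<1+n _) p) in b , there q , r
 ... | inj₂ (_ , e) | inj₂ (_ , f) rewrite e | f = let b , q , r = lt-gap xs p in b , there q , r

 -- For a member a of a strictly decreasing list, `gt a xs` is its position counted from 0; the
 -- first `gt t xs` positions are those of the letters above t.
 gt-sel : ∀ {q t xs} → Desc xs → q < gt t xs → ∃[ a ] a ∈ xs × t < a × gt a xs ≡ q
 gt-sel {q} {t} {x ∷ xs} (x> ∷ d) p with gt-view t x xs
 gt-sel {q} {t} {x ∷ xs} (x> ∷ d) p | inj₂ (x≤t , e) =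
   contradiction (subst (q <_) (gt-none t (x≤t ∷ All.map (λ y<x → ≤-trans (<⇒≤ y<x) x≤t) x>)) p) λ ()
 gt-sel {zero} {t} {x ∷ xs} (x> ∷ d) p | inj₁ (t<x , e) =
   x , here refl , t<x , gt-none x (≤-refl ∷ All.map <⇒≤ x>)
 gt-sel {suc q} {t} {x ∷ xs} (x> ∷ d) p | inj₁ (t<x , e) with gt-sel d (s≤s⁻¹ (subst (suc q <_) e p))
 ... | a , a∈ , t<a , e′ = a , there a∈ , t<a , trans (gt-yes a xs (All.lookup x> a∈)) (cong suc e′)

 lt-sel : ∀ {q v xs} → Asc xs → q < lt v xs → ∃[ b ] b ∈ xs × b < v × lt b xs ≡ q
 lt-sel {q} {v} {x ∷ xs} (x< ∷ d) p with lt-view v x xs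
 lt-sel {q} {v} {x ∷ xs} (x< ∷ d) p | inj₂ (v≤x , e) =
   contradiction (subst (q <_) (lt-none v (v≤x ∷ All.map (λ x<y → ≤-trans v≤x (<⇒≤ x<y)) x<)) p) λ ()
 lt-sel {zero} {v} {x ∷ xs} (x< ∷ d) p | inj₁ (x<v , e) =
   x , here refl , x<v , lt-none x (≤-refl ∷ All.map <⇒≤ x<)
 lt-sel {suc q} {v} {x ∷ xs} (x< ∷ d) p | inj₁ (x<v , e) with lt-sel d (s≤s⁻¹ (subst (suc q <_) e p))
 ... | b , b∈ , b<v , e′ = b , there b∈ , b<v , trans (lt-yes b xs (All.lookup x< b∈)) (cong suc e′)

 lt-suc : ∀ {v xs} → Asc xs → lt (suc v) xs ≤ suc (lt v xs)
 lt-suc {v} {[]} [] = z≤n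
 lt-suc {v} {x ∷ xs} (x< ∷ d) with lt-view (suc v) x xs | lt-view v x xs
 ... | inj₁ (_ , e) | inj₁ (_ , f) rewrite e | f = s≤s (lt-suc d)
 ... | inj₁ (_ , e) | inj₂ (v≤x , f) rewrite e | f = s≤s (≤-reflexive (trans (lt-none (suc v) (All.map (≤-trans (s≤s v≤x)) x<)) (sym (lt-none v (All.map (λ y → ≤-trans v≤x (<⇒≤ y)) x<)))))
 ... | inj₂ (p , _) | inj₁ (q , _) = contradiction (m≤n⇒m≤1+n q) (≤⇒≯ p)
 ... | inj₂ (_ , e) | inj₂ (_ , f) rewrite e | f = lt-suc d

 record Row : Set where
   constructor ⟨_,_,_⟩
   field
     D : List ℕ
     m : ℕ
     I : List ℕ

 open Row public

 record Valid (r : Row) : Set where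
   constructor valid
   field
     desc : Desc (D r)
     D>m : All (m r <_) (D r)
     asc : Asc (I r)
     I>m : All (m r <_) (I r)

 open Valid public

 flat : Row → List ℕ
 flat r = D r ++ m r ∷ I r

 left right : Maybe Row → List ℕ
 left nothing = []
 left (just r) = D r ∷ʳ m r
 right nothing = []
 right (just r) = I r

 size : Maybe Row → ℕ
 size S = length (left S) + length (right S)

 IsMin : Maybe Row → ℕ → Set
 IsMin nothing y = ⊥
 IsMin (just r) y = y ≡ m r

 ValidLow : Maybe Row → Set
 ValidLow nothing = ⊤
 ValidLow (just r) = Valid r

 Elem : Maybe Row → ℕ → Set
 Elem S s = s ∈ left S ⊎ s ∈ right S

 module Lower (S : Maybe Row) where

   A B : List ℕ
   A = left S
   B = right S

   -- On members they are positions counted from 0: a letter s of A stands at `g s` in the row and a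
   -- letter s of B at `h s`. Inequalities between counts are therefore statements about columns.
   g h : ℕ → ℕ
   g s = gt s A
   h v = length A + lt v B

   -- For every b in B above y, the half-open interval from y, excluded, to b, included, contains a
   -- letter of A.
   E : ℕ → Set
   E y = ∀ {b} → b ∈ B → y < b → g b < g y

   -- `In y v` describes how y can enter the row without raising h at v: a letter of B in [y , v)
   -- makes room for it, or y is the minimum and is separated by A from all larger letters of B.
   Between In : ℕ → ℕ → Set
   Between y v = ∃[ b ] b ∈ B × y ≤ b × b < v
   In y v = Between y v ⊎ (IsMin S y × E y)

   g-anti : ∀ {s t} → s ≤ t → g t ≤ g s
   g-anti = gt-anti A

   h-mono : ∀ {u v} → u ≤ v → h u ≤ h v
   h-mono p = +-monoʳ-≤ (length A) (lt-mono B p)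

   h-mem : ∀ {u v b} → b ∈ B → u ≤ b → b < v → h u < h v
   h-mem p q r = +-monoʳ-< (length A) (lt-mem p q r)

   h-gap : ∀ {u v} → h u < h v → Between u v
   h-gap p = lt-gap B (+-cancelˡ-< (length A) _ _ p)

   A≤h : ∀ v → length A ≤ h v
   A≤h v = m≤m+n _ _

   h≤size : ∀ v → h v ≤ size S
   h≤size v = +-monoʳ-≤ (length A) (lt-len v B)

 module LowerV (S : Maybe Row) (vS : ValidLow S) where

   open Lower S public

   private
     dA : ∀ S → ValidLow S → Desc (left S)
     dA nothing v = []
     dA (just r) v = AllPairs.++⁺ (desc v) ([] ∷ []) (All.map (λ p → p ∷ []) (D>m v))

     aB : ∀ S → ValidLow S → Asc (right S)
     aB nothing v = []
     aB (just r) v = asc v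

     gE : ∀ S → ValidLow S → ∀ {s} → Elem S s → gt s (left S) < length (left S)
     gE (just r) v {s} e = ≤-<-trans (≤-reflexive (trans (gt-++ s (D r) (m r ∷ [])) (trans (cong (gt s (D r) +_) (gt-no s [] (m≤ e))) (+-identityʳ _))))
                             (≤-<-trans (gt-len s (D r)) (≤-reflexive (sym (trans (length-++ (D r)) (+-comm _ 1)))))
       where
       m≤ : Elem (just r) s → m r ≤ s
       m≤ (inj₂ s∈) = <⇒≤ (All.lookup (I>m v) s∈)
       m≤ (inj₁ s∈) with ∈-++⁻ (D r) s∈
       ... | inj₁ s∈D = <⇒≤ (All.lookup (D>m v) s∈D)
       ... | inj₂ (here refl) = ≤-refl
     gE nothing v (inj₁ ())
     gE nothing v (inj₂ ())

     mn : ∀ S → ValidLow S → ∀ {s} → IsMin S s → s ∈ left S × suc (gt s (left S)) ≡ length (left S)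
     mn (just r) v refl = ∈-++⁺ʳ (D r) (here refl) ,
       trans (cong suc (trans (gt-++ (m r) (D r) (m r ∷ [])) (trans (cong₂ _+_ (gt-all (m r) (D>m v)) (gt-no (m r) [] ≤-refl)) (+-identityʳ _))))
             (sym (trans (length-++ (D r)) (+-comm _ 1)))

     A⇒ : ∀ S → ValidLow S → ∀ {s} → s ∈ left S → IsMin S s ⊎ suc (gt s (left S)) < length (left S)
     A⇒ (just r) v {s} s∈ with ∈-++⁻ (D r) s∈
     ... | inj₂ (here refl) = inj₁ refl
     ... | inj₁ s∈D = inj₂ (subst₂ _<_ (cong suc (sym (trans (gt-++ s (D r) (m r ∷ [])) (trans (cong (gt s (D r) +_) (gt-no s [] (<⇒≤ (All.lookup (D>m v) s∈D)))) (+-identityʳ _)))))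
                                       (sym (trans (length-++ (D r)) (+-comm _ 1)))
                                       (s≤s (<-≤-trans (gt-mem s∈D (All.lookup (D>m v) s∈D) ≤-refl) (gt-len _ (D r)))))

     mB : ∀ S → ValidLow S → ∀ {s b} → IsMin S s → b ∈ right S → s < b
     mB (just r) v refl b∈ = All.lookup (I>m v) b∈

   descA : Desc A
   descA = dA S vS

   ascB : Asc B
   ascB = aB S vS

   g<A : ∀ {s} → Elem S s → g s < length A
   g<A = gE S vS

   min∈ : ∀ {s} → IsMin S s → s ∈ A
   min∈ p = proj₁ (mn S vS p)

   min-g : ∀ {s} → IsMin S s → suc (g s) ≡ length A
   min-g p = proj₂ (mn S vS p)

   A-cases : ∀ {s} → s ∈ A → IsMin S s ⊎ suc (g s) < length A
   A-cases = A⇒ S vS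

   min<B : ∀ {s b} → IsMin S s → b ∈ B → s < b
   min<B = mB S vS

   h-suc : ∀ v → h (suc v) ≤ suc (h v)
   h-suc v = ≤-trans (+-monoʳ-≤ (length A) (lt-suc ascB)) (≤-reflexive (+-suc _ _))

   h-suc-mem : ∀ {b} → b ∈ B → h (suc b) ≡ suc (h b)
   h-suc-mem b∈ = ≤-antisym (h-suc _) (h-mem b∈ ≤-refl ≤-refl)

   g-sel : ∀ {q t} → q < g t → ∃[ a ] a ∈ A × t < a × g a ≡ q
   g-sel = gt-sel descA

   h-sel : ∀ {q v} → length A ≤ q → q < h v → ∃[ b ] b ∈ B × b < v × h b ≡ q
   h-sel {q} {v} p r with m≤n⇒∃[o]m+o≡n p
   ... | o , refl with lt-sel ascB (+-cancelˡ-< (length A) o _ r)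
   ... | b , b∈ , b<v , e = b , b∈ , b<v , cong (length A +_) e

-- Compatible rows and admissible letters

module Compatibility where

 open Rows

 -- The points at which the right-hand condition is tested: a letter of X itself, and the point just
 -- after a letter of Y, where `lt` already counts that letter.
 Pt : List ℕ → List ℕ → ℕ → Set
 Pt X Y v = v ∈ X ⊎ ∃[ r ] r ∈ Y × v ≡ suc r

 -- X and Y stand for `D R` and `m R ∷ I R` of the upper row. They are kept free because during a
 -- step the minimum may have to be written at the end of X instead.
 record UC (X Y : List ℕ) (S : Maybe Row) : Set where
   constructor uc
   open Lower S
   field
     CL : ∀ {s} → Elem S s → g s < gt s X
     CR : ∀ {v} → Pt X Y v → h v < length X + lt v Y

 open UC public

 record Compat (R : Row) (S : Maybe Row) : Set where
   constructor compat
   field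
     ucond : UC (D R) (m R ∷ I R) S
     shorter : size S < length (flat R)

 open Compat public

 -- The tight cases decide. Where CL has no slack at y, the letter entering the decreasing part of S
 -- must not raise g there; where CR has no slack at v, h must not rise at v. AE and AR express this
 -- through `E` and `In`.
 record AdmXY (X Y : List ℕ) (S : Maybe Row) (y : ℕ) : Set where
   constructor admXY
   open Lower S
   field
     base : UC X Y S
     AL : g y < gt y X
     AE : gt y X ≡ suc (g y) → E y
     AR : ∀ {v} → Pt X Y v → y < v → length X + lt v Y ≡ suc (h v) → In y v

 open AdmXY public

 record Adm (R : Row) (S : Maybe Row) (y : ℕ) : Set where
   constructor adm
   field
     axy : AdmXY (D R) (m R ∷ I R) S y
     room : size S < length (flat R)

 open Adm public

 len-∷ʳ : ∀ (xs : List ℕ) {x} → length (xs ∷ʳ x) ≡ suc (length xs)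
 len-∷ʳ xs = trans (length-++ xs) (+-comm _ 1)

 gt-∷ʳ-no : ∀ {s n} xs → n ≤ s → gt s (xs ∷ʳ n) ≡ gt s xs
 gt-∷ʳ-no {s} {n} xs p = trans (gt-++ s xs (n ∷ [])) (trans (cong (gt s xs +_) (gt-no s [] p)) (+-identityʳ _))

 ∈-∷ʳ⁻ : ∀ {v n : ℕ} xs → v ∈ xs ∷ʳ n → v ∈ xs ⊎ v ≡ n
 ∈-∷ʳ⁻ xs p with ∈-++⁻ xs p
 ... | inj₁ q = inj₁ q
 ... | inj₂ (here q) = inj₂ q

 lt-next : ∀ {a y Y} → Asc Y → a ∈ Y → y ≤ a → ∃[ r ] r ∈ Y × y ≤ r × lt (suc r) Y ≡ suc (lt y Y)
 lt-next {a} {y} {z ∷ Y} (z< ∷ asc) a∈ y≤a with lt-view y z Y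
 ... | inj₂ (y≤z , e) = z , here refl , y≤z ,
       trans (lt-yes (suc z) Y ≤-refl) (cong suc (trans (lt-none (suc z) z<) (sym (trans e (lt-none y (All.map (λ z<u → ≤-trans y≤z (<⇒≤ z<u)) z<))))))
 lt-next {a} {y} {z ∷ Y} (z< ∷ asc) (here refl) y≤a | inj₁ (z<y , e) = contradiction z<y (≤⇒≯ y≤a)
 lt-next {a} {y} {z ∷ Y} (z< ∷ asc) (there a∈) y≤a | inj₁ (z<y , e) with lt-next asc a∈ y≤a
 ... | r , r∈ , y≤r , f = r , there r∈ , y≤r , trans (lt-yes (suc r) Y (s≤s (≤-trans (<⇒≤ z<y) y≤r))) (trans (cong suc f) (cong suc (sym e)))

 module _ {S : Maybe Row} (vS : ValidLow S) where
   open LowerV S vS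

   -- Rewriting the minimum n from the end of X to the head of Y adds the single test point `suc n`,
   -- whose condition is the extra hypothesis. That hypothesis also bounds `length A` by `length X`,
   -- which gives CL for letters of S below n.
   valley-in : ∀ {X n Y} → All (n <_) X → All (n <_) Y → UC (X ∷ʳ n) Y S → h (suc n) < suc (length X) → UC X (n ∷ Y) S
   valley-in {X} {n} {Y} X>n Y>n U V = uc cl cr
     where
     cl : ∀ {s} → Elem S s → g s < gt s X
     cl {s} e with n ≤? s
     ... | yes n≤s = subst (g s <_) (gt-∷ʳ-no X n≤s) (CL U e)
     ... | no n≰s = subst (g s <_) (sym (gt-all s (All.map (<-trans (≰⇒> n≰s)) X>n)))
                       (<-≤-trans (g<A e) (≤-trans (A≤h (suc n)) (s≤s⁻¹ V)))
     shift : ∀ v → n < v → length (X ∷ʳ n) + lt v Y ≡ length X + lt v (n ∷ Y)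
     shift v p = trans (cong (_+ lt v Y) (len-∷ʳ X)) (trans (sym (+-suc _ _)) (cong (length X +_) (sym (lt-yes v Y p))))
     cr : ∀ {v} → Pt X (n ∷ Y) v → h v < length X + lt v (n ∷ Y)
     cr {v} (inj₁ v∈) = subst (h v <_) (shift v (All.lookup X>n v∈)) (CR U (inj₁ (∈-++⁺ˡ v∈)))
     cr (inj₂ (r , here refl , refl)) = <-≤-trans V (≤-trans (≤-trans (≤-reflexive (sym (len-∷ʳ X))) (m≤m+n _ _)) (≤-reflexive (shift (suc n) ≤-refl)))
     cr (inj₂ (r , there r∈ , refl)) = subst (h (suc r) <_) (shift (suc r) (m≤n⇒m≤1+n (All.lookup Y>n r∈))) (CR U (inj₂ (r , r∈ , refl)))

   valley-out : ∀ {X n Y} → All (n <_) X → All (n <_) Y → UC X (n ∷ Y) S → UC (X ∷ʳ n) Y S × h (suc n) < suc (length X)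
   valley-out {X} {n} {Y} X>n Y>n U = uc cl cr , V
     where
     shift : ∀ v → n < v → length (X ∷ʳ n) + lt v Y ≡ length X + lt v (n ∷ Y)
     shift v p = trans (cong (_+ lt v Y) (len-∷ʳ X)) (trans (sym (+-suc _ _)) (cong (length X +_) (sym (lt-yes v Y p))))
     V : h (suc n) < suc (length X)
     V = subst (h (suc n) <_) (trans (cong (length X +_) (trans (lt-yes (suc n) Y ≤-refl) (cong suc (lt-none (suc n) Y>n)))) (+-comm _ 1))
           (CR U (inj₂ (n , here refl , refl)))
     cl : ∀ {s} → Elem S s → g s < gt s (X ∷ʳ n)
     cl {s} e = <-≤-trans (CL U e) (≤-trans (m≤m+n _ _) (≤-reflexive (sym (gt-++ s X (n ∷ [])))))
     cr : ∀ {v} → Pt (X ∷ʳ n) Y v → h v < length (X ∷ʳ n) + lt v Y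
     cr {v} (inj₂ (r , r∈ , refl)) = subst (h v <_) (sym (shift v (m≤n⇒m≤1+n (All.lookup Y>n r∈)))) (CR U (inj₂ (r , there r∈ , refl)))
     cr {v} (inj₁ v∈) with ∈-∷ʳ⁻ X v∈
     ... | inj₁ p = subst (h v <_) (sym (shift v (All.lookup X>n p))) (CR U (inj₁ p))
     ... | inj₂ refl = ≤-<-trans (h-mono (n≤1+n n)) (<-≤-trans V (≤-trans (≤-reflexive (sym (len-∷ʳ X))) (m≤m+n _ _)))

 -- The two-sided words D1 c D2 | Y1 a Y2 and D1 y D2 | Y1 c Y2.
 record Cfg : Set where
   constructor cfg
   field
     D1 D2 Y1 Y2 : List ℕ
     c a y : ℕ
     D1>c : All (c <_) D1
     y<c : y < c
     D2≤y : All (_≤ y) D2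
     Y1<a : All (_< a) Y1
     a<c : a < c
     Y2≥c : All (c ≤_) Y2

   q : ℕ
   q = length D1

   X X* Y Y* : List ℕ
   X = D1 ++ c ∷ D2
   X* = D1 ++ y ∷ D2
   Y = Y1 ++ a ∷ Y2
   Y* = Y1 ++ c ∷ Y2

   -- The count `length X + lt v Y` equals x + 1 for a < v ≤ c; replacing a by c lowers it to x
   -- there and leaves it unchanged elsewhere.
   x : ℕ
   x = length X + length Y1

 module CfgLemmas (K : Cfg) where
   open Cfg K

   len-X* : length X* ≡ length X
   len-X* = trans (length-++ D1) (sym (length-++ D1))

   q<X : q < length X
   q<X = ≤-trans (≤-reflexive (+-comm 1 q)) (≤-trans (+-monoʳ-≤ q (s≤s z≤n)) (≤-reflexive (sym (length-++ D1))))

   gt-X : ∀ {s} → y ≤ s → s < c → gt s X ≡ suc q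
   gt-X {s} y≤s s<c = trans (gt-++ s D1 (c ∷ D2)) (trans (cong₂ _+_ (gt-all s (All.map (<-trans s<c) D1>c))
     (trans (gt-yes s D2 s<c) (cong suc (gt-none s (All.map (λ p → ≤-trans p y≤s) D2≤y))))) (+-comm q 1))

   gt-X*-mid : ∀ {s} → y ≤ s → s < c → gt s X* ≡ q
   gt-X*-mid {s} y≤s s<c = trans (gt-++ s D1 (y ∷ D2)) (trans (cong₂ _+_ (gt-all s (All.map (<-trans s<c) D1>c))
     (gt-none s (y≤s ∷ All.map (λ p → ≤-trans p y≤s) D2≤y))) (+-identityʳ q))

   gt-X*-lo : ∀ {s} → s < y → gt s X* ≡ gt s X
   gt-X*-lo {s} s<y = trans (gt-++ s D1 (y ∷ D2)) (trans (cong (gt s D1 +_) (trans (gt-yes s D2 s<y) (sym (gt-yes s D2 (<-trans s<y y<c))))) (sym (gt-++ s D1 (c ∷ D2))))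

   gt-X*-hi : ∀ {s} → c ≤ s → gt s X* ≡ gt s X
   gt-X*-hi {s} c≤s = trans (gt-++ s D1 (y ∷ D2)) (trans (cong (gt s D1 +_) (trans (gt-no s D2 (≤-trans (<⇒≤ y<c) c≤s)) (sym (gt-no s D2 c≤s)))) (sym (gt-++ s D1 (c ∷ D2))))

   gt-X-hi : ∀ {s} → c ≤ s → gt s X ≤ q
   gt-X-hi {s} c≤s = ≤-trans (≤-reflexive (trans (gt-++ s D1 (c ∷ D2)) (trans (cong (gt s D1 +_) (gt-none s (c≤s ∷ All.map (λ p → ≤-trans p (≤-trans (<⇒≤ y<c) c≤s)) D2≤y))) (+-identityʳ _)))) (gt-len s D1)

   lt-Y-lo : ∀ {v} → v ≤ a → lt v Y* ≡ lt v Y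
   lt-Y-lo {v} v≤a = trans (lt-++ v Y1 (c ∷ Y2)) (trans (cong (lt v Y1 +_) (trans (lt-no v Y2 (≤-trans v≤a (<⇒≤ a<c))) (sym (lt-no v Y2 v≤a)))) (sym (lt-++ v Y1 (a ∷ Y2))))

   lt-Y-hi : ∀ {v} → c < v → lt v Y* ≡ lt v Y
   lt-Y-hi {v} c<v = trans (lt-++ v Y1 (c ∷ Y2)) (trans (cong (lt v Y1 +_) (trans (lt-yes v Y2 c<v) (sym (lt-yes v Y2 (<-trans a<c c<v))))) (sym (lt-++ v Y1 (a ∷ Y2))))

   lt-Y-mid : ∀ {v} → a < v → v ≤ c → lt v Y ≡ suc (length Y1)
   lt-Y-mid {v} a<v v≤c = trans (lt-++ v Y1 (a ∷ Y2)) (trans (cong₂ _+_ (lt-all v (All.map (λ p → <-trans p a<v) Y1<a))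
     (trans (lt-yes v Y2 a<v) (cong suc (lt-none v (All.map (≤-trans v≤c) Y2≥c))))) (+-comm _ 1))

   lt-Y*-mid : ∀ {v} → a < v → v ≤ c → lt v Y* ≡ length Y1
   lt-Y*-mid {v} a<v v≤c = trans (lt-++ v Y1 (c ∷ Y2)) (trans (cong₂ _+_ (lt-all v (All.map (λ p → <-trans p a<v) Y1<a))
     (lt-none v (v≤c ∷ All.map (≤-trans v≤c) Y2≥c))) (+-identityʳ _))

   H-mid : ∀ {v} → a < v → v ≤ c → length X + lt v Y ≡ suc x
   H-mid a<v v≤c = trans (cong (length X +_) (lt-Y-mid a<v v≤c)) (+-suc _ _)

   c∈X : c ∈ X
   c∈X = ∈-++⁺ʳ D1 (here refl)

   a∈Y : a ∈ Y
   a∈Y = ∈-++⁺ʳ Y1 (here refl)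

   X-above : ∀ {v} → v ∈ X → y < v → c ≤ v
   X-above v∈ y<v with ∈-++⁻ D1 v∈
   ... | inj₁ p = <⇒≤ (All.lookup D1>c p)
   ... | inj₂ (here refl) = ≤-refl
   ... | inj₂ (there p) = contradiction y<v (≤⇒≯ (All.lookup D2≤y p))

 module Back (K : Cfg) {S : Maybe Row} (vS : ValidLow S) (ascY : Asc (Cfg.Y K))
             (𝐀 : AdmXY (Cfg.X K) (Cfg.Y K) S (Cfg.y K)) where
   open Cfg K
   open CfgLemmas K
   open LowerV S vS

   -- After y has replaced c, only q letters of X* lie above y. A letter y of S with `g y ≡ q` would
   -- then violate CL.
   LB : Set
   LB = Elem S y × g y ≡ q

   gy≤q : g y ≤ q
   gy≤q = s≤s⁻¹ (subst (g y <_) (gt-X ≤-refl y<c) (AL 𝐀))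

   tightE : g y ≡ q → E y
   tightE e = AE 𝐀 (trans (gt-X ≤-refl y<c) (cong suc (sym e)))

   -- Otherwise h does not grow from y to v and CR is tight at v, so AR yields `In y v`. A letter of
   -- B in between would make h grow, and y as the minimum of S would have `g y ≡ q`, which is `LB`.
   strict : ¬ LB → ∀ {v} → Pt X Y v → y < v → suc (h y) < length X + lt v Y
   strict ¬lb {v} pt y<v with suc (h y) <? length X + lt v Y
   ... | yes p = p
   ... | no ¬p = ⊥-elim (bad (AR 𝐀 pt y<v K≡))
     where
     hv≤hy : h v ≤ h y
     hv≤hy = s≤s⁻¹ (<-≤-trans (CR (base 𝐀) pt) (≮⇒≥ ¬p))
     hv≡hy : h v ≡ h y
     hv≡hy = ≤-antisym hv≤hy (h-mono (<⇒≤ y<v))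
     K≡ : length X + lt v Y ≡ suc (h v)
     K≡ = ≤-antisym (subst (λ z → length X + lt v Y ≤ suc z) (sym hv≡hy) (≮⇒≥ ¬p)) (CR (base 𝐀) pt)
     lt≥1 : Pt X Y v → 1 ≤ lt v Y
     lt≥1 (inj₁ v∈) = ≤-trans (s≤s z≤n) (lt-mem a∈Y ≤-refl (<-≤-trans a<c (X-above v∈ y<v)))
     lt≥1 (inj₂ (r , r∈ , refl)) = ≤-trans (s≤s z≤n) (lt-mem r∈ ≤-refl ≤-refl)
     bad : ¬ In y v
     bad (inj₁ (b , b∈ , y≤b , b<v)) = <-irrefl (sym hv≡hy) (h-mem b∈ y≤b b<v)
     bad (inj₂ (mn , e)) = ¬lb (inj₁ (min∈ mn) , ≤-antisym gy≤q (s≤s⁻¹ (s≤s⁻¹ q+2≤)))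
       where
       hy≡ : h y ≡ suc (g y)
       hy≡ = trans (cong (length A +_) (lt-none y (All.tabulate (λ b∈ → <⇒≤ (min<B mn b∈))))) (trans (+-identityʳ _) (sym (min-g mn)))
       q+2≤ : suc (suc q) ≤ suc (suc (g y))
       q+2≤ = ≤-trans (≤-trans (≤-reflexive (+-comm 1 (suc q))) (+-mono-≤ q<X (lt≥1 pt))) (≤-reflexive (trans K≡ (cong suc (trans hv≡hy hy≡))))

   hy<x : ¬ LB → h y < x
   hy<x ¬lb = s≤s⁻¹ (subst (suc (h y) <_) (H-mid a<c ≤-refl) (strict ¬lb (inj₁ c∈X) y<c))

   hy-low : ¬ LB → y ≤ a → h y < length X + lt y Y
   hy-low ¬lb y≤a with lt-next ascY a∈Y y≤a
   ... | r , r∈ , y≤r , e = s≤s⁻¹ (subst (suc (h y) <_) (trans (cong (length X +_) e) (+-suc _ _)) (strict ¬lb (inj₂ (r , r∈ , refl)) (s≤s y≤r)))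

   -- Only on [y , c) does X* count less than X, namely q instead of q + 1, so g must avoid the
   -- value q there. If g took it at some s > y, then also at y, against strict descent in A or, for
   -- s in B, against `tightE`.
   CL* : ¬ LB → ∀ {s} → Elem S s → g s < gt s X*
   CL* ¬lb {s} e with y ≤? s | s <? c
   ... | no y≰s | _ = subst (g s <_) (sym (gt-X*-lo (≰⇒> y≰s))) (CL (base 𝐀) e)
   ... | yes _ | no s≮c = subst (g s <_) (sym (gt-X*-hi (≮⇒≥ s≮c))) (CL (base 𝐀) e)
   ... | yes y≤s | yes s<c = subst (g s <_) (sym (gt-X*-mid y≤s s<c)) (≤∧≢⇒< gs≤q (λ gs≡q → bad gs≡q))
     where
     gs≤q : g s ≤ q
     gs≤q = s≤s⁻¹ (subst (g s <_) (gt-X y≤s s<c) (CL (base 𝐀) e))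
     bad : ¬ (g s ≡ q)
     bad gs≡q with m≤n⇒m<n∨m≡n y≤s
     ... | inj₂ refl = ¬lb (e , gs≡q)
     ... | inj₁ y<s = <-irrefl (trans gs≡q (sym gy≡q)) (strictly e)
       where
       gy≡q : g y ≡ q
       gy≡q = ≤-antisym gy≤q (subst (_≤ g y) gs≡q (g-anti y≤s))
       strictly : Elem S s → g s < g y
       strictly (inj₁ s∈) = gt-mem s∈ y<s ≤-refl
       strictly (inj₂ s∈) = tightE gy≡q s∈ y<s

   hc≤x : h c ≤ x
   hc≤x = s≤s⁻¹ (subst (h c <_) (H-mid a<c ≤-refl) (CR (base 𝐀) (inj₁ c∈X)))

   private
     H* : ∀ {v} → lt v Y* ≡ lt v Y → length X + lt v Y ≡ length X* + lt v Y*
     H* e = cong₂ _+_ (sym len-X*) (sym e)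

     at-y : ¬ LB → ∀ {Z} → (y ≤ a → lt y Z ≡ lt y Y) → (a < y → length Y1 ≤ lt y Z) → h y < length X* + lt y Z
     at-y ¬lb e₁ e₂ with y ≤? a
     ... | yes p = subst (h y <_) (cong₂ _+_ (sym len-X*) (sym (e₁ p))) (hy-low ¬lb p)
     ... | no p = <-≤-trans (hy<x ¬lb) (+-mono-≤ (≤-reflexive (sym len-X*)) (e₂ (≰⇒> p)))

     D2-at : ∀ {v n} → v ∈ D2 → (v ≤ y → a < v → h v < x) → n ≡ length X → h v < n + lt v Y*
     D2-at {v} v∈ f refl with v ≤? a
     ... | yes p = subst (h v <_) (cong (length X +_) (sym (lt-Y-lo p))) (CR (base 𝐀) (inj₁ (∈-++⁺ʳ D1 (there v∈))))
     ... | no p = subst (h v <_) (cong (length X +_) (sym (lt-Y*-mid (≰⇒> p) (≤-trans v≤y (<⇒≤ y<c))))) (f v≤y (≰⇒> p))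
       where v≤y = All.lookup D2≤y v∈

     Y*-at : All (c <_) Y2 → h (suc c) ≤ x → ∀ {r n} → r ∈ Y* → n ≡ length X → h (suc r) < n + lt (suc r) Y*
     Y*-at Y2>c hc {r} r∈ refl with ∈-++⁻ Y1 r∈
     ... | inj₁ p = subst (h (suc r) <_) (cong (length X +_) (sym (lt-Y-lo (All.lookup Y1<a p)))) (CR (base 𝐀) (inj₂ (r , ∈-++⁺ˡ p , refl)))
     ... | inj₂ (here refl) = <-≤-trans (s≤s hc) (≤-trans (≤-reflexive (trans (sym (+-suc _ _)) (cong (length X +_) (sym (trans (lt-++ (suc c) Y1 (c ∷ Y2))
             (trans (cong₂ _+_ (lt-all (suc c) (All.map (λ p → <-trans p (m≤n⇒m≤1+n a<c)) Y1<a)) (trans (lt-yes (suc c) Y2 ≤-refl) (cong suc (lt-none (suc c) Y2>c)))) (+-comm _ 1))))))) ≤-refl)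
     ... | inj₂ (there p) = subst (h (suc r) <_) (cong (length X +_) (sym (lt-Y-hi (m≤n⇒m≤1+n (All.lookup Y2>c p))))) (CR (base 𝐀) (inj₂ (r , ∈-++⁺ʳ Y1 (there p) , refl)))

   hc+1≤x : ¬ (c ∈ B × h c ≡ x) → h (suc c) ≤ x
   hc+1≤x ¬is with m≤n⇒m<n∨m≡n hc≤x
   ... | inj₁ p = ≤-trans (h-suc c) p
   ... | inj₂ e with h (suc c) ≤? x
   ... | yes p = p
   ... | no p with h-gap {c} {suc c} (subst (_< h (suc c)) (sym e) (≰⇒> p))
   ... | b , b∈ , c≤b , b<sc = ⊥-elim (¬is (subst (_∈ B) (≤-antisym (s≤s⁻¹ b<sc) c≤b) b∈ , e))

   UC-PP : ¬ LB → All (c <_) Y2 → ¬ (c ∈ B × h c ≡ x) → UC X* Y* S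
   UC-PP ¬lb Y2>c ¬is = uc (CL* ¬lb) cr
     where
     cr : ∀ {v} → Pt X* Y* v → h v < length X* + lt v Y*
     cr {v} (inj₁ v∈) with ∈-++⁻ D1 v∈
     ... | inj₁ p = subst (h v <_) (H* (lt-Y-hi (All.lookup D1>c p))) (CR (base 𝐀) (inj₁ (∈-++⁺ˡ p)))
     ... | inj₂ (here refl) = at-y ¬lb {Y*} lt-Y-lo (λ p → ≤-reflexive (sym (lt-Y*-mid p (<⇒≤ y<c))))
     ... | inj₂ (there p) = D2-at p (λ v≤y _ → ≤-<-trans (h-mono v≤y) (hy<x ¬lb)) len-X*
     cr (inj₂ (r , r∈ , refl)) = Y*-at Y2>c (hc+1≤x ¬is) r∈ len-X*

   UC-PB : ¬ LB → UC X* Y S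
   UC-PB ¬lb = uc (CL* ¬lb) cr
     where
     L : ∀ v → length X + lt v Y ≡ length X* + lt v Y
     L v = cong (_+ lt v Y) (sym len-X*)
     cr : ∀ {v} → Pt X* Y v → h v < length X* + lt v Y
     cr {v} (inj₁ v∈) with ∈-++⁻ D1 v∈
     ... | inj₁ p = subst (h v <_) (L v) (CR (base 𝐀) (inj₁ (∈-++⁺ˡ p)))
     ... | inj₂ (here refl) = at-y ¬lb {Y} (λ _ → refl) (λ p → ≤-trans (n≤1+n _) (≤-reflexive (sym (lt-Y-mid p (<⇒≤ y<c)))))
     ... | inj₂ (there p) = subst (h v <_) (L v) (CR (base 𝐀) (inj₁ (∈-++⁺ʳ D1 (there p))))
     cr (inj₂ (r , r∈ , refl)) = subst (h (suc r) <_) (L (suc r)) (CR (base 𝐀) (inj₂ (r , r∈ , refl)))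

   -- Here c stays in X and remains a test point, while the count at c has dropped to x. So h must
   -- be below x already at c. When c leaves X, only `suc c` is tested, and h at most x there is
   -- enough.
   UC-BP : All (c <_) Y2 → h c < x → UC X Y* S
   UC-BP Y2>c hc<x = uc (CL (base 𝐀)) cr
     where
     cr : ∀ {v} → Pt X Y* v → h v < length X + lt v Y*
     cr {v} (inj₁ v∈) with ∈-++⁻ D1 v∈
     ... | inj₁ p = subst (h v <_) (cong (length X +_) (sym (lt-Y-hi (All.lookup D1>c p)))) (CR (base 𝐀) (inj₁ (∈-++⁺ˡ p)))
     ... | inj₂ (here refl) = subst (h v <_) (cong (length X +_) (sym (lt-Y*-mid a<c ≤-refl))) hc<x
     ... | inj₂ (there p) = D2-at p (λ v≤y _ → ≤-<-trans (h-mono (≤-trans v≤y (<⇒≤ y<c))) hc<x) refl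
     cr (inj₂ (r , r∈ , refl)) = Y*-at Y2>c (≤-trans (h-suc c) hc<x) r∈ refl

   -- As the new minimum, y brings the test point `suc y`, where h may be at most q. It is at most q
   -- at y, and it exceeds q after y only if y is in B with `h y ≡ q`.
   valley-y : ¬ LB → D2 ≡ [] → ¬ (y ∈ B × h y ≡ q) → All (y ≤_) Y ⊎ Y1 ≡ [] → h (suc y) < suc q
   valley-y ¬lb refl ¬ip low = s≤s step
     where
     X≡ : length X ≡ suc q
     X≡ = len-∷ʳ D1
     hy≤q : h y ≤ q
     hy≤q = s≤s⁻¹ (subst (h y <_) X≡ (bound low))
       where
       bound : All (y ≤_) Y ⊎ Y1 ≡ [] → h y < length X
       bound (inj₁ p) = subst (h y <_) (trans (cong (length X +_) (lt-none y p)) (+-identityʳ _)) (hy-low ¬lb (All.lookup p a∈Y))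
       bound (inj₂ refl) = subst (h y <_) (+-identityʳ _) (hy<x ¬lb)
     step : h (suc y) ≤ q
     step with m≤n⇒m<n∨m≡n hy≤q
     ... | inj₁ p = ≤-trans (h-suc y) p
     ... | inj₂ e with h (suc y) ≤? q
     ... | yes p = p
     ... | no p with h-gap {y} {suc y} (subst (_< h (suc y)) (sym e) (≰⇒> p))
     ... | b , b∈ , y≤b , b<sy = ⊥-elim (¬ip (subst (_∈ B) (≤-antisym (s≤s⁻¹ b<sy) y≤b) b∈ , e))

-- The step read backwards: blocked exchanges and the four modes

module Reverse where

 open Rows
 open Compatibility
 open import Relation.Nullary.Decidable using (_×-dec_; _⊎-dec_; ¬?)
 open DecMem _≟_ using (_∈?_)

 rowOf : Cfg → Row
 rowOf (cfg D1 D2 [] Y2 c a y _ _ _ _ _ _) = ⟨ D1 ++ c ∷ D2 , a , Y2 ⟩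
 rowOf (cfg D1 D2 (z ∷ Z) Y2 c a y _ _ _ _ _ _) = ⟨ D1 ++ c ∷ D2 , z , Z ++ a ∷ Y2 ⟩

 D-rowOf : ∀ K → D (rowOf K) ≡ Cfg.X K
 D-rowOf (cfg D1 D2 [] Y2 c a y _ _ _ _ _ _) = refl
 D-rowOf (cfg D1 D2 (z ∷ Z) Y2 c a y _ _ _ _ _ _) = refl

 mI-rowOf : ∀ K → m (rowOf K) ∷ I (rowOf K) ≡ Cfg.Y K
 mI-rowOf (cfg D1 D2 [] Y2 c a y _ _ _ _ _ _) = refl
 mI-rowOf (cfg D1 D2 (z ∷ Z) Y2 c a y _ _ _ _ _ _) = refl

 flat-rowOf : ∀ K → flat (rowOf K) ≡ Cfg.X K ++ Cfg.Y K
 flat-rowOf K = cong₂ _++_ (D-rowOf K) (mI-rowOf K)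

 split-desc : ∀ {y} xs → Desc xs → 0 < gt y xs →
   ∃[ D1 ] ∃[ c ] ∃[ D2 ] xs ≡ D1 ++ c ∷ D2 × y < c × All (_≤ y) D2 × All (c <_) D1
 split-desc {y} (x ∷ xs) (x> ∷ d) p with y <? x
 ... | no y≮x = contradiction (subst (0 <_) (gt-none y (≮⇒≥ y≮x ∷ All.map (λ z<x → ≤-trans (<⇒≤ z<x) (≮⇒≥ y≮x)) x>)) p) λ ()
 ... | yes y<x with 0 <? gt y xs
 ... | yes p′ with split-desc xs d p′
 ... | D1 , c , D2 , refl , y<c , D2≤y , D1>c = x ∷ D1 , c , D2 , refl , y<c , D2≤y , All.head (All.++⁻ʳ D1 x>) ∷ D1>c
 split-desc {y} (x ∷ xs) (x> ∷ d) p | yes y<x | no ¬p′ =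
   [] , x , xs , refl , y<x , All.tabulate (λ {z} z∈ → ≮⇒≥ λ y<z → ¬p′ (≤-<-trans z≤n (gt-mem z∈ y<z ≤-refl))) , []

 split-asc : ∀ {c m} ys → Asc (m ∷ ys) → m < c →
   ∃[ Y1 ] ∃[ a ] ∃[ Y2 ] m ∷ ys ≡ Y1 ++ a ∷ Y2 × a < c × All (_< a) Y1 × All (c ≤_) Y2
 split-asc [] asc m<c = [] , _ , [] , refl , m<c , [] , []
 split-asc {c} {m} (z ∷ ys) ((m<z ∷ m<) ∷ asc) m<c with z <? c
 ... | no z≮c = [] , m , z ∷ ys , refl , m<c , [] , ≮⇒≥ z≮c ∷ All.map (λ z<u → ≤-trans (≮⇒≥ z≮c) (<⇒≤ z<u)) (head< asc)
   where
   head< : ∀ {z ys} → Asc (z ∷ ys) → All (z <_) ys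
   head< (p ∷ _) = p
 ... | yes z<c with split-asc ys asc z<c
 ... | Y1 , a , Y2 , e , a<c , Y1<a , Y2≥c = m ∷ Y1 , a , Y2 , cong (m ∷_) e , a<c , m<a Y1 e ∷ Y1<a , Y2≥c
   where
   m<a : ∀ Y1 → z ∷ ys ≡ Y1 ++ a ∷ Y2 → m < a
   m<a [] refl = m<z
   m<a (_ ∷ Y1) refl = All.head (All.++⁻ʳ Y1 m<)

 module Conditions (K : Cfg) (S : Maybe Row) where
   open Cfg K
   open Lower S

   -- `iR` and `iS` block c from taking the place of a: it is in the row already, or S contains it
   -- where CR would fail at `suc c`. When c also stays in X, CR is tested at c itself, so `h c ≡ x`
   -- alone blocks; hence `iB` besides `iBP`. `dB` blocks y from taking the place of c. Either y is
   -- in D2, or it equals the minimum and that minimum survives, or CL would fail at y (`LB`), or y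
   -- would become the minimum and CR would fail at `suc y` (`ip`). In `ip`, y becomes the minimum
   -- if it lies weakly below Y, or if a is the head of Y and is replaced.
   LB iR iS iBP iB ip IsHead dB : Set
   LB = Elem S y × g y ≡ q
   iR = c ∈ Y2
   iS = c ∈ B × h c ≡ x
   iBP = iR ⊎ iS
   iB = iR ⊎ h c ≡ x
   ip = y ∈ B × h y ≡ q × D2 ≡ [] × (All (y ≤_) Y ⊎ (Y1 ≡ [] × ¬ iBP))
   IsHead = y ∈ Y × All (y ≤_) Y
   dB = y ∈ D2 ⊎ (IsHead × (¬ Y1 ≡ [] ⊎ iBP)) ⊎ LB ⊎ ip

   private
     []? : (xs : List ℕ) → Dec (xs ≡ [])
     []? [] = yes refl
     []? (_ ∷ _) = no λ ()

   iBP? : Dec iBP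
   iBP? = (c ∈? Y2) ⊎-dec ((c ∈? B) ×-dec (h c ≟ x))

   iB? : Dec iB
   iB? = (c ∈? Y2) ⊎-dec (h c ≟ x)

   dB? : Dec dB
   dB? = (y ∈? D2) ⊎-dec ((((y ∈? Y) ×-dec All.all? (y ≤?_) Y) ×-dec (¬? ([]? Y1) ⊎-dec iBP?))
         ⊎-dec ((((y ∈? A) ⊎-dec (y ∈? B)) ×-dec (g y ≟ q))
         ⊎-dec ((y ∈? B) ×-dec ((h y ≟ q) ×-dec ([]? D2 ×-dec (All.all? (y ≤?_) Y ⊎-dec ([]? Y1 ×-dec ¬? iBP?)))))))

 -- The first letter of a constructor concerns y in the place of c, the second c in the place of a;
 -- b means blocked. The index is the plain word of the new row, which leaves open where its minimum
 -- is.
 data Mode (K : Cfg) (S : Maybe Row) : List ℕ → Set where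
   pp : ¬ Conditions.dB K S → ¬ Conditions.iBP K S → Mode K S (Cfg.X* K ++ Cfg.Y* K)
   pb : ¬ Conditions.dB K S → Conditions.iBP K S → Mode K S (Cfg.X* K ++ Cfg.Y K)
   bp : Conditions.dB K S → ¬ Conditions.iB K S → Mode K S (Cfg.X K ++ Cfg.Y* K)
   bb : Conditions.dB K S → Conditions.iB K S → Mode K S (Cfg.X K ++ Cfg.Y K)

 -- The letter a inserted in R above S neither extends R nor ends there.
 NonTerminal : Row → Maybe Row → ℕ → Set
 NonTerminal R S a =
   (∃[ z ] z ∈ I R × a < z) ⊎
   (a ∈ m R ∷ I R × All (_≤ a) (m R ∷ I R) × suc (size S) ≡ length (flat R) × 1 < length (flat R))

 record Step (S : Maybe Row) (R′ : Row) (y : ℕ) (R : Row) (a : ℕ) : Set where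
   constructor step
   field
     K : Cfg
     R′≡ : R′ ≡ rowOf K
     y≡ : y ≡ Cfg.y K
     a≡ : a ≡ Cfg.a K
     valid′ : Valid R′
     admits : Adm R′ S y
     mode : Mode K S (flat R)
     validR : Valid R
     compatR : Compat R S
     nonterm : NonTerminal R S a

 Adm-X : ∀ {S} K → Adm (rowOf K) S (Cfg.y K) → AdmXY (Cfg.X K) (Cfg.Y K) S (Cfg.y K)
 Adm-X {S} K p = subst₂ (λ X Y → AdmXY X Y S (Cfg.y K)) (D-rowOf K) (mI-rowOf K) (axy p)

 asc-mI : ∀ {R} → Valid R → Asc (m R ∷ I R)
 asc-mI v = I>m v ∷ asc v

 asc-Y : ∀ K → Valid (rowOf K) → Asc (Cfg.Y K)
 asc-Y K v = subst Asc (mI-rowOf K) (asc-mI v)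

 len-XY : ∀ (xs : List ℕ) {u} ys → length (xs ++ u ∷ ys) ≡ suc (length xs + length ys)
 len-XY xs ys = trans (length-++ xs) (+-suc _ _)

 module _ (K : Cfg) where
   open Cfg K
   len-both : ∀ (X′ Y′ : List ℕ) → length X′ ≡ length X → length Y′ ≡ length Y → length (X′ ++ Y′) ≡ length (X ++ Y)
   len-both X′ Y′ e f = trans (length-++ X′) (trans (cong₂ _+_ e f) (sym (length-++ X)))

   len-Y* : length Y* ≡ length Y
   len-Y* = trans (length-++ Y1) (sym (length-++ Y1))

   len-mode : ∀ {S l} → Mode K S l → length l ≡ length (X ++ Y)
   len-mode (pp _ _) = len-both X* Y* (CfgLemmas.len-X* K) len-Y*
   len-mode (pb _ _) = len-both X* Y (CfgLemmas.len-X* K) refl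
   len-mode (bp _ _) = len-both X Y* refl len-Y*
   len-mode (bb _ _) = refl

   total-len : length (X ++ Y) ≡ suc (x + length Y2)
   total-len = trans (length-++ X) (trans (cong (length X +_) (trans (length-++ Y1) (+-suc _ _))) (trans (+-suc _ _) (cong suc (sym (+-assoc (length X) (length Y1) (length Y2))))))

 -- When c is blocked in the increasing part by S, that part goes on after a.
 module Wit (K : Cfg) {S : Maybe Row} (vS : ValidLow S) (ascY : Asc (Cfg.Y K))
            (U : UC (Cfg.X K) (Cfg.Y K) S) (room : size S < length (Cfg.X K ++ Cfg.Y K)) where
   open Cfg K
   open CfgLemmas K
   open LowerV S vS

   next : Conditions.iBP K S → ∃[ z ] z ∈ Y2 × c ≤ z × All (z <_) D1
   next (inj₁ c∈) = c , c∈ , ≤-refl , D1>c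
   next (inj₂ (c∈B , hc≡x)) = go Y2 refl
     where
     hsc : h (suc c) ≡ suc x
     hsc = trans (h-suc-mem c∈B) (cong suc hc≡x)
     go : ∀ Z → Y2 ≡ Z → ∃[ z ] z ∈ Y2 × c ≤ z × All (z <_) D1
     -- Without Y2 the row has x + 1 letters, and `h (suc c)` equal to x + 1 would make S as long.
     go [] e = contradiction (≤-trans (≤-reflexive (sym hsc)) (h≤size (suc c)))
       (<⇒≱ (<-≤-trans room (≤-reflexive (trans (total-len K) (cong suc (trans (cong (λ w → x + length w) e) (+-identityʳ x)))))))
     go (z ∷ Z) refl = z , here refl , All.head Y2≥c , All.tabulate below
       where
       z<Z : All (z <_) Z
       z<Z = head (proj₁ (proj₂ (AllPairs-++⁻ (Y1 ∷ʳ a) (subst Asc (sym (++-assoc Y1 (a ∷ []) (z ∷ Z))) ascY))))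
         where head : ∀ {z Z} → Asc (z ∷ Z) → All (z <_) Z
               head (p ∷ _) = p
       below : ∀ {v} → v ∈ D1 → z < v
       below {v} v∈ with z <? v
       ... | yes p = p
       ... | no p = contradiction (CR U (inj₁ (∈-++⁺ˡ v∈)))
             (≤⇒≯ (≤-trans (≤-reflexive Hv) (≤-trans (≤-reflexive (sym hsc)) (h-mono c<v))))
         where
         c<v = All.lookup D1>c v∈
         Hv : length X + lt v Y ≡ suc x
         Hv = trans (cong (length X +_) (trans (lt-++ v Y1 (a ∷ z ∷ Z)) (trans (cong₂ _+_ (lt-all v (All.map (λ r → <-trans r (<-trans a<c c<v)) Y1<a))
                (trans (lt-yes v (z ∷ Z) (<-trans a<c c<v)) (cong suc (lt-none v (≮⇒≥ p ∷ All.map (λ r → ≤-trans (≮⇒≥ p) (<⇒≤ r)) z<Z))))) (+-comm _ 1)))) (+-suc _ _)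

 []≢∷ : ∀ {u : ℕ} {us : List ℕ} → ¬ ([] ≡ u ∷ us)
 []≢∷ ()

 unsnoc : ∀ (xs : List ℕ) → xs ≡ [] ⊎ ∃[ ys ] ∃[ n ] xs ≡ ys ∷ʳ n
 unsnoc [] = inj₁ refl
 unsnoc (x ∷ xs) with unsnoc xs
 ... | inj₁ refl = inj₂ ([] , x , refl)
 ... | inj₂ (ys , n , refl) = inj₂ (x ∷ ys , n , refl)

 desc-∷ʳ⁻ : ∀ {R : ℕ → ℕ → Set} xs {n} → AllPairs R (xs ∷ʳ n) → AllPairs R xs × All (λ x → R x n) xs
 desc-∷ʳ⁻ xs p = let a , _ , c = AllPairs-++⁻ xs p in a , All.map (λ { (q ∷ _) → q }) c

 asc-head : ∀ {z Z} → Asc (z ∷ Z) → All (z <_) Z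
 asc-head (p ∷ _) = p

 cfgOf : ∀ {S R y} → Valid R → Adm R S y → ∃[ K ] R ≡ rowOf K × y ≡ Cfg.y K
 cfgOf {S} {⟨ D₀ , m₀ , I₀ ⟩} {y} v ad with split-desc D₀ (desc v) (≤-<-trans z≤n (AL (axy ad)))
 ... | D1 , c , D2 , refl , y<c , D2≤y , D1>c with split-asc I₀ (asc-mI v) (All.lookup (D>m v) (∈-++⁺ʳ D1 (here refl)))
 ... | [] , a , Y2 , refl , a<c , Y1<a , Y2≥c = cfg D1 D2 [] Y2 c a y D1>c y<c D2≤y Y1<a a<c Y2≥c , refl , refl
 ... | z ∷ Z , a , Y2 , refl , a<c , Y1<a , Y2≥c = cfg D1 D2 (z ∷ Z) Y2 c a y D1>c y<c D2≤y Y1<a a<c Y2≥c , refl , refl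

 module RowFacts (K : Cfg) (v : Valid (rowOf K)) where
   open Cfg K

   descX : Desc X
   descX = subst Desc (D-rowOf K) (desc v)

   ascY : Asc Y
   ascY = asc-Y K v

   descD1 : Desc D1
   descD1 = proj₁ (AllPairs-++⁻ D1 descX)

   descD2 : Desc D2
   descD2 with proj₁ (proj₂ (AllPairs-++⁻ D1 descX))
   ... | _ ∷ p = p

   D1>D2 : All (λ u → All (u >_) (c ∷ D2)) D1
   D1>D2 = proj₂ (proj₂ (AllPairs-++⁻ D1 descX))

   descX* : All (_< y) D2 → Desc X*
   descX* p = AllPairs.++⁺ descD1 (p ∷ descD2) (All.tabulate λ {u} u∈ →
     <-trans y<c (All.lookup D1>c u∈) ∷ All.tail (All.lookup D1>D2 u∈))

   ascY* : All (c <_) Y2 → Asc Y*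
   ascY* p with AllPairs-++⁻ Y1 ascY
   ... | a₁ , _ ∷ a₂ , a₃ = AllPairs.++⁺ a₁ (p ∷ a₂) (All.tabulate λ {u} u∈ → <-trans (All.lookup Y1<a u∈) a<c ∷ All.tail (All.lookup a₃ u∈))

   mI<D : ∀ {u} → u ∈ X → m (rowOf K) < u
   mI<D u∈ = All.lookup (D>m v) (subst (_ ∈_) (sym (D-rowOf K)) u∈)

   head-m : ∀ {z Z} → Y1 ≡ z ∷ Z → m (rowOf K) ≡ z
   head-m e = cong hd (trans (mI-rowOf K) (cong (_++ a ∷ Y2) e))
     where hd : List ℕ → ℕ
           hd [] = 0
           hd (u ∷ _) = u

   m≤a : m (rowOf K) ≤ a
   m≤a with subst (a ∈_) (sym (mI-rowOf K)) (∈-++⁺ʳ Y1 (here refl))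
   ... | here e = ≤-reflexive (sym e)
   ... | there p = <⇒≤ (All.lookup (I>m v) p)

   Y2⊂I : ∀ {u} → u ∈ Y2 → u ∈ I (rowOf K)
   Y2⊂I {u} u∈ with subst (u ∈_) (sym (mI-rowOf K)) (∈-++⁺ʳ Y1 (there u∈))
   ... | there p = p
   ... | here e = contradiction m≤a (<⇒≱ (<-≤-trans a<c (subst (c ≤_) e (All.lookup Y2≥c u∈))))

   D2<y : ¬ y ∈ D2 → All (_< y) D2
   D2<y y∉ = All.tabulate λ {u} u∈ → ≤∧≢⇒< (All.lookup D2≤y u∈) λ { refl → y∉ u∈ }

   Y2>c : ¬ c ∈ Y2 → All (c <_) Y2
   Y2>c c∉ = All.tabulate λ {u} u∈ → ≤∧≢⇒< (All.lookup Y2≥c u∈) λ { refl → c∉ u∈ }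

 module Build {S : Maybe Row} (vS : ValidLow S) (K : Cfg) (v : Valid (rowOf K)) (ad : Adm (rowOf K) S (Cfg.y K)) where
   open Cfg K
   open CfgLemmas K
   open RowFacts K v
   open Conditions K S
   open Back K vS ascY (Adm-X K ad) hiding (LB)
   open LowerV S vS

   Result : Set
   Result = ∃[ R ] Step S (rowOf K) y R a

   mk : ∀ {l} R → Mode K S l → flat R ≡ l → Valid R → UC (D R) (m R ∷ I R) S → NonTerminal R S a → Result
   mk R md refl vR U nt = R , step K refl refl refl v ad md vR
     (compat U (<-≤-trans (room ad) (≤-reflexive (trans (cong length (flat-rowOf K)) (sym (len-mode K md)))))) nt

   ¬LB-of : ¬ dB → ¬ LB
   ¬LB-of nd lb = nd (inj₂ (inj₂ (inj₁ lb)))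

   ¬D2-of : ¬ dB → ¬ y ∈ D2
   ¬D2-of nd p = nd (inj₁ p)

   room′ : size S < length (X ++ Y)
   room′ = subst (size S <_) (cong length (flat-rowOf K)) (room ad)

   module _ (nd : ¬ dB) where
     private
       dX* = descX* (D2<y (¬D2-of nd))

     valleyD1 : ∀ Y₀ → D2 ≡ [] → Asc Y₀ → All (y <_) Y₀ → UC X* Y₀ S → All (y ≤_) Y ⊎ (Y1 ≡ [] × ¬ iBP) →
                Valid ⟨ D1 , y , Y₀ ⟩ × UC D1 (y ∷ Y₀) S
     valleyD1 Y₀ e ascY₀ y<Y₀ U low = valid descD1 D1>y ascY₀ y<Y₀ , valley-in vS D1>y y<Y₀ (subst (λ z → UC (D1 ++ y ∷ z) Y₀ S) e U)
           (valley-y (¬LB-of nd) e (λ { (b , hy) → nd (inj₂ (inj₂ (inj₂ (b , hy , e , low)))) }) ([ inj₁ , inj₂ ∘ proj₁ ]′ low))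
       where
       D1>y : All (y <_) D1
       D1>y = All.map (<-trans y<c) D1>c

   D2-empty : ∀ {z} → All (z <_) D2 → y < z → D2 ≡ []
   D2-empty p y<z = go D2 D2≤y p
     where
     go : ∀ xs → All (_≤ y) xs → All (_ <_) xs → xs ≡ []
     go [] _ _ = refl
     go (u ∷ _) (u≤y ∷ _) (z<u ∷ _) = contradiction u≤y (<⇒≱ (<-trans y<z z<u))

   -- Only the place of the minimum is open. If Y1 has a head z, it is z or y, whichever is smaller,
   -- and equality is blocked by `IsHead`. If Y1 is empty, it is the last letter of D2, or y when D2
   -- is empty too.
   build-pp : ¬ dB → ¬ iBP → Result
   build-pp nd ni = go Y1 refl
     where
     c∉ = ni ∘ inj₁
     U : UC X* Y* S
     U = UC-PP (¬LB-of nd) (Y2>c c∉) (ni ∘ inj₂)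
     aY* = ascY* (Y2>c c∉)
     go : ∀ Z → Y1 ≡ Z → Result
     go [] e with unsnoc D2
     ... | inj₁ e₂ = let aY₀ = subst (λ Z → Asc (Z ++ c ∷ Y2)) e aY*
                         y<Y = y<c ∷ All.map (λ p → <-≤-trans y<c p) Y2≥c
                         vR , UR = valleyD1 nd (c ∷ Y2) e₂ aY₀ y<Y (subst (λ Z → UC X* (Z ++ c ∷ Y2) S) e U) (inj₂ (e , ni))
                     in mk ⟨ D1 , y , c ∷ Y2 ⟩ (pp nd ni) (trans (sym (++-assoc D1 (y ∷ []) (c ∷ Y2))) (sym (cong₂ (λ p r → (D1 ++ y ∷ p) ++ r ++ c ∷ Y2) e₂ e))) vR UR (inj₁ (c , here refl , a<c))
     ... | inj₂ (ys , n , e₂) = mk ⟨ D1 ++ y ∷ ys , n , c ∷ Y2 ⟩ (pp nd ni)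
             (trans (sym (++-assoc (D1 ++ y ∷ ys) (n ∷ []) (c ∷ Y2))) (trans (cong (_++ c ∷ Y2) (sym X*≡)) (cong (λ r → X* ++ r ++ c ∷ Y2) (sym e))))
             (valid (proj₁ dl) (proj₂ dl) (subst (λ Z → Asc (Z ++ c ∷ Y2)) e aY*) n<Y)
             (valley-in vS (proj₂ dl) n<Y (subst₂ (λ p r → UC p (r ++ c ∷ Y2) S) X*≡ e U) hn)
             (inj₁ (c , here refl , a<c))
       where
       X*≡ : X* ≡ (D1 ++ y ∷ ys) ∷ʳ n
       X*≡ = trans (cong (λ p → D1 ++ y ∷ p) e₂) (sym (++-assoc D1 (y ∷ ys) (n ∷ [])))
       dl = desc-∷ʳ⁻ (D1 ++ y ∷ ys) (subst Desc X*≡ (descX* (D2<y (¬D2-of nd))))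
       n∈ : n ∈ D2
       n∈ = subst (n ∈_) (sym e₂) (∈-++⁺ʳ ys (here refl))
       n<y : n < y
       n<y = All.lookup (D2<y (¬D2-of nd)) n∈
       n<Y : All (n <_) (c ∷ Y2)
       n<Y = <-trans n<y y<c ∷ All.map (λ p → <-≤-trans (<-trans n<y y<c) p) Y2≥c
       hn : h (suc n) < suc (length (D1 ++ y ∷ ys))
       hn = ≤-<-trans (h-mono n<y) (<-≤-trans (hy<x (¬LB-of nd)) (≤-reflexive (trans (cong (λ w → length X + length w) e)
              (trans (+-identityʳ _) (trans (sym len-X*) (trans (cong length X*≡) (len-∷ʳ (D1 ++ y ∷ ys))))))))
     go (z ∷ Z) e with <-cmp y z
     ... | tri> _ _ z<y = mk ⟨ X* , z , Z ++ c ∷ Y2 ⟩ (pp nd ni) (cong (λ r → X* ++ r ++ c ∷ Y2) (sym e))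
             (valid (descX* (D2<y (¬D2-of nd))) (All.tabulate z<) (proj₂ as) (proj₁ as))
             (subst (λ r → UC X* (r ++ c ∷ Y2) S) e U) (inj₁ (c , ∈-++⁺ʳ Z (here refl) , a<c))
       where
       uncons : ∀ {z Z} → Asc (z ∷ Z) → All (z <_) Z × Asc Z
       uncons (p ∷ r) = p , r
       as = uncons (subst (λ r → Asc (r ++ c ∷ Y2)) e aY*)
       mz = head-m e
       z< : ∀ {u} → u ∈ X* → z < u
       z< u∈ with ∈-++⁻ D1 u∈
       ... | inj₁ p = subst (_< _) mz (mI<D (∈-++⁺ˡ p))
       ... | inj₂ (here refl) = z<y
       ... | inj₂ (there p) = subst (_< _) mz (mI<D (∈-++⁺ʳ D1 (there p)))
     ... | tri≈ _ refl _ = ⊥-elim (nd (inj₂ (inj₁ ((subst (λ r → y ∈ r ++ a ∷ Y2) (sym e) (here refl) , low) , inj₁ (λ e′ → []≢∷ (trans (sym e′) e))))))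
       where
       low : All (y ≤_) Y
       low = subst (All (y ≤_)) (cong (_++ a ∷ Y2) (sym e)) (≤-refl ∷ All.map <⇒≤ (asc-head (subst (λ r → Asc (r ++ a ∷ Y2)) e ascY)))
     ... | tri< y<z _ _ = let vR , UR = valleyD1 nd (z ∷ Z ++ c ∷ Y2) (D2-empty D2>z y<z) as (<-below y<z as) (subst (λ r → UC X* (r ++ c ∷ Y2) S) e U) (inj₁ low)
                          in mk ⟨ D1 , y , z ∷ Z ++ c ∷ Y2 ⟩ (pp nd ni) (trans (sym (++-assoc D1 (y ∷ []) _)) (sym (cong₂ (λ p r → (D1 ++ y ∷ p) ++ r ++ c ∷ Y2) (D2-empty D2>z y<z) e))) vR UR
                             (inj₁ (c , there (∈-++⁺ʳ Z (here refl)) , a<c))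
       where
       as = subst (λ r → Asc (r ++ c ∷ Y2)) e aY*
       <-below : ∀ {z Z} → y < z → Asc (z ∷ Z) → All (y <_) (z ∷ Z)
       <-below p (r ∷ _) = p ∷ All.map (<-trans p) r
       mz = head-m e
       D2>z : All (z <_) D2
       D2>z = All.tabulate (λ u∈ → subst (_< _) mz (mI<D (∈-++⁺ʳ D1 (there u∈))))
       low : All (y ≤_) Y
       low = subst (All (y ≤_)) (cong (_++ a ∷ Y2) (sym e)) (All.map <⇒≤ (<-below y<z (subst (λ r → Asc (r ++ a ∷ Y2)) e ascY)))

   IsHead-m : y ≡ m (rowOf K) → IsHead
   IsHead-m e = subst (y ∈_) (mI-rowOf K) (here e) ,
                subst (All (y ≤_)) (mI-rowOf K) (≤-reflexive e ∷ All.map (λ p → ≤-trans (≤-reflexive e) (<⇒≤ p)) (I>m v))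

   D2>m : All (m (rowOf K) <_) D2
   D2>m = All.tabulate (λ u∈ → mI<D (∈-++⁺ʳ D1 (there u∈)))

   nonterm-Y2 : ∀ R {u} → u ∈ I R → c ≤ u → NonTerminal R S a
   nonterm-Y2 R u∈ c≤u = inj₁ (_ , u∈ , <-≤-trans a<c c≤u)

   build-pb : ¬ dB → iBP → Result
   build-pb nd ib with Wit.next K vS ascY (base (Adm-X K ad)) room′ ib | <-cmp y (m (rowOf K))
   ... | u , u∈ , c≤u , _ | tri> _ _ m<y =
         mk ⟨ X* , m (rowOf K) , I (rowOf K) ⟩ (pb nd ib) (cong (X* ++_) (mI-rowOf K))
           (valid (descX* (D2<y (¬D2-of nd))) (All.tabulate m<) (asc v) (I>m v))
           (subst (λ Z → UC X* Z S) (sym (mI-rowOf K)) (UC-PB (¬LB-of nd)))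
           (nonterm-Y2 ⟨ X* , m (rowOf K) , I (rowOf K) ⟩ (Y2⊂I u∈) c≤u)
     where
     m< : ∀ {u} → u ∈ X* → m (rowOf K) < u
     m< u∈ with ∈-++⁻ D1 u∈
     ... | inj₁ p = mI<D (∈-++⁺ˡ p)
     ... | inj₂ (here refl) = m<y
     ... | inj₂ (there p) = mI<D (∈-++⁺ʳ D1 (there p))
   ... | _ | tri≈ _ e _ = ⊥-elim (nd (inj₂ (inj₁ (IsHead-m e , inj₂ ib))))
   ... | u , u∈ , c≤u , _ | tri< y<m _ _ =
         let e₂ = D2-empty D2>m y<m
             vR , UR = valleyD1 nd Y e₂ ascY y<Y (UC-PB (¬LB-of nd)) (inj₁ (All.map <⇒≤ y<Y))
         in mk ⟨ D1 , y , Y ⟩ (pb nd ib) (trans (sym (++-assoc D1 (y ∷ []) Y)) (cong (λ p → (D1 ++ y ∷ p) ++ Y) (sym e₂))) vR UR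
              (nonterm-Y2 ⟨ D1 , y , Y ⟩ (∈-++⁺ʳ Y1 (there u∈)) c≤u)
     where
     y<Y : All (y <_) Y
     y<Y = subst (All (y <_)) (mI-rowOf K) (y<m ∷ All.map (<-trans y<m) (I>m v))

   build-bp : dB → ¬ iB → Result
   build-bp db ni = go Y1 refl
     where
     hc<x : h c < x
     hc<x = ≤∧≢⇒< hc≤x (ni ∘ inj₂)
     U : UC X Y* S
     U = UC-BP (Y2>c (ni ∘ inj₁)) hc<x
     aY* = ascY* (Y2>c (ni ∘ inj₁))
     go : ∀ Z → Y1 ≡ Z → Result
     go (z ∷ Z) e = mk ⟨ X , z , Z ++ c ∷ Y2 ⟩ (bp db ni) (cong (λ r → X ++ r ++ c ∷ Y2) (sym e))
         (valid descX (subst (λ w → All (w <_) X) (head-m e) (All.tabulate mI<D)) (proj₂ as) (proj₁ as))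
         (subst (λ r → UC X (r ++ c ∷ Y2) S) e U) (inj₁ (c , ∈-++⁺ʳ Z (here refl) , a<c))
       where
       uncons : ∀ {z Z} → Asc (z ∷ Z) → All (z <_) Z × Asc Z
       uncons (p ∷ r) = p , r
       as = uncons (subst (λ r → Asc (r ++ c ∷ Y2)) e aY*)
     go [] e with unsnoc D2
     ... | inj₂ (ys , n , e₂) = mk ⟨ D1 ++ c ∷ ys , n , c ∷ Y2 ⟩ (bp db ni)
             (trans (sym (++-assoc (D1 ++ c ∷ ys) (n ∷ []) (c ∷ Y2))) (trans (cong (_++ c ∷ Y2) (sym X≡)) (cong (λ r → X ++ r ++ c ∷ Y2) (sym e))))
             (valid (proj₁ dl) (proj₂ dl) (subst (λ Z → Asc (Z ++ c ∷ Y2)) e aY*) n<Y)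
             (valley-in vS (proj₂ dl) n<Y (subst₂ (λ p r → UC p (r ++ c ∷ Y2) S) X≡ e U) hn)
             (inj₁ (c , here refl , a<c))
       where
       X≡ : X ≡ (D1 ++ c ∷ ys) ∷ʳ n
       X≡ = trans (cong (λ p → D1 ++ c ∷ p) e₂) (sym (++-assoc D1 (c ∷ ys) (n ∷ [])))
       dl = desc-∷ʳ⁻ (D1 ++ c ∷ ys) (subst Desc X≡ descX)
       n<c : n < c
       n<c = ≤-<-trans (All.lookup D2≤y (subst (n ∈_) (sym e₂) (∈-++⁺ʳ ys (here refl)))) y<c
       n<Y : All (n <_) (c ∷ Y2)
       n<Y = n<c ∷ All.map (λ p → <-≤-trans n<c p) Y2≥c
       hn : h (suc n) < suc (length (D1 ++ c ∷ ys))
       hn = ≤-<-trans (h-mono n<c) (<-≤-trans hc<x (≤-reflexive (trans (cong (λ w → length X + length w) e)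
              (trans (+-identityʳ _) (trans (cong length X≡) (len-∷ʳ (D1 ++ c ∷ ys)))))))
     -- With Y1 and D2 empty, c would stand twice next to each other. This cannot happen: now x = q
     -- + 1, and every remaining reason for blocking y pushes `h c` up to q + 1.
     ... | inj₁ e₂ = ⊥-elim (<⇒≱ hc<x (≤-trans (≤-reflexive x≡) (bound db)))
       where
       x≡ : x ≡ suc q
       x≡ = trans (cong (λ w → length X + length w) e) (trans (+-identityʳ _) (trans (cong (λ p → length (D1 ++ c ∷ p)) e₂) (len-∷ʳ D1)))
       bound : dB → suc q ≤ h c
       bound (inj₁ y∈) with subst (y ∈_) e₂ y∈
       ... | ()
       bound (inj₂ (inj₁ (_ , inj₁ ne))) = ⊥-elim (ne e)
       bound (inj₂ (inj₁ (_ , inj₂ (inj₁ r)))) = ⊥-elim (ni (inj₁ r))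
       bound (inj₂ (inj₁ (_ , inj₂ (inj₂ (_ , r))))) = ⊥-elim (ni (inj₂ r))
       bound (inj₂ (inj₂ (inj₁ (el , gy)))) = ≤-trans (subst (_< length A) gy (g<A el)) (A≤h c)
       bound (inj₂ (inj₂ (inj₂ (y∈ , hy , _)))) = subst (_< h c) hy (h-mem y∈ ≤-refl y<c)

   build-bb : dB → iB → Result
   build-bb db ib = mk (rowOf K) (bb db ib) (flat-rowOf K) v (subst₂ (λ p r → UC p r S) (sym (D-rowOf K)) (sym (mI-rowOf K)) (base (Adm-X K ad))) (nt ib)
     where
     nt : iB → NonTerminal (rowOf K) S a
     nt (inj₁ c∈) = nonterm-Y2 (rowOf K) (Y2⊂I c∈) ≤-refl
     nt (inj₂ hc) = go Y2 refl
       where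
       go : ∀ Z → Y2 ≡ Z → NonTerminal (rowOf K) S a
       go (u ∷ Z) e = nonterm-Y2 (rowOf K) (Y2⊂I u∈) (All.lookup Y2≥c u∈)
         where u∈ : u ∈ Y2
               u∈ = subst (u ∈_) (sym e) (here refl)
       -- a ends the row, and `h c ≡ x` forces S to have x letters, one fewer than the row. So the
       -- shape has no corner here and the letter a cannot end in this row.
       go [] e = inj₂ (subst (a ∈_) (sym (mI-rowOf K)) a∈Y ,
                       subst (All (_≤ a)) (sym (mI-rowOf K)) (All.++⁺ (All.map <⇒≤ Y1<a) (≤-refl ∷ subst (All (_≤ a)) (sym e) [])) ,
                       trans (≤-antisym (subst (size S <_) len room′) (s≤s (≤-trans (≤-reflexive (sym hc)) (h≤size c)))) (sym len′) ,
                       subst (1 <_) (sym len′) (s≤s (≤-trans (≤-trans (s≤s z≤n) q<X) (m≤m+n _ _))))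
         where
         len : length (X ++ Y) ≡ suc x
         len = trans (total-len K) (cong suc (trans (cong (λ w → x + length w) e) (+-identityʳ x)))
         len′ : length (flat (rowOf K)) ≡ suc x
         len′ = trans (cong length (flat-rowOf K)) len

   build : Result
   build with dB? | iBP? | iB?
   ... | no nd | no ni | _ = build-pp nd ni
   ... | no nd | yes ib | _ = build-pb nd ib
   ... | yes db | _ | no ni = build-bp db ni
   ... | yes db | _ | yes ib = build-bb db ib

 backward : ∀ {S R′ y} → ValidLow S → Valid R′ → Adm R′ S y → ∃[ R ] ∃[ a ] Step S R′ y R a
 backward vS v ad with cfgOf v ad
 ... | K , refl , refl = let R , s = Build.build vS K v ad in R , Cfg.a K , s

-- The step preserves the 0-Hecke class

module HeckeWords where

 open Hyperoctahedral using (≈-reflexive)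
 open Rows
 open Compatibility
 open Reverse
 open import Data.List using (concat)
 open import Data.List.Properties using (++-identityʳ; concat-++)
 open import Data.Nat using () renaming (∣_-_∣ to dist)
 open import Relation.Binary using (Setoid)
 import Relation.Binary.Reasoning.Setoid as SetoidReasoning
 open DecMem _≟_ using (_∈?_)

 [_] : ℕ → List ℕ
 [ i ] = i ∷ []

 Word : Set
 Word = List (List ℕ)

 infix 4 _~_
 -- Words are cut into blocks so that whole blocks can be commuted; the relation keeps the cutting,
 -- which concatenation forgets.
 record _~_ (us vs : Word) : Set where
   constructor mk~
   field un~ : concat us ≈ concat vs
 open _~_

 ~-setoid : Setoid _ _
 ~-setoid = record { Carrier = Word ; _≈_ = _~_ ; isEquivalence = record
   { refl = mk~ ≈-refl ; sym = λ p → mk~ (≈-sym (un~ p)) ; trans = λ p q → mk~ (≈-trans (un~ p) (un~ q)) } }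

 open SetoidReasoning ~-setoid
 open Setoid ~-setoid using () renaming (refl to ~-refl; sym to ~-sym; trans to ~-trans)

 Comm : List ℕ → List ℕ → Set
 Comm u v = u ++ v ≈ v ++ u

 skip : ∀ {b us vs} → us ~ vs → b ∷ us ~ b ∷ vs
 skip p = mk~ (++-cong ≈-refl (un~ p))

 rule : ∀ us vs {post} → concat us ≈ concat vs → us ++ post ~ vs ++ post
 rule us vs {post} p = mk~ (≈-trans (≈-reflexive (sym (concat-++ us post))) (≈-trans (++-cong p ≈-refl) (≈-reflexive (concat-++ vs post))))

 swap~ : ∀ {u v post} → Comm u v → u ∷ v ∷ post ~ v ∷ u ∷ post
 swap~ {u} {v} {post} p = rule (u ∷ v ∷ []) (v ∷ u ∷ []) (subst₂ _≈_ (cong (u ++_) (sym (++-identityʳ v))) (cong (v ++_) (sym (++-identityʳ u))) p)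

 sk2 : ∀ {b₁ b₂ us vs} → us ~ vs → b₁ ∷ b₂ ∷ us ~ b₁ ∷ b₂ ∷ vs
 sk2 p = skip (skip p)

 sk3 : ∀ {b₁ b₂ b₃ us vs} → us ~ vs → b₁ ∷ b₂ ∷ b₃ ∷ us ~ b₁ ∷ b₂ ∷ b₃ ∷ vs
 sk3 p = skip (sk2 p)

 sk4 : ∀ {b₁ b₂ b₃ b₄ us vs} → us ~ vs → b₁ ∷ b₂ ∷ b₃ ∷ b₄ ∷ us ~ b₁ ∷ b₂ ∷ b₃ ∷ b₄ ∷ vs
 sk4 p = skip (sk3 p)

 sk5 : ∀ {b₁ b₂ b₃ b₄ b₅ us vs} → us ~ vs → b₁ ∷ b₂ ∷ b₃ ∷ b₄ ∷ b₅ ∷ us ~ b₁ ∷ b₂ ∷ b₃ ∷ b₄ ∷ b₅ ∷ vs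
 sk5 p = skip (sk4 p)

 fwd2 : ∀ {u v w post} → Comm u v → Comm u w → u ∷ v ∷ w ∷ post ~ v ∷ w ∷ u ∷ post
 fwd2 p q = ~-trans (swap~ p) (skip (swap~ q))

 back2 : ∀ {u v w post} → Comm u v → Comm u w → v ∷ w ∷ u ∷ post ~ u ∷ v ∷ w ∷ post
 back2 p q = ~-sym (fwd2 p q)

 back : ∀ {u v post} → Comm u v → v ∷ u ∷ post ~ u ∷ v ∷ post
 back p = ~-sym (swap~ p)

 double : ∀ {i post} → [ i ] ∷ [ i ] ∷ post ~ [ i ] ∷ post
 double {i} = rule ([ i ] ∷ [ i ] ∷ []) ([ i ] ∷ []) (idem i)

 far-up : ∀ {i j} → suc i < j → dist i j ≥ 2
 far-up {i} {j} p = ≤-trans (m+n≤o⇒m≤o∸n 2 p) (≤-reflexive (sym (m≤n⇒∣m-n∣≡n∸m (≤-trans (n≤1+n i) (<⇒≤ p)))))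

 far-down : ∀ {i j} → suc j < i → dist i j ≥ 2
 far-down {i} {j} p = subst (_≥ 2) (∣-∣-comm j i) (far-up p)

 Far : ℕ → ℕ → Set
 Far i j = suc i < j ⊎ suc j < i

 Comm-letter : ∀ {i xs} → All (Far i) xs → Comm [ i ] xs
 Comm-letter {i} {[]} [] = ≈-refl
 Comm-letter {i} {x ∷ xs} (f ∷ fs) =
   ≈-trans (++-cong {i ∷ x ∷ []} {x ∷ i ∷ []} {xs} {xs} (comm i x ([ far-up , far-down ]″ f)) ≈-refl)
           (++-cong {[ x ]} {[ x ]} ≈-refl (Comm-letter fs))
   where
   [_,_]″ : (suc i < x → dist i x ≥ 2) → (suc x < i → dist i x ≥ 2) → Far i x → dist i x ≥ 2
   [ f , g ]″ (inj₁ p) = f p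
   [ f , g ]″ (inj₂ p) = g p

 above : ∀ {i xs} → All (suc i <_) xs → Comm [ i ] xs
 above p = Comm-letter (All.map inj₁ p)

 below : ∀ {i xs} → All (λ x → suc x < i) xs → Comm [ i ] xs
 below p = Comm-letter (All.map inj₂ p)

 adjacent? : ∀ {a c} → a < c → c ≡ suc a ⊎ suc a < c
 adjacent? a<c with m≤n⇒m<n∨m≡n a<c
 ... | inj₁ p = inj₂ p
 ... | inj₂ e = inj₁ (sym e)

 far2 : ∀ {a c} → suc a < c → Comm [ a ] [ c ]
 far2 p = above (p ∷ [])

 -- For letters that are not adjacent both sides reduce to `[ a ] ∷ [ c ]` by commuting and
 -- idempotence. For adjacent ones it is the braid relation, which is available only for a > 0.
 aca : ∀ {a c post} → a < c → (c ≡ suc a → 0 < a) → [ a ] ∷ [ c ] ∷ [ a ] ∷ post ~ [ c ] ∷ [ a ] ∷ [ c ] ∷ post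
 aca {a} {c} {post} a<c pos with adjacent? a<c
 ... | inj₁ refl = rule ([ a ] ∷ [ c ] ∷ [ a ] ∷ []) ([ c ] ∷ [ a ] ∷ [ c ] ∷ []) (braid a (pos refl))
 ... | inj₂ far = begin
   [ a ] ∷ [ c ] ∷ [ a ] ∷ post ≈⟨ skip (back (far2 far)) ⟩
   [ a ] ∷ [ a ] ∷ [ c ] ∷ post ≈⟨ double ⟩
   [ a ] ∷ [ c ] ∷ post ≈⟨ skip double ⟨
   [ a ] ∷ [ c ] ∷ [ c ] ∷ post ≈⟨ swap~ (far2 far) ⟩
   [ c ] ∷ [ a ] ∷ [ c ] ∷ post ∎

 -- In contrast to `aca` this holds for all a < c, with the relation of length four for 0 and 1.
 acac : ∀ {a c post} → a < c → [ a ] ∷ [ c ] ∷ [ a ] ∷ [ c ] ∷ post ~ [ c ] ∷ [ a ] ∷ [ c ] ∷ [ a ] ∷ post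
 acac {zero} {c} {post} a<c with adjacent? a<c
 ... | inj₁ refl = rule ([ 0 ] ∷ [ 1 ] ∷ [ 0 ] ∷ [ 1 ] ∷ []) ([ 1 ] ∷ [ 0 ] ∷ [ 1 ] ∷ [ 0 ] ∷ []) (≈-sym braid₀)
 ... | inj₂ far = begin
   [ 0 ] ∷ [ c ] ∷ [ 0 ] ∷ [ c ] ∷ post ≈⟨ sk2 (swap~ (far2 far)) ⟩
   [ 0 ] ∷ [ c ] ∷ [ c ] ∷ [ 0 ] ∷ post ≈⟨ swap~ (far2 far) ⟩
   [ c ] ∷ [ 0 ] ∷ [ c ] ∷ [ 0 ] ∷ post ∎
 acac {suc a} {c} {post} a<c = begin
   [ suc a ] ∷ [ c ] ∷ [ suc a ] ∷ [ c ] ∷ post ≈⟨ aca a<c (λ _ → s≤s z≤n) ⟩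
   [ c ] ∷ [ suc a ] ∷ [ c ] ∷ [ c ] ∷ post ≈⟨ sk2 double ⟩
   [ c ] ∷ [ suc a ] ∷ [ c ] ∷ post ≈⟨ double ⟨
   [ c ] ∷ [ c ] ∷ [ suc a ] ∷ [ c ] ∷ post ≈⟨ skip (aca a<c (λ _ → s≤s z≤n)) ⟨
   [ c ] ∷ [ suc a ] ∷ [ c ] ∷ [ suc a ] ∷ post ∎

 -- Four alternating letters already give the longest element of the group generated by s_a and s_c,
 -- and it absorbs both.
 cacaca : ∀ {a c post} → a < c → [ c ] ∷ [ a ] ∷ [ c ] ∷ [ a ] ∷ [ c ] ∷ [ a ] ∷ post ~ [ c ] ∷ [ a ] ∷ [ c ] ∷ [ a ] ∷ post
 cacaca {a} {c} {post} p = begin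
   [ c ] ∷ [ a ] ∷ [ c ] ∷ [ a ] ∷ [ c ] ∷ [ a ] ∷ post ≈⟨ sk2 (acac p) ⟨
   [ c ] ∷ [ a ] ∷ [ a ] ∷ [ c ] ∷ [ a ] ∷ [ c ] ∷ post ≈⟨ skip double ⟩
   [ c ] ∷ [ a ] ∷ [ c ] ∷ [ a ] ∷ [ c ] ∷ post ≈⟨ acac p ⟨
   [ a ] ∷ [ c ] ∷ [ a ] ∷ [ c ] ∷ [ c ] ∷ post ≈⟨ sk3 double ⟩
   [ a ] ∷ [ c ] ∷ [ a ] ∷ [ c ] ∷ post ≈⟨ acac p ⟩
   [ c ] ∷ [ a ] ∷ [ c ] ∷ [ a ] ∷ post ∎

 caca-pos : ∀ {a c post} → a < c → 0 < a → [ c ] ∷ [ a ] ∷ [ c ] ∷ [ a ] ∷ post ~ [ c ] ∷ [ a ] ∷ [ c ] ∷ post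
 caca-pos {a} {c} {post} p pos = begin
   [ c ] ∷ [ a ] ∷ [ c ] ∷ [ a ] ∷ post ≈⟨ skip (aca p (λ _ → pos)) ⟩
   [ c ] ∷ [ c ] ∷ [ a ] ∷ [ c ] ∷ post ≈⟨ double ⟩
   [ c ] ∷ [ a ] ∷ [ c ] ∷ post ∎

 acac-pos : ∀ {a c post} → a < c → 0 < a → [ a ] ∷ [ c ] ∷ [ a ] ∷ [ c ] ∷ post ~ [ a ] ∷ [ c ] ∷ [ a ] ∷ post
 acac-pos {a} {c} {post} p pos = begin
   [ a ] ∷ [ c ] ∷ [ a ] ∷ [ c ] ∷ post ≈⟨ aca p (λ _ → pos) ⟩
   [ c ] ∷ [ a ] ∷ [ c ] ∷ [ c ] ∷ post ≈⟨ sk2 double ⟩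
   [ c ] ∷ [ a ] ∷ [ c ] ∷ post ≈⟨ aca p (λ _ → pos) ⟨
   [ a ] ∷ [ c ] ∷ [ a ] ∷ post ∎

 desc-split : ∀ {y xs} → Desc xs → y ∈ xs → ∃[ P ] ∃[ Q ] xs ≡ P ++ y ∷ Q × All (y <_) P × All (_< y) Q
 desc-split {y} d y∈ with ∈-∃++ y∈
 ... | P , Q , refl with AllPairs-++⁻ P d
 ... | _ , q ∷ _ , r = P , Q , refl , All.map All.head r , q

 asc-split : ∀ {y xs} → Asc xs → y ∈ xs → ∃[ P ] ∃[ Q ] xs ≡ P ++ y ∷ Q × All (_< y) P × All (y <_) Q
 asc-split {y} d y∈ with ∈-∃++ y∈
 ... | P , Q , refl with AllPairs-++⁻ P d
 ... | _ , q ∷ _ , r = P , Q , refl , All.map All.head r , q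

 peel : ∀ {p xs} → Asc xs → p ∈ xs → All (p ≤_) xs → ∃[ Q ] xs ≡ p ∷ Q × All (p <_) Q
 peel (p< ∷ _) (here refl) _ = _ , refl , p<
 peel (p< ∷ _) (there q) (p≤ ∷ _) = contradiction (All.lookup p< q) (≤⇒≯ p≤)

 peel-desc : ∀ {p xs} → Desc xs → p ∈ xs → All (_≤ p) xs → ∃[ Q ] xs ≡ p ∷ Q × All (_< p) Q
 peel-desc (p< ∷ _) (here refl) _ = _ , refl , p<
 peel-desc (p< ∷ _) (there q) (p≤ ∷ _) = contradiction (All.lookup p< q) (≤⇒≯ p≤)

 last-two : ∀ {xs c y} → Desc xs → c ∈ xs → y ∈ xs → y < c → (∀ {u} → u ∈ xs → y ≤ u) → c ≡ suc y → ∃[ P ] xs ≡ P ++ c ∷ y ∷ []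
 last-two {xs} {c} {y} d c∈ y∈ y<c low e with desc-split d c∈
 ... | P , Q , refl , P>c , Q<c with peel-desc (AllPairs.tail (proj₁ (proj₂ (AllPairs-++⁻ P d)))) y∈Q (All.map (λ p → s≤s⁻¹ (≤-trans p (≤-reflexive e))) Q<c)
   where
   y∈Q : y ∈ Q
   y∈Q with ∈-++⁻ P y∈
   ... | inj₁ r = ⊥-elim (<-asym y<c (All.lookup P>c r))
   ... | inj₂ (here r) = ⊥-elim (<-irrefl r y<c)
   ... | inj₂ (there r) = r
 ... | [] , refl , _ = P , refl
 ... | u ∷ _ , refl , (u<y ∷ _) = contradiction (low (∈-++⁺ʳ P (there (there (here refl))))) (<⇒≱ u<y)

 module _ {A B : List ℕ} (dA : Desc A) (aB : Asc B) {y : ℕ} where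

   private p = suc y

   above-p : ∀ {Q} → All (y <_) Q → ¬ p ∈ Q → All (p <_) Q
   above-p q n = All.tabulate λ u∈ → ≤∧≢⇒< (All.lookup q u∈) λ { refl → n u∈ }

   -- y commutes back to the y of B unless p = y + 1 is in B. Then y p y becomes p y p, and the
   -- first p is taken back to the p of A. If A contains y after that p, the letters collect to p y
   -- p y p, which shortens; the gap at y - 1 is what lets y pass the rest of A and B.
   absorb-B : y ∈ B → (p ∈ B → p ∈ A × (y ∈ A → ∀ {s} → s ∈ A ⊎ s ∈ B → s < y → suc s < y)) → 0 < y →
              A ∷ B ∷ [ y ] ∷ [] ~ A ∷ B ∷ []
   absorb-B y∈B pBA pos with asc-split aB y∈B
   ... | B1 , B2 , refl , B1<y , B2>y with p ∈? B2
   ... | no p∉ = skip (begin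
     (B1 ++ [ y ] ++ B2) ∷ [ y ] ∷ [] ≈⟨ unfold ⟩
     B1 ∷ [ y ] ∷ B2 ∷ [ y ] ∷ [] ≈⟨ sk2 (back (above (above-p B2>y p∉))) ⟩
     B1 ∷ [ y ] ∷ [ y ] ∷ B2 ∷ [] ≈⟨ skip double ⟩
     B1 ∷ [ y ] ∷ B2 ∷ [] ≈⟨ fold ⟩
     (B1 ++ [ y ] ++ B2) ∷ [] ∎)
     where
     unfold : (B1 ++ [ y ] ++ B2) ∷ [ y ] ∷ [] ~ B1 ∷ [ y ] ∷ B2 ∷ [ y ] ∷ []
     unfold = mk~ (≈-reflexive (++-assoc B1 (y ∷ B2) [ y ]))
     fold : B1 ∷ [ y ] ∷ B2 ∷ [] ~ (B1 ++ [ y ] ++ B2) ∷ []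
     fold = mk~ (≈-reflexive (trans (sym (++-assoc B1 (y ∷ B2) [])) refl))
   ... | yes p∈ with peel (proj₁ (proj₂ (AllPairs-++⁻ (B1 ∷ʳ y) (subst Asc (sym (++-assoc B1 [ y ] B2)) aB)))) p∈ B2>y
                     | desc-split dA (proj₁ (pBA (∈-++⁺ʳ B1 (there p∈))))
   ... | B3 , refl , B3>p | A0 , A3 , refl , A0>p , A3<p = main (y ∈? A3)
     where
     y-B3 : Comm [ y ] B3
     y-B3 = above B3>p
     p-B1 : Comm [ p ] B1
     p-B1 = below (All.map s≤s B1<y)
     unfold : (A0 ++ p ∷ A3) ∷ (B1 ++ y ∷ p ∷ B3) ∷ [ y ] ∷ [] ~ A0 ∷ [ p ] ∷ A3 ∷ B1 ∷ [ y ] ∷ [ p ] ∷ B3 ∷ [ y ] ∷ []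
     unfold = mk~ (≈-reflexive (trans (++-assoc A0 (p ∷ A3) _) (cong (λ z → A0 ++ p ∷ A3 ++ z) (++-assoc B1 (y ∷ p ∷ B3) [ y ]))))
     fold : A0 ∷ [ p ] ∷ A3 ∷ B1 ∷ [ y ] ∷ [ p ] ∷ B3 ∷ [] ~ (A0 ++ p ∷ A3) ∷ (B1 ++ y ∷ p ∷ B3) ∷ []
     fold = mk~ (≈-reflexive (sym (trans (++-assoc A0 (p ∷ A3) _) (cong (λ z → A0 ++ p ∷ A3 ++ z) (++-assoc B1 (y ∷ p ∷ B3) [])))))
     main : Dec (y ∈ A3) → (A0 ++ p ∷ A3) ∷ (B1 ++ y ∷ p ∷ B3) ∷ [ y ] ∷ [] ~ (A0 ++ p ∷ A3) ∷ (B1 ++ y ∷ p ∷ B3) ∷ []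
     main (no y∉) = begin
       _ ≈⟨ unfold ⟩
       A0 ∷ [ p ] ∷ A3 ∷ B1 ∷ [ y ] ∷ [ p ] ∷ B3 ∷ [ y ] ∷ [] ≈⟨ sk5 (skip (back y-B3)) ⟩
       A0 ∷ [ p ] ∷ A3 ∷ B1 ∷ [ y ] ∷ [ p ] ∷ [ y ] ∷ B3 ∷ [] ≈⟨ sk4 (aca ≤-refl (λ _ → pos)) ⟩
       A0 ∷ [ p ] ∷ A3 ∷ B1 ∷ [ p ] ∷ [ y ] ∷ [ p ] ∷ B3 ∷ [] ≈⟨ sk2 (back2 p-A3 p-B1) ⟩
       A0 ∷ [ p ] ∷ [ p ] ∷ A3 ∷ B1 ∷ [ y ] ∷ [ p ] ∷ B3 ∷ [] ≈⟨ skip double ⟩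
       A0 ∷ [ p ] ∷ A3 ∷ B1 ∷ [ y ] ∷ [ p ] ∷ B3 ∷ [] ≈⟨ fold ⟩
       _ ∎
       where
       p-A3 : Comm [ p ] A3
       p-A3 = below (All.tabulate λ {u} u∈ → s≤s (≤∧≢⇒< (s≤s⁻¹ (All.lookup A3<p u∈)) λ { refl → y∉ u∈ }))
     main (yes y∈) with peel-desc (AllPairs.tail (proj₁ (proj₂ (AllPairs-++⁻ A0 dA)))) y∈ (All.map s≤s⁻¹ A3<p)
     ... | A4 , refl , A4<y = begin
       _ ≈⟨ unfold ⟩
       A0 ∷ [ p ] ∷ (y ∷ A4) ∷ B1 ∷ [ y ] ∷ [ p ] ∷ B3 ∷ [ y ] ∷ [] ≈⟨ sk5 (skip (back y-B3)) ⟩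
       A0 ∷ [ p ] ∷ (y ∷ A4) ∷ B1 ∷ [ y ] ∷ [ p ] ∷ [ y ] ∷ B3 ∷ [] ≈⟨ sk4 (aca ≤-refl (λ _ → pos)) ⟩
       A0 ∷ [ p ] ∷ (y ∷ A4) ∷ B1 ∷ [ p ] ∷ [ y ] ∷ [ p ] ∷ B3 ∷ [] ≈⟨ collect3 ⟩
       A0 ∷ [ p ] ∷ [ y ] ∷ [ p ] ∷ [ y ] ∷ [ p ] ∷ A4 ∷ B1 ∷ B3 ∷ [] ≈⟨ sk2 (acac-pos ≤-refl pos) ⟩
       A0 ∷ [ p ] ∷ [ y ] ∷ [ p ] ∷ [ y ] ∷ A4 ∷ B1 ∷ B3 ∷ [] ≈⟨ skip (caca-pos ≤-refl pos) ⟩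
       A0 ∷ [ p ] ∷ [ y ] ∷ [ p ] ∷ A4 ∷ B1 ∷ B3 ∷ [] ≈⟨ collect2 ⟨
       A0 ∷ [ p ] ∷ (y ∷ A4) ∷ B1 ∷ [ y ] ∷ [ p ] ∷ B3 ∷ [] ≈⟨ fold ⟩
       _ ∎
       where
       yA : y ∈ A0 ++ p ∷ y ∷ A4
       yA = ∈-++⁺ʳ A0 (there (here refl))
       gap = proj₂ (pBA (∈-++⁺ʳ B1 (there p∈)))
       y-A4 : Comm [ y ] A4
       y-A4 = below (All.tabulate λ u∈ → gap yA (inj₁ (∈-++⁺ʳ A0 (there (there u∈)))) (All.lookup A4<y u∈))
       y-B1 : Comm [ y ] B1
       y-B1 = below (All.tabulate λ u∈ → gap yA (inj₂ (∈-++⁺ˡ u∈)) (All.lookup B1<y u∈))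
       p-A4 : Comm [ p ] A4
       p-A4 = below (All.map s≤s A4<y)
       open-y : ∀ {post} → (y ∷ A4) ∷ post ~ [ y ] ∷ A4 ∷ post
       open-y = mk~ ≈-refl
       collect3 : A0 ∷ [ p ] ∷ (y ∷ A4) ∷ B1 ∷ [ p ] ∷ [ y ] ∷ [ p ] ∷ B3 ∷ [] ~ A0 ∷ [ p ] ∷ [ y ] ∷ [ p ] ∷ [ y ] ∷ [ p ] ∷ A4 ∷ B1 ∷ B3 ∷ []
       collect3 = begin
         _ ≈⟨ sk2 open-y ⟩
         A0 ∷ [ p ] ∷ [ y ] ∷ A4 ∷ B1 ∷ [ p ] ∷ [ y ] ∷ [ p ] ∷ B3 ∷ [] ≈⟨ sk3 (back2 p-A4 p-B1) ⟩
         A0 ∷ [ p ] ∷ [ y ] ∷ [ p ] ∷ A4 ∷ B1 ∷ [ y ] ∷ [ p ] ∷ B3 ∷ [] ≈⟨ sk4 (back2 y-A4 y-B1) ⟩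
         A0 ∷ [ p ] ∷ [ y ] ∷ [ p ] ∷ [ y ] ∷ A4 ∷ B1 ∷ [ p ] ∷ B3 ∷ [] ≈⟨ sk5 (back2 p-A4 p-B1) ⟩
         _ ∎
       collect2 : A0 ∷ [ p ] ∷ (y ∷ A4) ∷ B1 ∷ [ y ] ∷ [ p ] ∷ B3 ∷ [] ~ A0 ∷ [ p ] ∷ [ y ] ∷ [ p ] ∷ A4 ∷ B1 ∷ B3 ∷ []
       collect2 = begin
         _ ≈⟨ sk2 open-y ⟩
         A0 ∷ [ p ] ∷ [ y ] ∷ A4 ∷ B1 ∷ [ y ] ∷ [ p ] ∷ B3 ∷ [] ≈⟨ sk3 (back2 y-A4 y-B1) ⟩
         A0 ∷ [ p ] ∷ [ y ] ∷ [ y ] ∷ A4 ∷ B1 ∷ [ p ] ∷ B3 ∷ [] ≈⟨ sk2 double ⟩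
         A0 ∷ [ p ] ∷ [ y ] ∷ A4 ∷ B1 ∷ [ p ] ∷ B3 ∷ [] ≈⟨ sk3 (back2 p-A4 p-B1) ⟩
         _ ∎

   -- The letter y - 1 occurs neither in A nor in B, so y can travel back to the y of A. If p = y +
   -- 1 is in B, it travels along to the p of A, and p y p y shortens to p y p because y > 0.
   absorb-A : y ∈ A → ¬ y ∈ B → (∀ {s} → s ∈ A ⊎ s ∈ B → s < y → suc s < y) → (p ∈ B → p ∈ A × 0 < y) →
              A ∷ B ∷ [ y ] ∷ [] ~ A ∷ B ∷ []
   absorb-A y∈A y∉B gap pBA with p ∈? B
   ... | no p∉B with desc-split dA y∈A
   ... | A1 , A3 , refl , A1>y , A3<y = begin
     (A1 ++ y ∷ A3) ∷ B ∷ [ y ] ∷ [] ≈⟨ mk~ (≈-reflexive (++-assoc A1 (y ∷ A3) _)) ⟩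
     A1 ∷ [ y ] ∷ A3 ∷ B ∷ [ y ] ∷ [] ≈⟨ sk2 (back2 y-A3 y-B) ⟩
     A1 ∷ [ y ] ∷ [ y ] ∷ A3 ∷ B ∷ [] ≈⟨ skip double ⟩
     A1 ∷ [ y ] ∷ A3 ∷ B ∷ [] ≈⟨ mk~ (≈-reflexive (sym (++-assoc A1 (y ∷ A3) _))) ⟩
     (A1 ++ y ∷ A3) ∷ B ∷ [] ∎
     where
     y-A3 : Comm [ y ] A3
     y-A3 = below (All.tabulate λ u∈ → gap (inj₁ (∈-++⁺ʳ A1 (there u∈))) (All.lookup A3<y u∈))
     y-B : Comm [ y ] B
     y-B = Comm-letter (All.tabulate λ {u} u∈ → far u u∈)
       where
       far : ∀ u → u ∈ B → Far y u
       far u u∈ with ≤-<-connex u y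
       ... | inj₁ u≤y = inj₂ (gap (inj₂ u∈) (≤∧≢⇒< u≤y λ { refl → y∉B u∈ }))
       ... | inj₂ y<u = inj₁ (≤∧≢⇒< y<u λ { refl → p∉B u∈ })
   absorb-A y∈A y∉B gap pBA | yes p∈B with desc-split dA (proj₁ (pBA p∈B)) | asc-split aB p∈B
   ... | A0 , A2 , refl , A0>p , A2<p | B1 , B3 , refl , B1<p , B3>p
         with peel-desc (AllPairs.tail (proj₁ (proj₂ (AllPairs-++⁻ A0 dA)))) (y∈A2 y∈A) (All.map s≤s⁻¹ A2<p)
       where
       y∈A2 : y ∈ A0 ++ p ∷ A2 → y ∈ A2
       y∈A2 q with ∈-++⁻ A0 q
       ... | inj₁ r = contradiction (All.lookup A0>p r) (≤⇒≯ (n≤1+n y))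
       ... | inj₂ (there r) = r
   ... | A3 , refl , A3<y = begin
     (A0 ++ p ∷ y ∷ A3) ∷ (B1 ++ p ∷ B3) ∷ [ y ] ∷ [] ≈⟨ mk~ (≈-reflexive (trans (++-assoc A0 _ _) (cong (λ z → A0 ++ p ∷ y ∷ A3 ++ z) (++-assoc B1 (p ∷ B3) [ y ])))) ⟩
     A0 ∷ [ p ] ∷ [ y ] ∷ A3 ∷ B1 ∷ [ p ] ∷ B3 ∷ [ y ] ∷ [] ≈⟨ sk3 (skip (sk2 (back (above B3>p)))) ⟩
     A0 ∷ [ p ] ∷ [ y ] ∷ A3 ∷ B1 ∷ [ p ] ∷ [ y ] ∷ B3 ∷ [] ≈⟨ sk3 (back2 p-A3 p-B1) ⟩
     A0 ∷ [ p ] ∷ [ y ] ∷ [ p ] ∷ A3 ∷ B1 ∷ [ y ] ∷ B3 ∷ [] ≈⟨ sk4 (back2 y-A3 y-B1) ⟩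
     A0 ∷ [ p ] ∷ [ y ] ∷ [ p ] ∷ [ y ] ∷ A3 ∷ B1 ∷ B3 ∷ [] ≈⟨ skip (caca-pos ≤-refl (proj₂ (pBA p∈B))) ⟩
     A0 ∷ [ p ] ∷ [ y ] ∷ [ p ] ∷ A3 ∷ B1 ∷ B3 ∷ [] ≈⟨ sk3 (fwd2 p-A3 p-B1) ⟩
     A0 ∷ [ p ] ∷ [ y ] ∷ A3 ∷ B1 ∷ [ p ] ∷ B3 ∷ [] ≈⟨ mk~ (≈-reflexive (sym (trans (++-assoc A0 _ _) (cong (λ z → A0 ++ p ∷ y ∷ A3 ++ z) (++-assoc B1 (p ∷ B3) []))))) ⟩
     (A0 ++ p ∷ y ∷ A3) ∷ (B1 ++ p ∷ B3) ∷ [] ∎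
     where
     B1<y : All (_< y) B1
     B1<y = All.tabulate λ u∈ → ≤∧≢⇒< (s≤s⁻¹ (All.lookup B1<p u∈)) λ { refl → y∉B (∈-++⁺ˡ u∈) }
     y-A3 : Comm [ y ] A3
     y-A3 = below (All.tabulate λ u∈ → gap (inj₁ (∈-++⁺ʳ A0 (there (there u∈)))) (All.lookup A3<y u∈))
     y-B1 : Comm [ y ] B1
     y-B1 = below (All.tabulate λ u∈ → gap (inj₂ (∈-++⁺ˡ u∈)) (All.lookup B1<y u∈))
     p-A3 : Comm [ p ] A3
     p-A3 = below (All.map s≤s A3<y)
     p-B1 : Comm [ p ] B1
     p-B1 = below (All.map s≤s B1<y)

 gt-gap : ∀ {y} xs → gt (suc y) xs < gt y xs → suc y ∈ xs
 gt-gap {y} (x ∷ xs) p with gt-view (suc y) x xs | gt-view y x xs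
 ... | inj₁ (_ , e) | inj₁ (_ , f) rewrite e | f = there (gt-gap xs (s≤s⁻¹ p))
 ... | inj₁ (a , _) | inj₂ (b , _) = contradiction (<-trans (n<1+n _) a) (≤⇒≯ b)
 ... | inj₂ (x≤ , e) | inj₁ (y<x , f) = here (≤-antisym y<x x≤)
 ... | inj₂ (_ , e) | inj₂ (_ , f) rewrite e | f = there (gt-gap xs p)

 word : Maybe Row → List ℕ
 word nothing = []
 word (just r) = flat r

 word-AB : ∀ S → word S ≡ left S ++ right S
 word-AB nothing = refl
 word-AB (just r) = sym (++-assoc (D r) (m r ∷ []) (I r))

 right>0 : ∀ S → ValidLow S → ∀ {b} → b ∈ right S → 0 < b
 right>0 (just r) v b∈ = ≤-<-trans z≤n (All.lookup (I>m v) b∈)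

 module StepHecke {S : Maybe Row} (vS : ValidLow S) (K : Cfg) (v : Valid (rowOf K)) (ad : Adm (rowOf K) S (Cfg.y K)) where
   open Cfg K
   open CfgLemmas K
   open RowFacts K v
   open Conditions K S hiding (LB)
   𝐀 = Adm-X K ad
   open Back K vS ascY 𝐀
   open LowerV S vS

   c-Y1 : Comm [ c ] Y1
   c-Y1 = below (All.map (λ p → ≤-<-trans p a<c) Y1<a)

   y-D1 : Comm [ y ] D1
   y-D1 = above (All.map (≤-<-trans y<c) D1>c)

   c-D2 : ∀ {xs} → All (_< y) xs → Comm [ c ] xs
   c-D2 p = below (All.map (λ q → ≤-<-trans q y<c) p)

   a-Y2 : All (c <_) Y2 → Comm [ a ] Y2
   a-Y2 p = above (All.map (≤-<-trans a<c) p)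

   mh : ℕ
   mh = m (rowOf K)

   Refined : Set
   Refined = IsHead × (¬ Y1 ≡ [] ⊎ iBP)

   h-mh : h (suc mh) < length X + 1
   h-mh = subst (h (suc mh) <_) (cong (length X +_) lt1) (CR (base 𝐀) (inj₂ (mh , subst (mh ∈_) (mI-rowOf K) (here refl) , refl)))
     where
     lt1 : lt (suc mh) Y ≡ 1
     lt1 = trans (cong (lt (suc mh)) (sym (mI-rowOf K))) (trans (lt-yes (suc mh) _ ≤-refl) (cong suc (lt-none (suc mh) (I>m v))))

   head-mh : IsHead → y ≡ mh
   head-mh (y∈ , low) = ≤-antisym (All.lookup low (subst (mh ∈_) (mI-rowOf K) (here refl))) (mh≤ (subst (y ∈_) (sym (mI-rowOf K)) y∈))
     where
     mh≤ : y ∈ mh ∷ I (rowOf K) → mh ≤ y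
     mh≤ (here e) = ≤-reflexive (sym e)
     mh≤ (there p) = <⇒≤ (All.lookup (I>m v) p)

   mh-head : y ≡ mh → IsHead
   mh-head e = subst (y ∈_) (mI-rowOf K) (here e) ,
               subst (All (y ≤_)) (mI-rowOf K) (≤-reflexive e ∷ All.map (λ p → ≤-trans (≤-reflexive e) (<⇒≤ p)) (I>m v))

   low-mh : All (y ≤_) Y → y ≤ mh
   low-mh low = All.lookup low (subst (mh ∈_) (mI-rowOf K) (here refl))

   D2-nil : y ≤ mh → D2 ≡ []
   D2-nil y≤ = go D2 D2≤y (All.tabulate (λ u∈ → mI<D (∈-++⁺ʳ D1 (there u∈))))
     where
     go : ∀ xs → All (_≤ y) xs → All (mh <_) xs → xs ≡ []
     go [] _ _ = refl
     go (u ∷ _) (p ∷ _) (r ∷ _) = contradiction (≤-trans p y≤) (<⇒≱ r)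

   lenX-nil : D2 ≡ [] → length X ≡ suc q
   lenX-nil e = trans (cong (λ p → length (D1 ++ c ∷ p)) e) (len-∷ʳ D1)

   x-nil : D2 ≡ [] → Y1 ≡ [] → x ≡ suc q
   x-nil e f = trans (cong (λ w → length X + length w) f) (trans (+-identityʳ _) (lenX-nil e))

   gt-X-below : ∀ {s} → s < c → All (_≤ s) D2 → gt s X ≡ suc q
   gt-X-below {s} s<c p = trans (gt-++ s D1 (c ∷ D2)) (trans (cong₂ _+_ (gt-all s (All.map (<-trans s<c) D1>c))
     (trans (gt-yes s D2 s<c) (cong suc (gt-none s p)))) (+-comm q 1))

   -- If y - 1 were in S, the letter y of A would make g at y - 1 at least q + 1, but X has only q +
   -- 1 letters above y - 1, against CL.
   gap-A : ¬ y ∈ D2 → g y ≡ q → y ∈ A → ∀ {s} → s ∈ A ⊎ s ∈ B → s < y → suc s < y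
   gap-A y∉ gy y∈A {s} el s<y = ≤∧≢⇒< s<y λ { e → <-irrefl refl (<-≤-trans (≤-<-trans (≤-trans (≤-reflexive (cong suc (sym gy))) (gt-mem y∈A s<y ≤-refl)) (CL (base 𝐀) el))
       (≤-reflexive (gt-X-below (<-trans s<y y<c) (All.map (λ p → s≤s⁻¹ (≤-trans p (≤-reflexive (sym e)))) (D2<y y∉))))) }

   -- Under `LB` the condition AE is tight, so `E y` holds. Applied to y + 1 in B, it puts y + 1
   -- into A, as the absorption lemmas require.
   absorb-LB : ¬ y ∈ D2 → ¬ Refined → LB → A ∷ B ∷ [ y ] ∷ [] ~ A ∷ B ∷ []
   absorb-LB y∉ nr (el , gy) with y ∈? B
   ... | yes y∈B = absorb-B descA ascB y∈B (λ p∈ → gt-gap A (tightE gy p∈ ≤-refl) , gap-A y∉ gy) (right>0 S vS y∈B)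
   ... | no y∉B = absorb-A descA ascB y∈A y∉B (gap-A y∉ gy y∈A) (λ p∈ → gt-gap A (tightE gy p∈ ≤-refl) , pos p∈)
     where
     y∈A : y ∈ A
     y∈A = [ id , (λ r → ⊥-elim (y∉B r)) ]′ el
     pos : suc y ∈ B → 0 < y
     pos p∈ = n≢0⇒n>0 contra
       where
       contra : y ≡ 0 → ⊥
       -- y = 0 has to be excluded because the braid relation fails there. If the minimum of R′ is 0
       -- as well, y is this minimum and c = 1 is blocked by S, which is the case `Refined`. If it
       -- is positive, `h (suc mh)` is at least q + 2, against CR.
       contra y≡ = [ (λ m<1 → nr (hd m<1 , inj₂ (inj₂ (subst (_∈ B) (sym (c≡ m<1)) p∈ , ≤-antisym hc≤x (≤-trans (≤-reflexive (x≡ m<1)) (≤-trans q<A (A≤h c))))))) ,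
                       (λ 1≤m → <⇒≱ h-mh (≤-trans (≤-trans (≤-reflexive (trans (cong (_+ 1) (lenX-nil D2≡)) (+-comm (suc q) 1))) h2) (h-mono (s≤s (subst (_< mh) (sym y≡) 1≤m))))) ]′ (<-≤-connex mh 1)
         where
         y≤ : ∀ {u} → y ≤ u
         y≤ = subst (_≤ _) (sym y≡) z≤n
         D2≡ = D2-nil y≤
         q<A : suc q ≤ length A
         q<A = subst (_< length A) gy (g<A el)
         h2 : suc (suc q) ≤ h (suc (suc y))
         h2 = ≤-trans (s≤s (≤-trans q<A (A≤h (suc y)))) (h-mem p∈ ≤-refl ≤-refl)
         module _ (m<1 : mh < 1) where
           hd : IsHead
           hd = mh-head (trans y≡ (sym (n<1⇒n≡0 m<1)))
           Y1≡ : Y1 ≡ []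
           Y1≡ with []? Y1
             where []? : ∀ (xs : List ℕ) → xs ≡ [] ⊎ ¬ xs ≡ []
                   []? [] = inj₁ refl
                   []? (_ ∷ _) = inj₂ λ ()
           ... | inj₁ e = e
           ... | inj₂ ne = ⊥-elim (nr (hd , inj₁ ne))
           x≡ : x ≡ suc q
           x≡ = x-nil D2≡ Y1≡
           c≡ : c ≡ suc y
           c≡ = ≤-antisym (≮⇒≥ λ p → <⇒≱ (≤-trans h2 (h-mono p)) (≤-trans hc≤x (≤-reflexive x≡))) y<c

   -- y is in B, so it suffices that y + 1 is not. Otherwise h would reach q + 2 at y + 2, and both
   -- c = y + 1 and c > y + 1 then contradict CR, the clause of `ip` on the minimum, or the failure
   -- of `Refined`.
   absorb-ip : ¬ Refined → ip → A ∷ B ∷ [ y ] ∷ [] ~ A ∷ B ∷ []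
   absorb-ip nr (y∈B , hy , D2≡ , low) = absorb-B descA ascB y∈B (λ p∈ → ⊥-elim (contra p∈)) (right>0 S vS y∈B)
     where
     module _ (p∈ : suc y ∈ B) where
       hsy : h (suc y) ≡ suc q
       hsy = trans (h-suc-mem y∈B) (cong suc hy)
       h2 : h (suc (suc y)) ≡ suc (suc q)
       h2 = trans (h-suc-mem p∈) (cong suc hsy)
       X≡ = lenX-nil D2≡
       contra : ⊥
       contra with adjacent? y<c
       ... | inj₁ c≡ = bad low
         where
         hc : h c ≡ suc q
         hc = trans (cong h c≡) hsy
         is : Y1 ≡ [] → iS
         is Y1≡ = subst (_∈ B) (sym c≡) p∈ , trans hc (sym (x-nil D2≡ Y1≡))
         bad : All (y ≤_) Y ⊎ (Y1 ≡ [] × ¬ iBP) → ⊥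
         bad (inj₂ (Y1≡ , ni)) = ni (inj₂ (is Y1≡))
         bad (inj₁ lw) = nr ((subst (_∈ Y) (sym y≡a) a∈Y , lw) , inj₂ (inj₂ (is (nil Y1 Y1<a (All.++⁻ˡ Y1 lw)))))
           where
           y≡a : y ≡ a
           y≡a = ≤-antisym (All.lookup lw a∈Y) (s≤s⁻¹ (≤-trans a<c (≤-reflexive c≡)))
           nil : ∀ xs → All (_< a) xs → All (y ≤_) xs → xs ≡ []
           nil [] _ _ = refl
           nil (u ∷ _) (p ∷ _) (r ∷ _) = contradiction (≤-trans (≤-reflexive (sym y≡a)) r) (<⇒≱ p)
       ... | inj₂ far = bad low
         where
         q+2≤x : suc (suc q) ≤ x
         q+2≤x = ≤-trans (≤-reflexive (sym h2)) (≤-trans (h-mono far) hc≤x)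
         bad : All (y ≤_) Y ⊎ (Y1 ≡ [] × ¬ iBP) → ⊥
         bad (inj₂ (Y1≡ , _)) = <⇒≱ q+2≤x (≤-reflexive (x-nil D2≡ Y1≡))
         bad (inj₁ lw) with m≤n⇒m<n∨m≡n (low-mh lw)
         ... | inj₂ e = nr (mh-head e , inj₁ (λ Y1≡ → <⇒≱ q+2≤x (≤-reflexive (x-nil D2≡ Y1≡))))
         ... | inj₁ y<m = <⇒≱ h-mh (≤-trans (≤-reflexive (trans (cong (_+ 1) X≡) (trans (+-comm (suc q) 1) (sym h2)))) (h-mono (s≤s y<m)))

   Absorbed : Set
   Absorbed = A ∷ B ∷ [ y ] ∷ [] ~ A ∷ B ∷ []

   absorb : Absorbed → ∀ {post} → A ∷ B ∷ [ y ] ∷ post ~ A ∷ B ∷ post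
   absorb p {post} = rule (A ∷ B ∷ [ y ] ∷ []) (A ∷ B ∷ []) {post} (_~_.un~ p)

   -- The alternatives of `dB` sorted by the relations they call for. `LB` and `ip` both let S
   -- swallow y. The case of the minimum splits, because with Y1 empty y equals a and may be 0 next
   -- to c = 1.
   data Reason : Set where
     inD2 : y ∈ D2 → Reason
     isHead : IsHead → ¬ Y1 ≡ [] → Reason
     headNil : IsHead → Y1 ≡ [] → iBP → Reason
     absorbed : ¬ y ∈ D2 → Absorbed → Reason

   []? : ∀ (xs : List ℕ) → xs ≡ [] ⊎ ¬ xs ≡ []
   []? [] = inj₁ refl
   []? (_ ∷ _) = inj₂ λ ()

   reason : dB → Reason
   reason db with y ∈? D2 | IsHead? | []? Y1 | iBP?
     where
     IsHead? : Dec IsHead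
     IsHead? with y ∈? Y | All.all? (y ≤?_) Y
     ... | yes p | yes r = yes (p , r)
     ... | no np | _ = no (np ∘ proj₁)
     ... | _ | no nr = no (nr ∘ proj₂)
   ... | yes p | _ | _ | _ = inD2 p
   ... | no _ | yes hd | inj₂ ne | _ = isHead hd ne
   ... | no _ | yes hd | inj₁ e | yes ib = headNil hd e ib
   ... | no y∉ | yes hd | inj₁ e | no ni = absorbed y∉ (rest db (λ { (_ , inj₁ ne) → ne e ; (_ , inj₂ ib) → ni ib }))
     where
     rest : dB → ¬ Refined → Absorbed
     rest (inj₁ p) _ = ⊥-elim (y∉ p)
     rest (inj₂ (inj₁ r)) nr = ⊥-elim (nr r)
     rest (inj₂ (inj₂ (inj₁ lb))) nr = absorb-LB y∉ nr lb
     rest (inj₂ (inj₂ (inj₂ i))) nr = absorb-ip nr i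
   ... | no y∉ | no nh | _ | _ = absorbed y∉ (rest db (nh ∘ proj₁))
     where
     rest : dB → ¬ Refined → Absorbed
     rest (inj₁ p) _ = ⊥-elim (y∉ p)
     rest (inj₂ (inj₁ r)) nr = ⊥-elim (nr r)
     rest (inj₂ (inj₂ (inj₁ lb))) nr = absorb-LB y∉ nr lb
     rest (inj₂ (inj₂ (inj₂ i))) nr = absorb-ip nr i

   y>0-D2 : y ∈ D2 → 0 < y
   y>0-D2 p = ≤-<-trans z≤n (mI<D (∈-++⁺ʳ D1 (there p)))

   head-split : IsHead → ¬ Y1 ≡ [] → ∃[ Z ] Y1 ≡ y ∷ Z
   head-split hd ne with Y1 in e
   ... | [] = ⊥-elim (ne refl)
   ... | z ∷ Z = Z , cong (_∷ Z) (trans (sym (head-m e)) (sym (head-mh hd′)))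
     where hd′ = subst (λ W → y ∈ W ++ a ∷ Y2) (sym e) (proj₁ hd) , subst (λ W → All (y ≤_) (W ++ a ∷ Y2)) (sym e) (proj₂ hd)

   -- Although y is blocked, a letter c still moves on to the increasing part. If y is in D2, y c y
   -- becomes c y c; if y heads Y1, it is far from c and both letters can be doubled; if S swallows
   -- y, the letter c of the row is doubled.
   push : (y ∈ D2 ⊎ (IsHead × ¬ Y1 ≡ []) ⊎ (¬ y ∈ D2 × Absorbed)) → ∀ {post} →
          A ∷ B ∷ [ y ] ∷ D1 ∷ [ c ] ∷ D2 ∷ Y1 ∷ post ~ A ∷ B ∷ D1 ∷ [ c ] ∷ D2 ∷ Y1 ∷ [ c ] ∷ post
   push (inj₁ y∈) {post} with peel-desc descD2 y∈ D2≤y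
   ... | D3 , e , D3<y = subst (λ W → A ∷ B ∷ [ y ] ∷ D1 ∷ [ c ] ∷ W ∷ Y1 ∷ post ~ A ∷ B ∷ D1 ∷ [ c ] ∷ W ∷ Y1 ∷ [ c ] ∷ post) (sym e) (begin
     A ∷ B ∷ [ y ] ∷ D1 ∷ [ c ] ∷ (y ∷ D3) ∷ Y1 ∷ post ≈⟨ mk~ ≈-refl ⟩
     A ∷ B ∷ [ y ] ∷ D1 ∷ [ c ] ∷ [ y ] ∷ D3 ∷ Y1 ∷ post ≈⟨ sk2 (swap~ y-D1) ⟩
     A ∷ B ∷ D1 ∷ [ y ] ∷ [ c ] ∷ [ y ] ∷ D3 ∷ Y1 ∷ post ≈⟨ sk3 (aca y<c (λ _ → y>0-D2 y∈)) ⟩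
     A ∷ B ∷ D1 ∷ [ c ] ∷ [ y ] ∷ [ c ] ∷ D3 ∷ Y1 ∷ post ≈⟨ sk5 (fwd2 (c-D2 D3<y) c-Y1) ⟩
     A ∷ B ∷ D1 ∷ [ c ] ∷ [ y ] ∷ D3 ∷ Y1 ∷ [ c ] ∷ post ≈⟨ mk~ ≈-refl ⟩
     A ∷ B ∷ D1 ∷ [ c ] ∷ (y ∷ D3) ∷ Y1 ∷ [ c ] ∷ post ∎)
   push (inj₂ (inj₁ (hd , ne))) {post} with head-split hd ne
   ... | Z , e = subst (λ W → A ∷ B ∷ [ y ] ∷ D1 ∷ [ c ] ∷ D2 ∷ W ∷ post ~ A ∷ B ∷ D1 ∷ [ c ] ∷ D2 ∷ W ∷ [ c ] ∷ post) (sym e)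
                (subst (λ W → A ∷ B ∷ [ y ] ∷ D1 ∷ [ c ] ∷ W ∷ (y ∷ Z) ∷ post ~ A ∷ B ∷ D1 ∷ [ c ] ∷ W ∷ (y ∷ Z) ∷ [ c ] ∷ post) (sym (D2-nil (≤-reflexive (head-mh hd)))) (begin
     A ∷ B ∷ [ y ] ∷ D1 ∷ [ c ] ∷ [] ∷ (y ∷ Z) ∷ post ≈⟨ mk~ ≈-refl ⟩
     A ∷ B ∷ [ y ] ∷ D1 ∷ [ c ] ∷ [ y ] ∷ Z ∷ post ≈⟨ sk2 (swap~ y-D1) ⟩
     A ∷ B ∷ D1 ∷ [ y ] ∷ [ c ] ∷ [ y ] ∷ Z ∷ post ≈⟨ sk3 (skip (back (far2 far))) ⟩
     A ∷ B ∷ D1 ∷ [ y ] ∷ [ y ] ∷ [ c ] ∷ Z ∷ post ≈⟨ sk3 double ⟩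
     A ∷ B ∷ D1 ∷ [ y ] ∷ [ c ] ∷ Z ∷ post ≈⟨ sk4 double ⟨
     A ∷ B ∷ D1 ∷ [ y ] ∷ [ c ] ∷ [ c ] ∷ Z ∷ post ≈⟨ sk3 (swap~ (far2 far)) ⟩
     A ∷ B ∷ D1 ∷ [ c ] ∷ [ y ] ∷ [ c ] ∷ Z ∷ post ≈⟨ sk5 (swap~ c-Z) ⟩
     A ∷ B ∷ D1 ∷ [ c ] ∷ [ y ] ∷ Z ∷ [ c ] ∷ post ≈⟨ mk~ ≈-refl ⟩
     A ∷ B ∷ D1 ∷ [ c ] ∷ [] ∷ (y ∷ Z) ∷ [ c ] ∷ post ∎))
     where
     Y1<a′ = subst (All (_< a)) e Y1<a
     far : suc y < c
     far = ≤-<-trans (All.head Y1<a′) a<c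
     c-Z : Comm [ c ] Z
     c-Z = below (All.map (λ p → ≤-<-trans p a<c) (All.tail Y1<a′))
   push (inj₂ (inj₂ (y∉ , ab))) {post} = begin
     A ∷ B ∷ [ y ] ∷ D1 ∷ [ c ] ∷ D2 ∷ Y1 ∷ post ≈⟨ absorb ab ⟩
     A ∷ B ∷ D1 ∷ [ c ] ∷ D2 ∷ Y1 ∷ post ≈⟨ sk3 double ⟨
     A ∷ B ∷ D1 ∷ [ c ] ∷ [ c ] ∷ D2 ∷ Y1 ∷ post ≈⟨ sk4 (fwd2 (c-D2 (D2<y y∉)) c-Y1) ⟩
     A ∷ B ∷ D1 ∷ [ c ] ∷ D2 ∷ Y1 ∷ [ c ] ∷ post ∎

   four-small : ∀ {u post} → y < u → 0 < y → [ y ] ∷ [ u ] ∷ [ y ] ∷ [ u ] ∷ [ y ] ∷ post ~ [ y ] ∷ [ u ] ∷ [ y ] ∷ post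
   four-small {u} {post} y<u pos = begin
     [ y ] ∷ [ u ] ∷ [ y ] ∷ [ u ] ∷ [ y ] ∷ post ≈⟨ acac-pos y<u pos ⟩
     [ y ] ∷ [ u ] ∷ [ y ] ∷ [ y ] ∷ post ≈⟨ sk2 double ⟩
     [ y ] ∷ [ u ] ∷ [ y ] ∷ post ∎

   -- When c is blocked by S, the letters of S after c and those of D1 are far from c.
   module Spaced (c∈B : c ∈ B) (hc : h c ≡ x) (c∉Y2 : ¬ c ∈ Y2) where
     room′ : size S < length (X ++ Y)
     room′ = subst (size S <_) (cong length (flat-rowOf K)) (room ad)

     private
       w = Wit.next K vS ascY (base 𝐀) room′ (inj₂ (c∈B , hc))
       z = proj₁ w
       z∈ = proj₁ (proj₂ w)
       c<z : c < z
       c<z = All.lookup (Y2>c c∉Y2) z∈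
       ascY2 : Asc Y2
       ascY2 = atail (proj₁ (proj₂ (AllPairs-++⁻ Y1 ascY)))
         where atail : ∀ {u us} → Asc (u ∷ us) → Asc us
               atail (_ ∷ d) = d

     D1-far : All (suc c <_) D1
     D1-far = All.map (≤-<-trans c<z) (proj₂ (proj₂ (proj₂ w)))

     c+1∉B : ¬ suc c ∈ B
     c+1∉B p∈ with uncons z∈
       where
       uncons : ∀ {t : ℕ} {xs} → t ∈ xs → ∃[ u ] ∃[ Z ] xs ≡ u ∷ Z
       uncons {xs = u ∷ Z} _ = u , Z , refl
     ... | u , Z , e = <⇒≱ (CR (base 𝐀) (inj₂ (u , ∈-++⁺ʳ Y1 (there (subst (u ∈_) (sym e) (here refl))) , refl)))
             (≤-trans (≤-reflexive Hu) (≤-trans (≤-reflexive (sym h2)) (h-mono (s≤s c<u))))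
       where
       h2 : h (suc (suc c)) ≡ suc (suc x)
       h2 = trans (h-suc-mem p∈) (cong suc (trans (h-suc-mem c∈B) (cong suc hc)))
       c<u : c < u
       c<u = All.head (subst (All (c <_)) e (Y2>c c∉Y2))
       u<Z : All (u <_) Z
       u<Z = asc-head (subst Asc e ascY2)
       Hu : length X + lt (suc u) Y ≡ suc (suc x)
       Hu = trans (cong (λ w → length X + lt (suc u) (Y1 ++ a ∷ w)) e) (trans (cong (length X +_) (trans (lt-++ (suc u) Y1 (a ∷ u ∷ Z)) (cong₂ _+_ (lt-all (suc u) (All.map (λ p → <-trans p (<-trans a<c (m≤n⇒m≤1+n c<u))) Y1<a))
              (trans (lt-yes (suc u) (u ∷ Z) (<-trans a<c (m≤n⇒m≤1+n c<u))) (cong suc (trans (lt-yes (suc u) Z ≤-refl) (cong suc (lt-none (suc u) u<Z))))))))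
              (trans (sym (+-assoc (length X) (length Y1) 2)) (+-comm x 2)))

     spl = asc-split ascB c∈B
     B0 J : List ℕ
     B0 = proj₁ spl
     J = proj₁ (proj₂ spl)
     B≡ : B ≡ B0 ++ c ∷ J
     B≡ = proj₁ (proj₂ (proj₂ spl))
     B0<c : All (_< c) B0
     B0<c = proj₁ (proj₂ (proj₂ (proj₂ spl)))

     J-far : All (suc c <_) J
     J-far = above-p descA ascB (proj₂ (proj₂ (proj₂ (proj₂ spl)))) (λ p∈ → c+1∉B (subst (suc c ∈_) (sym B≡) (∈-++⁺ʳ B0 (there p∈))))

     c-J : Comm [ c ] J
     c-J = above J-far
     c-D1 : Comm [ c ] D1
     c-D1 = above D1-far
     y-J : Comm [ y ] J
     y-J = above (All.map (<-trans (s≤s y<c)) J-far)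

     openB : ∀ {post} → B ∷ post ~ B0 ∷ [ c ] ∷ J ∷ post
     openB {post} = mk~ (≈-reflexive (trans (cong (_++ concat post) B≡) (++-assoc B0 (c ∷ J) (concat post))))

     -- If y precedes c immediately in the letter order and occurs in B, it is the last letter of B0.
     B0-y : c ≡ suc y → y ∈ B → ∃[ B00 ] B0 ≡ B00 ∷ʳ y
     B0-y e y∈B with unsnoc B0
     ... | inj₁ nil = ⊥-elim (lem (subst (y ∈_) (trans B≡ (cong (_++ c ∷ J) nil)) y∈B))
       where
       lem : ¬ y ∈ c ∷ J
       lem (here p) = <-irrefl p y<c
       lem (there p) = <-asym y<c (<-trans (n<1+n c) (All.lookup J-far p))
     ... | inj₂ (B00 , n , e₂) = B00 , trans e₂ (cong (B00 ∷ʳ_) (sym y≡n))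
       where
       y∈ : y ∈ B0
       y∈ with ∈-++⁻ B0 (subst (y ∈_) B≡ y∈B)
       ... | inj₁ p = p
       ... | inj₂ (here p) = ⊥-elim (<-irrefl p y<c)
       ... | inj₂ (there p) = ⊥-elim (<-asym y<c (<-trans (n<1+n c) (All.lookup J-far p)))
       n<c : n < c
       n<c = All.lookup B0<c (subst (n ∈_) (sym e₂) (∈-++⁺ʳ B00 (here refl)))
       y≡n : y ≡ n
       y≡n with ∈-∷ʳ⁻ B00 (subst (y ∈_) e₂ y∈)
       ... | inj₂ p = p
       ... | inj₁ p = ⊥-elim (<⇒≱ (All.lookup (proj₂ (desc-∷ʳ⁻ B00 (subst Asc e₂ (proj₁ (AllPairs-++⁻ B0 (subst Asc B≡ ascB)))))) p) (s≤s⁻¹ (≤-trans n<c (≤-reflexive e))))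

     openBy : (e : c ≡ suc y) (y∈B : y ∈ B) → ∀ {post} → B ∷ post ~ proj₁ (B0-y e y∈B) ∷ [ y ] ∷ [ c ] ∷ J ∷ post
     openBy e y∈B {post} = ~-trans openB (mk~ (≈-reflexive (trans (cong (_++ (c ∷ J ++ concat post)) (proj₂ (B0-y e y∈B))) (++-assoc (proj₁ (B0-y e y∈B)) [ y ] _))))

   -- CR is tight at c, so AR applies, and the interval from y to c = y + 1 has room for y only.
   tight-adj : c ≡ suc y → h c ≡ x → y ∈ B ⊎ (IsMin S y × E y)
   tight-adj e hc with AR 𝐀 (inj₁ c∈X) y<c (trans (H-mid a<c ≤-refl) (cong suc (sym hc)))
   ... | inj₁ (b , b∈ , y≤b , b<c) = inj₁ (subst (_∈ B) (≤-antisym (s≤s⁻¹ (≤-trans b<c (≤-reflexive e))) y≤b) b∈)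
   ... | inj₂ p = inj₂ p

   not-below-min : IsMin S y → ∀ {s} → s ∈ A → ¬ s < y
   not-below-min mn s∈ s<y = <⇒≱ (gt-mem (min∈ mn) s<y ≤-refl) (s≤s⁻¹ (≤-trans (g<A (inj₁ s∈)) (≤-reflexive (sym (min-g mn)))))

   absorb-min : IsMin S y → E y → ¬ y ∈ B → 0 < y → Absorbed
   absorb-min mn ey y∉B pos = absorb-A descA ascB (min∈ mn) y∉B
     (λ { (inj₁ s∈) s<y → ⊥-elim (not-below-min mn s∈ s<y) ; (inj₂ s∈) s<y → ⊥-elim (<-asym s<y (min<B mn s∈)) })
     (λ p∈ → gt-gap A (ey p∈ ≤-refl) , pos)

   Goal : Word → Set
   Goal w = A ∷ B ∷ [ y ] ∷ D1 ∷ [ c ] ∷ D2 ∷ Y1 ∷ [ a ] ∷ Y2 ∷ [] ~ w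

   goal-pp : ¬ dB → ¬ iBP → Goal (A ∷ B ∷ D1 ∷ [ y ] ∷ D2 ∷ Y1 ∷ [ c ] ∷ Y2 ∷ [ a ] ∷ [])
   goal-pp nd ni = begin
     A ∷ B ∷ [ y ] ∷ D1 ∷ [ c ] ∷ D2 ∷ Y1 ∷ [ a ] ∷ Y2 ∷ [] ≈⟨ sk2 (swap~ y-D1) ⟩
     A ∷ B ∷ D1 ∷ [ y ] ∷ [ c ] ∷ D2 ∷ Y1 ∷ [ a ] ∷ Y2 ∷ [] ≈⟨ sk4 (fwd2 (c-D2 (D2<y (nd ∘ inj₁))) c-Y1) ⟩
     A ∷ B ∷ D1 ∷ [ y ] ∷ D2 ∷ Y1 ∷ [ c ] ∷ [ a ] ∷ Y2 ∷ [] ≈⟨ sk5 (sk2 (swap~ (a-Y2 (Y2>c (ni ∘ inj₁))))) ⟩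
     A ∷ B ∷ D1 ∷ [ y ] ∷ D2 ∷ Y1 ∷ [ c ] ∷ Y2 ∷ [ a ] ∷ [] ∎

   open-Y2 : c ∈ Y2 → ∃[ Y3 ] Y2 ≡ c ∷ Y3 × All (c <_) Y3
   open-Y2 c∈ = peel (atail (proj₁ (proj₂ (AllPairs-++⁻ Y1 ascY)))) c∈ Y2≥c
     where atail : ∀ {u us} → Asc (u ∷ us) → Asc us
           atail (_ ∷ d) = d

   aca-ok : ¬ (IsHead × iBP) → iR → c ≡ suc a → 0 < a
   aca-ok nh r e = n≢0⇒n>0 λ a≡0 → nh (hd a≡0 , inj₁ r)
     where
     hd : a ≡ 0 → IsHead
     hd a≡0 = subst (_∈ Y) (sym y≡a) a∈Y , subst (λ w → All (w ≤_) Y) (sym y≡0) (All.tabulate λ _ → z≤n)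
       where y≡0 = n<1⇒n≡0 (≤-trans y<c (≤-reflexive (trans e (cong suc a≡0))))
             y≡a = trans y≡0 (sym a≡0)

   -- y takes the place of c, and the displaced c has to vanish: into the c at the head of Y2, where
   -- c a c becomes a c a, or into the c of S by `lose`.
   goal-pb : ¬ dB → iBP → Goal (A ∷ B ∷ D1 ∷ [ y ] ∷ D2 ∷ Y1 ∷ [ a ] ∷ Y2 ∷ [ a ] ∷ [])
   goal-pb nd ib@(inj₁ c∈) with open-Y2 c∈
   ... | Y3 , e , Y3>c = subst (λ W → A ∷ B ∷ [ y ] ∷ D1 ∷ [ c ] ∷ D2 ∷ Y1 ∷ [ a ] ∷ W ∷ [] ~ A ∷ B ∷ D1 ∷ [ y ] ∷ D2 ∷ Y1 ∷ [ a ] ∷ W ∷ [ a ] ∷ []) (sym e) (begin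
     A ∷ B ∷ [ y ] ∷ D1 ∷ [ c ] ∷ D2 ∷ Y1 ∷ [ a ] ∷ (c ∷ Y3) ∷ [] ≈⟨ mk~ ≈-refl ⟩
     A ∷ B ∷ [ y ] ∷ D1 ∷ [ c ] ∷ D2 ∷ Y1 ∷ [ a ] ∷ [ c ] ∷ Y3 ∷ [] ≈⟨ sk2 (swap~ y-D1) ⟩
     A ∷ B ∷ D1 ∷ [ y ] ∷ [ c ] ∷ D2 ∷ Y1 ∷ [ a ] ∷ [ c ] ∷ Y3 ∷ [] ≈⟨ sk4 (fwd2 (c-D2 (D2<y (nd ∘ inj₁))) c-Y1) ⟩
     A ∷ B ∷ D1 ∷ [ y ] ∷ D2 ∷ Y1 ∷ [ c ] ∷ [ a ] ∷ [ c ] ∷ Y3 ∷ [] ≈⟨ sk5 (skip (aca a<c (aca-ok (λ { (hd , r) → nd (inj₂ (inj₁ (hd , inj₂ r))) }) c∈))) ⟨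
     A ∷ B ∷ D1 ∷ [ y ] ∷ D2 ∷ Y1 ∷ [ a ] ∷ [ c ] ∷ [ a ] ∷ Y3 ∷ [] ≈⟨ sk5 (sk3 (swap~ (above (All.map (≤-<-trans a<c) Y3>c)))) ⟩
     A ∷ B ∷ D1 ∷ [ y ] ∷ D2 ∷ Y1 ∷ [ a ] ∷ [ c ] ∷ Y3 ∷ [ a ] ∷ [] ≈⟨ mk~ ≈-refl ⟩
     A ∷ B ∷ D1 ∷ [ y ] ∷ D2 ∷ Y1 ∷ [ a ] ∷ (c ∷ Y3) ∷ [ a ] ∷ [] ∎)
   goal-pb nd (inj₂ (c∈B , hc)) with c ∈? Y2
   ... | yes c∈ = goal-pb nd (inj₁ c∈)
   ... | no c∉ = begin
     A ∷ B ∷ [ y ] ∷ D1 ∷ [ c ] ∷ D2 ∷ Y1 ∷ [ a ] ∷ Y2 ∷ [] ≈⟨ sk2 (swap~ y-D1) ⟩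
     A ∷ B ∷ D1 ∷ [ y ] ∷ [ c ] ∷ D2 ∷ Y1 ∷ [ a ] ∷ Y2 ∷ [] ≈⟨ lose ⟩
     A ∷ B ∷ D1 ∷ [ y ] ∷ D2 ∷ Y1 ∷ [ a ] ∷ Y2 ∷ [] ≈⟨ sk5 (skip double) ⟨
     A ∷ B ∷ D1 ∷ [ y ] ∷ D2 ∷ Y1 ∷ [ a ] ∷ [ a ] ∷ Y2 ∷ [] ≈⟨ sk5 (sk2 (swap~ (a-Y2 (Y2>c c∉)))) ⟩
     A ∷ B ∷ D1 ∷ [ y ] ∷ D2 ∷ Y1 ∷ [ a ] ∷ Y2 ∷ [ a ] ∷ [] ∎
     where
     open Spaced c∈B hc c∉
     y∈B : c ≡ suc y → y ∈ B
     y∈B e with h-gap (<-≤-trans (hy<x (λ lb → nd (inj₂ (inj₂ (inj₁ lb))))) (≤-reflexive (sym hc)))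
     ... | b , b∈ , y≤b , b<c = subst (_∈ B) (≤-antisym (s≤s⁻¹ (≤-trans b<c (≤-reflexive e))) y≤b) b∈
     lose : ∀ {post} → A ∷ B ∷ D1 ∷ [ y ] ∷ [ c ] ∷ post ~ A ∷ B ∷ D1 ∷ [ y ] ∷ post
     lose {post} with adjacent? y<c
     ... | inj₂ far = begin
       A ∷ B ∷ D1 ∷ [ y ] ∷ [ c ] ∷ post ≈⟨ skip openB ⟩
       A ∷ B0 ∷ [ c ] ∷ J ∷ D1 ∷ [ y ] ∷ [ c ] ∷ post ≈⟨ sk5 (swap~ (far2 far)) ⟩
       A ∷ B0 ∷ [ c ] ∷ J ∷ D1 ∷ [ c ] ∷ [ y ] ∷ post ≈⟨ sk3 (back2 c-J c-D1) ⟩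
       A ∷ B0 ∷ [ c ] ∷ [ c ] ∷ J ∷ D1 ∷ [ y ] ∷ post ≈⟨ sk2 double ⟩
       A ∷ B0 ∷ [ c ] ∷ J ∷ D1 ∷ [ y ] ∷ post ≈⟨ skip openB ⟨
       A ∷ B ∷ D1 ∷ [ y ] ∷ post ∎
     -- Now c = y + 1 does not commute with y. But y is in B as well, just before c, so both pairs
     -- meet as y c y c, which shortens because letters of B are positive.
     ... | inj₁ e = begin
       A ∷ B ∷ D1 ∷ [ y ] ∷ [ c ] ∷ post ≈⟨ skip (openBy e yb) ⟩
       A ∷ B00 ∷ [ y ] ∷ [ c ] ∷ J ∷ D1 ∷ [ y ] ∷ [ c ] ∷ post ≈⟨ sk4 (back2 y-J y-D1) ⟩
       A ∷ B00 ∷ [ y ] ∷ [ c ] ∷ [ y ] ∷ J ∷ D1 ∷ [ c ] ∷ post ≈⟨ sk5 (back2 c-J c-D1) ⟩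
       A ∷ B00 ∷ [ y ] ∷ [ c ] ∷ [ y ] ∷ [ c ] ∷ J ∷ D1 ∷ post ≈⟨ sk2 (acac-pos y<c (right>0 S vS yb)) ⟩
       A ∷ B00 ∷ [ y ] ∷ [ c ] ∷ [ y ] ∷ J ∷ D1 ∷ post ≈⟨ sk4 (fwd2 y-J y-D1) ⟩
       A ∷ B00 ∷ [ y ] ∷ [ c ] ∷ J ∷ D1 ∷ [ y ] ∷ post ≈⟨ skip (openBy e yb) ⟨
       A ∷ B ∷ D1 ∷ [ y ] ∷ post ∎
       where
       yb = y∈B e
       B00 = proj₁ (B0-y e yb)

   goal-bp : dB → ¬ iB → Goal (A ∷ B ∷ D1 ∷ [ c ] ∷ D2 ∷ Y1 ∷ [ c ] ∷ Y2 ∷ [ a ] ∷ [])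
   goal-bp db ni = begin
     A ∷ B ∷ [ y ] ∷ D1 ∷ [ c ] ∷ D2 ∷ Y1 ∷ [ a ] ∷ Y2 ∷ [] ≈⟨ push (pushable (reason db)) ⟩
     A ∷ B ∷ D1 ∷ [ c ] ∷ D2 ∷ Y1 ∷ [ c ] ∷ [ a ] ∷ Y2 ∷ [] ≈⟨ sk5 (sk2 (swap~ (a-Y2 (Y2>c (ni ∘ inj₁))))) ⟩
     A ∷ B ∷ D1 ∷ [ c ] ∷ D2 ∷ Y1 ∷ [ c ] ∷ Y2 ∷ [ a ] ∷ [] ∎
     where
     pushable : Reason → y ∈ D2 ⊎ (IsHead × ¬ Y1 ≡ []) ⊎ (¬ y ∈ D2 × Absorbed)
     pushable (inD2 p) = inj₁ p
     pushable (isHead p q) = inj₂ (inj₁ (p , q))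
     pushable (absorbed p q) = inj₂ (inj₂ (p , q))
     pushable (headNil _ _ (inj₁ r)) = ⊥-elim (ni (inj₁ r))
     pushable (headNil _ _ (inj₂ (_ , r))) = ⊥-elim (ni (inj₂ r))

   Final : Word
   Final = A ∷ B ∷ D1 ∷ [ c ] ∷ D2 ∷ Y1 ∷ [ a ] ∷ Y2 ∷ [ a ] ∷ []

   settle : ¬ iR → Final ~ A ∷ B ∷ D1 ∷ [ c ] ∷ D2 ∷ Y1 ∷ [ a ] ∷ Y2 ∷ []
   settle nr = begin
     Final ≈⟨ sk5 (sk2 (swap~ (a-Y2 (Y2>c nr)))) ⟨
     A ∷ B ∷ D1 ∷ [ c ] ∷ D2 ∷ Y1 ∷ [ a ] ∷ [ a ] ∷ Y2 ∷ [] ≈⟨ sk5 (skip double) ⟩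
     A ∷ B ∷ D1 ∷ [ c ] ∷ D2 ∷ Y1 ∷ [ a ] ∷ Y2 ∷ [] ∎

   bb-R : iR → ¬ (IsHead × Y1 ≡ []) → A ∷ B ∷ D1 ∷ [ c ] ∷ D2 ∷ Y1 ∷ [ c ] ∷ [ a ] ∷ Y2 ∷ [] ~ Final
   bb-R c∈ nh with open-Y2 c∈
   ... | Y3 , e , Y3>c = subst (λ W → A ∷ B ∷ D1 ∷ [ c ] ∷ D2 ∷ Y1 ∷ [ c ] ∷ [ a ] ∷ W ∷ [] ~ A ∷ B ∷ D1 ∷ [ c ] ∷ D2 ∷ Y1 ∷ [ a ] ∷ W ∷ [ a ] ∷ []) (sym e) (sk5 (skip (begin
       [ c ] ∷ [ a ] ∷ (c ∷ Y3) ∷ [] ≈⟨ mk~ ≈-refl ⟩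
       [ c ] ∷ [ a ] ∷ [ c ] ∷ Y3 ∷ [] ≈⟨ aca a<c pos ⟨
       [ a ] ∷ [ c ] ∷ [ a ] ∷ Y3 ∷ [] ≈⟨ sk2 (swap~ (above (All.map (≤-<-trans a<c) Y3>c))) ⟩
       [ a ] ∷ [ c ] ∷ Y3 ∷ [ a ] ∷ [] ≈⟨ mk~ ≈-refl ⟩
       [ a ] ∷ (c ∷ Y3) ∷ [ a ] ∷ [] ∎)))
     where
     pos : c ≡ suc a → 0 < a
     pos e′ = n≢0⇒n>0 λ a≡0 → nh (hd a≡0 , nil a≡0)
       where
       nil : a ≡ 0 → Y1 ≡ []
       nil a≡0 = go Y1 Y1<a
         where go : ∀ xs → All (_< a) xs → xs ≡ []
               go [] _ = refl
               go (u ∷ _) (p ∷ _) = contradiction (subst (u <_) a≡0 p) λ ()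
       hd : a ≡ 0 → IsHead
       hd a≡0 = subst (_∈ Y) (sym (trans y≡0 (sym a≡0))) a∈Y , subst (λ w → All (w ≤_) Y) (sym y≡0) (All.tabulate λ _ → z≤n)
         where y≡0 = n<1⇒n≡0 (≤-trans y<c (≤-reflexive (trans e′ (cong suc a≡0))))

   -- The c pushed into the increasing part has to vanish. It travels back to the c of the row
   -- unless D2 begins with y = c - 1. In that case c y c is shortened with the help of S, where y
   -- occurs by `tight-adj`.
   bb-S : h c ≡ x → ¬ iR → (y ∈ D2 ⊎ All (_< y) D2) → A ∷ B ∷ D1 ∷ [ c ] ∷ D2 ∷ Y1 ∷ [ c ] ∷ [ a ] ∷ Y2 ∷ [] ~ Final
   bb-S hc nr dd = ~-trans (lose dd) (~-sym (settle nr))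
     where
     lose-far : ∀ {xs post} → Comm [ c ] xs → A ∷ B ∷ D1 ∷ [ c ] ∷ xs ∷ Y1 ∷ [ c ] ∷ post ~ A ∷ B ∷ D1 ∷ [ c ] ∷ xs ∷ Y1 ∷ post
     lose-far {xs} {post} cm = begin
       A ∷ B ∷ D1 ∷ [ c ] ∷ xs ∷ Y1 ∷ [ c ] ∷ post ≈⟨ sk4 (back2 cm c-Y1) ⟩
       A ∷ B ∷ D1 ∷ [ c ] ∷ [ c ] ∷ xs ∷ Y1 ∷ post ≈⟨ sk3 double ⟩
       A ∷ B ∷ D1 ∷ [ c ] ∷ xs ∷ Y1 ∷ post ∎
     lose : (y ∈ D2 ⊎ All (_< y) D2) → ∀ {post} → A ∷ B ∷ D1 ∷ [ c ] ∷ D2 ∷ Y1 ∷ [ c ] ∷ post ~ A ∷ B ∷ D1 ∷ [ c ] ∷ D2 ∷ Y1 ∷ post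
     lose (inj₂ p) = lose-far (c-D2 p)
     lose (inj₁ y∈) {post} with peel-desc descD2 y∈ D2≤y
     ... | D3 , e , D3<y with adjacent? y<c
     ... | inj₂ far = lose-far (subst (Comm [ c ]) (sym e) (below (far ∷ All.map (λ p → ≤-<-trans p y<c) D3<y)))
     ... | inj₁ c≡ = subst (λ W → A ∷ B ∷ D1 ∷ [ c ] ∷ W ∷ Y1 ∷ [ c ] ∷ post ~ A ∷ B ∷ D1 ∷ [ c ] ∷ W ∷ Y1 ∷ post) (sym e) (begin
         A ∷ B ∷ D1 ∷ [ c ] ∷ (y ∷ D3) ∷ Y1 ∷ [ c ] ∷ post ≈⟨ mk~ ≈-refl ⟩
         A ∷ B ∷ D1 ∷ [ c ] ∷ [ y ] ∷ D3 ∷ Y1 ∷ [ c ] ∷ post ≈⟨ sk5 (back2 (c-D2 D3<y) c-Y1) ⟩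
         A ∷ B ∷ D1 ∷ [ c ] ∷ [ y ] ∷ [ c ] ∷ D3 ∷ Y1 ∷ post ≈⟨ cyc ⟩
         A ∷ B ∷ D1 ∷ [ c ] ∷ [ y ] ∷ D3 ∷ Y1 ∷ post ≈⟨ mk~ ≈-refl ⟩
         A ∷ B ∷ D1 ∷ [ c ] ∷ (y ∷ D3) ∷ Y1 ∷ post ∎)
       where
       pos = y>0-D2 y∈
       from-absorbed : Absorbed → ∀ {post} → A ∷ B ∷ D1 ∷ [ c ] ∷ [ y ] ∷ [ c ] ∷ post ~ A ∷ B ∷ D1 ∷ [ c ] ∷ [ y ] ∷ post
       from-absorbed ab {post} = begin
         A ∷ B ∷ D1 ∷ [ c ] ∷ [ y ] ∷ [ c ] ∷ post ≈⟨ sk3 (aca y<c (λ _ → pos)) ⟨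
         A ∷ B ∷ D1 ∷ [ y ] ∷ [ c ] ∷ [ y ] ∷ post ≈⟨ sk2 (swap~ y-D1) ⟨
         A ∷ B ∷ [ y ] ∷ D1 ∷ [ c ] ∷ [ y ] ∷ post ≈⟨ absorb ab ⟩
         A ∷ B ∷ D1 ∷ [ c ] ∷ [ y ] ∷ post ∎
       cyc : ∀ {post} → A ∷ B ∷ D1 ∷ [ c ] ∷ [ y ] ∷ [ c ] ∷ post ~ A ∷ B ∷ D1 ∷ [ c ] ∷ [ y ] ∷ post
       cyc {post} with y ∈? B | c ∈? B
       ... | yes y∈B | no c∉B = from-absorbed (absorb-B descA ascB y∈B (λ p∈ → ⊥-elim (c∉B (subst (_∈ B) (sym c≡) p∈))) pos)
       ... | no y∉B | _ = from-absorbed ([ (λ p → ⊥-elim (y∉B p)) , (λ { (mn , ey) → absorb-min mn ey y∉B pos }) ]′ (tight-adj c≡ hc))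
       ... | yes y∈B | yes c∈B = begin
         A ∷ B ∷ D1 ∷ [ c ] ∷ [ y ] ∷ [ c ] ∷ post ≈⟨ skip (openBy c≡ y∈B) ⟩
         A ∷ B00 ∷ [ y ] ∷ [ c ] ∷ J ∷ D1 ∷ [ c ] ∷ [ y ] ∷ [ c ] ∷ post ≈⟨ sk4 (back2 c-J c-D1) ⟩
         A ∷ B00 ∷ [ y ] ∷ [ c ] ∷ [ c ] ∷ J ∷ D1 ∷ [ y ] ∷ [ c ] ∷ post ≈⟨ sk3 double ⟩
         A ∷ B00 ∷ [ y ] ∷ [ c ] ∷ J ∷ D1 ∷ [ y ] ∷ [ c ] ∷ post ≈⟨ sk4 (back2 y-J y-D1) ⟩
         A ∷ B00 ∷ [ y ] ∷ [ c ] ∷ [ y ] ∷ J ∷ D1 ∷ [ c ] ∷ post ≈⟨ sk5 (back2 c-J c-D1) ⟩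
         A ∷ B00 ∷ [ y ] ∷ [ c ] ∷ [ y ] ∷ [ c ] ∷ J ∷ D1 ∷ post ≈⟨ sk2 (acac-pos y<c pos) ⟩
         A ∷ B00 ∷ [ y ] ∷ [ c ] ∷ [ y ] ∷ J ∷ D1 ∷ post ≈⟨ sk4 (fwd2 y-J y-D1) ⟩
         A ∷ B00 ∷ [ y ] ∷ [ c ] ∷ J ∷ D1 ∷ [ y ] ∷ post ≈⟨ sk3 double ⟨
         A ∷ B00 ∷ [ y ] ∷ [ c ] ∷ [ c ] ∷ J ∷ D1 ∷ [ y ] ∷ post ≈⟨ sk4 (fwd2 c-J c-D1) ⟩
         A ∷ B00 ∷ [ y ] ∷ [ c ] ∷ J ∷ D1 ∷ [ c ] ∷ [ y ] ∷ post ≈⟨ skip (openBy c≡ y∈B) ⟨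
         A ∷ B ∷ D1 ∷ [ c ] ∷ [ y ] ∷ post ∎
         where
         open Spaced c∈B hc nr
         B00 = proj₁ (B0-y c≡ y∈B)

   -- The case y = a = min of the row above, with y last in its decreasing part.
   module HeadNil (hd : IsHead) (Y1≡ : Y1 ≡ []) where
     a≡y : a ≡ y
     a≡y = trans (sym mh≡a) (sym (head-mh hd))
       where
       mh≡a : mh ≡ a
       mh≡a = go Y1≡ (mI-rowOf K)
         where
         go : Y1 ≡ [] → mh ∷ I (rowOf K) ≡ Y → mh ≡ a
         go e f = ∷-injectiveˡ (trans f (cong (_++ a ∷ Y2) e))
     D2≡ : D2 ≡ []
     D2≡ = D2-nil (≤-reflexive (head-mh hd))

     simp : ∀ {pre post} → pre ∷ D2 ∷ Y1 ∷ [ a ] ∷ post ~ pre ∷ [ y ] ∷ post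
     simp {pre} {post} = mk~ (≈-reflexive (cong (pre ++_) (trans (cong₂ (λ p r → p ++ r ++ a ∷ concat post) D2≡ Y1≡) (cong (_∷ concat post) a≡y))))

     Lhs Rhs : Word → Word
     Lhs w = A ∷ B ∷ [ y ] ∷ D1 ∷ [ c ] ∷ [ y ] ∷ w
     Rhs w = A ∷ B ∷ D1 ∷ [ c ] ∷ [ y ] ∷ w

     from : Lhs (Y2 ∷ []) ~ Rhs (Y2 ∷ [ y ] ∷ []) → Goal Final
     from p = begin
       A ∷ B ∷ [ y ] ∷ D1 ∷ [ c ] ∷ D2 ∷ Y1 ∷ [ a ] ∷ Y2 ∷ [] ≈⟨ sk4 simp ⟩
       Lhs (Y2 ∷ []) ≈⟨ p ⟩
       Rhs (Y2 ∷ [ y ] ∷ []) ≈⟨ mk~ (≈-reflexive (cong (λ w → A ++ B ++ D1 ++ c ∷ y ∷ Y2 ++ w ∷ []) (sym a≡y))) ⟩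
       Rhs (Y2 ∷ [ a ] ∷ []) ≈⟨ sk3 simp ⟨
       Final ∎

     via-R : iR → Goal Final
     via-R c∈ with open-Y2 c∈
     ... | Y3 , e , Y3>c = from (subst (λ W → Lhs (W ∷ []) ~ Rhs (W ∷ [ y ] ∷ [])) (sym e) (begin
       A ∷ B ∷ [ y ] ∷ D1 ∷ [ c ] ∷ [ y ] ∷ (c ∷ Y3) ∷ [] ≈⟨ mk~ ≈-refl ⟩
       A ∷ B ∷ [ y ] ∷ D1 ∷ [ c ] ∷ [ y ] ∷ [ c ] ∷ Y3 ∷ [] ≈⟨ sk2 (swap~ y-D1) ⟩
       -- y may be 0 with c = 1 here, so the relation of length four is used.
       A ∷ B ∷ D1 ∷ [ y ] ∷ [ c ] ∷ [ y ] ∷ [ c ] ∷ Y3 ∷ [] ≈⟨ sk3 (acac y<c) ⟩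
       A ∷ B ∷ D1 ∷ [ c ] ∷ [ y ] ∷ [ c ] ∷ [ y ] ∷ Y3 ∷ [] ≈⟨ sk5 (skip (swap~ (above (All.map (≤-<-trans y<c) Y3>c)))) ⟩
       A ∷ B ∷ D1 ∷ [ c ] ∷ [ y ] ∷ [ c ] ∷ Y3 ∷ [ y ] ∷ [] ≈⟨ mk~ ≈-refl ⟩
       A ∷ B ∷ D1 ∷ [ c ] ∷ [ y ] ∷ (c ∷ Y3) ∷ [ y ] ∷ [] ∎))

     via-S : c ∈ B → h c ≡ x → ¬ iR → Goal Final
     via-S c∈B hc nr = from (begin
       Lhs (Y2 ∷ []) ≈⟨ lose ⟩
       Rhs (Y2 ∷ []) ≈⟨ sk4 double ⟨
       Rhs ([ y ] ∷ Y2 ∷ []) ≈⟨ sk5 (swap~ (above (All.map (≤-<-trans y<c) (Y2>c nr)))) ⟩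
       Rhs (Y2 ∷ [ y ] ∷ []) ∎)
       where
       open Spaced c∈B hc nr
       lose : ∀ {post} → A ∷ B ∷ [ y ] ∷ D1 ∷ [ c ] ∷ [ y ] ∷ post ~ A ∷ B ∷ D1 ∷ [ c ] ∷ [ y ] ∷ post
       lose {post} with adjacent? y<c
       ... | inj₂ far = begin
         A ∷ B ∷ [ y ] ∷ D1 ∷ [ c ] ∷ [ y ] ∷ post ≈⟨ sk2 (swap~ y-D1) ⟩
         A ∷ B ∷ D1 ∷ [ y ] ∷ [ c ] ∷ [ y ] ∷ post ≈⟨ sk3 (swap~ (far2 far)) ⟩
         A ∷ B ∷ D1 ∷ [ c ] ∷ [ y ] ∷ [ y ] ∷ post ≈⟨ sk4 double ⟩
         A ∷ B ∷ D1 ∷ [ c ] ∷ [ y ] ∷ post ∎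
       ... | inj₁ c≡ with y ∈? B
       ... | yes y∈B = begin
         A ∷ B ∷ [ y ] ∷ D1 ∷ [ c ] ∷ [ y ] ∷ post ≈⟨ skip (openBy c≡ y∈B) ⟩
         A ∷ B00 ∷ [ y ] ∷ [ c ] ∷ J ∷ [ y ] ∷ D1 ∷ [ c ] ∷ [ y ] ∷ post ≈⟨ sk4 (back y-J) ⟩
         A ∷ B00 ∷ [ y ] ∷ [ c ] ∷ [ y ] ∷ J ∷ D1 ∷ [ c ] ∷ [ y ] ∷ post ≈⟨ sk5 (back2 c-J c-D1) ⟩
         A ∷ B00 ∷ [ y ] ∷ [ c ] ∷ [ y ] ∷ [ c ] ∷ J ∷ D1 ∷ [ y ] ∷ post ≈⟨ sk5 (skip (back2 y-J y-D1)) ⟩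
         A ∷ B00 ∷ [ y ] ∷ [ c ] ∷ [ y ] ∷ [ c ] ∷ [ y ] ∷ J ∷ D1 ∷ post ≈⟨ sk2 (four-small y<c (right>0 S vS y∈B)) ⟩
         A ∷ B00 ∷ [ y ] ∷ [ c ] ∷ [ y ] ∷ J ∷ D1 ∷ post ≈⟨ sk4 (fwd2 y-J y-D1) ⟩
         A ∷ B00 ∷ [ y ] ∷ [ c ] ∷ J ∷ D1 ∷ [ y ] ∷ post ≈⟨ sk3 double ⟨
         A ∷ B00 ∷ [ y ] ∷ [ c ] ∷ [ c ] ∷ J ∷ D1 ∷ [ y ] ∷ post ≈⟨ sk4 (fwd2 c-J c-D1) ⟩
         A ∷ B00 ∷ [ y ] ∷ [ c ] ∷ J ∷ D1 ∷ [ c ] ∷ [ y ] ∷ post ≈⟨ skip (openBy c≡ y∈B) ⟨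
         A ∷ B ∷ D1 ∷ [ c ] ∷ [ y ] ∷ post ∎
         where B00 = proj₁ (B0-y c≡ y∈B)
       ... | no y∉B with tight-adj c≡ hc
       ... | inj₁ p = ⊥-elim (y∉B p)
       ... | inj₂ (mn , ey) = begin
         A ∷ B ∷ [ y ] ∷ D1 ∷ [ c ] ∷ [ y ] ∷ post ≈⟨ openAB ⟩
         A0 ∷ [ c ] ∷ [ y ] ∷ [ c ] ∷ J ∷ [ y ] ∷ D1 ∷ [ c ] ∷ [ y ] ∷ post ≈⟨ sk4 (back y-J) ⟩
         A0 ∷ [ c ] ∷ [ y ] ∷ [ c ] ∷ [ y ] ∷ J ∷ D1 ∷ [ c ] ∷ [ y ] ∷ post ≈⟨ sk5 (back2 c-J c-D1) ⟩
         A0 ∷ [ c ] ∷ [ y ] ∷ [ c ] ∷ [ y ] ∷ [ c ] ∷ J ∷ D1 ∷ [ y ] ∷ post ≈⟨ sk5 (skip (back2 y-J y-D1)) ⟩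
         A0 ∷ [ c ] ∷ [ y ] ∷ [ c ] ∷ [ y ] ∷ [ c ] ∷ [ y ] ∷ J ∷ D1 ∷ post ≈⟨ skip (cacaca y<c) ⟩
         A0 ∷ [ c ] ∷ [ y ] ∷ [ c ] ∷ [ y ] ∷ J ∷ D1 ∷ post ≈⟨ sk4 (fwd2 y-J y-D1) ⟩
         A0 ∷ [ c ] ∷ [ y ] ∷ [ c ] ∷ J ∷ D1 ∷ [ y ] ∷ post ≈⟨ sk3 double ⟨
         A0 ∷ [ c ] ∷ [ y ] ∷ [ c ] ∷ [ c ] ∷ J ∷ D1 ∷ [ y ] ∷ post ≈⟨ sk4 (fwd2 c-J c-D1) ⟩
         A0 ∷ [ c ] ∷ [ y ] ∷ [ c ] ∷ J ∷ D1 ∷ [ c ] ∷ [ y ] ∷ post ≈⟨ openAB ⟨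
         A ∷ B ∷ D1 ∷ [ c ] ∷ [ y ] ∷ post ∎
         where
         c∈A : c ∈ A
         c∈A = subst (_∈ A) (sym c≡) (gt-gap A (subst (λ w → g w < g y) c≡ (ey c∈B y<c)))
         two : ∃[ A0 ] A ≡ A0 ++ c ∷ y ∷ []
         two = last-two descA c∈A (min∈ mn) y<c (λ s∈ → ≮⇒≥ (not-below-min mn s∈)) c≡
         A0 = proj₁ two
         B0≡ : B0 ≡ []
         B0≡ = nil B0 B0<c (All.tabulate (λ u∈ → min<B mn (subst (_ ∈_) (sym B≡) (∈-++⁺ˡ u∈))))
           where
           nil : ∀ xs → All (_< c) xs → All (y <_) xs → xs ≡ []
           nil [] _ _ = refl
           nil (u ∷ _) (p ∷ _) (r ∷ _) = contradiction r (≤⇒≯ (s≤s⁻¹ (≤-trans p (≤-reflexive c≡))))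
         openAB : ∀ {post} → A ∷ B ∷ post ~ A0 ∷ [ c ] ∷ [ y ] ∷ [ c ] ∷ J ∷ post
         openAB {post} = mk~ (≈-reflexive (trans (cong₂ (λ p r → p ++ r ++ concat post) (proj₂ two) (trans B≡ (cong (_++ c ∷ J) B0≡))) (++-assoc A0 (c ∷ y ∷ []) _)))

   goal-bb : dB → iB → Goal Final
   goal-bb db ib₀ = by ib₀ (reason db)
     where
     pushed : y ∈ D2 ⊎ (IsHead × ¬ Y1 ≡ []) ⊎ (¬ y ∈ D2 × Absorbed) → A ∷ B ∷ D1 ∷ [ c ] ∷ D2 ∷ Y1 ∷ [ c ] ∷ [ a ] ∷ Y2 ∷ [] ~ Final → Goal Final
     pushed r p = ~-trans (push r) p
     split : iB → (y ∈ D2 ⊎ All (_< y) D2) → ¬ (IsHead × Y1 ≡ []) → A ∷ B ∷ D1 ∷ [ c ] ∷ D2 ∷ Y1 ∷ [ c ] ∷ [ a ] ∷ Y2 ∷ [] ~ Final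
     split ib dd nh with c ∈? Y2 | ib
     ... | yes r | _ = bb-R r nh
     ... | no nr | inj₁ r = ⊥-elim (nr r)
     ... | no nr | inj₂ hc = bb-S hc nr dd
     from-headNil : IsHead → Y1 ≡ [] → iBP → Goal Final
     from-headNil hd e jb with c ∈? Y2 | jb
     ... | yes r | _ = HeadNil.via-R hd e r
     ... | no nr | inj₁ r = ⊥-elim (nr r)
     ... | no nr | inj₂ (c∈B , hc) = HeadNil.via-S hd e c∈B hc nr
     by : iB → Reason → Goal Final
     by ib (inD2 p) = pushed (inj₁ p) (split ib (inj₁ p) λ { (hd , _) → contradiction (subst (y ∈_) (D2-nil (≤-reflexive (head-mh hd))) p) λ () })
     by ib (isHead p r) = pushed (inj₂ (inj₁ (p , r))) (split ib (inj₂ (subst (All (_< y)) (sym (D2-nil (≤-reflexive (head-mh p)))) [])) (r ∘ proj₂))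
     by ib (headNil p e r) = from-headNil p e r
     by ib (absorbed p r) with c ∈? Y2 | ib
     ... | no nr | inj₁ r₁ = ⊥-elim (nr r₁)
     ... | no nr | inj₂ hc = pushed (inj₂ (inj₂ (p , r))) (bb-S hc nr (inj₂ (D2<y p)))
     ... | yes c∈ | _ with IsHead? | []? Y1
       where
       IsHead? : Dec IsHead
       IsHead? with y ∈? Y | All.all? (y ≤?_) Y
       ... | yes p | yes r = yes (p , r)
       ... | no np | _ = no (np ∘ proj₁)
       ... | _ | no nr = no (nr ∘ proj₂)
     ... | yes hd | inj₁ e = HeadNil.via-R hd e c∈
     ... | no nh | _ = pushed (inj₂ (inj₂ (p , r))) (bb-R c∈ (nh ∘ proj₁))
     ... | _ | inj₂ ne = pushed (inj₂ (inj₂ (p , r))) (bb-R c∈ (ne ∘ proj₂))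

   source : word S ++ y ∷ flat (rowOf K) ≡ concat (A ∷ B ∷ [ y ] ∷ D1 ∷ [ c ] ∷ D2 ∷ Y1 ∷ [ a ] ∷ Y2 ∷ [])
   source = trans (cong₂ (λ p r → p ++ y ∷ r) (word-AB S) (flat-rowOf K)) (trans (++-assoc A B _)
     (cong (λ z → A ++ B ++ y ∷ z) flatten))
     where
     flatten : (D1 ++ c ∷ D2) ++ (Y1 ++ a ∷ Y2) ≡ D1 ++ c ∷ D2 ++ Y1 ++ a ∷ Y2 ++ []
     flatten = trans (++-assoc D1 (c ∷ D2) _) (cong (λ z → D1 ++ c ∷ D2 ++ Y1 ++ a ∷ z) (sym (++-identityʳ Y2)))

   target : ∀ u v → word S ++ ((D1 ++ u ∷ D2) ++ (Y1 ++ v ∷ Y2)) ++ [ a ] ≡ concat (A ∷ B ∷ D1 ∷ [ u ] ∷ D2 ∷ Y1 ∷ [ v ] ∷ Y2 ∷ [ a ] ∷ [])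
   target u v = trans (cong (_++ (((D1 ++ u ∷ D2) ++ (Y1 ++ v ∷ Y2)) ++ [ a ])) (word-AB S)) (trans (++-assoc A B _) (cong (λ z → A ++ B ++ z)
     (trans (++-assoc (D1 ++ u ∷ D2) _ _) (trans (++-assoc D1 (u ∷ D2) _) (cong (λ z → D1 ++ u ∷ D2 ++ z) (++-assoc Y1 (v ∷ Y2) [ a ]))))))

   mode-≈ : ∀ {l} → Mode K S l → word S ++ y ∷ flat (rowOf K) ≈ word S ++ l ++ [ a ]
   mode-≈ md = ≈-trans (≈-reflexive source) (go md)
     where
     go : ∀ {l} → Mode K S l → concat (A ∷ B ∷ [ y ] ∷ D1 ∷ [ c ] ∷ D2 ∷ Y1 ∷ [ a ] ∷ Y2 ∷ []) ≈ word S ++ l ++ [ a ]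
     go (pp nd ni) = ≈-trans (_~_.un~ (goal-pp nd ni)) (≈-reflexive (sym (target y c)))
     go (pb nd ib) = ≈-trans (_~_.un~ (goal-pb nd ib)) (≈-reflexive (sym (target y a)))
     go (bp db ni) = ≈-trans (_~_.un~ (goal-bp db ni)) (≈-reflexive (sym (target c c)))
     go (bb db ib) = ≈-trans (_~_.un~ (goal-bb db ib)) (≈-reflexive (sym (target c a)))

 Step⇒≈ : ∀ {S R′ y R a} → ValidLow S → Step S R′ y R a → word S ++ y ∷ flat R′ ≈ word S ++ flat R ++ [ a ]
 Step⇒≈ vS (step K refl refl refl v ad md _ _ _) = StepHecke.mode-≈ vS K v ad md

-- Compatibility with the row above, before and after a step

module Transfer where

 open Rows
 open Compatibility
 open Reverse
 open import Data.List.Properties using (∷ʳ-injectiveʳ)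

 -- The conditions of UC with the lower row given by any two-sided word for it.
 record LC (U : Row) (X Y : List ℕ) : Set where
   constructor lc
   field
     cl : ∀ {s} → s ∈ X ⊎ s ∈ Y → gt s X < gt s (D U)
     cr : ∀ {v} → Pt (D U) (m U ∷ I U) v → length X + lt v Y < length (D U) + lt v (m U ∷ I U)

 open LC

 Eᴸ : List ℕ → List ℕ → ℕ → Set
 Eᴸ A B a = ∀ {b} → b ∈ B → a < b → gt b A < gt a A

 -- The conditions of `AdmXY` in the same form. `mn` singles out the minimum, which a word cut in
 -- two does not show.
 record LA (U : Row) (A B : List ℕ) (mn : ℕ → Set) (a : ℕ) : Set where
   constructor la
   field
     lbase : LC U A B
     al : gt a A < gt a (D U)
     ae : gt a (D U) ≡ suc (gt a A) → Eᴸ A B a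
     ar : ∀ {v} → Pt (D U) (m U ∷ I U) v → a < v → length (D U) + lt v (m U ∷ I U) ≡ suc (length A + lt v B) →
             (∃[ b ] b ∈ B × a ≤ b × b < v) ⊎ (mn a × Eᴸ A B a)

 open LA

 module Modes (U : Row) (K : Cfg) (mn : ℕ → Set) where
   open Cfg K
   open CfgLemmas K

   private
     DU = D U
     H : ℕ → ℕ
     H v = length DU + lt v (m U ∷ I U)

     y∈X* : y ∈ X*
     y∈X* = ∈-++⁺ʳ D1 (here refl)

     X*≤X : ∀ s → gt s X* ≤ gt s X
     X*≤X s with y ≤? s | s <? c
     ... | no p | _ = ≤-reflexive (gt-X*-lo (≰⇒> p))
     ... | yes _ | no p = ≤-reflexive (gt-X*-hi (≮⇒≥ p))
     ... | yes p | yes r = subst₂ _≤_ (sym (gt-X*-mid p r)) (sym (gt-X p r)) (n≤1+n q)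

     gt-above : ∀ {b} → c ≤ b → gt b X* ≤ q
     gt-above p = subst (_≤ q) (sym (gt-X*-hi p)) (gt-X-hi p)

     gt-cX : gt c X ≡ q
     gt-cX = trans (gt-++ c D1 (c ∷ D2)) (trans (cong₂ _+_ (gt-all c D1>c) (gt-none c (≤-refl ∷ All.map (λ p → ≤-trans p (<⇒≤ y<c)) D2≤y))) (+-identityʳ q))

     gt-cX* : gt c X* ≡ q
     gt-cX* = trans (gt-X*-hi ≤-refl) gt-cX

     gt-lowX* : ∀ {s} → s < y → suc q ≤ gt s X*
     gt-lowX* {s} s<y = subst (suc q ≤_) (sym (gt-X*-lo s<y)) (≤-trans (≤-reflexive (sym (gt-X ≤-refl y<c))) (gt-anti X (<⇒≤ s<y)))

     Y-cases : ∀ {b} → b ∈ Y → b ≤ a ⊎ c ≤ b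
     Y-cases b∈ with ∈-++⁻ Y1 b∈
     ... | inj₁ p = inj₁ (<⇒≤ (All.lookup Y1<a p))
     ... | inj₂ (here refl) = inj₁ ≤-refl
     ... | inj₂ (there p) = inj₂ (All.lookup Y2≥c p)

     Y*-cases : ∀ {b} → b ∈ Y* → b < a ⊎ c ≤ b
     Y*-cases b∈ with ∈-++⁻ Y1 b∈
     ... | inj₁ p = inj₁ (All.lookup Y1<a p)
     ... | inj₂ (here refl) = inj₂ ≤-refl
     ... | inj₂ (there p) = inj₂ (All.lookup Y2≥c p)

     c∈Y* : c ∈ Y*
     c∈Y* = ∈-++⁺ʳ Y1 (here refl)

     Y⊂ : ∀ {b} → b ∈ Y → b ∈ Y* ⊎ b ≡ a
     Y⊂ b∈ with ∈-++⁻ Y1 b∈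
     ... | inj₁ p = inj₁ (∈-++⁺ˡ p)
     ... | inj₂ (here e) = inj₂ e
     ... | inj₂ (there p) = inj₁ (∈-++⁺ʳ Y1 (there p))

     Y*⊂ : ∀ {b} → b ∈ Y* → b ∈ Y ⊎ b ≡ c
     Y*⊂ b∈ with ∈-++⁻ Y1 b∈
     ... | inj₁ p = inj₁ (∈-++⁺ˡ p)
     ... | inj₂ (here e) = inj₂ e
     ... | inj₂ (there p) = inj₁ (∈-++⁺ʳ Y1 (there p))

     X⇒X* : (∀ {s} → s ∈ X → gt s X < gt s DU) → ∀ {s} → s ∈ X* → gt s X* < gt s DU
     X⇒X* f {s} s∈ with ∈-++⁻ D1 s∈
     ... | inj₁ p = ≤-<-trans (X*≤X s) (f (∈-++⁺ˡ p))
     ... | inj₂ (there p) = ≤-<-trans (X*≤X s) (f (∈-++⁺ʳ D1 (there p)))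
     ... | inj₂ (here refl) = ≤-<-trans (≤-reflexive (trans (gt-X*-mid ≤-refl y<c) (sym gt-cX))) (<-≤-trans (f c∈X) (gt-anti DU (<⇒≤ y<c)))

     X*⇒X : (∀ {s} → s ∈ X* → gt s X* < gt s DU) → q < gt c DU → (∀ {s} → s ∈ D2 → y ≤ s → gt s X < gt s DU) → ∀ {s} → s ∈ X → gt s X < gt s DU
     X*⇒X f qc eqy {s} s∈ with ∈-++⁻ D1 s∈
     ... | inj₁ p = subst (_< gt s DU) (gt-X*-hi (<⇒≤ (All.lookup D1>c p))) (f (∈-++⁺ˡ p))
     ... | inj₂ (here refl) = subst (_< gt c DU) (sym gt-cX) qc
     ... | inj₂ (there p) with y ≤? s
     ... | yes y≤s = eqy p y≤s
     ... | no y≰s = subst (_< gt s DU) (gt-X*-lo (≰⇒> y≰s)) (f (∈-++⁺ʳ D1 (there p)))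

     mid-bound : ∀ {s} → y ≤ s → s ≤ a → gt a X* < gt a DU → (gt a DU ≡ suc (gt a X*) → ⊥) → suc q < gt s DU
     mid-bound {s} y≤s s≤a p ne = <-≤-trans (≤∧≢⇒< (subst (_< gt a DU) e p) (λ r → ne (trans (sym r) (cong suc (sym e))))) (gt-anti DU s≤a)
       where e = gt-X*-mid (≤-trans y≤s s≤a) a<c

   module PP (mn-y : mn a → a ≡ y) (y∉D2 : ¬ y ∈ D2) where

     -- X | Y counts one letter more than X* | Y*, on the left in
     -- [y , c) and on the right in (a , c]. The conditions AE and AR for a say that CL and CR of U
     -- can bear this: beyond c the letter c of Y* witnesses `In`, and up to c tightness is
     -- impossible.
     to : LC U X Y → LA U X* Y* mn a
     to L = la (lc cl* cr*) (≤-<-trans (X*≤X a) aa) ae* ar*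
       where
       aa : gt a X < gt a DU
       aa = cl L (inj₂ a∈Y)
       cl* : ∀ {s} → s ∈ X* ⊎ s ∈ Y* → gt s X* < gt s DU
       cl* (inj₁ p) = X⇒X* (λ r → cl L (inj₁ r)) p
       cl* {s} (inj₂ p) with Y*⊂ p
       ... | inj₁ r = ≤-<-trans (X*≤X s) (cl L (inj₂ r))
       ... | inj₂ refl = ≤-<-trans (X*≤X s) (cl L (inj₁ c∈X))
       lt≤ : ∀ v → lt v Y* ≤ lt v Y
       lt≤ v with v ≤? a | c <? v
       ... | yes p | _ = ≤-reflexive (lt-Y-lo p)
       ... | no _ | yes p = ≤-reflexive (lt-Y-hi p)
       ... | no p | no r = subst₂ _≤_ (sym (lt-Y*-mid (≰⇒> p) (≮⇒≥ r))) (sym (lt-Y-mid (≰⇒> p) (≮⇒≥ r))) (n≤1+n _)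
       cr* : ∀ {v} → Pt DU (m U ∷ I U) v → length X* + lt v Y* < H v
       cr* {v} pt = ≤-<-trans (+-mono-≤ (≤-reflexive len-X*) (lt≤ v)) (cr L pt)
       ae* : gt a DU ≡ suc (gt a X*) → Eᴸ X* Y* a
       ae* e {b} b∈ a<b with y ≤? a
       ... | yes y≤a = ⊥-elim (<-irrefl (trans (gt-X y≤a a<c) (cong suc (sym (gt-X*-mid y≤a a<c)))) (subst (gt a X <_) e aa))
       ... | no y≰a with Y*-cases b∈
       ... | inj₁ p = ⊥-elim (<-asym p a<b)
       ... | inj₂ p = ≤-<-trans (gt-above p) (gt-lowX* (≰⇒> y≰a))
       ar* : ∀ {v} → Pt DU (m U ∷ I U) v → a < v → H v ≡ suc (length X* + lt v Y*) → (∃[ b ] b ∈ Y* × a ≤ b × b < v) ⊎ (mn a × Eᴸ X* Y* a)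
       ar* {v} pt a<v e with c <? v
       ... | yes p = inj₁ (c , c∈Y* , <⇒≤ a<c , p)
       ... | no p = ⊥-elim (<-irrefl (trans (cong (length X +_) (lt-Y-mid a<v (≮⇒≥ p))) (trans (+-suc _ _) (sym (trans e (cong suc (cong₂ _+_ len-X* (lt-Y*-mid a<v (≮⇒≥ p)))))))) (cr L pt))

     from : LA U X* Y* mn a → LC U X Y
     from L = lc cl* cr*
       where
       ne : y ≤ a → gt a DU ≡ suc (gt a X*) → ⊥
       ne y≤a e = <-irrefl refl (subst₂ _<_ gt-cX* (gt-X*-mid y≤a a<c) (ae L e c∈Y* a<c))
       cl* : ∀ {s} → s ∈ X ⊎ s ∈ Y → gt s X < gt s DU
       cl* (inj₁ p) = X*⇒X (λ r → cl (lbase L) (inj₁ r)) (subst (_< gt c DU) gt-cX* (cl (lbase L) (inj₂ c∈Y*)))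
                        (λ s∈ y≤s → ⊥-elim (y∉D2 (subst (_∈ D2) (≤-antisym (All.lookup D2≤y s∈) y≤s) s∈))) p
       cl* {s} (inj₂ p) with Y-cases p
       ... | inj₂ c≤s with Y⊂ p
       ... | inj₁ r = subst (_< gt s DU) (gt-X*-hi c≤s) (cl (lbase L) (inj₂ r))
       ... | inj₂ refl = ⊥-elim (<⇒≱ a<c c≤s)
       cl* {s} (inj₂ p) | inj₁ s≤a with y ≤? s
       ... | yes y≤s = subst (_< gt s DU) (sym (gt-X y≤s (≤-<-trans s≤a a<c))) (mid-bound y≤s s≤a (al L) (ne (≤-trans y≤s s≤a)))
       ... | no y≰s with Y⊂ p
       ... | inj₁ r = subst (_< gt s DU) (gt-X*-lo (≰⇒> y≰s)) (cl (lbase L) (inj₂ r))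
       ... | inj₂ refl = subst (_< gt s DU) (gt-X*-lo (≰⇒> y≰s)) (al L)
       cr* : ∀ {v} → Pt DU (m U ∷ I U) v → length X + lt v Y < H v
       cr* {v} pt with v ≤? a | c <? v
       ... | yes p | _ = subst (_< H v) (cong₂ _+_ len-X* (lt-Y-lo p)) (cr (lbase L) pt)
       ... | no _ | yes p = subst (_< H v) (cong₂ _+_ len-X* (lt-Y-hi p)) (cr (lbase L) pt)
       ... | no a≮v | no c≮v = subst (_< H v) (sym (trans (cong (length X +_) (lt-Y-mid a<v v≤c)) (+-suc _ _)))
               (≤∧≢⇒< (subst (_< H v) e₀ (cr (lbase L) pt)) (λ e → bad (ar L pt a<v (trans (sym e) (cong suc (sym e₀))))))
         where
         a<v = ≰⇒> a≮v
         v≤c = ≮⇒≥ c≮v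
         e₀ : length X* + lt v Y* ≡ length X + length Y1
         e₀ = cong₂ _+_ len-X* (lt-Y*-mid a<v v≤c)
         bad : (∃[ b ] b ∈ Y* × a ≤ b × b < v) ⊎ (mn a × Eᴸ X* Y* a) → ⊥
         bad (inj₁ (b , b∈ , a≤b , b<v)) with Y*-cases b∈
         ... | inj₁ p = <⇒≱ p a≤b
         ... | inj₂ p = <⇒≱ b<v (≤-trans v≤c p)
         bad (inj₂ (mna , ev)) = <-irrefl refl (subst₂ _<_ gt-cX* (trans (cong (λ w → gt w X*) (mn-y mna)) (gt-X*-mid ≤-refl y<c)) (ev c∈Y* a<c))

   module BP (mn-no : ¬ mn a) where

     to : LC U X Y → LA U X Y* mn a
     to L = la (lc cl* cr*) (cl L (inj₂ a∈Y)) ae* ar*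
       where
       cl* : ∀ {s} → s ∈ X ⊎ s ∈ Y* → gt s X < gt s DU
       cl* (inj₁ p) = cl L (inj₁ p)
       cl* (inj₂ p) with Y*⊂ p
       ... | inj₁ r = cl L (inj₂ r)
       ... | inj₂ refl = cl L (inj₁ c∈X)
       lt≤ : ∀ v → lt v Y* ≤ lt v Y
       lt≤ v with v ≤? a | c <? v
       ... | yes p | _ = ≤-reflexive (lt-Y-lo p)
       ... | no _ | yes p = ≤-reflexive (lt-Y-hi p)
       ... | no p | no r = subst₂ _≤_ (sym (lt-Y*-mid (≰⇒> p) (≮⇒≥ r))) (sym (lt-Y-mid (≰⇒> p) (≮⇒≥ r))) (n≤1+n _)
       cr* : ∀ {v} → Pt DU (m U ∷ I U) v → length X + lt v Y* < H v
       cr* {v} pt = ≤-<-trans (+-monoʳ-≤ (length X) (lt≤ v)) (cr L pt)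
       ae* : gt a DU ≡ suc (gt a X) → Eᴸ X Y* a
       ae* e {b} b∈ a<b with Y*-cases b∈
       ... | inj₁ p = ⊥-elim (<-asym p a<b)
       ... | inj₂ p = gt-mem c∈X a<c p
       ar* : ∀ {v} → Pt DU (m U ∷ I U) v → a < v → H v ≡ suc (length X + lt v Y*) → (∃[ b ] b ∈ Y* × a ≤ b × b < v) ⊎ (mn a × Eᴸ X Y* a)
       ar* {v} pt a<v e with c <? v
       ... | yes p = inj₁ (c , c∈Y* , <⇒≤ a<c , p)
       ... | no p = ⊥-elim (<-irrefl (trans (cong (length X +_) (lt-Y-mid a<v (≮⇒≥ p))) (trans (+-suc _ _) (sym (trans e (cong suc (cong (length X +_) (lt-Y*-mid a<v (≮⇒≥ p)))))))) (cr L pt))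

     from : LA U X Y* mn a → LC U X Y
     from L = lc cl* cr*
       where
       cl* : ∀ {s} → s ∈ X ⊎ s ∈ Y → gt s X < gt s DU
       cl* (inj₁ p) = cl (lbase L) (inj₁ p)
       cl* (inj₂ p) with Y⊂ p
       ... | inj₁ r = cl (lbase L) (inj₂ r)
       ... | inj₂ refl = al L
       cr* : ∀ {v} → Pt DU (m U ∷ I U) v → length X + lt v Y < H v
       cr* {v} pt with v ≤? a | c <? v
       ... | yes p | _ = subst (_< H v) (cong (length X +_) (lt-Y-lo p)) (cr (lbase L) pt)
       ... | no _ | yes p = subst (_< H v) (cong (length X +_) (lt-Y-hi p)) (cr (lbase L) pt)
       ... | no a≮v | no c≮v = subst (_< H v) (sym (trans (cong (length X +_) (lt-Y-mid a<v v≤c)) (+-suc _ _)))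
               (≤∧≢⇒< (subst (_< H v) e₀ (cr (lbase L) pt)) (λ e → bad (ar L pt a<v (trans (sym e) (cong suc (sym e₀))))))
         where
         a<v = ≰⇒> a≮v
         v≤c = ≮⇒≥ c≮v
         e₀ : length X + lt v Y* ≡ length X + length Y1
         e₀ = cong (length X +_) (lt-Y*-mid a<v v≤c)
         bad : (∃[ b ] b ∈ Y* × a ≤ b × b < v) ⊎ (mn a × Eᴸ X Y* a) → ⊥
         bad (inj₁ (b , b∈ , a≤b , b<v)) with Y*-cases b∈
         ... | inj₁ p = <⇒≱ p a≤b
         ... | inj₂ p = <⇒≱ b<v (≤-trans v≤c p)
         bad (inj₂ (mna , _)) = mn-no mna

   module PB (B : List ℕ) (a∈ : a ∈ B ⊎ (mn a × a < y)) (a∈R : a ∈ X* ⊎ a ∈ B)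
             (B-cases : ∀ {b} → b ∈ B → b ≤ a ⊎ c ≤ b) (y∉D2 : ¬ y ∈ D2)
             (wit : ∃[ z ] z ∈ B × c ≤ z × All (z <_) D1) where

     private
       z = proj₁ wit
       z∈ = proj₁ (proj₂ wit)
       c≤z = proj₁ (proj₂ (proj₂ wit))
       gt-z : gt z X* ≡ q
       gt-z = trans (gt-++ z D1 (y ∷ D2)) (trans (cong₂ _+_ (gt-all z (proj₂ (proj₂ (proj₂ wit)))) (gt-none z (y≤z ∷ All.map (λ p → ≤-trans p y≤z) D2≤y))) (+-identityʳ q))
         where y≤z = ≤-trans (<⇒≤ y<c) c≤z

     a-X : (∀ {s} → s ∈ X ⊎ s ∈ B → gt s X < gt s DU) → gt a X < gt a DU
     a-X f = go a∈R a∈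
       where
       go : a ∈ X* ⊎ a ∈ B → a ∈ B ⊎ (mn a × a < y) → gt a X < gt a DU
       go _ (inj₁ p) = f (inj₂ p)
       go (inj₂ p) _ = f (inj₂ p)
       go (inj₁ p) (inj₂ (_ , a<y)) with ∈-++⁻ D1 p
       ... | inj₁ r = f (inj₁ (∈-++⁺ˡ r))
       ... | inj₂ (there r) = f (inj₁ (∈-++⁺ʳ D1 (there r)))
       ... | inj₂ (here e) = ⊥-elim (<-irrefl e a<y)

     to : LC U X B → LA U X* B mn a
     to L = la (lc cl* cr*) (≤-<-trans (X*≤X a) (a-X (cl L))) ae* ar*
       where
       cl* : ∀ {s} → s ∈ X* ⊎ s ∈ B → gt s X* < gt s DU
       cl* (inj₁ p) = X⇒X* (λ r → cl L (inj₁ r)) p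
       cl* {s} (inj₂ p) = ≤-<-trans (X*≤X s) (cl L (inj₂ p))
       cr* : ∀ {v} → Pt DU (m U ∷ I U) v → length X* + lt v B < H v
       cr* {v} pt = subst (_< H v) (cong (_+ lt v B) (sym len-X*)) (cr L pt)
       ev : a < y → Eᴸ X* B a
       ev a<y b∈ a<b with B-cases b∈
       ... | inj₁ p = ⊥-elim (<⇒≱ a<b p)
       ... | inj₂ p = ≤-<-trans (gt-above p) (gt-lowX* a<y)
       ae* : gt a DU ≡ suc (gt a X*) → Eᴸ X* B a
       ae* e with y ≤? a
       ... | yes y≤a = ⊥-elim (<-irrefl (trans (gt-X y≤a a<c) (cong suc (sym (gt-X*-mid y≤a a<c)))) (subst (gt a X <_) e (a-X (cl L))))
       ... | no y≰a = ev (≰⇒> y≰a)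
       ar* : ∀ {v} → Pt DU (m U ∷ I U) v → a < v → H v ≡ suc (length X* + lt v B) → (∃[ b ] b ∈ B × a ≤ b × b < v) ⊎ (mn a × Eᴸ X* B a)
       ar* {v} pt a<v e = go a∈
         where
         go : a ∈ B ⊎ (mn a × a < y) → (∃[ b ] b ∈ B × a ≤ b × b < v) ⊎ (mn a × Eᴸ X* B a)
         go (inj₁ p) = inj₁ (a , p , ≤-refl , a<v)
         go (inj₂ (p , a<y)) = inj₂ (p , λ b∈ → ev a<y b∈)

     from : LA U X* B mn a → LC U X B
     from L = lc cl* cr*
       where
       ne : y ≤ a → gt a DU ≡ suc (gt a X*) → ⊥
       -- z does the service that c did in `PP`: a letter of B beyond c with exactly q letters of X*
       -- above it.
       ne y≤a e = <-irrefl refl (subst₂ _<_ gt-z (gt-X*-mid y≤a a<c) (ae L e z∈ (<-≤-trans a<c c≤z)))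
       qc : q < gt c DU
       qc = <-≤-trans (subst (_< gt z DU) gt-z (cl (lbase L) (inj₂ z∈))) (gt-anti DU c≤z)
       cl* : ∀ {s} → s ∈ X ⊎ s ∈ B → gt s X < gt s DU
       cl* (inj₁ p) = X*⇒X (λ r → cl (lbase L) (inj₁ r)) qc (λ s∈ y≤s → ⊥-elim (y∉D2 (subst (_∈ D2) (≤-antisym (All.lookup D2≤y s∈) y≤s) s∈))) p
       cl* {s} (inj₂ p) with B-cases p
       ... | inj₂ c≤s = subst (_< gt s DU) (gt-X*-hi c≤s) (cl (lbase L) (inj₂ p))
       ... | inj₁ s≤a with y ≤? s
       ... | yes y≤s = subst (_< gt s DU) (sym (gt-X y≤s (≤-<-trans s≤a a<c))) (mid-bound y≤s s≤a (al L) (ne (≤-trans y≤s s≤a)))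
       ... | no y≰s = subst (_< gt s DU) (gt-X*-lo (≰⇒> y≰s)) (cl (lbase L) (inj₂ p))
       cr* : ∀ {v} → Pt DU (m U ∷ I U) v → length X + lt v B < H v
       cr* {v} pt = subst (_< H v) (cong (_+ lt v B) len-X*) (cr (lbase L) pt)

 module _ {U : Row} where

   move-in : ∀ {X n Y} → All (n <_) X → All (n <_) Y → LC U (X ∷ʳ n) Y → LC U X (n ∷ Y)
   move-in {X} {n} {Y} X>n Y>n L = lc cl* cr*
     where
     n≤ : ∀ {s} → s ∈ X ⊎ s ∈ n ∷ Y → n ≤ s
     n≤ (inj₁ p) = <⇒≤ (All.lookup X>n p)
     n≤ (inj₂ (here refl)) = ≤-refl
     n≤ (inj₂ (there p)) = <⇒≤ (All.lookup Y>n p)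
     el : ∀ {s} → s ∈ X ⊎ s ∈ n ∷ Y → s ∈ X ∷ʳ n ⊎ s ∈ Y
     el (inj₁ p) = inj₁ (∈-++⁺ˡ p)
     el (inj₂ (here refl)) = inj₁ (∈-++⁺ʳ X (here refl))
     el (inj₂ (there p)) = inj₂ p
     cl* : ∀ {s} → s ∈ X ⊎ s ∈ n ∷ Y → gt s X < gt s (D U)
     cl* {s} e = subst (_< gt s (D U)) (gt-∷ʳ-no X (n≤ e)) (cl L (el e))
     cr* : ∀ {v} → Pt (D U) (m U ∷ I U) v → length X + lt v (n ∷ Y) < length (D U) + lt v (m U ∷ I U)
     cr* {v} pt = ≤-<-trans (le (lt-view v n Y)) (cr L pt)
       where
       le : (n < v × lt v (n ∷ Y) ≡ suc (lt v Y)) ⊎ (v ≤ n × lt v (n ∷ Y) ≡ lt v Y) → length X + lt v (n ∷ Y) ≤ length (X ∷ʳ n) + lt v Y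
       le (inj₁ (_ , e)) = ≤-reflexive (trans (cong (length X +_) e) (trans (+-suc _ _) (cong (_+ lt v Y) (sym (len-∷ʳ X)))))
       le (inj₂ (_ , e)) = ≤-trans (≤-reflexive (cong (length X +_) e)) (+-monoˡ-≤ (lt v Y) (≤-trans (n≤1+n _) (≤-reflexive (sym (len-∷ʳ X)))))

   -- At test points v ≤ n the count of the lower row grows by one. The slack comes from CL at n,
   -- which gives more than `length X` letters of `D U` above n, and the test point v accounts for
   -- one further letter of U.
   move-out : ∀ {X n Y} → All (n <_) X → All (n <_) Y → LC U X (n ∷ Y) → LC U (X ∷ʳ n) Y
   move-out {X} {n} {Y} X>n Y>n L = lc cl* cr*
     where
     n≤ : ∀ {s} → s ∈ X ∷ʳ n ⊎ s ∈ Y → n ≤ s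
     n≤ (inj₁ p) with ∈-∷ʳ⁻ X p
     ... | inj₁ r = <⇒≤ (All.lookup X>n r)
     ... | inj₂ refl = ≤-refl
     n≤ (inj₂ p) = <⇒≤ (All.lookup Y>n p)
     el : ∀ {s} → s ∈ X ∷ʳ n ⊎ s ∈ Y → s ∈ X ⊎ s ∈ n ∷ Y
     el (inj₁ p) with ∈-∷ʳ⁻ X p
     ... | inj₁ r = inj₁ r
     ... | inj₂ refl = inj₂ (here refl)
     el (inj₂ p) = inj₂ (there p)
     cl* : ∀ {s} → s ∈ X ∷ʳ n ⊎ s ∈ Y → gt s (X ∷ʳ n) < gt s (D U)
     cl* {s} e = subst (_< gt s (D U)) (sym (gt-∷ʳ-no X (n≤ e))) (cl L (el e))
     top : suc (length X) ≤ gt n (D U)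
     top = subst (_< gt n (D U)) (gt-all n X>n) (cl L (inj₂ (here refl)))
     cr* : ∀ {v} → Pt (D U) (m U ∷ I U) v → length (X ∷ʳ n) + lt v Y < length (D U) + lt v (m U ∷ I U)
     cr* {v} pt with lt-view v n Y
     ... | inj₁ (_ , e) = subst (_< length (D U) + lt v (m U ∷ I U)) (trans (cong (length X +_) e) (trans (+-suc _ _) (cong (_+ lt v Y) (sym (len-∷ʳ X))))) (cr L pt)
     ... | inj₂ (v≤n , e) = subst (_< length (D U) + lt v (m U ∷ I U)) (sym (trans (cong₂ _+_ (len-∷ʳ X) (lt-none v (All.map (λ p → ≤-trans v≤n (<⇒≤ p)) Y>n))) (+-identityʳ _))) (hi pt)
       where
       hi : Pt (D U) (m U ∷ I U) v → suc (length X) < length (D U) + lt v (m U ∷ I U)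
       hi (inj₁ p) = <-≤-trans (s≤s top) (≤-trans (short p) (m≤m+n _ _))
         where
         short : v ∈ D U → gt n (D U) < length (D U)
         short p with ∈-∃++ p
         ... | P , Q , e rewrite e = ≤-trans (s≤s (≤-trans (≤-reflexive (trans (gt-++ n P (v ∷ Q)) (cong (gt n P +_) (gt-no n Q v≤n)))) (+-mono-≤ (gt-len n P) (gt-len n Q))))
                                       (≤-reflexive (trans (sym (+-suc _ _)) (sym (length-++ P))))
       hi (inj₂ (r , r∈ , refl)) = <-≤-trans (s≤s top) (≤-trans (≤-reflexive (+-comm 1 _)) (+-mono-≤ (gt-len n (D U)) (≤-trans (s≤s z≤n) (lt-mem {r} {suc r} r∈ ≤-refl ≤-refl))))

 -- Anything but the minimum at the cut would put an ascent into the decreasing part or a descent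
 -- into the increasing one.
 two-words : ∀ {R} → Valid R → ∀ Xs {Ys} → flat R ≡ Xs ++ Ys → Desc Xs → Asc Ys →
             (Xs ≡ D R × Ys ≡ m R ∷ I R) ⊎ (Xs ≡ D R ∷ʳ m R × Ys ≡ I R)
 two-words {⟨ [] , n , J ⟩} v [] e dX aY = inj₁ (refl , sym e)
 two-words {⟨ [] , n , J ⟩} v (x ∷ []) e dX aY = inj₂ (cong (_∷ []) (sym (∷-injectiveˡ e)) , sym (∷-injectiveʳ e))
 two-words {⟨ [] , n , .(x′ ∷ _) ⟩} v (x ∷ x′ ∷ Xs) refl ((x>x′ ∷ _) ∷ _) aY = ⊥-elim (<-asym x>x′ (All.head (I>m v)))
 two-words {⟨ d ∷ Ds , n , J ⟩} v [] refl dX aY = ⊥-elim (<-asym (All.lookup (asc-head aY) (∈-++⁺ʳ Ds (here refl))) (All.head (D>m v)))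
 two-words {⟨ d ∷ Ds , n , J ⟩} (valid (_ ∷ dd) (_ ∷ dm) ai im) (x ∷ Xs) e (_ ∷ dX) aY
   with two-words {⟨ Ds , n , J ⟩} (valid dd dm ai im) Xs (∷-injectiveʳ e) dX aY
 ... | inj₁ (p , r) = inj₁ (cong₂ _∷_ (sym (∷-injectiveˡ e)) p , r)
 ... | inj₂ (p , r) = inj₂ (cong₂ _∷_ (sym (∷-injectiveˡ e)) p , r)

 flat-injective : ∀ {R R′} → Valid R → Valid R′ → flat R ≡ flat R′ → R ≡ R′
 flat-injective {R} {R′} v v′ e with two-words v (D R′) e (desc v′) (asc-mI v′)
 ... | inj₁ (p , r) = row-≡ (sym p) (sym (∷-injectiveˡ r)) (sym (∷-injectiveʳ r))
   where
   row-≡ : ∀ {d n i d′ n′ i′} → d ≡ d′ → n ≡ n′ → i ≡ i′ → ⟨ d , n , i ⟩ ≡ ⟨ d′ , n′ , i′ ⟩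
   row-≡ refl refl refl = refl
 ... | inj₂ (p , r) = ⊥-elim (<-asym (All.lookup (D>m v′) (subst (m R ∈_) (sym p) (∈-++⁺ʳ (D R) (here refl))))
                                     (All.lookup (I>m v) (subst (m R′ ∈_) r (here refl))))

 size-flat : ∀ R → size (just R) ≡ length (flat R)
 size-flat R = trans (cong (_+ length (I R)) (len-∷ʳ (D R))) (sym (len-XY (D R) (I R)))

 module _ {U : Row} {R : Row} where

   UC⇔LC : UC (D U) (m U ∷ I U) (just R) ⇔ LC U (D R ∷ʳ m R) (I R)
   UC⇔LC = mk⇔ (λ u → lc (CL u) (CR u)) (λ l → uc (cl l) (cr l))

   Adm⇔LA : ∀ {a} → AdmXY (D U) (m U ∷ I U) (just R) a ⇔ LA U (D R ∷ʳ m R) (I R) (_≡ m R) a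
   Adm⇔LA = mk⇔ (λ p → la (lc (CL (base p)) (CR (base p))) (AL p) (AE p) (AR p))
                (λ p → admXY (uc (cl (lbase p)) (cr (lbase p))) (al p) (ae p) (ar p))

 module Through {S R′ y R a} (vS : ValidLow S) (st : Step S R′ y R a) (U : Row) where
   open Step st
   vK : Valid (rowOf K)
   vK = subst Valid R′≡ valid′
   adK : Adm (rowOf K) S (Cfg.y K)
   adK = subst₂ (λ r z → Adm r S z) R′≡ y≡ admits
   open Cfg K hiding (y; a)
   open Cfg K using () renaming (y to y₀; a to a₀)
   open RowFacts K vK
   open Conditions K S
   MN : ℕ → Set
   MN = _≡ m R

   R′-rep : LC U (D R′ ∷ʳ m R′) (I R′) ⇔ LC U X Y
   R′-rep = mk⇔
     (λ l → subst₂ (LC U) (D-rowOf K) (mI-rowOf K) (subst (λ r → LC U (D r) (m r ∷ I r)) R′≡ (move-in (D>m valid′) (I>m valid′) l)))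
     (λ l → move-out (D>m valid′) (I>m valid′) (subst (λ r → LC U (D r) (m r ∷ I r)) (sym R′≡) (subst₂ (LC U) (sym (D-rowOf K)) (sym (mI-rowOf K)) l)))

   Z-split : ∀ {z Z} → Y1 ≡ z ∷ Z → All (z <_) X × All (z <_) (Z ++ a₀ ∷ Y2)
   Z-split e = subst (λ w → All (w <_) X) (head-m e) (All.tabulate mI<D) , asc-head (subst (λ w → Asc (w ++ a₀ ∷ Y2)) e ascY)

   Goal : Set
   Goal = LC U X Y ⇔ LA U (D R ∷ʳ m R) (I R) MN a₀

   -- The same configuration with the first letter z of Y1 moved to the end of D2.
   shifted : ∀ {z Z} → Y1 ≡ z ∷ Z → z < y₀ → Cfg
   shifted {z} {Z} e z<y = cfg D1 (D2 ∷ʳ z) Z Y2 c a₀ y₀ D1>c y<c (All.∷ʳ⁺ D2≤y (<⇒≤ z<y)) (All.tail (subst (All (_< a₀)) e Y1<a)) a<c Y2≥c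

   snoc-assoc : ∀ u z → D1 ++ u ∷ (D2 ∷ʳ z) ≡ (D1 ++ u ∷ D2) ∷ʳ z
   snoc-assoc u z = sym (++-assoc D1 (u ∷ D2) (z ∷ []))

   shift-LC : ∀ {z Z} → Y1 ≡ z ∷ Z → LC U X Y ⇔ LC U (D1 ++ c ∷ (D2 ∷ʳ z)) (Z ++ a₀ ∷ Y2)
   shift-LC {z} {Z} e = mk⇔
     (λ l → subst (λ w → LC U w (Z ++ a₀ ∷ Y2)) (sym (snoc-assoc c z)) (move-out X>z Y>z (subst (λ w → LC U X (w ++ a₀ ∷ Y2)) e l)))
     (λ l → subst (λ w → LC U X (w ++ a₀ ∷ Y2)) (sym e) (move-in X>z Y>z (subst (λ w → LC U w (Z ++ a₀ ∷ Y2)) (snoc-assoc c z) l)))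
     where X>z = proj₁ (Z-split e)
           Y>z = proj₂ (Z-split e)

   last-D2 : ∀ u → D1 ++ u ∷ D2 ≡ D R ∷ʳ m R → Y1 ≢ [] ⊎ m (rowOf K) ≡ a₀ → (∀ {w} → Y1 ≢ [] → w ≡ m (rowOf K) → m R < w) → m R ≡ a₀ → D2 ≡ []
   last-D2 u e hd I>m′ m≡a with unsnoc D2
   ... | inj₁ p = p
   ... | inj₂ (ys , n , p) = ⊥-elim (bad hd)
     where
     n≡m : n ≡ m R
     n≡m = ∷ʳ-injectiveʳ (D1 ++ u ∷ ys) (D R) (trans (trans (++-assoc D1 (u ∷ ys) (n ∷ [])) (cong (λ w → D1 ++ u ∷ w) (sym p))) e)
     m′<n : m (rowOf K) < n
     m′<n = mI<D (∈-++⁺ʳ D1 (there (subst (n ∈_) (sym p) (∈-++⁺ʳ ys (here refl)))))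
     bad : Y1 ≢ [] ⊎ m (rowOf K) ≡ a₀ → ⊥
     bad (inj₂ r) = <-irrefl (trans r (sym (trans n≡m m≡a))) m′<n
     bad (inj₁ ne) = <-asym m′<n (subst (_< m (rowOf K)) (sym n≡m) (I>m′ ne refl))

   Y1-cases : Y1 ≢ [] ⊎ m (rowOf K) ≡ a₀
   Y1-cases = go Y1 refl
     where
     go : ∀ W → Y1 ≡ W → Y1 ≢ [] ⊎ m (rowOf K) ≡ a₀
     go [] e = inj₂ (∷-injectiveˡ (trans (mI-rowOf K) (cong (_++ a₀ ∷ Y2) e)))
     go (_ ∷ _) e = inj₁ (λ e′ → []≢∷ (trans (sym e′) e))

   m′∈Y1 : Y1 ≢ [] → m (rowOf K) ∈ Y1
   m′∈Y1 ne = go Y1 refl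
     where
     go : ∀ W → Y1 ≡ W → m (rowOf K) ∈ Y1
     go [] e = ⊥-elim (ne e)
     go (z ∷ Z) e = subst (_∈ Y1) (sym (head-m e)) (subst (z ∈_) (sym e) (here refl))

   vld = validR

   goal-pp : ¬ dB → ¬ iBP → flat R ≡ X* ++ Y* → Goal
   goal-pp nd ni e with two-words validR X* e (descX* (D2<y (nd ∘ inj₁))) (ascY* (Y2>c (ni ∘ inj₁)))
   ... | inj₂ (p , r) = subst₂ (λ A B → LC U X Y ⇔ LA U A B MN a₀) p r (mk⇔ M.to M.from)
     where
     mn-y : MN a₀ → a₀ ≡ y₀
     mn-y q = trans q (sym (∷ʳ-injectiveʳ D1 (D R) (trans (cong (λ w → D1 ++ y₀ ∷ w) (sym D2≡)) p)))
       where D2≡ = last-D2 y₀ p Y1-cases (λ ne w≡ → subst (m R <_) (sym w≡) (All.lookup (I>m validR) (subst (m (rowOf K) ∈_) r (∈-++⁺ˡ (m′∈Y1 ne))))) (sym q)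
     module M = Modes.PP U K MN mn-y (nd ∘ inj₁)
   ... | inj₁ (p , r) = go Y1 refl
     where
     go : ∀ W → Y1 ≡ W → Goal
     go [] w = ⊥-elim (<-asym y<c (subst (_< y₀) (sym (∷-injectiveˡ (trans (cong (_++ c ∷ Y2) (sym w)) r))) (All.lookup (D>m validR) (subst (y₀ ∈_) p (∈-++⁺ʳ D1 (here refl))))))
     go (z ∷ Z) w = subst₂ (λ A B → LC U X Y ⇔ LA U A B MN a₀) (trans (snoc-assoc y₀ z) (cong₂ _∷ʳ_ p z≡)) (∷-injectiveʳ r′)
                      (mk⇔ (M.to ∘ Equivalence.to (shift-LC w)) (Equivalence.from (shift-LC w) ∘ M.from))
       where
       r′ : z ∷ Z ++ c ∷ Y2 ≡ m R ∷ I R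
       r′ = trans (cong (_++ c ∷ Y2) (sym w)) r
       z≡ : z ≡ m R
       z≡ = ∷-injectiveˡ r′
       z<y : z < y₀
       z<y = subst (_< y₀) (sym z≡) (All.lookup (D>m validR) (subst (y₀ ∈_) p (∈-++⁺ʳ D1 (here refl))))
       y∉ : ¬ y₀ ∈ D2 ∷ʳ z
       y∉ q = [ nd ∘ inj₁ , (λ { refl → <-irrefl refl z<y }) ]′ (∈-∷ʳ⁻ D2 q)
       module M = Modes.PP U (shifted w z<y) MN (λ q → ⊥-elim (<-irrefl (trans z≡ (sym q)) (All.head (subst (All (_< a₀)) w Y1<a)))) y∉

   goal-bp : dB → ¬ iB → flat R ≡ X ++ Y* → Goal
   goal-bp db ni e with two-words validR X e descX (ascY* (Y2>c (ni ∘ inj₁)))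
   ... | inj₂ (p , r) = subst₂ (λ A B → LC U X Y ⇔ LA U A B MN a₀) p r (mk⇔ M.to M.from)
     where
     mn-no : ¬ MN a₀
     mn-no q = <-irrefl (trans q (sym (∷ʳ-injectiveʳ D1 (D R) (trans (cong (λ w → D1 ++ c ∷ w) (sym D2≡)) p)))) a<c
       where D2≡ = last-D2 c p Y1-cases (λ ne w≡ → subst (m R <_) (sym w≡) (All.lookup (I>m validR) (subst (m (rowOf K) ∈_) r (∈-++⁺ˡ (m′∈Y1 ne))))) (sym q)
     module M = Modes.BP U K MN mn-no
   ... | inj₁ (p , r) = go Y1 refl
     where
     go : ∀ W → Y1 ≡ W → Goal
     go [] w = ⊥-elim (<-irrefl refl (subst (_< c) (sym (∷-injectiveˡ (trans (cong (_++ c ∷ Y2) (sym w)) r))) (All.lookup (D>m validR) (subst (c ∈_) p (∈-++⁺ʳ D1 (here refl))))))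
     go (z ∷ Z) w = subst₂ (λ A B → LC U X Y ⇔ LA U A B MN a₀) (trans (snoc-assoc c z) (cong₂ _∷ʳ_ p z≡)) (∷-injectiveʳ r′)
                      (mk⇔ (M.to ∘ Equivalence.to (shift-LC w)) (Equivalence.from (shift-LC w) ∘ M.from))
       where
       r′ : z ∷ Z ++ c ∷ Y2 ≡ m R ∷ I R
       r′ = trans (cong (_++ c ∷ Y2) (sym w)) r
       z≡ : z ≡ m R
       z≡ = ∷-injectiveˡ r′
       K′ : Cfg
       -- z need not lie below y₀. In a mode that does not place y, any y with D2 ≤ y < c gives the
       -- same words, so it is raised to cover z.
       K′ = cfg D1 (D2 ∷ʳ z) Z Y2 c a₀ (y₀ ⊔ z) D1>c (⊔-pres-<m y<c z<c) (All.∷ʳ⁺ (All.map (λ q → ≤-trans q (m≤m⊔n y₀ z)) D2≤y) (m≤n⊔m y₀ z)) (All.tail (subst (All (_< a₀)) w Y1<a)) a<c Y2≥c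
         where
         z<c : z < c
         z<c = <-trans (All.head (subst (All (_< a₀)) w Y1<a)) a<c
       module M = Modes.BP U K′ MN (λ q → <-irrefl (trans z≡ (sym q)) (All.head (subst (All (_< a₀)) w Y1<a)))

   goal-pb : ¬ dB → iBP → flat R ≡ X* ++ Y → Goal
   goal-pb nd ib e with two-words validR X* e (descX* (D2<y (nd ∘ inj₁))) ascY | Wit.next K vS ascY (base (Adm-X K adK)) (subst (size S <_) (cong length (flat-rowOf K)) (room adK)) ib
   ... | inj₂ (p , r) | z , z∈ , c≤z , D1>z = subst₂ (λ A B → LC U X Y ⇔ LA U A B MN a₀) p r (mk⇔ M.to M.from)
     where
     B-cases : ∀ {b} → b ∈ Y → b ≤ a₀ ⊎ c ≤ b
     B-cases b∈ with ∈-++⁻ Y1 b∈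
     ... | inj₁ p = inj₁ (<⇒≤ (All.lookup Y1<a p))
     ... | inj₂ (here refl) = inj₁ ≤-refl
     ... | inj₂ (there p) = inj₂ (All.lookup Y2≥c p)
     a∈ : a₀ ∈ Y
     a∈ = ∈-++⁺ʳ Y1 (here refl)
     module M = Modes.PB U K MN Y (inj₁ a∈) (inj₂ a∈) B-cases (nd ∘ inj₁) (z , ∈-++⁺ʳ Y1 (there z∈) , c≤z , D1>z)
   ... | inj₁ (p , r) | u , u∈ , c≤u , D1>u = go Y1 refl
     where
     m<y : m R < y₀
     m<y = All.lookup (D>m validR) (subst (y₀ ∈_) p (∈-++⁺ʳ D1 (here refl)))
     go : ∀ W → Y1 ≡ W → Goal
     go [] w = subst₂ (λ A B → LC U X Y ⇔ LA U A B MN a₀) (trans (snoc-assoc y₀ a₀) (cong₂ _∷ʳ_ p a≡m)) (∷-injectiveʳ r′)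
                 (mk⇔ (λ l → M.to (subst (λ v → LC U v Y2) (sym (snoc-assoc c a₀)) (move-out X>a Y2>a (subst (λ v → LC U X (v ++ a₀ ∷ Y2)) w l))))
                      (λ l → subst (λ v → LC U X (v ++ a₀ ∷ Y2)) (sym w) (move-in X>a Y2>a (subst (λ v → LC U v Y2) (snoc-assoc c a₀) (M.from l)))))
       where
       r′ : a₀ ∷ Y2 ≡ m R ∷ I R
       r′ = trans (cong (_++ a₀ ∷ Y2) (sym w)) r
       a≡m : a₀ ≡ m R
       a≡m = ∷-injectiveˡ r′
       a<y : a₀ < y₀
       a<y = subst (_< y₀) (sym a≡m) m<y
       X>a : All (a₀ <_) X
       X>a = subst (λ v → All (v <_) X) (∷-injectiveˡ (trans (mI-rowOf K) (cong (_++ a₀ ∷ Y2) w))) (All.tabulate mI<D)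
       Y2>a : All (a₀ <_) Y2
       Y2>a = All.map (<-≤-trans a<c) Y2≥c
       K′ : Cfg
       K′ = cfg D1 (D2 ∷ʳ a₀) [] Y2 c a₀ y₀ D1>c y<c (All.∷ʳ⁺ D2≤y (<⇒≤ a<y)) [] a<c Y2≥c
       y∉ : ¬ y₀ ∈ D2 ∷ʳ a₀
       y∉ q = [ nd ∘ inj₁ , (λ e₁ → <-irrefl (sym e₁) a<y) ]′ (∈-∷ʳ⁻ D2 q)
       module M = Modes.PB U K′ MN Y2 (inj₂ (a≡m , a<y)) (inj₁ (∈-++⁺ʳ D1 (there (∈-++⁺ʳ D2 (here refl))))) (λ b∈ → inj₂ (All.lookup Y2≥c b∈)) y∉ (u , u∈ , c≤u , D1>u)
     go (z ∷ Z) w = subst₂ (λ A B → LC U X Y ⇔ LA U A B MN a₀) (trans (snoc-assoc y₀ z) (cong₂ _∷ʳ_ p z≡)) (∷-injectiveʳ r′)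
                      (mk⇔ (M.to ∘ Equivalence.to (shift-LC w)) (Equivalence.from (shift-LC w) ∘ M.from))
       where
       r′ : z ∷ Z ++ a₀ ∷ Y2 ≡ m R ∷ I R
       r′ = trans (cong (_++ a₀ ∷ Y2) (sym w)) r
       z≡ : z ≡ m R
       z≡ = ∷-injectiveˡ r′
       z<y : z < y₀
       z<y = subst (_< y₀) (sym z≡) m<y
       y∉ : ¬ y₀ ∈ D2 ∷ʳ z
       y∉ q = [ nd ∘ inj₁ , (λ { refl → <-irrefl refl z<y }) ]′ (∈-∷ʳ⁻ D2 q)
       Z<a = All.tail (subst (All (_< a₀)) w Y1<a)
       B-cases : ∀ {b} → b ∈ Z ++ a₀ ∷ Y2 → b ≤ a₀ ⊎ c ≤ b
       B-cases b∈ with ∈-++⁻ Z b∈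
       ... | inj₁ p = inj₁ (<⇒≤ (All.lookup Z<a p))
       ... | inj₂ (here refl) = inj₁ ≤-refl
       ... | inj₂ (there p) = inj₂ (All.lookup Y2≥c p)
       a∈ : a₀ ∈ Z ++ a₀ ∷ Y2
       a∈ = ∈-++⁺ʳ Z (here refl)
       module M = Modes.PB U (shifted w z<y) MN (Z ++ a₀ ∷ Y2) (inj₁ a∈) (inj₂ a∈) B-cases y∉ (u , ∈-++⁺ʳ Z (there u∈) , c≤u , D1>u)

   -- The row is unchanged and contains a. Every larger letter of its right part is at least c, and
   -- c in the left part separates a from it. So `E` and `In` hold at a, and admissibility of a
   -- amounts to compatibility.
   goal-bb : flat R ≡ X ++ Y → Goal
   goal-bb e = mk⇔ (to ∘ Equivalence.from R-rep) (Equivalence.to R-rep ∘ lbase)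
     where
     R≡ : R ≡ rowOf K
     R≡ = flat-injective validR vK (trans e (sym (flat-rowOf K)))
     R-rep : LC U (D R ∷ʳ m R) (I R) ⇔ LC U X Y
     R-rep = subst (λ r → LC U (D r ∷ʳ m r) (I r) ⇔ LC U X Y) (trans R′≡ (sym R≡)) R′-rep
     a∈ : a₀ ∈ m R ∷ I R
     a∈ = subst (a₀ ∈_) (trans (sym (mI-rowOf K)) (cong (λ r → m r ∷ I r) (sym R≡))) (∈-++⁺ʳ Y1 (here refl))
     c∈ : c ∈ D R ∷ʳ m R
     c∈ = ∈-++⁺ˡ (subst (c ∈_) (trans (sym (D-rowOf K)) (cong D (sym R≡))) (∈-++⁺ʳ D1 (here refl)))
     a∈AB : a₀ ∈ D R ∷ʳ m R ⊎ a₀ ∈ I R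
     a∈AB with a∈
     ... | here q = inj₁ (∈-++⁺ʳ (D R) (here q))
     ... | there q = inj₂ q
     big : ∀ {b} → b ∈ I R → a₀ < b → c ≤ b
     big {b} b∈ a<b with ∈-++⁻ Y1 (subst (b ∈_) (trans (cong (λ r → m r ∷ I r) R≡) (mI-rowOf K)) (there b∈))
     ... | inj₁ p = ⊥-elim (<-asym a<b (All.lookup Y1<a p))
     ... | inj₂ (here refl) = ⊥-elim (<-irrefl refl a<b)
     ... | inj₂ (there p) = All.lookup Y2≥c p
     ev : Eᴸ (D R ∷ʳ m R) (I R) a₀
     ev b∈ a<b = gt-mem c∈ a<c (big b∈ a<b)
     to : LC U (D R ∷ʳ m R) (I R) → LA U (D R ∷ʳ m R) (I R) MN a₀
     to l = la l (cl l a∈AB) (λ _ → ev) (λ pt a<v _ → go a∈ a<v)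
       where
       go : ∀ {v} → a₀ ∈ m R ∷ I R → a₀ < v → (∃[ b ] b ∈ I R × a₀ ≤ b × b < v) ⊎ (MN a₀ × Eᴸ (D R ∷ʳ m R) (I R) a₀)
       go (here q) _ = inj₂ (q , ev)
       go (there q) a<v = inj₁ (a₀ , q , ≤-refl , a<v)

   goal : Goal
   goal with flat R in eq | mode
   ... | _ | pp nd ni = goal-pp nd ni eq
   ... | _ | pb nd ib = goal-pb nd ib eq
   ... | _ | bp db ni = goal-bp db ni eq
   ... | _ | bb db ib = goal-bb eq

   same-size : size (just R) ≡ size (just R′)
   same-size = trans (size-flat R) (trans (trans (len-mode K mode) (sym (cong length (flat-rowOf K)))) (trans (cong (length ∘ flat) (sym R′≡)) (sym (size-flat R′))))

   through : Compat U (just R′) ⇔ Adm U (just R) a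
   through = mk⇔
     (λ p → adm (subst (AdmXY (D U) (m U ∷ I U) (just R)) (sym a≡) (Equivalence.from Adm⇔LA (Equivalence.to goal (Equivalence.to R′-rep (Equivalence.to UC⇔LC (ucond p))))))
                (subst (_< length (flat U)) (sym same-size) (shorter p)))
     (λ p → compat (Equivalence.from UC⇔LC (Equivalence.from R′-rep (Equivalence.from goal (Equivalence.to Adm⇔LA (subst (AdmXY (D U) (m U ∷ I U) (just R)) a≡ (axy p))))))
                   (subst (_< length (flat U)) same-size (room p)))

-- Admissibility of the letter that leaves a row

module Placement where

 open Rows
 open Compatibility
 open Reverse
 open import Relation.Nullary.Decidable using (_×-dec_)
 open DecMem _≟_ using (_∈?_)

 module Place (K : Cfg) {S : Maybe Row} (vS : ValidLow S) where
   open Cfg K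
   open CfgLemmas K
   open LowerV S vS

   gt-X*-≤q : ∀ {s} → y ≤ s → gt s X* ≤ q
   gt-X*-≤q {s} y≤s with s <? c
   ... | yes p = ≤-reflexive (gt-X*-mid y≤s p)
   ... | no p = subst (_≤ q) (sym (gt-X*-hi (≮⇒≥ p))) (gt-X-hi (≮⇒≥ p))

   X*≤X : ∀ s → gt s X* ≤ gt s X
   X*≤X s with y ≤? s | s <? c
   ... | no p | _ = ≤-reflexive (gt-X*-lo (≰⇒> p))
   ... | yes _ | no p = ≤-reflexive (gt-X*-hi (≮⇒≥ p))
   ... | yes p | yes r = subst₂ _≤_ (sym (gt-X*-mid p r)) (sym (gt-X p r)) (n≤1+n q)

   module Left {Z} (U : UC X* Z S) where

     -- Otherwise the letter of A in position q lies above y, and by CL more than q letters of X*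
     -- lie above it; but at most q lie above y.
     gy≤q : g y ≤ q
     gy≤q = ≮⇒≥ λ q<gy → let a′ , a∈ , y<a′ , e = g-sel q<gy in
       <⇒≱ (subst (_< gt a′ X*) e (CL U (inj₁ a∈))) (gt-X*-≤q (<⇒≤ y<a′))

     al : g y < gt y X
     al = ≤-trans (s≤s gy≤q) (≤-reflexive (sym (gt-X ≤-refl y<c)))

     ae : gt y X ≡ suc (g y) → E y
     ae e {b} b∈ y<b = <-≤-trans (CL U (inj₂ b∈)) (≤-trans (gt-X*-≤q (<⇒≤ y<b)) (≤-reflexive (suc-injective (trans (sym (gt-X ≤-refl y<c)) e))))

     clX : ∀ {s} → Elem S s → g s < gt s X
     clX {s} e = <-≤-trans (CL U e) (X*≤X s)

     hy : h y < length X + lt y Z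
     hy = subst (h y <_) (cong (_+ lt y Z) len-X*) (CR U (inj₁ (∈-++⁺ʳ D1 (here refl))))

     crX : ∀ {v} → v ∈ X → ¬ v ≡ c → h v < length X + lt v Z
     crX {v} v∈ ne with ∈-++⁻ D1 v∈
     ... | inj₁ p = subst (h v <_) (cong (_+ lt v Z) len-X*) (CR U (inj₁ (∈-++⁺ˡ p)))
     ... | inj₂ (here e) = ⊥-elim (ne e)
     ... | inj₂ (there p) = subst (h v <_) (cong (_+ lt v Z) len-X*) (CR U (inj₁ (∈-++⁺ʳ D1 (there p))))

     crY : ∀ {r} → r ∈ Z → h (suc r) < length X + lt (suc r) Z
     crY {r} r∈ = subst (h (suc r) <_) (cong (_+ lt (suc r) Z) len-X*) (CR U (inj₂ (r , r∈ , refl)))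

     ¬LB : ¬ (Elem S y × g y ≡ q)
     ¬LB (el , e) = <-irrefl refl (subst₂ _<_ e (gt-X*-mid ≤-refl y<c) (CL U el))

   -- X* | Z is compatible with S, which refutes `LB`. The hypotheses on the head of Y1 and on `iBP`
   -- exclude a duplicate of the minimum, and the last one excludes `ip`.
   nd : ∀ {Z} → UC X* Z S → All (_< y) D2 → (∀ {z W} → Y1 ≡ z ∷ W → ¬ y ≡ z) → (Y1 ≡ [] → y ∈ Y → ¬ Conditions.iBP K S) → Asc Y →
        (D2 ≡ [] → h (suc y) < suc q ⊎ (¬ All (y ≤_) Y × (¬ Y1 ≡ [] ⊎ Conditions.iBP K S))) → ¬ Conditions.dB K S
   nd U D2<y hd nib aY ipx (inj₁ p) = <-irrefl refl (All.lookup D2<y p)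
   nd U D2<y hd nib aY ipx (inj₂ (inj₂ (inj₁ lb))) = Left.¬LB U lb
   nd U D2<y hd nib aY ipx (inj₂ (inj₂ (inj₂ (y∈ , hy , e , low)))) with ipx e
   ... | inj₁ p = <-irrefl (trans (h-suc-mem y∈) (cong suc hy)) p
   ... | inj₂ (nl , ne) = [ nl , (λ { (e₁ , ni) → [ (λ f → f e₁) , ni ]′ ne }) ]′ low
   nd U D2<y hd nib aY ipx (inj₂ (inj₁ ((y∈ , low) , r))) = go Y1 refl
     where
     go : ∀ W → Y1 ≡ W → ⊥
     go [] e = [ (λ f → f e) , nib e y∈ ]′ r
     go (z ∷ W) e = hd e (≤-antisym (All.lookup low (subst (λ w → z ∈ w ++ a ∷ Y2) (sym e) (here refl))) z≤y)
       where
       head≤ : ∀ {t T u} → Asc (t ∷ T) → u ∈ t ∷ T → t ≤ u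
       head≤ _ (here refl) = ≤-refl
       head≤ (p ∷ _) (there r) = <⇒≤ (All.lookup p r)
       z≤y : z ≤ y
       z≤y = head≤ (subst (λ w → Asc (w ++ a ∷ Y2)) e aY) (subst (λ w → y ∈ w ++ a ∷ Y2) e y∈)

   module PP (U : UC X* Y* S) (c∉ : ¬ c ∈ Y2) where
     open Left U public

     Y2>c : All (c <_) Y2
     Y2>c = All.tabulate λ {u} u∈ → ≤∧≢⇒< (All.lookup Y2≥c u∈) λ { refl → c∉ u∈ }

     lt-c+1 : lt (suc c) Y* ≡ suc (length Y1)
     lt-c+1 = trans (lt-++ (suc c) Y1 (c ∷ Y2)) (trans (cong₂ _+_ (lt-all (suc c) (All.map (λ p → <-trans p (m≤n⇒m≤1+n a<c)) Y1<a))
                (trans (lt-yes (suc c) Y2 ≤-refl) (cong suc (lt-none (suc c) Y2>c)))) (+-comm _ 1))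

     hsc≤x : h (suc c) ≤ x
     hsc≤x = s≤s⁻¹ (subst (h (suc c) <_) (trans (cong (length X +_) lt-c+1) (+-suc _ _)) (crY (∈-++⁺ʳ Y1 (here refl))))

     lt≤ : ∀ v → lt v Y* ≤ lt v Y
     lt≤ v with v ≤? a | c <? v
     ... | yes p | _ = ≤-reflexive (lt-Y-lo p)
     ... | no _ | yes p = ≤-reflexive (lt-Y-hi p)
     ... | no p | no r = subst₂ _≤_ (sym (lt-Y*-mid (≰⇒> p) (≮⇒≥ r))) (sym (lt-Y-mid (≰⇒> p) (≮⇒≥ r))) (n≤1+n _)

     cr : ∀ {v} → Pt X Y v → h v < length X + lt v Y
     cr {v} (inj₁ v∈) with v ≟ c
     ... | no ne = <-≤-trans (crX v∈ ne) (+-monoʳ-≤ (length X) (lt≤ v))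
     ... | yes refl = ≤-<-trans (h-mono (n≤1+n c)) (≤-<-trans hsc≤x (≤-reflexive (sym (H-mid a<c ≤-refl))))
     cr (inj₂ (r , r∈ , refl)) with ∈-++⁻ Y1 r∈
     ... | inj₁ p = <-≤-trans (crY (∈-++⁺ˡ p)) (+-monoʳ-≤ (length X) (lt≤ (suc r)))
     ... | inj₂ (there p) = <-≤-trans (crY (∈-++⁺ʳ Y1 (there p))) (+-monoʳ-≤ (length X) (lt≤ (suc r)))
     ... | inj₂ (here refl) = ≤-<-trans (h-mono (s≤s (<⇒≤ a<c))) (≤-<-trans hsc≤x (≤-reflexive (sym (H-mid ≤-refl a<c))))

     -- y was a letter of X*, so CR bounds `h y` by the old count at y. From y to a later test point
     -- the count of X | Y exceeds this one, and tightness forces h to grow too; hence B has a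
     -- letter in between.
     ar : ∀ {v} → Pt X Y v → y < v → length X + lt v Y ≡ suc (h v) → In y v
     ar {v} pt y<v e = inj₁ (h-gap (s≤s⁻¹ (≤-<-trans hy (≤-trans (≤-reflexive (sym (+-suc _ _))) (≤-trans (+-monoʳ-≤ (length X) (up pt)) (≤-reflexive e))))))
       where
       up : Pt X Y v → lt y Y* < lt v Y
       up (inj₁ v∈) = ≤-<-trans (lt-mono Y* (<⇒≤ y<c)) (<-≤-trans (≤-reflexive (cong suc (lt-Y*-mid a<c ≤-refl)))
                        (≤-trans (≤-reflexive (sym (lt-Y-mid a<c ≤-refl))) (lt-mono Y (X-above v∈ y<v))))
       up (inj₂ (r , r∈ , refl)) = ≤-<-trans (lt≤ y) (lt-mem r∈ (s≤s⁻¹ y<v) ≤-refl)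

     admits : AdmXY X Y S y
     admits = admXY (uc clX cr) al ae ar

     ¬iBP : ¬ Conditions.iBP K S
     ¬iBP (inj₁ p) = c∉ p
     ¬iBP (inj₂ (c∈ , e)) = <⇒≱ (≤-reflexive (sym (trans (h-suc-mem c∈) (cong suc e)))) hsc≤x

   module PB (U : UC X* Y S) (hc≤x : h c ≤ x) (hy≢x : a < y → ¬ h y ≡ x) where
     open Left U public

     cr : ∀ {v} → Pt X Y v → h v < length X + lt v Y
     cr {v} (inj₁ v∈) with v ≟ c
     ... | no ne = crX v∈ ne
     ... | yes refl = ≤-<-trans hc≤x (≤-reflexive (sym (H-mid a<c ≤-refl)))
     cr (inj₂ (r , r∈ , refl)) = crY r∈

     ar : ∀ {v} → Pt X Y v → y < v → length X + lt v Y ≡ suc (h v) → In y v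
     ar {v} (inj₂ (r , r∈ , refl)) y<v e = inj₁ (h-gap (s≤s⁻¹ (≤-<-trans hy (≤-trans (≤-reflexive (sym (+-suc _ _)))
         (≤-trans (+-monoʳ-≤ (length X) (lt-mem r∈ (s≤s⁻¹ y<v) ≤-refl)) (≤-reflexive e))))))
     ar {v} (inj₁ v∈) y<v e with h y <? h v
     ... | yes p = inj₁ (h-gap p)
     ... | no p = ⊥-elim (hy≢x a<y hy≡x)
       where
       x≤hv : x ≤ h v
       x≤hv = s≤s⁻¹ (≤-trans (≤-reflexive (sym (H-mid a<c ≤-refl))) (≤-trans (+-monoʳ-≤ (length X) (lt-mono Y (X-above v∈ y<v))) (≤-reflexive e)))
       hy≡x : h y ≡ x
       hy≡x = ≤-antisym (≤-trans (h-mono (<⇒≤ y<c)) hc≤x) (≤-trans x≤hv (≮⇒≥ p))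
       a<y : a < y
       a<y = ≰⇒> λ y≤a → <⇒≱ hy (≤-trans (+-monoʳ-≤ (length X) (≤-trans (lt-mono Y y≤a) (≤-reflexive lt-a))) (≤-reflexive (sym hy≡x)))
         where
         lt-a : lt a Y ≡ length Y1
         lt-a = trans (lt-++ a Y1 (a ∷ Y2)) (trans (cong₂ _+_ (lt-all a Y1<a) (lt-none a (≤-refl ∷ All.map (λ p → ≤-trans (<⇒≤ a<c) p) Y2≥c))) (+-identityʳ _))

     admits : AdmXY X Y S y
     admits = admXY (uc clX cr) al ae ar

 largest : ∀ {P : ℕ → Set} → (∀ u → Dec (P u)) → ∀ xs →
           (∃[ s ] s ∈ xs × P s × (∀ {u} → u ∈ xs → P u → u ≤ s)) ⊎ (∀ {u} → u ∈ xs → ¬ P u)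
 largest P? [] = inj₂ λ ()
 largest P? (x ∷ xs) with P? x | largest P? xs
 ... | no nx | inj₂ n = inj₂ λ { (here refl) → nx ; (there p) → n p }
 ... | no nx | inj₁ (s , s∈ , ps , mx) = inj₁ (s , there s∈ , ps , λ { (here refl) pu → ⊥-elim (nx pu) ; (there p) pu → mx p pu })
 ... | yes px | inj₂ n = inj₁ (x , here refl , px , λ { (here refl) _ → ≤-refl ; (there p) pu → ⊥-elim (n p pu) })
 ... | yes px | inj₁ (s , s∈ , ps , mx) with ≤-total x s
 ... | inj₁ x≤s = inj₁ (s , there s∈ , ps , λ { (here refl) _ → x≤s ; (there p) pu → mx p pu })
 ... | inj₂ s≤x = inj₁ (x , here refl , px , λ { (here refl) _ → ≤-refl ; (there p) pu → ≤-trans (mx p pu) s≤x })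

 least : ∀ {P : ℕ → Set} → (∀ u → Dec (P u)) → ∀ xs →
         (∃[ s ] s ∈ xs × P s × (∀ {u} → u ∈ xs → P u → s ≤ u)) ⊎ (∀ {u} → u ∈ xs → ¬ P u)
 least P? [] = inj₂ λ ()
 least P? (x ∷ xs) with P? x | least P? xs
 ... | no nx | inj₂ n = inj₂ λ { (here refl) → nx ; (there p) → n p }
 ... | no nx | inj₁ (s , s∈ , ps , mx) = inj₁ (s , there s∈ , ps , λ { (here refl) pu → ⊥-elim (nx pu) ; (there p) pu → mx p pu })
 ... | yes px | inj₂ n = inj₁ (x , here refl , px , λ { (here refl) _ → ≤-refl ; (there p) pu → ⊥-elim (n p pu) })
 ... | yes px | inj₁ (s , s∈ , ps , mx) with ≤-total s x
 ... | inj₁ s≤x = inj₁ (s , there s∈ , ps , λ { (here refl) _ → s≤x ; (there p) pu → mx p pu })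
 ... | inj₂ x≤s = inj₁ (x , here refl , px , λ { (here refl) _ → ≤-refl ; (there p) pu → ≤-trans x≤s (mx p pu) })

 IsMin? : ∀ S y → Dec (IsMin S y)
 IsMin? nothing y = no id
 IsMin? (just r) y = y ≟ m r

 min-exists : ∀ S → 0 < length (left S) → ∃[ s ] IsMin S s
 min-exists (just r) _ = m r , refl

 module Block (D1 D2 Y1 Y2 : List ℕ) (c a : ℕ) (D1>c : All (c <_) D1) (Y1<a : All (_< a) Y1) (a<c : a < c)
              (Y2≥c : All (c ≤_) Y2) {S : Maybe Row} (vS : ValidLow S) where
   open LowerV S vS

   K : ∀ y → y < c → All (_≤ y) D2 → Cfg
   K y p r = cfg D1 D2 Y1 Y2 c a y D1>c p r Y1<a a<c Y2≥c

   X Y Y* : List ℕ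
   X = D1 ++ c ∷ D2
   Y = Y1 ++ a ∷ Y2
   Y* = Y1 ++ c ∷ Y2

   q x : ℕ
   q = length D1
   x = length X + length Y1

   Chosen : Set
   Chosen = ∃[ y ] Σ (y < c) λ p → Σ (All (_≤ y) D2) λ r → AdmXY X Y S y × Conditions.dB (K y p r) S

   -- The sources of AR at y: y lies in B and is itself the letter in between, or it is the minimum
   -- of S with `E`, or `h y` is small enough for h to grow before any tight point.
   Good : (ℕ → Set) → ℕ → Set
   Good Hy y = y ∈ B ⊎ (IsMin S y × E y) ⊎ Hy y

   -- yd is the letter that c meets when S plays no part: the head of D2 or, if D2 is empty, the
   -- minimum of the row.
   data Next (yd : ℕ) : Set where
     inD2 : yd ∈ D2 → Next yd
     valley : D2 ≡ [] → yd ∈ Y → All (yd ≤_) Y → h (suc yd) ≤ length X → Next yd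

   module Choose
     (Hy : ℕ → Set)
     (clX : ∀ {s} → Elem S s → g s < gt s X)
     (crX : ∀ {v} → Pt X Y v → h v < length X + lt v Y)
     (AR′ : ∀ {y} → y < c → All (_≤ y) D2 → Good Hy y → ∀ {v} → Pt X Y v → y < v → length X + lt v Y ≡ suc (h v) → In y v)
     (yd : ℕ) (yd<c : yd < c) (D2≤yd : All (_≤ yd) D2) (nx : Next yd)
     (Hyd : yd ∈ D2 → Hy yd)
     (Hyv : D2 ≡ [] → h yd < length X → Hy yd)
     (Hym : ∀ {s} → yd < s → s < c → h s ≡ h yd → Hy yd → Hy s)
     (iB-val : D2 ≡ [] → Y1 ≡ [] → ¬ Conditions.iBP (K yd yd<c D2≤yd) S → h c ≡ x)
     where

     module L (y : ℕ) (y<c : y < c) (D2≤y : All (_≤ y) D2) = CfgLemmas (K y y<c D2≤y)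

     gtX : ∀ {s} → yd ≤ s → s < c → gt s X ≡ suc q
     gtX = L.gt-X yd yd<c D2≤yd

     gtX-hi : ∀ {s} → c ≤ s → gt s X ≤ q
     gtX-hi = L.gt-X-hi yd yd<c D2≤yd

     -- For s in S above yd this is `LB` with s in the place of y. The largest such letter is the
     -- one that leaves.
     Cand : ℕ → Set
     Cand s = yd < s × s < c × g s ≡ q

     NoCand : Set
     NoCand = ∀ {u} → u ∈ A ++ B → ¬ Cand u

     elem : ∀ {u} → Elem S u → u ∈ A ++ B
     elem = [ ∈-++⁺ˡ , ∈-++⁺ʳ A ]′

     g≤q-at : ∀ {s} → Elem S s → yd ≤ s → g s ≤ q
     g≤q-at {s} el yd≤s with s <? c
     ... | yes p = s≤s⁻¹ (subst (g s <_) (gtX yd≤s p) (clX el))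
     ... | no p = <⇒≤ (<-≤-trans (clX el) (gtX-hi (≮⇒≥ p)))

     above-c : ∀ {b} → b ∈ B → c ≤ b → g b < q
     above-c b∈ c≤b = <-≤-trans (clX (inj₂ b∈)) (gtX-hi c≤b)

     mk : ∀ y (y<c : y < c) (D2≤y : All (_≤ y) D2) → g y ≤ q → (g y ≡ q → E y) → Good Hy y → Conditions.dB (K y y<c D2≤y) S → Chosen
     mk y y<c D2≤y gy ey good db = y , y<c , D2≤y ,
       admXY (uc clX crX) (≤-trans (s≤s gy) (≤-reflexive (sym gty))) (λ e → ey (suc-injective (trans (sym e) gty))) (AR′ y<c D2≤y good) , db
       where gty = L.gt-X y y<c D2≤y ≤-refl y<c

     -- Maximality of s gives `E s`: a letter of B above s and below c with g equal to q would be a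
     -- larger candidate, and from c on CL keeps g below q.
     pick : ∀ s → s ∈ A ++ B → Cand s → (∀ {u} → u ∈ A ++ B → Cand u → u ≤ s) → Chosen
     pick s s∈ (yd<s , s<c , gs) mx = mk s s<c D2≤s (≤-reflexive gs) es good (inj₂ (inj₂ (inj₁ (el , gs))))
       where
       el : Elem S s
       el = ∈-++⁻ A s∈
       D2≤s : All (_≤ s) D2
       D2≤s = All.map (λ p → ≤-trans p (<⇒≤ yd<s)) D2≤yd
       es : g s ≡ q → E s
       es _ {b} b∈ s<b with b <? c
       ... | no p = <-≤-trans (above-c b∈ (≮⇒≥ p)) (≤-reflexive (sym gs))
       ... | yes p = subst (g b <_) (sym gs) (≤∧≢⇒< (g≤q-at (inj₂ b∈) (<⇒≤ (<-trans yd<s s<b)))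
                       (λ e → <⇒≱ s<b (mx (elem (inj₂ b∈)) (<-trans yd<s s<b , p , e))))
       flat-h : s ∈ A → h s ≡ h yd
       flat-h s∈A = ≤-antisym (≮⇒≥ λ lt′ → let b , b∈ , yd≤b , b<s = h-gap lt′ in
           <⇒≱ (subst (_< g b) gs (gt-mem s∈A b<s ≤-refl)) (g≤q-at (inj₂ b∈) yd≤b)) (h-mono (<⇒≤ yd<s))
       by : Next yd → s ∈ A → suc (g s) < length A → Good Hy s
       by (inD2 p) s∈A nm = inj₂ (inj₂ (Hym yd<s s<c (flat-h s∈A) (Hyd p)))
       by (valley e _ _ hv) s∈A nm = ⊥-elim (<⇒≱ (≤-trans (s≤s (subst (λ w → suc w ≤ length A) (cong suc gs) nm)) (s≤s (A≤h yd)))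
                                      (s≤s (≤-trans (≤-trans (h-mono (n≤1+n yd)) hv) (≤-reflexive (trans (cong (λ w → length (D1 ++ c ∷ w)) e) (len-∷ʳ D1))))))
       good : Good Hy s
       good with el
       ... | inj₂ s∈B = inj₁ s∈B
       ... | inj₁ s∈A with A-cases s∈A
       ... | inj₁ mn = inj₂ (inj₁ (mn , es gs))
       ... | inj₂ nm = by nx s∈A nm

     module None (no-cand : NoCand) where

       gyd≤q : g yd ≤ q
       gyd≤q = ≮⇒≥ λ q<g → let s , s∈ , yd<s , e = g-sel q<g in
         no-cand (∈-++⁺ˡ s∈) (yd<s , ≰⇒> (λ c≤s → <⇒≱ (subst (_< gt s X) e (clX (inj₁ s∈))) (gtX-hi c≤s)) , e)

       beyond : ∀ {b} → b ∈ B → yd < b → g b < q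
       beyond {b} b∈ yd<b with b <? c
       ... | no p = above-c b∈ (≮⇒≥ p)
       ... | yes p = ≤∧≢⇒< (g≤q-at (inj₂ b∈) (<⇒≤ yd<b)) (λ e → no-cand (∈-++⁺ʳ A b∈) (yd<b , p , e))

       eyd : g yd ≡ q → E yd
       eyd e b∈ yd<b = subst (_ <_) (sym e) (beyond b∈ yd<b)

       stay : Good Hy yd → Conditions.dB (K yd yd<c D2≤yd) S → Chosen
       stay = mk yd yd<c D2≤yd gyd≤q eyd

       module Valley (e : D2 ≡ []) (yd∈ : yd ∈ Y) (low : All (yd ≤_) Y) (hv : h (suc yd) ≤ length X) where

         X≡ : length X ≡ suc q
         X≡ = trans (cong (λ w → length (D1 ++ c ∷ w)) e) (len-∷ʳ D1)

         nil≤ : ∀ {y} → All (_≤ y) D2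
         nil≤ = subst (All (_≤ _)) (sym e) []

         yd∉B : h yd ≡ suc q → ¬ yd ∈ B
         yd∉B hy b∈ = <⇒≱ (≤-reflexive (sym (trans (h-suc-mem b∈) (cong suc (trans hy (sym X≡)))))) hv

         -- Since `h z` is q + 1, position q of S is occupied by a letter counted at z: a letter of
         -- B if A has at most q letters, and the minimum of S if A has q + 1.
         sigma : ∀ z → h z ≡ suc q → (∃[ b ] b ∈ B × b < z × h b ≡ q) ⊎ (∃[ s ] IsMin S s × g s ≡ q × length A ≡ suc q)
         sigma z hz with length A ≤? q
         ... | yes p = inj₁ (h-sel p (≤-reflexive (sym hz)))
         ... | no p = let s , mn = min-exists S (≤-trans (s≤s z≤n) (≰⇒> p)) in inj₂ (s , mn , suc-injective (trans (min-g mn) A≡) , A≡)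
           where A≡ : length A ≡ suc q
                 A≡ = ≤-antisym (≤-trans (A≤h z) (≤-reflexive hz)) (≰⇒> p)

         -- z is a point where h has the value q + 1. The letter in position q of S lies below it
         -- and becomes y: the minimum of S is blocked by `LB`, a letter of B by `ip`.
         take : ∀ z → z ≤ c → h z ≡ suc q → (∀ {b} → b ∈ B → z ≤ b → g b < q) → (∀ {s} → IsMin S s → g s ≡ q → s < z) →
                (∀ {y} → y < z → All (y ≤_) Y ⊎ (Y1 ≡ [] × (∀ p r → ¬ Conditions.iBP (K y p r) S))) → Chosen
         take z z≤c hz far mnz low′ with sigma z hz
         ... | inj₂ (s , mn , gs , A≡) = mk s s<c nil≤ (≤-reflexive gs) es (inj₂ (inj₁ (mn , es gs))) (inj₂ (inj₂ (inj₁ (inj₁ (min∈ mn) , gs))))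
           where
           s<c : s < c
           s<c = <-≤-trans (mnz mn gs) z≤c
           es : g s ≡ q → E s
           es _ {b} b∈ s<b = subst (g b <_) (sym gs) (far b∈ (≮⇒≥ λ b<z → <⇒≱ (h-mem b∈ ≤-refl b<z) (≤-trans (≤-reflexive hz) (≤-trans (≤-reflexive (sym A≡)) (A≤h b)))))
         ... | inj₁ (b₀ , b∈ , b<z , hb) = mk b₀ b<c nil≤ (s≤s⁻¹ (subst (g b₀ <_) gtb (clX (inj₂ b∈)))) es (inj₁ b∈)
                 (inj₂ (inj₂ (inj₂ (b∈ , hb , e , [ inj₁ , (λ { (p , r) → inj₂ (p , r b<c nil≤) }) ]′ (low′ b<z)))))
           where
           b<c : b₀ < c
           b<c = <-≤-trans b<z z≤c
           gtb : gt b₀ X ≡ suc q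
           gtb = L.gt-X b₀ b<c nil≤ ≤-refl b<c
           es : g b₀ ≡ q → E b₀
           es gq {b} b∈′ b₀<b = subst (g b <_) (sym gq) (far b∈′ (≮⇒≥ λ b<z′ → <⇒≱ (h-mem b∈′ ≤-refl b<z′)
                  (≤-trans (≤-reflexive hz) (≤-trans (≤-reflexive (sym (trans (h-suc-mem b∈) (cong suc hb)))) (h-mono b₀<b)))))

         finish : Good Hy yd → Chosen
         finish good with []? Y1 | Conditions.iBP? (K yd yd<c D2≤yd) S
           where []? : ∀ (xs : List ℕ) → xs ≡ [] ⊎ ¬ xs ≡ []
                 []? [] = inj₁ refl
                 []? (_ ∷ _) = inj₂ λ ()
         ... | inj₂ ne | _ = stay good (inj₂ (inj₁ ((yd∈ , low) , inj₁ ne)))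
         ... | _ | yes ib = stay good (inj₂ (inj₁ ((yd∈ , low) , inj₂ ib)))
         ... | inj₁ Y1≡ | no ni = take c ≤-refl hc (λ b∈ c≤b → above-c b∈ c≤b)
                 (λ {s} mn gs → ≰⇒> (λ c≤s → <⇒≱ (subst (_< gt s X) gs (clX (inj₁ (min∈ mn)))) (gtX-hi c≤s)))
                 (λ _ → inj₂ (Y1≡ , λ _ _ → ni))
           where
           hc : h c ≡ suc q
           hc = trans (iB-val e Y1≡ ni) (trans (cong (λ w → length X + length w) Y1≡) (trans (+-identityʳ _) X≡))

         -- yd is too large if `h yd` is q + 1 and yd is not the minimum of S; then a smaller letter
         -- is taken below yd. Otherwise yd is blocked as the minimum of the row, except when Y1 is
         -- empty and c is not blocked by `iBP`; then a letter below c is taken.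
         result : Chosen
         result with h yd ≟ suc q | IsMin? S yd
         ... | yes hy | no nm = take yd (<⇒≤ yd<c) hy far mnz (λ y<yd → inj₁ (All.map (≤-trans (<⇒≤ y<yd)) low))
           where
           far : ∀ {b} → b ∈ B → yd ≤ b → g b < q
           far {b} b∈ yd≤b = beyond b∈ (≤∧≢⇒< yd≤b λ { refl → yd∉B hy b∈ })
           mnz : ∀ {s} → IsMin S s → g s ≡ q → s < yd
           mnz {s} mn gs with <-cmp s yd
           ... | tri< p _ _ = p
           ... | tri≈ _ refl _ = ⊥-elim (nm mn)
           ... | tri> _ _ p = ⊥-elim (no-cand (∈-++⁺ˡ (min∈ mn)) (p , ≰⇒> (λ c≤s → <⇒≱ (subst (_< gt s X) gs (clX (inj₁ (min∈ mn)))) (gtX-hi c≤s)) , gs))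
         ... | no hy | _ = finish (inj₂ (inj₂ (Hyv e (<-≤-trans (≤∧≢⇒< (≤-trans (≤-trans (h-mono (n≤1+n yd)) hv) (≤-reflexive X≡)) hy) (≤-reflexive (sym X≡))))))
         ... | yes hy | yes mn = finish (inj₂ (inj₁ (mn , eyd gq)))
           where
           gq : g yd ≡ q
           gq = suc-injective (trans (min-g mn) (trans (sym A≡h) hy))
             where A≡h : h yd ≡ length A
                   A≡h = trans (cong (length A +_) (lt-none yd (All.tabulate (λ b∈ → <⇒≤ (min<B mn b∈))))) (+-identityʳ _)

       chosen : Next yd → Chosen
       chosen (inD2 p) = stay (inj₂ (inj₂ (Hyd p))) (inj₁ p)
       chosen (valley e yd∈ low hv) = Valley.result e yd∈ low hv

     choose : Chosen
     choose with largest (λ u → (yd <? u) ×-dec ((u <? c) ×-dec (g u ≟ q))) (A ++ B)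
     ... | inj₁ (s , s∈ , cs , mx) = pick s s∈ cs mx
     ... | inj₂ n = None.chosen n nx

   -- The bound compares `h y` with the count in the row before the step, where the right part is Y*
   -- in mode `bp` and Y in mode `bb`. In mode `bb` the count does not drop before c, and `h y ≡ x`
   -- is excluded separately.
   HyBP HyBB : ℕ → Set
   HyBP y = h y < length X + lt y Y*
   HyBB y = h y < length X + lt y Y × (a < y → ¬ h y ≡ x)

   module _ {y : ℕ} (y<c : y < c) (D2≤y : All (_≤ y) D2) where
     open CfgLemmas (K y y<c D2≤y)

     lt≤ : ∀ v → lt v Y* ≤ lt v Y
     lt≤ v with v ≤? a | c <? v
     ... | yes p | _ = ≤-reflexive (lt-Y-lo p)
     ... | no _ | yes p = ≤-reflexive (lt-Y-hi p)
     ... | no p | no r = subst₂ _≤_ (sym (lt-Y*-mid (≰⇒> p) (≮⇒≥ r))) (sym (lt-Y-mid (≰⇒> p) (≮⇒≥ r))) (n≤1+n _)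

     hc<x : UC X Y* S → h c < x
     hc<x U = subst (h c <_) (cong (length X +_) (lt-Y*-mid a<c ≤-refl)) (CR U (inj₁ c∈X))

     crX-bp : UC X Y* S → ∀ {v} → Pt X Y v → h v < length X + lt v Y
     crX-bp U {v} (inj₁ v∈) = <-≤-trans (CR U (inj₁ v∈)) (+-monoʳ-≤ (length X) (lt≤ v))
     crX-bp U (inj₂ (r , r∈ , refl)) with ∈-++⁻ Y1 r∈
     ... | inj₁ p = <-≤-trans (CR U (inj₂ (r , ∈-++⁺ˡ p , refl))) (+-monoʳ-≤ (length X) (lt≤ (suc r)))
     ... | inj₂ (there p) = <-≤-trans (CR U (inj₂ (r , ∈-++⁺ʳ Y1 (there p) , refl))) (+-monoʳ-≤ (length X) (lt≤ (suc r)))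
     ... | inj₂ (here refl) = ≤-<-trans (h-mono a<c) (<-trans (hc<x U) (≤-reflexive (sym (H-mid ≤-refl a<c))))

     tight-x : ∀ {v} → c ≤ v → length X + lt v Y ≡ suc (h v) → x ≤ h v
     tight-x c≤v e = s≤s⁻¹ (≤-trans (≤-reflexive (sym (H-mid a<c ≤-refl))) (≤-trans (+-monoʳ-≤ (length X) (lt-mono Y c≤v)) (≤-reflexive e)))

     AR-bp : UC X Y* S → Good HyBP y → ∀ {v} → Pt X Y v → y < v → length X + lt v Y ≡ suc (h v) → In y v
     AR-bp U good (inj₁ v∈) y<v e = inj₁ (h-gap (≤-<-trans (h-mono (<⇒≤ y<c)) (<-≤-trans (hc<x U) (tight-x (X-above v∈ y<v) e))))
     AR-bp U good (inj₂ (r , r∈ , refl)) y<v e with ∈-++⁻ Y1 r∈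
     ... | inj₂ (there p) = inj₁ (h-gap (≤-<-trans (h-mono (<⇒≤ y<c)) (<-≤-trans (hc<x U) (tight-x (m≤n⇒m≤1+n (All.lookup Y2≥c p)) e))))
     ... | inj₂ (here refl) = inj₁ (h-gap (≤-<-trans (h-mono (<⇒≤ y<c)) (<-≤-trans (hc<x U) (s≤s⁻¹ (≤-trans (≤-reflexive (sym (H-mid ≤-refl a<c))) (≤-reflexive e))))))
     ... | inj₁ p with good
     ... | inj₁ y∈B = inj₁ (y , y∈B , ≤-refl , y<v)
     ... | inj₂ (inj₁ mn) = inj₂ mn
     ... | inj₂ (inj₂ hy) = inj₁ (h-gap (s≤s⁻¹ (≤-<-trans hy (≤-trans (≤-reflexive (sym (+-suc _ _))) (≤-trans (+-monoʳ-≤ (length X) up) (≤-reflexive e))))))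
       where
       up : lt y Y* < lt (suc r) Y
       up = <-≤-trans (lt-mem {b = r} (∈-++⁺ˡ p) (s≤s⁻¹ y<v) ≤-refl) (lt≤ (suc r))

     below-c : ∀ {s} → h s ≡ x → h s < length X + lt s Y → a < s
     below-c {s} hs p = ≰⇒> λ s≤a → <⇒≱ p (≤-trans (+-monoʳ-≤ (length X) (≤-trans (lt-mono Y s≤a) (≤-reflexive lt-a))) (≤-reflexive (sym hs)))
       where
       lt-a : lt a Y ≡ length Y1
       lt-a = trans (lt-++ a Y1 (a ∷ Y2)) (trans (cong₂ _+_ (lt-all a Y1<a) (lt-none a (≤-refl ∷ All.map (λ p → ≤-trans (<⇒≤ a<c) p) Y2≥c))) (+-identityʳ _))

     AR-bb : h c ≤ x → Good HyBB y → ∀ {v} → Pt X Y v → y < v → length X + lt v Y ≡ suc (h v) → In y v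
     AR-bb hc (inj₁ y∈B) _ y<v _ = inj₁ (y , y∈B , ≤-refl , y<v)
     AR-bb hc (inj₂ (inj₁ mn)) _ _ _ = inj₂ mn
     AR-bb hc (inj₂ (inj₂ (hy , ne))) (inj₂ (r , r∈ , refl)) y<v e = inj₁ (h-gap (s≤s⁻¹ (≤-<-trans hy (≤-trans (≤-reflexive (sym (+-suc _ _)))
         (≤-trans (+-monoʳ-≤ (length X) (lt-mem r∈ (s≤s⁻¹ y<v) ≤-refl)) (≤-reflexive e))))))
     AR-bb hc (inj₂ (inj₂ (hy , ne))) {v} (inj₁ v∈) y<v e with h y <? h v
     ... | yes p = inj₁ (h-gap p)
     ... | no p = ⊥-elim (ne (below-c hy≡x hy) hy≡x)
       where
       hy≡x : h y ≡ x
       hy≡x = ≤-antisym (≤-trans (h-mono (<⇒≤ y<c)) hc) (≤-trans (tight-x (X-above v∈ y<v) e) (≮⇒≥ p))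

-- The step read forwards: recovering c and y

module Forward-step where

 open Rows
 open Compatibility
 open Reverse
 open HeckeWords using (desc-split; asc-split)
 open Placement
 open import Relation.Nullary.Decidable using (_×-dec_; _⊎-dec_)
 open DecMem _≟_ using (_∈?_)

 first-below : ∀ {c} xs → Desc xs → ¬ c ∈ xs →
   All (c <_) xs ⊎ ∃[ D1 ] ∃[ y ] ∃[ D2 ] xs ≡ D1 ++ y ∷ D2 × All (c <_) D1 × y < c × All (_< y) D2
 first-below [] _ _ = inj₁ []
 first-below {c} (x ∷ xs) (x> ∷ d) c∉ with c <? x
 ... | no p = inj₂ ([] , x , xs , refl , [] , ≤∧≢⇒< (≮⇒≥ p) (λ { refl → c∉ (here refl) }) , x>)
 ... | yes p with first-below xs d (c∉ ∘ there)
 ... | inj₁ q = inj₁ (p ∷ q)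
 ... | inj₂ (D1 , y , D2 , refl , D1> , y< , D2<) = inj₂ (x ∷ D1 , y , D2 , refl , p ∷ D1> , y< , D2<)

 first-above : ∀ {a z} xs → Asc xs → z ∈ xs → a < z → ¬ a ∈ xs →
   ∃[ I1 ] ∃[ c ] ∃[ I2 ] xs ≡ I1 ++ c ∷ I2 × All (_< a) I1 × a < c × All (c <_) I2
 first-above {a} (x ∷ xs) (x< ∷ d) z∈ a<z a∉ with a <? x
 ... | yes p = [] , x , xs , refl , [] , p , x<
 first-above {a} (x ∷ xs) (x< ∷ d) (here refl) a<z a∉ | no p = ⊥-elim (p a<z)
 first-above {a} (x ∷ xs) (x< ∷ d) (there z∈) a<z a∉ | no p with first-above xs d z∈ a<z (a∉ ∘ there)
 ... | I1 , c , I2 , refl , I1< , a<c , I2> = x ∷ I1 , c , I2 , refl , ≤∧≢⇒< (≮⇒≥ p) (λ { refl → a∉ (here refl) }) ∷ I1< , a<c , I2>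

 validRow : ∀ K → Desc (Cfg.X K) → Asc (Cfg.Y K) → (∀ {z W} → Cfg.Y K ≡ z ∷ W → All (z <_) (Cfg.X K)) → Valid (rowOf K)
 validRow (cfg D1 D2 [] Y2 c a y _ _ _ _ _ _) dX (p ∷ aY) f = valid dX (f refl) aY p
 validRow (cfg D1 D2 (z ∷ Z) Y2 c a y _ _ _ _ _ _) dX (p ∷ aY) f = valid dX (f refl) aY p

 replace-desc : ∀ {c y} D1 {D2} → Desc (D1 ++ y ∷ D2) → All (c <_) D1 → All (_< c) D2 → Desc (D1 ++ c ∷ D2)
 replace-desc D1 d D1>c D2<c with AllPairs-++⁻ D1 d
 ... | d1 , _ ∷ d2 , f = AllPairs.++⁺ d1 (D2<c ∷ d2) (All.tabulate λ u∈ → All.lookup D1>c u∈ ∷ All.tail (All.lookup f u∈))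

 replace-asc : ∀ {c a} Y1 {Y2} → Asc (Y1 ++ c ∷ Y2) → All (_< a) Y1 → All (a <_) Y2 → Asc (Y1 ++ a ∷ Y2)
 replace-asc Y1 d Y1<a Y2>a with AllPairs-++⁻ Y1 d
 ... | d1 , _ ∷ d2 , f = AllPairs.++⁺ d1 (Y2>a ∷ d2) (All.tabulate λ u∈ → All.lookup Y1<a u∈ ∷ All.tail (All.lookup f u∈))

 module Forward {S : Maybe Row} (vS : ValidLow S) {R : Row} {a : ℕ} (vR : Valid R) (cR : Compat R S) (nt : NonTerminal R S a) where
   open LowerV S vS

   private
     Dr = D R
     mr = m R
     Ir = I R

   U₀ : UC Dr (mr ∷ Ir) S
   U₀ = ucond cR

   Uv : UC (Dr ∷ʳ mr) Ir S
   Uv = proj₁ (valley-out vS (D>m vR) (I>m vR) U₀)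

   Vm : h (suc mr) < suc (length Dr)
   Vm = proj₂ (valley-out vS (D>m vR) (I>m vR) U₀)

   Dhat-desc : Desc (Dr ∷ʳ mr)
   Dhat-desc = AllPairs.++⁺ (desc vR) ([] ∷ []) (All.map (_∷ []) (D>m vR))

   Result : Set
   Result = ∃[ R′ ] ∃[ y ] Step S R′ y R a

   mk : ∀ (K : Cfg) {l} → Cfg.a K ≡ a → Desc (Cfg.X K) → Asc (Cfg.Y K) → (∀ {z W} → Cfg.Y K ≡ z ∷ W → All (z <_) (Cfg.X K)) →
        AdmXY (Cfg.X K) (Cfg.Y K) S (Cfg.y K) → Mode K S l → flat R ≡ l → Result
   mk K refl dX aY hd ad md refl = rowOf K , Cfg.y K , step K refl refl refl (validRow K dX aY hd)
     (adm (subst₂ (λ X Y → AdmXY X Y S (Cfg.y K)) (sym (D-rowOf K)) (sym (mI-rowOf K)) ad)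
          (<-≤-trans (shorter cR) (≤-reflexive (trans (len-mode K md) (sym (cong length (flat-rowOf K)))))))
     md vR cR nt

   flat-hat : flat R ≡ (Dr ∷ʳ mr) ++ Ir
   flat-hat = sym (++-assoc Dr (mr ∷ []) Ir)

   -- All of D lies above c, so the letter that makes room for c is the minimum of R, here written
   -- at the end of the left part.
   bump-min : ∀ I1 I2 c → Ir ≡ I1 ++ c ∷ I2 → All (_< a) I1 → a < c → All (c <_) I2 → All (c <_) Dr → Result
   bump-min I1 I2 c e I1<a a<c I2>c D>c = mk K refl dX aY hd (PP.admits U c∉) (pp (nd U [] hd′ (λ _ _ → PP.¬iBP U c∉) aY (λ _ → inj₁ Vm)) (PP.¬iBP U c∉)) (trans flat-hat (cong ((Dr ∷ʳ mr) ++_) e))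
     where
     m<c : mr < c
     m<c = All.lookup (I>m vR) (subst (c ∈_) (sym e) (∈-++⁺ʳ I1 (here refl)))
     K : Cfg
     K = cfg Dr [] I1 I2 c a mr D>c m<c [] I1<a a<c (All.map <⇒≤ I2>c)
     open Place K vS
     U : UC (Dr ∷ʳ mr) (I1 ++ c ∷ I2) S
     U = subst (λ w → UC (Dr ∷ʳ mr) w S) e Uv
     c∉ : ¬ c ∈ I2
     c∉ p = <-irrefl refl (All.lookup I2>c p)
     dX = replace-desc Dr Dhat-desc D>c []
     aY = replace-asc I1 (subst Asc e (asc vR)) I1<a (All.map (<-trans a<c) I2>c)
     hd′ : ∀ {z W} → I1 ≡ z ∷ W → ¬ mr ≡ z
     hd′ f refl = <-irrefl refl (All.lookup (I>m vR) (subst (mr ∈_) (sym (trans e (cong (_++ c ∷ I2) f))) (here refl)))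
     hd : ∀ {z W} → I1 ++ a ∷ I2 ≡ z ∷ W → All (z <_) (Dr ++ c ∷ [])
     hd f = All.map (≤-<-trans (z≤a I1 f I1<a)) (All.++⁺ (All.map (<-trans a<c) D>c) (a<c ∷ []))
       where
       z≤a : ∀ {z W} J → J ++ a ∷ I2 ≡ z ∷ W → All (_< a) J → z ≤ a
       z≤a [] refl _ = ≤-refl
       z≤a (_ ∷ _) refl (p ∷ _) = <⇒≤ p

   module Outside (a∉ : ¬ a ∈ mr ∷ Ir) where

     -- a displaces c, the least letter of I above it. If c is not in D, it displaces the next
     -- smaller letter of D or the minimum. If c is in D, it is blocked there, and y is found from S
     -- by `Choose`. For a below the minimum, the old minimum joins the left part.
     go : ∀ I1 c I2 → Ir ≡ I1 ++ c ∷ I2 → All (_< a) I1 → a < c → All (c <_) I2 → Result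
     go I1 c I2 e I1<a a<c I2>c with c ∈? Dr
     ... | no c∉D with first-below Dr (desc vR) c∉D
     ... | inj₁ D>c = bump-min I1 I2 c e I1<a a<c I2>c D>c
     ... | inj₂ (D1 , y , D2 , eD , D1>c , y<c , D2<y) with <-cmp a mr
     ... | tri≈ _ a≡m _ = ⊥-elim (a∉ (here a≡m))
     ... | tri> _ _ m<a = mk K refl dX aY hd (PP.admits U c∉) (pp (nd U D2<y hd′ (λ ()) aY ipx) (PP.¬iBP U c∉)) (cong₂ _++_ eD (cong (mr ∷_) e))
       where
       K : Cfg
       K = cfg D1 D2 (mr ∷ I1) I2 c a y D1>c y<c (All.map <⇒≤ D2<y) (m<a ∷ I1<a) a<c (All.map <⇒≤ I2>c)
       open Place K vS
       U = subst₂ (λ u w → UC u (mr ∷ w) S) eD e U₀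
       c∉ : ¬ c ∈ I2
       c∉ p = <-irrefl refl (All.lookup I2>c p)
       dX = replace-desc D1 (subst Desc eD (desc vR)) D1>c (All.map (λ p → <-trans p y<c) D2<y)
       aY = replace-asc (mr ∷ I1) (subst (λ w → Asc (mr ∷ w)) e (asc-mI vR)) (m<a ∷ I1<a) (All.map (<-trans a<c) I2>c)
       D>m′ = subst (All (mr <_)) eD (D>m vR)
       m<y : mr < y
       m<y = All.lookup D>m′ (∈-++⁺ʳ D1 (here refl))
       hd′ : ∀ {z W} → mr ∷ I1 ≡ z ∷ W → ¬ y ≡ z
       hd′ f e′ = <-irrefl (trans (∷-injectiveˡ f) (sym e′)) m<y
       ipx : D2 ≡ [] → h (suc y) < suc (length D1) ⊎ (¬ All (y ≤_) ((mr ∷ I1) ++ a ∷ I2) × (¬ mr ∷ I1 ≡ [] ⊎ Conditions.iBP K S))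
       ipx _ = inj₂ ((λ { (p ∷ _) → <⇒≱ m<y p }) , inj₁ (λ ()))
       hd : ∀ {z W} → mr ∷ I1 ++ a ∷ I2 ≡ z ∷ W → All (z <_) (D1 ++ c ∷ D2)
       hd f = subst (λ w → All (w <_) (D1 ++ c ∷ D2)) (∷-injectiveˡ f) (All.++⁺ (All.++⁻ˡ D1 D>m′) (<-trans m<a a<c ∷ All.tail (All.++⁻ʳ D1 D>m′)))
     ... | tri< a<m _ _ = mk K refl dX aY hd (PP.admits U c∉) (pp (nd U D2<y′ (λ ()) (λ _ _ → PP.¬iBP U c∉) aY (λ f → ⊥-elim (nonempty D2 f))) (PP.¬iBP U c∉))
                 (trans flat-hat (cong₂ _++_ hat≡ eI))
       where
       nonempty : ∀ (xs : List ℕ) {u} → ¬ xs ∷ʳ u ≡ []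
       nonempty [] ()
       nonempty (_ ∷ _) ()
       I1≡ : I1 ≡ []
       I1≡ = nil I1 I1<a (All.++⁻ˡ I1 (subst (All (mr <_)) e (I>m vR)))
         where
         nil : ∀ xs → All (_< a) xs → All (mr <_) xs → xs ≡ []
         nil [] _ _ = refl
         nil (u ∷ _) (p ∷ _) (r ∷ _) = ⊥-elim (<-asym p (<-trans a<m r))
       eI : Ir ≡ c ∷ I2
       eI = trans e (cong (_++ c ∷ I2) I1≡)
       hat≡ : Dr ∷ʳ mr ≡ D1 ++ y ∷ (D2 ∷ʳ mr)
       hat≡ = trans (cong (_∷ʳ mr) eD) (++-assoc D1 (y ∷ D2) (mr ∷ []))
       D>m′ = subst (All (mr <_)) eD (D>m vR)
       m<y : mr < y
       m<y = All.lookup D>m′ (∈-++⁺ʳ D1 (here refl))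
       D2<y′ : All (_< y) (D2 ∷ʳ mr)
       D2<y′ = All.∷ʳ⁺ D2<y m<y
       K : Cfg
       K = cfg D1 (D2 ∷ʳ mr) [] I2 c a y D1>c y<c (All.map <⇒≤ D2<y′) [] a<c (All.map <⇒≤ I2>c)
       open Place K vS
       U = subst₂ (λ u w → UC u w S) hat≡ eI Uv
       c∉ : ¬ c ∈ I2
       c∉ p = <-irrefl refl (All.lookup I2>c p)
       dX = replace-desc D1 (subst Desc hat≡ Dhat-desc) D1>c (All.map (λ p → <-trans p y<c) D2<y′)
       aY = replace-asc [] (subst Asc eI (asc vR)) [] (All.map (<-trans a<c) I2>c)
       hd : ∀ {z W} → a ∷ I2 ≡ z ∷ W → All (z <_) (D1 ++ c ∷ (D2 ∷ʳ mr))
       hd refl = All.++⁺ (All.map (<-trans a<c) D1>c) (a<c ∷ All.∷ʳ⁺ (All.map (<-trans a<m) (All.tail (All.++⁻ʳ D1 D>m′))) a<m)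
     go I1 c I2 e I1<a a<c I2>c | yes c∈D with desc-split (desc vR) c∈D
     ... | D1 , D2 , eD , D1>c , D2<c with <-cmp a mr
     ... | tri≈ _ a≡m _ = ⊥-elim (a∉ (here a≡m))
     ... | tri> _ _ m<a = result (choice D2 refl)
       where
       D>m′ = subst (All (mr <_)) eD (D>m vR)
       m<c : mr < c
       m<c = <-trans m<a a<c
       c∉ : ¬ c ∈ I2
       c∉ p = <-irrefl refl (All.lookup I2>c p)
       open Block D1 D2 (mr ∷ I1) I2 c a D1>c (m<a ∷ I1<a) a<c (All.map <⇒≤ I2>c) vS renaming (K to mkK)
       U : UC X Y* S
       U = subst₂ (λ u w → UC u (mr ∷ w) S) eD e U₀
       top = max-D2 D2 D2<c
         where
         max-D2 : ∀ xs → All (_< c) xs → ∃[ b ] b < c × All (_≤ b) xs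
         max-D2 [] [] = mr , m<c , []
         max-D2 (u ∷ us) (p ∷ ps) with max-D2 us ps
         ... | b , b<c , us≤b with ≤-total u b
         ... | inj₁ u≤b = b , b<c , u≤b ∷ us≤b
         ... | inj₂ b≤u = u , p , ≤-refl ∷ All.map (λ r → ≤-trans r b≤u) us≤b
       hcx : h c < x
       hcx = hc<x (proj₁ (proj₂ top)) (proj₂ (proj₂ top)) U
       choice : ∀ E2 → D2 ≡ E2 → Chosen
       choice [] f = Choose.choose HyBP (CL U) (crX-bp (proj₁ (proj₂ top)) (proj₂ (proj₂ top)) U) (λ p r → AR-bp p r U) mr m<c (subst (All (_≤ mr)) (sym f) [])
           (valley f (here refl) (≤-refl ∷ All.++⁺ (All.map <⇒≤ (All.++⁻ˡ I1 I>m′)) (<⇒≤ m<a ∷ All.map <⇒≤ (All.tail (All.++⁻ʳ I1 I>m′))))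
              (≤-trans (s≤s⁻¹ Vm) (≤-reflexive (cong length eD))))
           (λ p → contradiction (subst (mr ∈_) f p) λ ()) (λ _ p → <-≤-trans p (m≤m+n _ _))
           (λ m<s _ hs hm → ≤-<-trans (≤-reflexive hs) (<-≤-trans hm (+-monoʳ-≤ (length X) (lt-mono Y* (<⇒≤ m<s)))))
           (λ _ ())
         where I>m′ = subst (All (mr <_)) e (I>m vR)
       choice (d ∷ E2) f = Choose.choose HyBP (CL U) (crX-bp (proj₁ (proj₂ top)) (proj₂ (proj₂ top)) U) (λ p r → AR-bp p r U) d
           (All.lookup D2<c d∈) D2≤d
           (inD2 d∈) (λ _ → CR U (inj₁ (∈-++⁺ʳ D1 (there d∈)))) (λ _ p → <-≤-trans p (m≤m+n _ _))
           (λ m<s _ hs hm → ≤-<-trans (≤-reflexive hs) (<-≤-trans hm (+-monoʳ-≤ (length X) (lt-mono Y* (<⇒≤ m<s)))))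
           (λ _ ())
         where
         d∈ : d ∈ D2
         d∈ = subst (d ∈_) (sym f) (here refl)
         D2≤d : All (_≤ d) D2
         D2≤d = subst (All (_≤ d)) (sym f) (≤-refl ∷ All.map <⇒≤ (AllPairs.head (subst Desc f (AllPairs.tail (proj₁ (proj₂ (AllPairs-++⁻ D1 (subst Desc eD (desc vR)))))))))
       result : Chosen → Result
       result (y , y<c , D2≤y , ad , db) = mk (mkK y y<c D2≤y) refl (subst Desc eD (desc vR))
           (replace-asc (mr ∷ I1) (subst (λ w → Asc (mr ∷ w)) e (asc-mI vR)) (m<a ∷ I1<a) (All.map (<-trans a<c) I2>c))
           (λ f → subst (λ w → All (w <_) X) (∷-injectiveˡ f) D>m′) ad (bp db (λ { (inj₁ p) → c∉ p ; (inj₂ p) → <-irrefl p hcx })) (cong₂ _++_ eD (cong (mr ∷_) e))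
     ... | tri< a<m _ _ = result choice
       where
       D>m′ = subst (All (mr <_)) eD (D>m vR)
       m<c : mr < c
       m<c = All.lookup D>m′ (∈-++⁺ʳ D1 (here refl))
       c∉ : ¬ c ∈ I2
       c∉ p = <-irrefl refl (All.lookup I2>c p)
       I1≡ : I1 ≡ []
       I1≡ = nil I1 I1<a (All.++⁻ˡ I1 (subst (All (mr <_)) e (I>m vR)))
         where
         nil : ∀ xs → All (_< a) xs → All (mr <_) xs → xs ≡ []
         nil [] _ _ = refl
         nil (u ∷ _) (p ∷ _) (r ∷ _) = ⊥-elim (<-asym p (<-trans a<m r))
       eI : Ir ≡ c ∷ I2
       eI = trans e (cong (_++ c ∷ I2) I1≡)
       hat≡ : Dr ∷ʳ mr ≡ D1 ++ c ∷ (D2 ∷ʳ mr)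
       hat≡ = trans (cong (_∷ʳ mr) eD) (++-assoc D1 (c ∷ D2) (mr ∷ []))
       open Block D1 (D2 ∷ʳ mr) [] I2 c a D1>c [] a<c (All.map <⇒≤ I2>c) vS renaming (K to mkK)
       U : UC X Y* S
       U = subst₂ (λ u w → UC u w S) hat≡ eI Uv
       hatD2 : Desc (D2 ∷ʳ mr)
       hatD2 = AllPairs.tail (proj₁ (proj₂ (AllPairs-++⁻ D1 (subst Desc hat≡ Dhat-desc))))
       yd-spec : ∃[ d ] d ∈ D2 ∷ʳ mr × All (_≤ d) (D2 ∷ʳ mr)
       yd-spec = spec D2 hatD2
         where
         spec : ∀ xs → Desc (xs ∷ʳ mr) → ∃[ d ] d ∈ xs ∷ʳ mr × All (_≤ d) (xs ∷ʳ mr)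
         spec [] _ = mr , here refl , ≤-refl ∷ []
         spec (u ∷ us) (p ∷ _) = u , here refl , ≤-refl ∷ All.map <⇒≤ p
       yd = proj₁ yd-spec
       yd∈ = proj₁ (proj₂ yd-spec)
       D2≤yd = proj₂ (proj₂ yd-spec)
       yd<c : yd < c
       yd<c = All.lookup (All.∷ʳ⁺ D2<c m<c) yd∈
       choice : Chosen
       choice = Choose.choose HyBP (CL U) (crX-bp yd<c D2≤yd U) (λ p r → AR-bp p r U) yd yd<c D2≤yd
           (inD2 yd∈) (λ _ → CR U (inj₁ (∈-++⁺ʳ D1 (there yd∈)))) (λ _ p → <-≤-trans p (m≤m+n _ _))
           (λ m<s _ hs hm → ≤-<-trans (≤-reflexive hs) (<-≤-trans hm (+-monoʳ-≤ (length X) (lt-mono Y* (<⇒≤ m<s)))))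
           (λ f → ⊥-elim (nonempty D2 f))
         where
         nonempty : ∀ (xs : List ℕ) {u} → ¬ xs ∷ʳ u ≡ []
         nonempty [] ()
         nonempty (_ ∷ _) ()
       result : Chosen → Result
       result (y , y<c , D2≤y , ad , db) = mk (mkK y y<c D2≤y) refl (subst Desc hat≡ Dhat-desc)
           (replace-asc [] (subst Asc eI (asc vR)) [] (All.map (<-trans a<c) I2>c))
           (λ { refl → All.++⁺ (All.map (<-trans a<c) D1>c) (a<c ∷ All.∷ʳ⁺ (All.map (<-trans a<m) (All.tail (All.++⁻ʳ D1 D>m′))) a<m) })
           ad (bp db (λ { (inj₁ p) → c∉ p ; (inj₂ p) → <-irrefl p (hc<x yd<c D2≤yd U) })) (trans flat-hat (cong₂ _++_ hat≡ eI))

     result : NonTerminal R S a → Result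
     result (inj₂ (a∈ , _)) = ⊥-elim (a∉ a∈)
     result (inj₁ (z , z∈ , a<z)) with first-above Ir (asc vR) z∈ a<z (a∉ ∘ there)
     ... | I1 , c , I2 , e , I1<a , a<c , I2>c = go I1 c I2 e I1<a a<c I2>c

   module Inside (Y1 Y2 : List ℕ) (eY : mr ∷ Ir ≡ Y1 ++ a ∷ Y2) (Y1<a : All (_< a) Y1) (Y2>a : All (a <_) Y2) where

     x₀ : ℕ
     x₀ = length Dr + length Y1

     -- The exception among letters that already occur: a equals the minimum, the minimum itself
     -- leaves as y, and c moves to the left part while a takes its place. Both exchanges are
     -- unblocked.
     Valley : Set
     Valley = a ≡ mr × ∃[ c ] ∃[ I2 ] Ir ≡ c ∷ I2 × All (c <_) Dr

     valley? : Valley ⊎ ¬ Valley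
     valley? = dec Ir refl
       where
       dec : ∀ J → Ir ≡ J → Valley ⊎ ¬ Valley
       dec [] e = inj₂ λ { (_ , c , I2 , f , _) → contradiction (trans (sym e) f) λ () }
       dec (c ∷ I2) e with a ≟ mr | All.all? (c <?_) Dr
       ... | no n | _ = inj₂ (n ∘ proj₁)
       ... | yes p | yes r = inj₁ (p , c , I2 , e , r)
       ... | yes p | no n = inj₂ λ { (_ , c′ , I2′ , f , r) → n (subst (λ w → All (w <_) Dr) (∷-injectiveˡ (trans (sym f) e)) r) }

     valley-case : Valley → Result
     valley-case (a≡m , c , I2 , e , D>c) = bump-min [] I2 c e [] (subst (_< c) (sym a≡m) (All.lookup (I>m vR) c∈)) (asc-head (subst Asc e (asc vR))) D>c
       where c∈ = subst (c ∈_) (sym e) (here refl)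

     U : UC Dr (Y1 ++ a ∷ Y2) S
     U = subst (λ w → UC Dr w S) eY U₀

     Yasc : Asc (Y1 ++ a ∷ Y2)
     Yasc = subst Asc eY (asc-mI vR)

     m≤a : mr ≤ a
     m≤a = head≤ (asc-mI vR) (subst (a ∈_) (sym eY) (∈-++⁺ʳ Y1 (here refl)))
       where
       head≤ : ∀ {t T u} → Asc (t ∷ T) → u ∈ t ∷ T → t ≤ u
       head≤ _ (here refl) = ≤-refl
       head≤ (p ∷ _) (there r) = <⇒≤ (All.lookup p r)

     lt-sa : ∀ {z} → a < z → All (z ≤_) Y2 → lt z (Y1 ++ a ∷ Y2) ≡ suc (length Y1)
     lt-sa {z} a<z Y2≥z = trans (lt-++ z Y1 (a ∷ Y2)) (trans (cong₂ _+_ (lt-all z (All.map (λ p → <-trans p a<z) Y1<a))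
       (trans (lt-yes z Y2 a<z) (cong suc (lt-none z Y2≥z)))) (+-comm _ 1))

     lt-a : lt a (Y1 ++ a ∷ Y2) ≡ length Y1
     lt-a = trans (lt-++ a Y1 (a ∷ Y2)) (trans (cong₂ _+_ (lt-all a Y1<a) (lt-none a (≤-refl ∷ All.map <⇒≤ Y2>a))) (+-identityʳ _))

     hsa≤x : h (suc a) ≤ x₀
     hsa≤x = s≤s⁻¹ (subst (h (suc a) <_) (trans (cong (length Dr +_) (lt-sa ≤-refl Y2>a)) (+-suc _ _)) (CR U (inj₂ (a , ∈-++⁺ʳ Y1 (here refl) , refl))))

     -- The letters at which the passage of a can have been blocked: a letter of I, or a letter of S
     -- or D at which h has the critical value. The least one is c.
     Cand : ℕ → Set
     Cand z = a < z × (z ∈ Ir ⊎ (h z ≡ x₀ × (z ∈ B ⊎ z ∈ Dr)))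

     Cand? : ∀ z → Dec (Cand z)
     Cand? z = (a <? z) ×-dec ((z ∈? Ir) ⊎-dec ((h z ≟ x₀) ×-dec ((z ∈? B) ⊎-dec (z ∈? Dr))))

     pool : List ℕ
     pool = Ir ++ (B ++ Dr)

     inPool : ∀ {z} → Cand z → z ∈ pool
     inPool (_ , inj₁ p) = ∈-++⁺ˡ p
     inPool (_ , inj₂ (_ , inj₁ p)) = ∈-++⁺ʳ Ir (∈-++⁺ˡ p)
     inPool (_ , inj₂ (_ , inj₂ p)) = ∈-++⁺ʳ Ir (∈-++⁺ʳ B p)

     Y2⊆I : ∀ {z} → z ∈ Y2 → z ∈ Ir
     Y2⊆I {z} z∈ with subst (z ∈_) (sym eY) (∈-++⁺ʳ Y1 (there z∈))
     ... | there p = p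
     ... | here refl = ⊥-elim (<⇒≱ (All.lookup Y2>a z∈) m≤a)

     I⊆Y2 : ∀ {z} → z ∈ Ir → a < z → z ∈ Y2
     I⊆Y2 {z} z∈ a<z with ∈-++⁻ Y1 (subst (z ∈_) eY (there z∈))
     ... | inj₁ p = ⊥-elim (<-asym a<z (All.lookup Y1<a p))
     ... | inj₂ (here refl) = ⊥-elim (<-irrefl refl a<z)
     ... | inj₂ (there p) = p

     -- If a ends the row, S is shorter by exactly one letter. By CL the first letter d of D exceeds
     -- every letter of S, so `h d` is the size of S, which is x₀, and d is a candidate.
     exists : NonTerminal R S a → ∃[ z ] Cand z
     exists (inj₁ (z , z∈ , a<z)) = z , a<z , inj₁ z∈
     exists (inj₂ (_ , all≤a , tight , 1<len)) = go Dr refl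
       where
       Y2≡ : Y2 ≡ []
       Y2≡ = nil Y2 refl
         where
         nil : ∀ W → Y2 ≡ W → W ≡ []
         nil [] _ = refl
         nil (w ∷ W) e = ⊥-elim (<⇒≱ (All.lookup Y2>a (subst (w ∈_) (sym e) (here refl)))
                           (All.lookup all≤a (subst (w ∈_) (sym eY) (∈-++⁺ʳ Y1 (there (subst (w ∈_) (sym e) (here refl)))))))
       size≡ : size S ≡ x₀
       size≡ = suc-injective (trans tight (trans (cong (λ w → length (Dr ++ w)) eY) (trans (length-++ Dr) (trans (cong (length Dr +_)
         (trans (len-XY Y1 Y2) (cong (λ w → suc (length Y1 + length w)) Y2≡))) (trans (+-suc _ _) (cong suc (cong (length Dr +_) (+-identityʳ _))))))))
       sizeA : ∀ T → 1 ≤ size T → 1 ≤ length (left T)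
       sizeA (just r) _ = ≤-trans (s≤s z≤n) (≤-reflexive (sym (len-∷ʳ (D r))))
       go : ∀ E → Dr ≡ E → ∃[ z ] Cand z
       go [] e = ⊥-elim (<⇒≱ Vm (≤-trans (≤-reflexive (cong (suc ∘ length) e)) (≤-trans (sizeA S (s≤s⁻¹ (≤-trans 1<len (≤-reflexive (sym tight))))) (A≤h (suc mr)))))
       go (d ∷ E) e = d , a<d , inj₂ (hd , inj₂ d∈)
         where
         d∈ : d ∈ Dr
         d∈ = subst (d ∈_) (sym e) (here refl)
         S<d : ∀ {s} → Elem S s → s < d
         S<d {s} el = ≰⇒> λ d≤s → <⇒≱ (≤-<-trans z≤n (CL U el)) (≤-reflexive (trans (cong (gt s) e) (gt-none s (d≤s ∷ All.map (λ p → ≤-trans (<⇒≤ p) d≤s) E<d))))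
           where
           E<d : All (_< d) E
           E<d = AllPairs.head (subst Desc e (desc vR))
         hd : h d ≡ x₀
         hd = trans (cong (length A +_) (lt-all d (All.tabulate λ b∈ → S<d (inj₂ b∈)))) size≡
         a<d : a < d
         a<d = ≰⇒> λ d≤a → <⇒≱ (CR U (inj₁ d∈)) (≤-trans (+-monoʳ-≤ (length Dr) (≤-trans (lt-mono (Y1 ++ a ∷ Y2) d≤a) (≤-reflexive lt-a))) (≤-reflexive (sym hd)))

     module Chosen-c (nv : ¬ Valley) (c : ℕ) (a<c : a < c) (kind : c ∈ Ir ⊎ (h c ≡ x₀ × (c ∈ B ⊎ c ∈ Dr)))
                     (mn : ∀ {u} → Cand u → c ≤ u) where

       Y2≥c : All (c ≤_) Y2
       Y2≥c = All.tabulate λ u∈ → mn (All.lookup Y2>a u∈ , inj₁ (Y2⊆I u∈))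

       m<c : mr < c
       m<c = ≤-<-trans m≤a a<c

       -- If `h c` exceeded x₀, the letter of B in position x₀ would be a smaller candidate.
       hc≤ : h c ≤ x₀
       hc≤ = ≮⇒≥ λ x<hc → let b , b∈ , b<c , hb = h-sel (≤-trans (A≤h (suc a)) hsa≤x) x<hc in
         <⇒≱ b<c (mn (≰⇒> (λ b≤a → <⇒≱ (≤-reflexive (sym (trans (h-suc-mem b∈) (cong suc hb)))) (≤-trans (h-mono (s≤s b≤a)) hsa≤x)) , inj₂ (hb , inj₁ b∈)))

       head≡ : ∀ {z W} → Y1 ++ a ∷ Y2 ≡ z ∷ W → z ≡ mr
       head≡ f = ∷-injectiveˡ (trans (sym f) (sym eY))

       -- y is the first letter of D below c, or the minimum if D lies above c. In the latter case
       -- Y1 cannot be empty: a would be the minimum, and the first letter of I would lie below D,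
       -- which is `Valley`.
       place : ¬ c ∈ Dr → Result
       place c∉D with first-below Dr (desc vR) c∉D
       ... | inj₂ (D1 , y , D2 , eD , D1>c , y<c , D2<y) = mk K refl dX Yasc hd (PB.admits Up hc′ hy≢)
               (pb (nd Up D2<y hd′ nib Yasc (λ _ → inj₂ ((λ al → <⇒≱ m<y (All.lookup al (subst (mr ∈_) eY (here refl)))) , inj₂ ib))) ib) (cong₂ _++_ eD eY)
         where
         K : Cfg
         K = cfg D1 D2 Y1 Y2 c a y D1>c y<c (All.map <⇒≤ D2<y) Y1<a a<c Y2≥c
         open Place K vS
         y∈D : y ∈ Dr
         y∈D = subst (y ∈_) (sym eD) (∈-++⁺ʳ D1 (here refl))
         m<y : mr < y
         m<y = All.lookup (D>m vR) y∈D
         Up : UC (Cfg.X* K) (Cfg.Y K) S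
         Up = subst (λ w → UC w (Y1 ++ a ∷ Y2) S) eD U
         x≡ : x₀ ≡ Cfg.x K
         x≡ = cong (_+ length Y1) (trans (cong length eD) (CfgLemmas.len-X* K))
         hc′ : h c ≤ Cfg.x K
         hc′ = ≤-trans hc≤ (≤-reflexive x≡)
         hy≢ : a < y → ¬ h y ≡ Cfg.x K
         hy≢ a<y e = <⇒≱ y<c (mn (a<y , inj₂ (trans e (sym x≡) , inj₂ y∈D)))
         ib : Conditions.iBP K S
         ib = by kind
           where
           by : c ∈ Ir ⊎ (h c ≡ x₀ × (c ∈ B ⊎ c ∈ Dr)) → Conditions.iBP K S
           by (inj₁ p) = inj₁ (I⊆Y2 p a<c)
           by (inj₂ (e , inj₁ p)) = inj₂ (p , trans e x≡)
           by (inj₂ (e , inj₂ p)) = ⊥-elim (c∉D p)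
         hd′ : ∀ {z W} → Y1 ≡ z ∷ W → ¬ y ≡ z
         hd′ f refl = <-irrefl (sym (head≡ (cong (_++ a ∷ Y2) f))) m<y
         nib : Y1 ≡ [] → y ∈ Y1 ++ a ∷ Y2 → ¬ Conditions.iBP K S
         nib f y∈ _ with subst (λ w → y ∈ w ++ a ∷ Y2) f y∈
         ... | here y≡a = <-irrefl (sym (trans y≡a (head≡ (cong (_++ a ∷ Y2) f)))) m<y
         ... | there p = <⇒≱ y<c (All.lookup Y2≥c p)
         dX = replace-desc D1 (subst Desc eD (desc vR)) D1>c (All.map (λ p → <-trans p y<c) D2<y)
         D>m′ = subst (All (mr <_)) eD (D>m vR)
         hd : ∀ {z W} → Y1 ++ a ∷ Y2 ≡ z ∷ W → All (z <_) (D1 ++ c ∷ D2)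
         hd f = subst (λ w → All (w <_) (D1 ++ c ∷ D2)) (sym (head≡ f)) (All.++⁺ (All.++⁻ˡ D1 D>m′) (m<c ∷ All.tail (All.++⁻ʳ D1 D>m′)))
       ... | inj₁ D>c = low Y1 refl
         where
         low : ∀ W → Y1 ≡ W → Result
         low [] e = ⊥-elim (bad kind)
           where
           a≡m : a ≡ mr
           a≡m = head≡ (cong (_++ a ∷ Y2) e)
           I≡ : Ir ≡ Y2
           I≡ = ∷-injectiveʳ (trans eY (cong (_++ a ∷ Y2) e))
           bad : ¬ (c ∈ Ir ⊎ (h c ≡ x₀ × (c ∈ B ⊎ c ∈ Dr)))
           bad (inj₂ (_ , inj₂ p)) = c∉D p
           bad (inj₁ p) = hd Ir refl
             where
             hd : ∀ J → Ir ≡ J → ⊥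
             hd [] f = contradiction (subst (c ∈_) f p) λ ()
             hd (i ∷ J) f with subst (c ∈_) f p
             ... | here refl = nv (a≡m , c , J , f , D>c)
             ... | there q = <⇒≱ (All.lookup (asc-head (subst Asc f (asc vR))) q) (All.lookup (subst (All (c ≤_)) (trans (sym I≡) f) Y2≥c) (here refl))
           bad (inj₂ (e′ , inj₁ p)) = hd Ir refl
             where
             hc≡ : h c ≡ length Dr
             hc≡ = trans e′ (trans (cong (λ w → length Dr + length w) e) (+-identityʳ _))
             below : ∀ {d} → d ∈ Dr → ∃[ i ] i ∈ Ir × i < d
             below {d} d∈ with lt-gap {0} {d} Ir (subst (_< lt d Ir) (sym (lt-none 0 {Ir} (All.tabulate λ _ → z≤n))) pos)
               where
               pos : 0 < lt d Ir
               pos = +-cancelˡ-< (length Dr) 0 _ (s≤s⁻¹ (≤-<-trans (≤-trans (≤-reflexive (cong suc (+-identityʳ _))) (≤-trans (≤-reflexive (sym (trans (h-suc-mem p) (cong suc hc≡)))) (h-mono (All.lookup D>c d∈))))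
                       (<-≤-trans (CR U₀ (inj₁ d∈)) (≤-reflexive (trans (cong (length Dr +_) (lt-yes d Ir (All.lookup (D>m vR) d∈))) (+-suc _ _))))))
             ... | i , i∈ , _ , i<d = i , i∈ , i<d
             noD : ∀ E → Dr ≡ E → (∀ {d} → d ∈ Dr → ⊥) → ⊥
             noD (d ∷ _) f k = k (subst (d ∈_) (sym f) (here refl))
             noD [] f k = pos S p (≤-trans (A≤h c) (≤-reflexive (trans hc≡ (cong length f))))
               where
               pos : ∀ T → c ∈ right T → ¬ length (left T) ≤ 0
               pos (just r) _ q = <⇒≱ (s≤s z≤n) (≤-trans (≤-reflexive (sym (len-∷ʳ (D r)))) q)
             hd : ∀ J → Ir ≡ J → ⊥
             hd [] f = noD Dr refl λ d∈ → let i′ , i∈ , _ = below d∈ in contradiction (subst (i′ ∈_) f i∈) λ ()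
             hd (i ∷ J) f = nv (a≡m , i , J , f , All.tabulate λ d∈ → let i′ , i∈ , i<d = below d∈ in ≤-<-trans (first (subst (i′ ∈_) f i∈)) i<d)
               where
               first : ∀ {u} → u ∈ i ∷ J → i ≤ u
               first (here refl) = ≤-refl
               first (there q) = <⇒≤ (All.lookup (asc-head (subst Asc f (asc vR))) q)
         low (z ∷ Z) e = mk K refl dX aY hd (PB.admits Up hc′ hy≢) (pb (nd Up [] hd′ nib aY (λ _ → inj₁ Vm)) ib) (trans flat-hat (cong ((Dr ∷ʳ mr) ++_) I≡))
           where
           Z<a : All (_< a) Z
           Z<a = All.tail (subst (All (_< a)) e Y1<a)
           I≡ : Ir ≡ Z ++ a ∷ Y2
           I≡ = ∷-injectiveʳ (trans eY (cong (_++ a ∷ Y2) e))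
           K : Cfg
           K = cfg Dr [] Z Y2 c a mr D>c m<c [] Z<a a<c Y2≥c
           open Place K vS
           Up : UC (Cfg.X* K) (Cfg.Y K) S
           Up = subst (λ w → UC (Dr ∷ʳ mr) w S) I≡ Uv
           x≡ : x₀ ≡ Cfg.x K
           x≡ = trans (cong (λ w → length Dr + length w) e) (trans (+-suc _ _) (cong (_+ length Z) (sym (len-∷ʳ Dr))))
           hc′ : h c ≤ Cfg.x K
           hc′ = ≤-trans hc≤ (≤-reflexive x≡)
           hy≢ : a < mr → ¬ h mr ≡ Cfg.x K
           hy≢ p = ⊥-elim (<⇒≱ p m≤a)
           ib : Conditions.iBP K S
           ib = by kind
             where
             by : c ∈ Ir ⊎ (h c ≡ x₀ × (c ∈ B ⊎ c ∈ Dr)) → Conditions.iBP K S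
             by (inj₁ p) = inj₁ (I⊆Y2 p a<c)
             by (inj₂ (f , inj₁ p)) = inj₂ (p , trans f x≡)
             by (inj₂ (f , inj₂ p)) = ⊥-elim (c∉D p)
           I>m′ = subst (All (mr <_)) I≡ (I>m vR)
           hd′ : ∀ {u W} → Z ≡ u ∷ W → ¬ mr ≡ u
           hd′ f refl = <-irrefl refl (All.lookup I>m′ (∈-++⁺ˡ (subst (mr ∈_) (sym f) (here refl))))
           nib : Z ≡ [] → mr ∈ Z ++ a ∷ Y2 → ¬ Conditions.iBP K S
           nib _ p _ = <-irrefl refl (All.lookup I>m′ p)
           dX = replace-desc Dr Dhat-desc D>c []
           aY = subst Asc I≡ (asc vR)
           hd : ∀ {u W} → Z ++ a ∷ Y2 ≡ u ∷ W → All (u <_) (Dr ++ c ∷ [])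
           hd f = All.map (≤-<-trans (u≤a Z f Z<a)) (All.++⁺ (All.map (<-trans a<c) D>c) (a<c ∷ []))
             where
             u≤a : ∀ {u W} J → J ++ a ∷ Y2 ≡ u ∷ W → All (_< a) J → u ≤ a
             u≤a [] refl _ = ≤-refl
             u≤a (_ ∷ _) refl (p ∷ _) = <⇒≤ p

       block : c ∈ Dr → Result
       block c∈D with desc-split (desc vR) c∈D
       ... | D1 , D2 , eD , D1>c , D2<c = result (choice D2 refl)
         where
         open Block D1 D2 Y1 Y2 c a D1>c Y1<a a<c Y2≥c vS renaming (K to mkK)
         Ub : UC X Y S
         Ub = subst (λ w → UC w Y S) eD U
         x≡ : x₀ ≡ x
         x≡ = cong (λ w → length w + length Y1) eD
         hc′ : h c ≤ x
         hc′ = ≤-trans hc≤ (≤-reflexive x≡)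
         hx : h c ≡ x ⊎ c ∈ Y2
         hx = by kind
           where
           by : c ∈ Ir ⊎ (h c ≡ x₀ × (c ∈ B ⊎ c ∈ Dr)) → h c ≡ x ⊎ c ∈ Y2
           by (inj₁ p) = inj₂ (I⊆Y2 p a<c)
           by (inj₂ (f , _)) = inj₁ (trans f x≡)
         hxv : ¬ c ∈ Y2 → h c ≡ x
         hxv n with hx
         ... | inj₁ p = p
         ... | inj₂ p = ⊥-elim (n p)
         hym : ∀ {yd s} (p : yd < c) (r : All (_≤ yd) D2) → yd < s → s < c → h s ≡ h yd → HyBB yd → HyBB s
         hym p r yd<s _ hs (hm , ne) = ≤-<-trans (≤-reflexive hs) (<-≤-trans hm (+-monoʳ-≤ (length X) (lt-mono Y (<⇒≤ yd<s)))) ,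
           λ a<s hsx → let e = trans (sym hs) hsx in ne (below-c p r e hm) e
         choice : ∀ E2 → D2 ≡ E2 → Chosen
         choice [] f = Choose.choose HyBB (CL Ub) (CR Ub) (λ p r → AR-bb p r hc′) mr m<c nil
             (valley f (subst (mr ∈_) eY (here refl)) (subst (All (mr ≤_)) eY (≤-refl ∷ All.map <⇒≤ (I>m vR))) (≤-trans (s≤s⁻¹ Vm) (≤-reflexive (cong length eD))))
             (λ p → contradiction (subst (mr ∈_) f p) λ ()) (λ _ p → <-≤-trans p (m≤m+n _ _) , λ q → ⊥-elim (<⇒≱ q m≤a))
             (hym m<c nil) (λ _ _ ni → hxv (λ p → ni (inj₁ p)))
           where nil = subst (All (_≤ mr)) (sym f) []
         choice (d ∷ E2) f = Choose.choose HyBB (CL Ub) (CR Ub) (λ p r → AR-bb p r hc′) d d<c D2≤d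
             (inD2 d∈) (λ _ → CR Ub (inj₁ (∈-++⁺ʳ D1 (there d∈))) , λ a<d e → <⇒≱ d<c (mn (a<d , inj₂ (trans e (sym x≡) , inj₂ (subst (d ∈_) (sym eD) (∈-++⁺ʳ D1 (there d∈)))))))
             (λ g → contradiction (subst (d ∈_) g d∈) λ ()) (hym d<c D2≤d) (λ g → contradiction (subst (d ∈_) g d∈) λ ())
           where
           d∈ : d ∈ D2
           d∈ = subst (d ∈_) (sym f) (here refl)
           d<c = All.lookup D2<c d∈
           D2≤d : All (_≤ d) D2
           D2≤d = subst (All (_≤ d)) (sym f) (≤-refl ∷ All.map <⇒≤ (AllPairs.head (subst Desc f (AllPairs.tail (proj₁ (proj₂ (AllPairs-++⁻ D1 (subst Desc eD (desc vR)))))))))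
         result : Chosen → Result
         result (y , y<c , D2≤y , ad , db) = mk (mkK y y<c D2≤y) refl (subst Desc eD (desc vR)) Yasc
             (λ f → subst₂ (λ u w → All (u <_) w) (sym (head≡ f)) eD (D>m vR)) ad (bb db (by hx)) (cong₂ _++_ eD eY)
           where
           by : h c ≡ x ⊎ c ∈ Y2 → Conditions.iB (mkK y y<c D2≤y) S
           by (inj₁ p) = inj₂ p
           by (inj₂ p) = inj₁ p

       result : Result
       result with c ∈? Dr
       ... | yes p = block p
       ... | no p = place p

     result : NonTerminal R S a → Result
     result ntm with valley?
     ... | inj₁ v = valley-case v
     ... | inj₂ nv with least Cand? pool
     ... | inj₁ (c , _ , (a<c , kind) , mn) = Chosen-c.result nv c a<c kind (λ cu → mn (inPool cu) cu)
     ... | inj₂ none = ⊥-elim (none (inPool (proj₂ (exists ntm))) (proj₂ (exists ntm)))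

 forward : ∀ {S R a} → ValidLow S → Valid R → Compat R S → NonTerminal R S a → ∃[ R′ ] ∃[ y ] Step S R′ y R a
 forward {S} {R} {a} vS vR cR nt with a ∈? (m R ∷ I R)
 ... | no a∉ = Forward.Outside.result vS vR cR nt a∉ nt
 ... | yes a∈ with asc-split (asc-mI vR) a∈
 ... | Y1 , Y2 , e , Y1<a , Y2>a = Forward.Inside.result vS vR cR nt Y1 Y2 e Y1<a Y2>a nt

-- Both directions of the step are functional

module Uniqueness where

 open Rows
 open Compatibility
 open Reverse
 open Transfer using (flat-injective; two-words)

 module _ {P : ℕ → Set} where

   cut-last : ∀ D E {c d r s} → D ++ c ∷ r ≡ E ++ d ∷ s → All P D → P c → All (¬_ ∘ P) r → All P E → P d → All (¬_ ∘ P) s → D ≡ E × c ≡ d × r ≡ s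
   cut-last [] [] e _ _ _ _ _ _ = refl , ∷-injectiveˡ e , ∷-injectiveʳ e
   cut-last [] (u ∷ E) {d = d} e _ _ nr _ pd _ = ⊥-elim (All.lookup nr (subst (d ∈_) (sym (∷-injectiveʳ e)) (∈-++⁺ʳ E (here refl))) pd)
   cut-last (u ∷ D) [] {c} e _ pc _ _ _ ns = ⊥-elim (All.lookup ns (subst (c ∈_) (∷-injectiveʳ e) (∈-++⁺ʳ D (here refl))) pc)
   cut-last (u ∷ D) (w ∷ E) e (_ ∷ p) pc nr (_ ∷ p′) pd ns with cut-last D E (∷-injectiveʳ e) p pc nr p′ pd ns
   ... | f , g , h = cong₂ _∷_ (∷-injectiveˡ e) f , g , h

   cut-first : ∀ D E {c d r s} → D ++ c ∷ r ≡ E ++ d ∷ s → All P D → ¬ P c → All P E → ¬ P d → D ≡ E × c ≡ d × r ≡ s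
   cut-first [] [] e _ _ _ _ = refl , ∷-injectiveˡ e , ∷-injectiveʳ e
   cut-first [] (u ∷ E) e _ n (p ∷ _) _ = ⊥-elim (n (subst P (sym (∷-injectiveˡ e)) p))
   cut-first (u ∷ D) [] e (p ∷ _) _ _ n = ⊥-elim (n (subst P (∷-injectiveˡ e) p))
   cut-first (u ∷ D) (w ∷ E) e (_ ∷ p) n (_ ∷ p′) n′ with cut-first D E (∷-injectiveʳ e) p n p′ n′
   ... | f , g , h = cong₂ _∷_ (∷-injectiveˡ e) f , g , h

 last-occurrence : ∀ {a : ℕ} P Q {r s} → P ++ a ∷ r ≡ Q ++ a ∷ s → ¬ a ∈ r → ¬ a ∈ s → P ≡ Q × r ≡ s
 last-occurrence [] [] e _ _ = refl , ∷-injectiveʳ e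
 last-occurrence [] (u ∷ Q) e n _ = ⊥-elim (n (subst (_ ∈_) (sym (∷-injectiveʳ e)) (∈-++⁺ʳ Q (here refl))))
 last-occurrence (u ∷ P) [] e _ n = ⊥-elim (n (subst (_ ∈_) (∷-injectiveʳ e) (∈-++⁺ʳ P (here refl))))
 last-occurrence (u ∷ P) (w ∷ Q) e n n′ with last-occurrence P Q (∷-injectiveʳ e) n n′
 ... | f , g = cong₂ _∷_ (∷-injectiveˡ e) f , g

 below-first : ∀ D E {y c c′ r s} → D ++ y ∷ r ≡ E ++ c′ ∷ s → All (c <_) D → c′ < c → All (c′ <_) E → c′ ≤ y
 below-first [] [] e _ _ _ = ≤-reflexive (sym (∷-injectiveˡ e))
 below-first [] (u ∷ E) e _ _ (p ∷ _) = ≤-trans (<⇒≤ p) (≤-reflexive (sym (∷-injectiveˡ e)))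
 below-first (u ∷ D) [] e (p ∷ _) q _ = ⊥-elim (<-asym q (subst (_ <_) (∷-injectiveˡ e) p))
 below-first (u ∷ D) (w ∷ E) e (_ ∷ p) q (_ ∷ r) = below-first D E (∷-injectiveʳ e) p q r

 joined : ∀ (D1 D2 Y1 Y2 : List ℕ) {u w} → (D1 ++ u ∷ D2) ++ (Y1 ++ w ∷ Y2) ≡ D1 ++ u ∷ ((D2 ++ Y1) ++ w ∷ Y2)
 joined D1 D2 Y1 Y2 {u} {w} = trans (++-assoc D1 (u ∷ D2) (Y1 ++ w ∷ Y2)) (cong (λ z → D1 ++ u ∷ z) (sym (++-assoc D2 Y1 (w ∷ Y2))))

 -- c is the last letter of X above y and a the last letter of Y below c, so R′ and y determine the
 -- whole cut.
 same-cut : ∀ K K′ → rowOf K ≡ rowOf K′ → (∀ {u} → u ≡ Cfg.y K → u ≡ Cfg.y K′) →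
   Cfg.D1 K ≡ Cfg.D1 K′ × Cfg.c K ≡ Cfg.c K′ × Cfg.D2 K ≡ Cfg.D2 K′ × Cfg.Y1 K ≡ Cfg.Y1 K′ × Cfg.a K ≡ Cfg.a K′ × Cfg.Y2 K ≡ Cfg.Y2 K′
 same-cut K@(cfg D1 D2 Y1 Y2 c a y D1> y< D2≤ Y1< a< Y2≥) K′@(cfg E1 E2 Z1 Z2 d b y′ E1> y<′ E2≤ Z1< b< Z2≥) e f with f refl
 ... | refl with cut-last {P = y <_} D1 E1 (trans (sym (D-rowOf K)) (trans (cong D e) (D-rowOf K′)))
                  (All.map (<-trans y<) D1>) y< (All.map ≤⇒≯ D2≤) (All.map (<-trans y<′) E1>) y<′ (All.map ≤⇒≯ E2≤)
 ... | refl , refl , refl with cut-last {P = _< c} Y1 Z1 (trans (sym (mI-rowOf K)) (trans (cong (λ r → m r ∷ I r) e) (mI-rowOf K′)))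
                  (All.map (λ p → <-trans p a<) Y1<) a< (All.map ≤⇒≯ Y2≥) (All.map (λ p → <-trans p b<) Z1<) b< (All.map ≤⇒≯ Z2≥)
 ... | refl , refl , refl = refl , refl , refl , refl , refl , refl

 mode-det : ∀ K K′ {S l l′} → Cfg.D1 K ≡ Cfg.D1 K′ → Cfg.c K ≡ Cfg.c K′ → Cfg.D2 K ≡ Cfg.D2 K′ → Cfg.Y1 K ≡ Cfg.Y1 K′ → Cfg.a K ≡ Cfg.a K′ → Cfg.Y2 K ≡ Cfg.Y2 K′ →
   Cfg.y K ≡ Cfg.y K′ → Mode K S l → Mode K′ S l′ → l ≡ l′
 mode-det (cfg _ _ _ _ _ _ _ _ _ _ _ _ _) (cfg _ _ _ _ _ _ _ _ _ _ _ _ _) refl refl refl refl refl refl refl = go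
   where
   go : ∀ {l l′} → Mode _ _ l → Mode _ _ l′ → l ≡ l′
   go (pp _ _) (pp _ _) = refl
   go (pp _ n) (pb _ p) = ⊥-elim (n p)
   go (pp n _) (bp p _) = ⊥-elim (n p)
   go (pp n _) (bb p _) = ⊥-elim (n p)
   go (pb _ p) (pp _ n) = ⊥-elim (n p)
   go (pb _ _) (pb _ _) = refl
   go (pb n _) (bp p _) = ⊥-elim (n p)
   go (pb n _) (bb p _) = ⊥-elim (n p)
   go (bp p _) (pp n _) = ⊥-elim (n p)
   go (bp p _) (pb n _) = ⊥-elim (n p)
   go (bp _ _) (bp _ _) = refl
   go (bp _ n) (bb _ p) = ⊥-elim (n p)
   go (bb p _) (pp n _) = ⊥-elim (n p)
   go (bb p _) (pb n _) = ⊥-elim (n p)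
   go (bb _ p) (bp _ n) = ⊥-elim (n p)
   go (bb _ _) (bb _ _) = refl

 backward-unique : ∀ {S R′ y R₁ a₁ R₂ a₂} → Step S R′ y R₁ a₁ → Step S R′ y R₂ a₂ → R₁ ≡ R₂ × a₁ ≡ a₂
 backward-unique (step K e refl refl _ _ md v _ _) (step K′ e′ f′ refl _ _ md′ v′ _ _)
   with same-cut K K′ (trans (sym e) e′) (λ p → trans p f′)
 ... | q₁ , q₂ , q₃ , q₄ , q₅ , q₆ = flat-injective v v′ (mode-det K K′ q₁ q₂ q₃ q₄ q₅ q₆ f′ md md′) , q₅

 module YUnique {S : Maybe Row} (vS : ValidLow S)
   {D1 D2 Y1 Y2 : List ℕ} {c a y y′ : ℕ} {D1>c : All (c <_) D1} {y<c : y < c} {y′<c : y′ < c} {D2≤y : All (_≤ y) D2} {D2≤y′ : All (_≤ y′) D2}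
   {Y1<a : All (_< a) Y1} {a<c : a < c} {Y2≥c : All (c ≤_) Y2} where
   open LowerV S vS
   private
     K K′ : Cfg
     K = cfg D1 D2 Y1 Y2 c a y D1>c y<c D2≤y Y1<a a<c Y2≥c
     K′ = cfg D1 D2 Y1 Y2 c a y′ D1>c y′<c D2≤y′ Y1<a a<c Y2≥c
   open CfgLemmas K
   open Cfg K using (X; Y; q)

   -- The larger letter y′ has no reason to be blocked. In D2 it would exceed y. Under `LB` both
   -- letters would have g equal to q, against strict descent in A or against AE for y. Under `ip`,
   -- or as the minimum of the row, it clashes with each reason for y by counting S against q and q
   -- + 1.
   absurd : Valid (rowOf K) → AdmXY X Y S y → AdmXY X Y S y′ → y < y′ → Conditions.dB K S → Conditions.dB K′ S → ⊥
   absurd v ad ad′ y<y′ d d′ = by d′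
     where
     open RowFacts K v
     gy≤q : g y ≤ q
     gy≤q = s≤s⁻¹ (subst (g y <_) (gt-X ≤-refl y<c) (AL ad))
     A-large : Conditions.LB K S → suc q ≤ length A
     A-large (el , e) = subst (λ w → suc w ≤ length A) e (g<A el)
     by : Conditions.dB K′ S → ⊥
     by (inj₁ p) = <⇒≱ y<y′ (All.lookup D2≤y p)
     by (inj₂ (inj₂ (inj₁ (el , e)))) = [ (λ p → <-irrefl (trans e (sym gy)) (gt-mem p y<y′ ≤-refl)) ,
                                           (λ p → <-irrefl (trans e (sym gy)) (AE ad (trans (gt-X ≤-refl y<c) (cong suc (sym gy))) p y<y′)) ]′ el
       where gy : g y ≡ q
             gy = ≤-antisym gy≤q (≤-trans (≤-reflexive (sym e)) (g-anti (<⇒≤ y<y′)))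
     by (inj₂ (inj₂ (inj₂ (y′∈ , hy′ , e , low)))) = in-d d
       where
       in-d : Conditions.dB K S → ⊥
       in-d (inj₁ p) = contradiction (subst (y ∈_) e p) λ ()
       in-d (inj₂ (inj₁ ((y∈ , _) , r))) = [ (λ al → <⇒≱ y<y′ (All.lookup al y∈)) , (λ { (f , n) → [ (λ k → k f) , n ]′ r }) ]′ low
       in-d (inj₂ (inj₂ (inj₁ lb))) = <⇒≱ (A-large lb) (≤-trans (A≤h y′) (≤-reflexive hy′))
       in-d (inj₂ (inj₂ (inj₂ (y∈ , hy , _)))) = <-irrefl (trans hy (sym hy′)) (h-mem y∈ ≤-refl y<y′)
     by (inj₂ (inj₁ ((y′∈ , low) , _))) = in-d d
       where
       D2≡ : D2 ≡ []
       D2≡ = nil D2 refl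
         where
         m≤y′ : y′ ≤ m (rowOf K)
         m≤y′ = All.lookup low (subst (m (rowOf K) ∈_) (mI-rowOf K) (here refl))
         nil : ∀ W → D2 ≡ W → W ≡ []
         nil [] _ = refl
         nil (u ∷ W) e = ⊥-elim (<⇒≱ (<-trans (≤-<-trans m≤y′ (mI<D (∈-++⁺ʳ D1 (there u∈)))) (≤-<-trans (All.lookup D2≤y u∈) y<y′)) ≤-refl)
           where u∈ = subst (u ∈_) (sym e) (here refl)
       X≡ : length X ≡ suc q
       X≡ = trans (cong (λ w → length (D1 ++ c ∷ w)) D2≡) (len-∷ʳ D1)
       lt≡ : lt (suc y′) Y ≡ 1
       lt≡ = by-head ascY y′∈ low
         where
         by-head : ∀ {Z} → Asc Z → y′ ∈ Z → All (y′ ≤_) Z → lt (suc y′) Z ≡ 1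
         by-head (p ∷ _) (here refl) _ = trans (lt-yes (suc y′) _ ≤-refl) (cong suc (lt-none (suc y′) p))
         by-head (p ∷ _) (there r) (s ∷ _) = ⊥-elim (<⇒≱ (All.lookup p r) s)
       H≡ : length X + lt (suc y′) Y ≡ suc (suc q)
       H≡ = trans (cong₂ _+_ X≡ lt≡) (+-comm _ 1)
       pt : Pt X Y (suc y′)
       pt = inj₂ (y′ , y′∈ , refl)
       h≤ : h (suc y′) ≤ suc q
       h≤ = s≤s⁻¹ (subst (h (suc y′) <_) H≡ (CR (base ad) pt))
       tight : suc q ≤ h (suc y′) → In y′ (suc y′)
       tight p = AR ad′ pt ≤-refl (trans H≡ (cong suc (≤-antisym p h≤)))
       not-B : suc q ≤ h y′ → ¬ Between y′ (suc y′)
       not-B p (b , b∈ , y′≤b , b<) = <⇒≱ (h-mem b∈ y′≤b b<) (≤-trans h≤ p)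
       in-d : Conditions.dB K S → ⊥
       in-d (inj₁ p) = contradiction (subst (y ∈_) D2≡ p) λ ()
       in-d (inj₂ (inj₁ ((y∈ , _) , _))) = <⇒≱ y<y′ (All.lookup low y∈)
       in-d (inj₂ (inj₂ (inj₂ (y∈ , hy , _)))) with tight (≤-trans (≤-reflexive (sym (trans (h-suc-mem y∈) (cong suc hy)))) (h-mono (s≤s (<⇒≤ y<y′))))
       ... | inj₁ bt = not-B (≤-trans (≤-reflexive (cong suc (sym hy))) (h-mem y∈ ≤-refl y<y′)) bt
       ... | inj₂ (mn , _) = <-asym y<y′ (min<B mn y∈)
       in-d (inj₂ (inj₂ (inj₁ lb@(inj₂ y∈ , e)))) = <⇒≱ (s≤s (≤-trans (A-large lb) (A≤h y)))
              (≤-trans (≤-reflexive (sym (h-suc-mem y∈))) (≤-trans (h-mono (s≤s (<⇒≤ y<y′))) h≤))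
       in-d (inj₂ (inj₂ (inj₁ lb@(inj₁ y∈ , e)))) with tight (≤-trans (A-large lb) (A≤h (suc y′)))
       ... | inj₁ bt = not-B (≤-trans (A-large lb) (A≤h y′)) bt
       ... | inj₂ (mn , _) = <⇒≱ (s≤s (≤-trans (A-large lb) (≤-reflexive (sym (min-g mn))))) (≤-trans (s≤s (gt-mem {xs = A} (min∈ mn) y<y′ ≤-refl)) (s≤s (≤-reflexive e)))

 module Forward-unique {S : Maybe Row} (vS : ValidLow S) {R : Row} (vR : Valid R) where
   open LowerV S vS

   record Placed (R′ : Row) (y a : ℕ) (K : Cfg) : Set where
     constructor placed
     field
       R′≡ : R′ ≡ rowOf K
       y≡ : y ≡ Cfg.y K
       a≡ : a ≡ Cfg.a K
       v′ : Valid R′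
       ad : Adm R′ S y

     vK : Valid (rowOf K)
     vK = subst Valid R′≡ v′

     aK : AdmXY (Cfg.X K) (Cfg.Y K) S (Cfg.y K)
     aK = Adm-X K (subst₂ (λ r z → Adm r S z) R′≡ y≡ ad)

     flat≡ : flat R′ ≡ Cfg.D1 K ++ Cfg.c K ∷ ((Cfg.D2 K ++ Cfg.Y1 K) ++ Cfg.a K ∷ Cfg.Y2 K)
     flat≡ = trans (cong flat R′≡) (trans (flat-rowOf K) (joined (Cfg.D1 K) (Cfg.D2 K) (Cfg.Y1 K) (Cfg.Y2 K)))

     hc≤x : h (Cfg.c K) ≤ Cfg.x K
     hc≤x = Back.hc≤x K vS (asc-Y K vK) aK

     Y2>a : ¬ Cfg.a K ∈ Cfg.Y2 K
     Y2>a p = <⇒≱ (Cfg.a<c K) (All.lookup (Cfg.Y2≥c K) p)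

   Rep : List ℕ → List ℕ → Set
   Rep Xs Ys = (Xs ≡ D R × Ys ≡ m R ∷ I R) ⊎ (Xs ≡ D R ∷ʳ m R × Ys ≡ I R)

   rep-I : ∀ {Xs Ys u} → Rep Xs Ys → u ∈ I R → u ∈ Ys
   rep-I (inj₁ (_ , refl)) p = there p
   rep-I (inj₂ (_ , refl)) p = p

   module Moved (K : Cfg) (c∉ : ¬ Cfg.c K ∈ Cfg.Y2 K) {Xs : List ℕ} (rep : Rep Xs (Cfg.Y* K)) (low : ∃[ u ] u ∈ Xs × u ≤ Cfg.c K) where
     open Cfg K

     c∈I : c ∈ I R
     c∈I = by rep
       where
       by : Rep Xs Y* → c ∈ I R
       by (inj₂ (_ , e)) = subst (c ∈_) e (∈-++⁺ʳ Y1 (here refl))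
       by (inj₁ (refl , e)) with subst (c ∈_) e (∈-++⁺ʳ Y1 (here refl))
       ... | there p = p
       ... | here c≡m = let u , u∈ , u≤c = low in ⊥-elim (<⇒≱ (All.lookup (D>m vR) u∈) (≤-trans u≤c (≤-reflexive c≡m)))

     least-c : ∀ {z} → z ∈ I R → a < z → c ≤ z
     least-c z∈ a<z with ∈-++⁻ Y1 (rep-I rep z∈)
     ... | inj₁ p = ⊥-elim (<-asym a<z (All.lookup Y1<a p))
     ... | inj₂ (here refl) = ≤-refl
     ... | inj₂ (there p) = All.lookup Y2≥c p

     a∉Y* : ¬ a ∈ Y*
     a∉Y* p with ∈-++⁻ Y1 p
     ... | inj₁ q = <-irrefl refl (All.lookup Y1<a q)
     ... | inj₂ (here refl) = <-irrefl refl a<c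
     ... | inj₂ (there q) = <⇒≱ a<c (All.lookup Y2≥c q)

     a∈⇒ : a ∈ m R ∷ I R → a ≡ m R × Xs ≡ D R ∷ʳ m R × Y1 ≡ [] × I R ≡ c ∷ Y2
     a∈⇒ a∈ = by rep a∈
       where
       by : Rep Xs Y* → a ∈ m R ∷ I R → a ≡ m R × Xs ≡ D R ∷ʳ m R × Y1 ≡ [] × I R ≡ c ∷ Y2
       by (inj₁ (_ , e)) p = ⊥-elim (a∉Y* (subst (a ∈_) (sym e) p))
       by (inj₂ (_ , e)) (there p) = ⊥-elim (a∉Y* (subst (a ∈_) (sym e) p))
       by (inj₂ (e , f)) (here a≡m) = a≡m , e , nil Y1 refl , trans (sym f) (cong (_++ c ∷ Y2) (nil Y1 refl))
         where
         nil : ∀ W → Y1 ≡ W → Y1 ≡ []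
         nil [] g = g
         nil (u ∷ W) g = ⊥-elim (<-asym (All.lookup Y1<a u∈) (subst (_< u) (sym a≡m) (All.lookup (I>m vR) (subst (u ∈_) f (∈-++⁺ˡ u∈)))))
           where u∈ = subst (u ∈_) (sym g) (here refl)

   rep-pp : ∀ K → Valid (rowOf K) → ¬ Conditions.dB K S → ¬ Conditions.iBP K S → Cfg.X* K ++ Cfg.Y* K ≡ flat R → Rep (Cfg.X* K) (Cfg.Y* K)
   rep-pp K v nd ni e = two-words vR (Cfg.X* K) (sym e) (descX* (D2<y (nd ∘ inj₁))) (ascY* (Y2>c (ni ∘ inj₁)))
     where open RowFacts K v

   rep-pb : ∀ K → Valid (rowOf K) → ¬ Conditions.dB K S → Cfg.X* K ++ Cfg.Y K ≡ flat R → Rep (Cfg.X* K) (Cfg.Y K)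
   rep-pb K v nd e = two-words vR (Cfg.X* K) (sym e) (descX* (D2<y (nd ∘ inj₁))) ascY
     where open RowFacts K v

   rep-bp : ∀ K → Valid (rowOf K) → ¬ Conditions.iB K S → Cfg.X K ++ Cfg.Y* K ≡ flat R → Rep (Cfg.X K) (Cfg.Y* K)
   rep-bp K v ni e = two-words vR (Cfg.X K) (sym e) descX (ascY* (Y2>c (ni ∘ inj₁)))
     where open RowFacts K v

   rep-bb : ∀ K → Valid (rowOf K) → Cfg.X K ++ Cfg.Y K ≡ flat R → Rep (Cfg.X K) (Cfg.Y K)
   rep-bb K v e = two-words vR (Cfg.X K) (sym e) descX ascY
     where open RowFacts K v

   y∈X* : ∀ K → ∃[ u ] u ∈ Cfg.X* K × u ≤ Cfg.c K
   y∈X* K = Cfg.y K , ∈-++⁺ʳ (Cfg.D1 K) (here refl) , <⇒≤ (Cfg.y<c K)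

   c∈X : ∀ K → ∃[ u ] u ∈ Cfg.X K × u ≤ Cfg.c K
   c∈X K = Cfg.c K , ∈-++⁺ʳ (Cfg.D1 K) (here refl) , ≤-refl

   Y-mode-a : ∀ K {Xs} → Rep Xs (Cfg.Y K) → Cfg.a K ∈ m R ∷ I R
   Y-mode-a K (inj₁ (_ , e)) = subst (Cfg.a K ∈_) e (∈-++⁺ʳ (Cfg.Y1 K) (here refl))
   Y-mode-a K (inj₂ (_ , e)) = there (subst (Cfg.a K ∈_) e (∈-++⁺ʳ (Cfg.Y1 K) (here refl)))

   bp-a∉ : ∀ K → Valid (rowOf K) → ¬ Cfg.c K ∈ Cfg.Y2 K → Rep (Cfg.X K) (Cfg.Y* K) → ¬ Cfg.a K ∈ m R ∷ I R
   bp-a∉ K v n rep a∈ with Moved.a∈⇒ K n rep (c∈X K) a∈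
   ... | a≡m , X≡ , Y1≡ , _ = <-irrefl refl (<-≤-trans (All.lookup (D>m v) (subst (m R ∈_) (trans (sym X≡) (sym (D-rowOf K))) (∈-++⁺ʳ (D R) (here refl))))
       (≤-trans (≤-reflexive (sym a≡m)) (≤-reflexive (∷-injectiveˡ (trans (cong (_++ Cfg.a K ∷ Cfg.Y2 K) (sym Y1≡)) (sym (mI-rowOf K)))))))

   -- If c took the place of a and a still occurs on the right of R, then a is the minimum of R:
   -- this is the exceptional case of a minimum that leaves.
   pp-valley : ∀ K → Valid (rowOf K) → ¬ Cfg.c K ∈ Cfg.Y2 K → Rep (Cfg.X* K) (Cfg.Y* K) → Desc (Cfg.X* K) → Cfg.a K ∈ m R ∷ I R →
     Cfg.a K ≡ m R × All (Cfg.c K <_) (D R) × I R ≡ Cfg.c K ∷ Cfg.Y2 K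
   pp-valley K v n rep dX a∈ with Moved.a∈⇒ K n rep (y∈X* K) a∈
   ... | a≡m , X≡ , Y1≡ , I≡ = a≡m , All.tabulate above , I≡
     where
     open Cfg K
     a<X : ∀ {u} → u ∈ X → a < u
     a<X {u} u∈ = ≤-<-trans (≤-reflexive (∷-injectiveˡ (trans (cong (_++ a ∷ Y2) (sym Y1≡)) (sym (mI-rowOf K))))) (RowFacts.mI<D K v u∈)
     y≡m : y ≡ m R
     y≡m with ∈-++⁻ D1 (subst (m R ∈_) (sym X≡) (∈-++⁺ʳ (D R) (here refl)))
     ... | inj₁ p = ⊥-elim (<-irrefl a≡m (<-trans a<c (All.lookup D1>c p)))
     ... | inj₂ (here e) = sym e
     ... | inj₂ (there p) = ⊥-elim (<-irrefl a≡m (a<X (∈-++⁺ʳ D1 (there p))))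
     above : ∀ {u} → u ∈ D R → c < u
     above {u} u∈ with ∈-++⁻ D1 (subst (u ∈_) (sym X≡) (∈-++⁺ˡ u∈))
     ... | inj₁ p = All.lookup D1>c p
     ... | inj₂ (here u≡y) = ⊥-elim (<-irrefl (sym (trans u≡y y≡m)) (All.lookup (D>m vR) u∈))
     ... | inj₂ (there p) with AllPairs-++⁻ D1 dX
     ... | _ , (q ∷ _) , _ = ⊥-elim (<-asym (All.lookup (D>m vR) u∈) (subst (u <_) y≡m (All.lookup q p)))

   valley-clash : ∀ K {c Y2 Xs} → Cfg.a K ≡ m R → All (c <_) (D R) → I R ≡ c ∷ Y2 → Rep Xs (Cfg.Y K) → ∃[ u ] u ∈ Xs × u ≤ Cfg.c K → ⊥
   valley-clash K a≡m _ _ (inj₂ (_ , e)) _ = <-irrefl (sym a≡m) (All.lookup (I>m vR) (subst (Cfg.a K ∈_) e (∈-++⁺ʳ (Cfg.Y1 K) (here refl))))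
   valley-clash K {c} a≡m D>c I≡ (inj₁ (refl , e)) (u , u∈ , u≤) = by (Cfg.Y1 K) refl
     where
     by : ∀ W → Cfg.Y1 K ≡ W → ⊥
     by (z ∷ Z) f = <-irrefl (trans (∷-injectiveˡ (trans (cong (_++ Cfg.a K ∷ Cfg.Y2 K) (sym f)) e)) (sym a≡m)) (All.lookup (Cfg.Y1<a K) (subst (z ∈_) (sym f) (here refl)))
     by [] f = <⇒≱ (All.lookup D>c u∈) (≤-trans u≤ (All.lookup (Cfg.Y2≥c K) (subst (c ∈_) (sym (∷-injectiveʳ (trans (cong (_++ Cfg.a K ∷ Cfg.Y2 K) (sym f)) (trans e (cong (m R ∷_) I≡))))) (here refl))))

   Y-unique : ∀ K K′ → Valid (rowOf K) → rowOf K ≡ rowOf K′ → Cfg.c K ≡ Cfg.c K′ →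
     AdmXY (Cfg.X K) (Cfg.Y K) S (Cfg.y K) → AdmXY (Cfg.X K′) (Cfg.Y K′) S (Cfg.y K′) → Conditions.dB K S → Conditions.dB K′ S → Cfg.y K ≡ Cfg.y K′
   Y-unique K@(cfg D1 D2 Y1 Y2 c a y D1> y< D2≤ Y1< a< Y2≥) K′@(cfg E1 E2 Z1 Z2 _ b y′ E1> y<′ E2≤ Z1< b< Z2≥) v e refl ad ad′ d d′
     with cut-first {P = c <_} D1 E1 (trans (sym (D-rowOf K)) (trans (cong D e) (D-rowOf K′))) D1> (<-irrefl refl) E1> (<-irrefl refl)
        | cut-last {P = _< c} Y1 Z1 (trans (sym (mI-rowOf K)) (trans (cong (λ r → m r ∷ I r) e) (mI-rowOf K′)))
                  (All.map (λ p → <-trans p a<) Y1<) a< (All.map ≤⇒≯ Y2≥) (All.map (λ p → <-trans p b<) Z1<) b< (All.map ≤⇒≯ Z2≥)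
   ... | refl , _ , refl | refl , refl , refl with <-cmp y y′
   ... | tri≈ _ f _ = f
   ... | tri< p _ _ = ⊥-elim (YUnique.absurd vS {D1>c = D1>} {y<} {y<′} {D2≤} {E2≤} {Y1<} {a<} {Y2≥} v ad ad′ p d d′)
   ... | tri> _ _ p = ⊥-elim (YUnique.absurd vS {D1>c = E1>} {y<′} {y<} {E2≤} {D2≤} {Z1<} {b<} {Z2≥} (subst Valid e v) ad′ ad p d′ d)

   Same : (R₁ R₂ : Row) (y₁ y₂ : ℕ) → Set
   Same R₁ R₂ y₁ y₂ = R₁ ≡ R₂ × y₁ ≡ y₂

   module _ {R₁ R₂ y₁ y₂ a K K′} (p : Placed R₁ y₁ a K) (p′ : Placed R₂ y₂ a K′) where
     private
       module P = Placed p
       module P′ = Placed p′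
       module C = Cfg K
       module C′ = Cfg K′

     a≡a′ : C.a ≡ C′.a
     a≡a′ = trans (sym P.a≡) P′.a≡

     row≡ : C.D1 ≡ C′.D1 → C.c ≡ C′.c → C.D2 ++ C.Y1 ≡ C′.D2 ++ C′.Y1 → C.Y2 ≡ C′.Y2 → R₁ ≡ R₂
     row≡ e f g k = flat-injective P.v′ P′.v′ (trans P.flat≡ (trans (cong₂ (λ { u (w , x , z) → u ++ w ∷ (x ++ proj₁ z ∷ proj₂ z) }) e (cong₂ _,_ f (cong₂ _,_ g (cong₂ _,_ a≡a′ k)))) (sym P′.flat≡)))

     same-y : R₁ ≡ R₂ → C.c ≡ C′.c → Conditions.dB K S → Conditions.dB K′ S → Same R₁ R₂ y₁ y₂
     same-y e f d d′ = e , trans P.y≡ (trans (Y-unique K K′ P.vK (trans (sym P.R′≡) (trans e P′.R′≡)) f P.aK P′.aK d d′) (sym P′.y≡))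

     <c : ∀ (L : Cfg) → All (_< Cfg.c L) (Cfg.D2 L ++ Cfg.Y1 L)
     <c L = All.++⁺ (All.map (λ q → ≤-<-trans q (Cfg.y<c L)) (Cfg.D2≤y L)) (All.map (λ q → <-trans q (Cfg.a<c L)) (Cfg.Y1<a L))

     -- On both sides c is the least letter of `I R` above a.
     moved-c : (n : ¬ C.c ∈ C.Y2) (n′ : ¬ C′.c ∈ C′.Y2) → ∀ {Xs Xs′} → Rep Xs C.Y* → ∃[ u ] u ∈ Xs × u ≤ C.c → Rep Xs′ C′.Y* → ∃[ u ] u ∈ Xs′ × u ≤ C′.c → C.c ≡ C′.c
     moved-c n n′ rep low rep′ low′ = ≤-antisym
       (Moved.least-c K n rep low (Moved.c∈I K′ n′ rep′ low′) (subst (_< C′.c) (sym a≡a′) C′.a<c))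
       (Moved.least-c K′ n′ rep′ low′ (Moved.c∈I K n rep low) (subst (_< C.c) a≡a′ C.a<c))

     det-pp-pp : Valid R → ¬ Conditions.dB K S → ¬ Conditions.iBP K S → ¬ Conditions.dB K′ S → ¬ Conditions.iBP K′ S →
                 C.X* ++ C.Y* ≡ flat R → C′.X* ++ C′.Y* ≡ flat R → Same R₁ R₂ y₁ y₂
     det-pp-pp _ nd ni nd′ ni′ e e′ = fin (moved-c (ni ∘ inj₁) (ni′ ∘ inj₁) (rep-pp K P.vK nd ni e) (y∈X* K) (rep-pp K′ P′.vK nd′ ni′ e′) (y∈X* K′))
       where
       fin : C.c ≡ C′.c → Same R₁ R₂ y₁ y₂
       fin c≡ with cut-first {P = C.c <_} C.D1 C′.D1 (trans (sym (joined C.D1 C.D2 C.Y1 C.Y2)) (trans e (trans (sym e′) (joined C′.D1 C′.D2 C′.Y1 C′.Y2))))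
                     C.D1>c (<-asym C.y<c) (subst (λ w → All (w <_) C′.D1) (sym c≡) C′.D1>c) (<-asym (subst (C′.y <_) (sym c≡) C′.y<c))
       ... | D1≡ , y≡ , r≡ with cut-first {P = _< C.c} (C.D2 ++ C.Y1) (C′.D2 ++ C′.Y1) r≡ (<c K) (<-irrefl refl) (subst (λ w → All (_< w) (C′.D2 ++ C′.Y1)) (sym c≡) (<c K′)) (<-irrefl (sym c≡))
       ... | m≡ , _ , Y2≡ = row≡ D1≡ c≡ m≡ Y2≡ , trans P.y≡ (trans y≡ (sym P′.y≡))

     det-bp-bp : Conditions.dB K S → ¬ Conditions.iB K S → Conditions.dB K′ S → ¬ Conditions.iB K′ S →
                 C.X ++ C.Y* ≡ flat R → C′.X ++ C′.Y* ≡ flat R → Same R₁ R₂ y₁ y₂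
     det-bp-bp d ni d′ ni′ e e′ = fin (moved-c (ni ∘ inj₁) (ni′ ∘ inj₁) (rep-bp K P.vK ni e) (c∈X K) (rep-bp K′ P′.vK ni′ e′) (c∈X K′))
       where
       fin : C.c ≡ C′.c → Same R₁ R₂ y₁ y₂
       fin c≡ with cut-first {P = C.c <_} C.D1 C′.D1 (trans (sym (joined C.D1 C.D2 C.Y1 C.Y2)) (trans e (trans (sym e′) (joined C′.D1 C′.D2 C′.Y1 C′.Y2))))
                     C.D1>c (<-irrefl refl) (subst (λ w → All (w <_) C′.D1) (sym c≡) C′.D1>c) (<-irrefl c≡)
       ... | D1≡ , _ , r≡ with cut-first {P = _< C.c} (C.D2 ++ C.Y1) (C′.D2 ++ C′.Y1) r≡ (<c K) (<-irrefl refl) (subst (λ w → All (_< w) (C′.D2 ++ C′.Y1)) (sym c≡) (<c K′)) (<-irrefl (sym c≡))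
       ... | m≡ , _ , Y2≡ = same-y (row≡ D1≡ c≡ m≡ Y2≡) c≡ d d′

     det-pp-bp : ¬ Conditions.dB K S → ¬ Conditions.iBP K S → ¬ Conditions.iB K′ S →
                 C.X* ++ C.Y* ≡ flat R → C′.X ++ C′.Y* ≡ flat R → ⊥
     det-pp-bp nd ni ni′ e e′ = fin (moved-c (ni ∘ inj₁) (ni′ ∘ inj₁) (rep-pp K P.vK nd ni e) (y∈X* K) (rep-bp K′ P′.vK ni′ e′) (c∈X K′))
       where
       fin : C.c ≡ C′.c → ⊥
       fin c≡ with cut-first {P = C.c <_} C.D1 C′.D1 (trans (sym (joined C.D1 C.D2 C.Y1 C.Y2)) (trans e (trans (sym e′) (joined C′.D1 C′.D2 C′.Y1 C′.Y2))))
                     C.D1>c (<-asym C.y<c) (subst (λ w → All (w <_) C′.D1) (sym c≡) C′.D1>c) (<-irrefl c≡)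
       ... | _ , y≡ , _ = <-irrefl (trans y≡ (sym c≡)) C.y<c

     det-Y*-Y : ¬ C.a ∈ m R ∷ I R ⊎ (C.a ≡ m R × All (C.c <_) (D R) × I R ≡ C.c ∷ C.Y2) → ∀ {Xs} → Rep Xs C′.Y → ∃[ u ] u ∈ Xs × u ≤ C′.c → ⊥
     det-Y*-Y (inj₁ n) rep _ = n (subst (_∈ m R ∷ I R) (sym a≡a′) (Y-mode-a K′ rep))
     det-Y*-Y (inj₂ (a≡m , D>c , I≡)) rep low = valley-clash K′ (trans (sym a≡a′) a≡m) D>c I≡ rep low

     det-pp-Y : ¬ Conditions.dB K S → ¬ Conditions.iBP K S → C.X* ++ C.Y* ≡ flat R → ∀ {Xs} → Rep Xs C′.Y → ∃[ u ] u ∈ Xs × u ≤ C′.c → ⊥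
     det-pp-Y nd ni e rep = det-Y*-Y (inj₂ (pp-valley K P.vK (ni ∘ inj₁) (rep-pp K P.vK nd ni e) (RowFacts.descX* K P.vK (RowFacts.D2<y K P.vK (nd ∘ inj₁)))
                                (subst (_∈ m R ∷ I R) (sym a≡a′) (Y-mode-a K′ rep)))) rep

     det-bp-Y : ¬ Conditions.iB K S → C.X ++ C.Y* ≡ flat R → ∀ {Xs} → Rep Xs C′.Y → ∃[ u ] u ∈ Xs × u ≤ C′.c → ⊥
     det-bp-Y ni e rep = det-Y*-Y (inj₁ (bp-a∉ K P.vK (ni ∘ inj₁) (rep-bp K P.vK ni e))) rep

     -- a does not occur in Y2, so its last occurrence cuts both readings of the same word at the
     -- same place.
     tails : ∀ u u′ → C.D1 ++ u ∷ ((C.D2 ++ C.Y1) ++ C.a ∷ C.Y2) ≡ C′.D1 ++ u′ ∷ ((C′.D2 ++ C′.Y1) ++ C′.a ∷ C′.Y2) → C.Y2 ≡ C′.Y2 × C.x ≡ C′.x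
     tails u u′ e with last-occurrence {C.a} (C.D1 ++ u ∷ (C.D2 ++ C.Y1)) (C′.D1 ++ u′ ∷ (C′.D2 ++ C′.Y1))
                         (trans (++-assoc C.D1 (u ∷ (C.D2 ++ C.Y1)) (C.a ∷ C.Y2)) (trans e (trans (cong (λ w → C′.D1 ++ u′ ∷ ((C′.D2 ++ C′.Y1) ++ w ∷ C′.Y2)) (sym a≡a′)) (sym (++-assoc C′.D1 (u′ ∷ (C′.D2 ++ C′.Y1)) (C.a ∷ C′.Y2))))))
                         P.Y2>a (λ q → P′.Y2>a (subst (_∈ C′.Y2) a≡a′ q))
     ... | f , g = g , trans (len C.D1 C.D2 C.Y1) (trans (cong length f) (sym (len C′.D1 C′.D2 C′.Y1)))
       where
       len : ∀ (D1 D2 Y1 : List ℕ) {c u} → length (D1 ++ c ∷ D2) + length Y1 ≡ length (D1 ++ u ∷ (D2 ++ Y1))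
       len D1 D2 Y1 {c} {u} = trans (cong (_+ length Y1) (trans (length-++ D1) (sym (length-++ D1 {u ∷ D2}))))
         (trans (sym (length-++ (D1 ++ u ∷ D2))) (cong length (++-assoc D1 (u ∷ D2) Y1)))

     -- If c is in Y2, which both cuts share, it is at least c′. If S blocks c, h reaches x + 1
     -- right after c, while CR allows at most x at c′.
     no-smaller : Conditions.iBP K S → C.Y2 ≡ C′.Y2 → C.x ≡ C′.x → ¬ C.c < C′.c
     no-smaller (inj₁ q) Y2≡ _ c< = <⇒≱ c< (All.lookup C′.Y2≥c (subst (C.c ∈_) Y2≡ q))
     no-smaller (inj₂ (c∈ , hc)) _ x≡ c< = <⇒≱ (≤-reflexive (sym (trans (h-suc-mem c∈) (cong suc hc)))) (≤-trans (h-mono c<) (≤-trans P′.hc≤x (≤-reflexive (sym x≡))))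

   module _ {R₁ R₂ y₁ y₂ a K K′} (p : Placed R₁ y₁ a K) (p′ : Placed R₂ y₂ a K′) where
     private
       module P = Placed p
       module P′ = Placed p′
       module C = Cfg K
       module C′ = Cfg K′

     det-pb-pb : Conditions.iBP K S → Conditions.iBP K′ S → C.X* ++ C.Y ≡ flat R → C′.X* ++ C′.Y ≡ flat R → Same R₁ R₂ y₁ y₂
     det-pb-pb i i′ e e′ = fin (≤-antisym (≮⇒≥ (no-smaller p′ p i′ (sym Y2≡) (sym x≡))) (≮⇒≥ (no-smaller p p′ i Y2≡ x≡)))
       where
       W≡ = trans (sym (joined C.D1 C.D2 C.Y1 C.Y2)) (trans e (trans (sym e′) (joined C′.D1 C′.D2 C′.Y1 C′.Y2)))
       Y2≡ = proj₁ (tails p p′ C.y C′.y W≡)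
       x≡ = proj₂ (tails p p′ C.y C′.y W≡)
       fin : C.c ≡ C′.c → Same R₁ R₂ y₁ y₂
       fin c≡ with cut-first {P = C.c <_} C.D1 C′.D1 W≡ C.D1>c (<-asym C.y<c) (subst (λ w → All (w <_) C′.D1) (sym c≡) C′.D1>c) (<-asym (subst (C′.y <_) (sym c≡) C′.y<c))
       ... | D1≡ , y≡ , r≡ = flat-injective P.v′ P′.v′ (trans P.flat≡ (trans (cong₂ _++_ D1≡ (cong₂ _∷_ c≡ r≡)) (sym P′.flat≡))) , trans P.y≡ (trans y≡ (sym P′.y≡))

     -- The hard case is c′ < c: then c′ is at most y, so `h y` is at least the value x that h has
     -- at c′, whereas an unblocked y has `h y` below x.
     det-pb-bb : ¬ Conditions.dB K S → Conditions.iBP K S → Conditions.iB K′ S → C.X* ++ C.Y ≡ flat R → C′.X ++ C′.Y ≡ flat R → ⊥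
     det-pb-bb nd i i′ e e′ with <-cmp C.c C′.c
       where W≡ = trans (sym (joined C.D1 C.D2 C.Y1 C.Y2)) (trans e (trans (sym e′) (joined C′.D1 C′.D2 C′.Y1 C′.Y2)))
     ... | tri< q _ _ = let f , g = tails p p′ C.y C′.c W≡ in no-smaller p p′ i f g q
       where W≡ = trans (sym (joined C.D1 C.D2 C.Y1 C.Y2)) (trans e (trans (sym e′) (joined C′.D1 C′.D2 C′.Y1 C′.Y2)))
     ... | tri≈ _ c≡ _ with cut-first {P = C.c <_} C.D1 C′.D1 (trans (sym (joined C.D1 C.D2 C.Y1 C.Y2)) (trans e (trans (sym e′) (joined C′.D1 C′.D2 C′.Y1 C′.Y2)))) C.D1>c (<-asym C.y<c) (subst (λ w → All (w <_) C′.D1) (sym c≡) C′.D1>c) (<-irrefl c≡)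
     ... | _ , y≡ , _ = <-irrefl (trans y≡ (sym c≡)) C.y<c
     det-pb-bb nd i i′ e e′ | tri> _ _ q = by i′
       where
       W≡ = trans (sym (joined C.D1 C.D2 C.Y1 C.Y2)) (trans e (trans (sym e′) (joined C′.D1 C′.D2 C′.Y1 C′.Y2)))
       c′≤y : C′.c ≤ C.y
       c′≤y = below-first C.D1 C′.D1 W≡ C.D1>c q C′.D1>c
       by : Conditions.iB K′ S → ⊥
       by (inj₁ r) = <⇒≱ q (All.lookup C.Y2≥c (subst (C′.c ∈_) (sym (proj₁ (tails p p′ C.y C′.c W≡))) r))
       by (inj₂ hx) = <⇒≱ (Back.hy<x K vS (asc-Y K P.vK) P.aK (λ lb → nd (inj₂ (inj₂ (inj₁ lb)))))
                        (≤-trans (≤-reflexive (trans (proj₂ (tails p p′ C.y C′.c W≡)) (sym hx))) (h-mono c′≤y))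

     -- Both cuts are of the same row. c < c′ puts c into D2 of the second cut, so c ≤ y′, and h is
     -- constantly x from c to c′. CR is then tight at c′, but AR finds no letter of B there, and y′
     -- as the minimum of S would leave A too short for the value x.
     bb-< : Conditions.iB K S → Conditions.dB K′ S → C.X ++ C.Y ≡ flat R → C′.X ++ C′.Y ≡ flat R → ¬ C.c < C′.c
     bb-< i d′ e e′ c< = by i
       where
       W≡ = trans (sym (joined C.D1 C.D2 C.Y1 C.Y2)) (trans e (trans (sym e′) (joined C′.D1 C′.D2 C′.Y1 C′.Y2)))
       x≡ : C.x ≡ C′.x
       x≡ = proj₂ (tails p p′ C.c C′.c W≡)
       same-row : rowOf K ≡ rowOf K′
       same-row = flat-injective P.vK P′.vK (trans (flat-rowOf K) (trans e (trans (sym e′) (sym (flat-rowOf K′)))))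
       X≡ : C.X ≡ C′.X
       X≡ = trans (sym (D-rowOf K)) (trans (cong D same-row) (D-rowOf K′))
       c∈D2 : C.c ∈ C′.D2
       c∈D2 with ∈-++⁻ C′.D1 (subst (C.c ∈_) X≡ (∈-++⁺ʳ C.D1 (here refl)))
       ... | inj₁ q = ⊥-elim (<-asym c< (All.lookup C′.D1>c q))
       ... | inj₂ (here q) = ⊥-elim (<-irrefl q c<)
       ... | inj₂ (there q) = q
       c≤y′ : C.c ≤ C′.y
       c≤y′ = All.lookup C′.D2≤y c∈D2
       by : Conditions.iB K S → ⊥
       by (inj₁ q) = <⇒≱ c< (All.lookup C′.Y2≥c (subst (C.c ∈_) (proj₁ (tails p p′ C.c C′.c W≡)) q))
       by (inj₂ hc) = [ (λ { (b , b∈ , y′≤b , b<) → <-irrefl (trans hc (trans x≡ (sym hc′))) (≤-<-trans (h-mono (≤-trans c≤y′ y′≤b)) (h-mem b∈ ≤-refl b<)) }) , atMin ]′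
                        (AR P′.aK (inj₁ (∈-++⁺ʳ C′.D1 (here refl))) C′.y<c (trans (CfgLemmas.H-mid K′ C′.a<c ≤-refl) (cong suc (sym hc′))))
         where
         hc′ : h C′.c ≡ C′.x
         hc′ = ≤-antisym P′.hc≤x (≤-trans (≤-reflexive (trans (sym x≡) (sym hc))) (h-mono (<⇒≤ c<)))
         atMin : ¬ (IsMin S C′.y × E C′.y)
         atMin (mn , _) = <-irrefl refl (≤-<-trans (≤-reflexive (trans (sym x≡) (trans (sym hc) hA))) (≤-<-trans A≤ (≤-trans q<X (m≤m+n _ _))))
           where
           hA : h C.c ≡ length A
           hA = trans (cong (length A +_) (lt-none C.c (All.tabulate λ b∈ → <⇒≤ (≤-<-trans c≤y′ (min<B mn b∈))))) (+-identityʳ _)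
           A≤ : length A ≤ suc C′.q
           A≤ = ≤-trans (≤-reflexive (sym (min-g mn))) (≤-trans (AL P′.aK) (≤-reflexive (CfgLemmas.gt-X K′ ≤-refl C′.y<c)))
           q<X : suc C′.q < length C′.X
           q<X = ≤-trans (≤-reflexive (+-comm 2 C′.q)) (≤-trans (+-monoʳ-≤ C′.q (s≤s (nonempty c∈D2))) (≤-reflexive (sym (length-++ C′.D1))))
             where nonempty : ∀ {u} {W : List ℕ} → u ∈ W → 1 ≤ length W
                   nonempty (here _) = s≤s z≤n
                   nonempty (there _) = s≤s z≤n

   same : ∀ {R₁ R₂ y₁ y₂ a K K′ l l′} → Placed R₁ y₁ a K → Placed R₂ y₂ a K′ → Mode K S l → Mode K′ S l′ → l ≡ flat R → l′ ≡ flat R → Same R₁ R₂ y₁ y₂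
   same p p′ (pp nd ni) (pp nd′ ni′) e e′ = det-pp-pp p p′ vR nd ni nd′ ni′ e e′
   same p p′ (bp d ni) (bp d′ ni′) e e′ = det-bp-bp p p′ d ni d′ ni′ e e′
   same p p′ (pp nd ni) (bp _ ni′) e e′ = ⊥-elim (det-pp-bp p p′ nd ni ni′ e e′)
   same p p′ (bp _ ni) (pp nd ni′) e e′ = ⊥-elim (det-pp-bp p′ p nd ni′ ni e′ e)
   same {K′ = K′} p p′ (pp nd ni) (pb nd′ _) e e′ = ⊥-elim (det-pp-Y p p′ nd ni e (rep-pb K′ (Placed.vK p′) nd′ e′) (y∈X* K′))
   same {K′ = K′} p p′ (pp nd ni) (bb _ _) e e′ = ⊥-elim (det-pp-Y p p′ nd ni e (rep-bb K′ (Placed.vK p′) e′) (c∈X K′))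
   same {K′ = K′} p p′ (bp _ ni) (pb nd′ _) e e′ = ⊥-elim (det-bp-Y p p′ ni e (rep-pb K′ (Placed.vK p′) nd′ e′) (y∈X* K′))
   same {K′ = K′} p p′ (bp _ ni) (bb _ _) e e′ = ⊥-elim (det-bp-Y p p′ ni e (rep-bb K′ (Placed.vK p′) e′) (c∈X K′))
   same {K = K} p p′ (pb nd _) (pp nd′ ni′) e e′ = ⊥-elim (det-pp-Y p′ p nd′ ni′ e′ (rep-pb K (Placed.vK p) nd e) (y∈X* K))
   same {K = K} p p′ (bb _ _) (pp nd′ ni′) e e′ = ⊥-elim (det-pp-Y p′ p nd′ ni′ e′ (rep-bb K (Placed.vK p) e) (c∈X K))
   same {K = K} p p′ (pb nd _) (bp _ ni′) e e′ = ⊥-elim (det-bp-Y p′ p ni′ e′ (rep-pb K (Placed.vK p) nd e) (y∈X* K))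
   same {K = K} p p′ (bb _ _) (bp _ ni′) e e′ = ⊥-elim (det-bp-Y p′ p ni′ e′ (rep-bb K (Placed.vK p) e) (c∈X K))
   same p p′ (pb _ i) (pb _ i′) e e′ = det-pb-pb p p′ i i′ e e′
   same p p′ (pb nd i) (bb _ i′) e e′ = ⊥-elim (det-pb-bb p p′ nd i i′ e e′)
   same p p′ (bb _ i) (pb nd′ i′) e e′ = ⊥-elim (det-pb-bb p′ p nd′ i′ i e′ e)
   same {K = K} {K′} p p′ (bb d i) (bb d′ i′) e e′ = same-y p p′
     (flat-injective (Placed.v′ p) (Placed.v′ p′) (trans (cong flat (Placed.R′≡ p)) (trans (flat-rowOf K) (trans e (trans (sym e′) (trans (sym (flat-rowOf K′)) (sym (cong flat (Placed.R′≡ p′)))))))))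
     (≤-antisym (≮⇒≥ (bb-< p′ p i′ d e′ e)) (≮⇒≥ (bb-< p p′ i d′ e e′))) d d′

 forward-unique : ∀ {S R₁ y₁ R₂ y₂ R a} → ValidLow S → Step S R₁ y₁ R a → Step S R₂ y₂ R a → R₁ ≡ R₂ × y₁ ≡ y₂
 forward-unique vS (step K e f g v ad md vR _ _) (step K′ e′ f′ g′ v′ ad′ md′ _ _ _) =
   Forward-unique.same vS vR (Forward-unique.placed e f g v ad) (Forward-unique.placed e′ f′ g′ v′ ad′) md md′ refl refl

-- Inserting letters into tableaux

module Insertion where

 open Rows
 open Compatibility
 open Reverse
 open Forward-step using (forward)
 open Uniqueness
 open Transfer using (flat-injective; size-flat; module Through)
 open Hyperoctahedral using (≈-reflexive)
 open HeckeWords using (word; Step⇒≈; asc-split)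
 open import Data.Bool using (Bool; true; false)
 open import Data.List using (reverse)
 open import Data.List.Properties using (∷ʳ-injective; unfold-reverse)
 import Data.List.Relation.Unary.Any as Any
 open import Data.Unit using (tt)
 open DecMem _≟_ using (_∈?_)

 lt-∷ʳ-yes : ∀ {v a} xs → a < v → lt v (xs ∷ʳ a) ≡ suc (lt v xs)
 lt-∷ʳ-yes {v} {a} xs p = trans (lt-++ v xs (a ∷ [])) (trans (cong (lt v xs +_) (lt-yes v [] p)) (+-comm _ 1))

 lt-∷ʳ-no : ∀ {v a} xs → v ≤ a → lt v (xs ∷ʳ a) ≡ lt v xs
 lt-∷ʳ-no {v} {a} xs p = trans (lt-++ v xs (a ∷ [])) (trans (cong (lt v xs +_) (lt-no v [] p)) (+-identityʳ _))

 gt≤∷ʳ : ∀ s xs {a} → gt s xs ≤ gt s (xs ∷ʳ a)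
 gt≤∷ʳ s xs = ≤-trans (m≤m+n _ _) (≤-reflexive (sym (gt-++ s xs (_ ∷ []))))

 lt≤∷ʳ : ∀ v xs {a} → lt v xs ≤ lt v (xs ∷ʳ a)
 lt≤∷ʳ v xs = ≤-trans (m≤m+n _ _) (≤-reflexive (sym (lt-++ v xs (_ ∷ []))))

 data Append : Row → ℕ → Row → Set where
   up : ∀ {D m I a} → All (_< a) (m ∷ I) → Append ⟨ D , m , I ⟩ a ⟨ D , m , I ∷ʳ a ⟩
   down : ∀ {D m a} → a < m → Append ⟨ D , m , [] ⟩ a ⟨ D ∷ʳ m , a , [] ⟩

 flat-append : ∀ {R a R⁺} → Append R a R⁺ → flat R⁺ ≡ flat R ∷ʳ a
 flat-append (up {D} {m} {I} {a} _) = sym (++-assoc D (m ∷ I) (a ∷ []))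
 flat-append (down _) = refl

 length-append : ∀ {R a R⁺} → Append R a R⁺ → length (flat R⁺) ≡ suc (length (flat R))
 length-append {R} p = trans (cong length (flat-append p)) (len-∷ʳ (flat R))

 valid-append : ∀ {R a R⁺} → Append R a R⁺ → Valid R → Valid R⁺
 valid-append (up (m<a ∷ I<a)) (valid d dm i im) = valid d dm (AllPairs.++⁺ i ([] ∷ []) (All.map (_∷ []) I<a)) (All.∷ʳ⁺ im m<a)
 valid-append (down a<m) (valid d dm i im) = valid (AllPairs.++⁺ d ([] ∷ []) (All.map (_∷ []) dm)) (All.∷ʳ⁺ (All.map (<-trans a<m) dm) a<m) [] []

 valid-remove : ∀ {R a R⁺} → Append R a R⁺ → Valid R⁺ → Valid R
 valid-remove (up {I = I} _) (valid d dm i im) = valid d dm (proj₁ (AllPairs-++⁻ I i)) (All.++⁻ˡ I im)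
 valid-remove (down {D} _) (valid d dm i im) = let p , _ , f = AllPairs-++⁻ D d in valid p (All.map All.head f) [] []

 remove-last : ∀ R⁺ → Valid R⁺ → 1 < length (flat R⁺) → ∃[ R ] ∃[ a ] Append R a R⁺
 remove-last ⟨ D , m , I ⟩ v p with unsnoc I
 ... | inj₂ (J , a , refl) = ⟨ D , m , J ⟩ , a , up (All.lookup (I>m v) (∈-++⁺ʳ J (here refl)) ∷ All.map All.head (proj₂ (proj₂ (AllPairs-++⁻ J (asc v)))))
 ... | inj₁ refl with unsnoc D
 ... | inj₂ (E , n , refl) = ⟨ E , n , [] ⟩ , m , down (All.lookup (D>m v) (∈-++⁺ʳ E (here refl)))
 ... | inj₁ refl = ⊥-elim (<-irrefl refl p)

 -- The last component says that the end of this row is a removable corner of the shape; otherwise a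
 -- letter equal to the end of the row moves on.
 Kept : Row → Maybe Row → ℕ → Set
 Kept R S a = a ∈ m R ∷ I R × All (_≤ a) (m R ∷ I R) × (suc (size S) < length (flat R) ⊎ length (flat R) ≡ 1)

 len≥1 : ∀ R → 1 ≤ length (flat R)
 len≥1 R = ≤-trans (s≤s z≤n) (≤-reflexive (sym (len-XY (D R) (I R))))

 min≤ : ∀ {R a} → Valid R → a ∈ m R ∷ I R → m R ≤ a
 min≤ v (here e) = ≤-reflexive (sym e)
 min≤ v (there q) = <⇒≤ (All.lookup (I>m v) q)

 classify : ∀ {S R} a → Valid R → Compat R S → NonTerminal R S a ⊎ Kept R S a ⊎ ∃[ R⁺ ] Append R a R⁺
 classify {S} {R} a v c with Any.any? (a <?_) (I R)
 ... | yes p = let z , z∈ , q = Any⇒∃ p in inj₁ (inj₁ (z , z∈ , q))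
   where Any⇒∃ : ∀ {xs} → Any.Any (a <_) xs → ∃[ z ] z ∈ xs × a < z
         Any⇒∃ (here q) = _ , here refl , q
         Any⇒∃ (there q) = let z , z∈ , r = Any⇒∃ q in z , there z∈ , r
 ... | no n with a ∈? (m R ∷ I R)
 ... | yes a∈ = by (suc (size S) ≟ length (flat R)) (1 <? length (flat R))
   where
   I≤a : All (_≤ a) (I R)
   I≤a = All.map ≮⇒≥ (All.¬Any⇒All¬ (I R) n)
   m≤a : m R ≤ a
   m≤a = min≤ v a∈
   by : Dec (suc (size S) ≡ length (flat R)) → Dec (1 < length (flat R)) → NonTerminal R S a ⊎ Kept R S a ⊎ ∃[ R⁺ ] Append R a R⁺
   by (yes t) (yes l) = inj₁ (inj₂ (a∈ , m≤a ∷ I≤a , t , l))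
   by (no t) _ = inj₂ (inj₁ (a∈ , m≤a ∷ I≤a , inj₁ (≤∧≢⇒< (shorter c) t)))
   by (yes t) (no l) = inj₂ (inj₁ (a∈ , m≤a ∷ I≤a , inj₂ (≤-antisym (≮⇒≥ l) (len≥1 R))))
 ... | no a∉ = inj₂ (inj₂ (by R refl (<-cmp a (m R))))
   where
   I<a : All (_< a) (I R)
   I<a = All.tabulate λ {u} u∈ → ≤∧≢⇒< (≮⇒≥ (All.lookup (All.¬Any⇒All¬ (I R) n) u∈)) λ { refl → a∉ (there u∈) }
   by : ∀ Q → Q ≡ R → Tri (a < m R) (a ≡ m R) (m R < a) → ∃[ R⁺ ] Append Q a R⁺
   by Q refl (tri> _ _ m<a) = _ , up (m<a ∷ I<a)
   by Q refl (tri≈ _ e _) = ⊥-elim (a∉ (here e))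
   by ⟨ _ , _ , [] ⟩ refl (tri< a<m _ _) = _ , down a<m
   by ⟨ _ , _ , i ∷ _ ⟩ refl (tri< a<m _ _) = ⊥-elim (<-asym a<m (<-trans (All.head (I>m v)) (All.head I<a)))

 kept-not-nonterminal : ∀ {R S a} → Kept R S a → ¬ NonTerminal R S a
 kept-not-nonterminal (_ , all≤ , _) (inj₁ (z , z∈ , a<z)) = <⇒≱ a<z (All.lookup all≤ (there z∈))
 kept-not-nonterminal (_ , _ , inj₁ p) (inj₂ (_ , _ , q , _)) = <-irrefl q p
 kept-not-nonterminal (_ , _ , inj₂ p) (inj₂ (_ , _ , _ , q)) = <-irrefl (sym p) q

 append-∉ : ∀ {R a R⁺} → Append R a R⁺ → ¬ a ∈ m R ∷ I R
 append-∉ (up p) q = <-irrefl refl (All.lookup p q)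
 append-∉ (down p) (here refl) = <-irrefl refl p

 append-not-nonterminal : ∀ {R S a R⁺} → Append R a R⁺ → ¬ NonTerminal R S a
 append-not-nonterminal p (inj₂ (a∈ , _)) = append-∉ p a∈
 append-not-nonterminal (up p) (inj₁ (z , z∈ , q)) = <-asym q (All.lookup p (there z∈))
 append-not-nonterminal (down p) (inj₁ (z , () , q))

 -- At the new test points the longer row counts all the letters needed to exceed the size of S,
 -- which bounds h everywhere.
 append-compat : ∀ {S R a R⁺} → Append R a R⁺ → Compat R S → Compat R⁺ S
 append-compat {S} {R} {a} p@(up {D} {m} {I} Y<a) (compat u s) = compat (uc (CL u) cr) (<-≤-trans s (≤-trans (n≤1+n _) (≤-reflexive (sym (length-append p)))))
   where
   open Lower S
   cr : ∀ {v} → Pt D ((m ∷ I) ∷ʳ a) v → h v < length D + lt v ((m ∷ I) ∷ʳ a)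
   cr {v} (inj₁ v∈) = <-≤-trans (CR u (inj₁ v∈)) (+-monoʳ-≤ (length D) (lt≤∷ʳ v (m ∷ I)))
   cr (inj₂ (r , r∈ , refl)) with ∈-∷ʳ⁻ (m ∷ I) r∈
   ... | inj₁ q = <-≤-trans (CR u (inj₂ (r , q , refl))) (+-monoʳ-≤ (length D) (lt≤∷ʳ (suc r) (m ∷ I)))
   ... | inj₂ refl = ≤-<-trans (h≤size (suc r)) (<-≤-trans s (≤-trans (≤-reflexive (length-++ D))
           (+-monoʳ-≤ (length D) (≤-trans (≤-reflexive (sym (lt-all (suc r) (All.map m≤n⇒m≤1+n Y<a)))) (lt≤∷ʳ (suc r) (m ∷ I))))))
 append-compat {S} p@(down {D} {m} {a} a<m) (compat u s) = compat (uc cl cr) (<-≤-trans s (≤-trans (n≤1+n _) (≤-reflexive (sym (length-append p)))))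
   where
   open Lower S
   cl : ∀ {s} → Elem S s → g s < gt s (D ∷ʳ m)
   cl {s} e = <-≤-trans (CL u e) (gt≤∷ʳ s D)
   cr : ∀ {v} → Pt (D ∷ʳ m) (a ∷ []) v → h v < length (D ∷ʳ m) + lt v (a ∷ [])
   cr {v} _ = ≤-<-trans (h≤size v) (<-≤-trans s (m≤m+n _ _))

 -- Where the removed letter was counted, the remaining row still counts all of its own letters, and
 -- these outnumber S.
 remove-compat : ∀ {S R a R⁺} → ValidLow S → Append R a R⁺ → Valid R → Compat R⁺ S → size S < length (flat R) → Compat R S
 remove-compat {S} {a = a} vS (up {D} {m} {I} Y<a) _ (compat u _) s = compat (uc (CL u) cr) s
   where
   open LowerV S vS
   cr : ∀ {v} → Pt D (m ∷ I) v → h v < length D + lt v (m ∷ I)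
   cr {v} (inj₂ (r , r∈ , refl)) = <-≤-trans (CR u (inj₂ (r , ∈-++⁺ˡ r∈ , refl))) (≤-reflexive (cong (length D +_) (lt-∷ʳ-no (m ∷ I) (All.lookup Y<a r∈))))
   cr {v} (inj₁ v∈) with a <? v
   ... | no n = <-≤-trans (CR u (inj₁ v∈)) (≤-reflexive (cong (length D +_) (lt-∷ʳ-no (m ∷ I) (≮⇒≥ n))))
   ... | yes q = ≤-<-trans (h≤size v) (<-≤-trans s (≤-reflexive (trans (length-++ D) (cong (length D +_) (sym (lt-all v (All.map (λ r → <-trans r q) Y<a)))))))
 remove-compat {S} vS (down {D} {m} {a} a<m) vR (compat u _) s = compat (uc cl cr) s
   where
   open LowerV S vS
   len≡ : length (D ++ m ∷ []) ≡ suc (length D)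
   len≡ = len-∷ʳ D
   cl : ∀ {s} → Elem S s → g s < gt s D
   cl {t} e with m ≤? t
   ... | yes p = subst (g t <_) (gt-∷ʳ-no D p) (CL u e)
   ... | no p = <-≤-trans (g<A e) (≤-trans (≤-trans (m≤m+n _ _) (s≤s⁻¹ (≤-trans s (≤-reflexive len≡)))) (≤-reflexive (sym (gt-all t (All.map (<-trans (≰⇒> p)) (D>m vR))))))
   m<v : ∀ {v} → Pt D (m ∷ []) v → m < v
   m<v (inj₁ v∈) = All.lookup (D>m vR) v∈
   m<v (inj₂ (_ , here refl , refl)) = ≤-refl
   cr : ∀ {v} → Pt D (m ∷ []) v → h v < length D + lt v (m ∷ [])
   cr {v} pt = ≤-<-trans (h≤size v) (<-≤-trans s (≤-reflexive (trans len≡ (trans (+-comm 1 _) (cong (length D +_) (sym (lt-yes v [] (m<v pt))))))))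

 -- The compatibility conditions below a row to which a has just been appended at a new minimum.
 grow-down : ∀ {U S S⁺ a} → left S⁺ ≡ left S ∷ʳ a → right S ≡ [] → right S⁺ ≡ [] → All (a <_) (left S) → ¬ IsMin S a →
             Compat U S⁺ ⇔ Adm U S a
 grow-down {U} {S} {S⁺} {a} eA eB eB⁺ A>a nm = mk⇔ to from
   where
   X = D U
   Y = m U ∷ I U
   open Lower S
   module L⁺ = Lower S⁺
   len⁺ : length (left S⁺) ≡ suc (length A)
   len⁺ = trans (cong length eA) (len-∷ʳ A)
   h≡ : ∀ v → h v ≡ length A
   h≡ v = trans (cong (λ w → length A + lt v w) eB) (+-identityʳ _)
   h⁺≡ : ∀ v → L⁺.h v ≡ suc (h v)
   h⁺≡ v = trans (trans (cong (λ w → length (left S⁺) + lt v w) eB⁺) (+-identityʳ _)) (trans len⁺ (cong suc (sym (h≡ v))))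
   size≡ : size S ≡ length A
   size≡ = trans (cong (λ w → length A + length w) eB) (+-identityʳ _)
   size⁺ : size S⁺ ≡ suc (length A)
   size⁺ = trans (cong (λ w → length (left S⁺) + length w) eB⁺) (trans (+-identityʳ _) len⁺)
   in-A : ∀ {s} → Elem S s → s ∈ A
   in-A (inj₁ p) = p
   in-A {s} (inj₂ p) = contradiction (subst (s ∈_) eB p) λ ()
   elem⁺ : ∀ {s} → s ∈ A ∷ʳ a → Elem S⁺ s
   elem⁺ {s} p = inj₁ (subst (s ∈_) (sym eA) p)
   elem⁻ : ∀ {s} → Elem S⁺ s → s ∈ A ⊎ s ≡ a
   elem⁻ {s} (inj₁ p) = ∈-∷ʳ⁻ A (subst (s ∈_) eA p)
   elem⁻ {s} (inj₂ p) = contradiction (subst (s ∈_) eB⁺ p) λ ()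
   g≡ : ∀ {s} → a ≤ s → L⁺.g s ≡ g s
   g≡ {s} p = trans (cong (gt s) eA) (gt-∷ʳ-no A p)
   to : Compat U S⁺ → Adm U S a
   to (compat u s) = adm (admXY (uc (λ {s} e → subst (_< gt s X) (g≡ (<⇒≤ (All.lookup A>a (in-A e)))) (CL u (elem⁺ (∈-++⁺ˡ (in-A e)))))
       (λ {v} pt → <-trans (≤-reflexive (sym (h⁺≡ v))) (CR u pt)))
       (subst (_< gt a X) (g≡ ≤-refl) (CL u (elem⁺ (∈-++⁺ʳ A (here refl)))))
       (λ _ {b} b∈ → contradiction (subst (b ∈_) eB b∈) λ ())
       (λ {v} pt _ e → ⊥-elim (<-irrefl (trans (h⁺≡ v) (sym e)) (CR u pt))))
       (<-trans (≤-reflexive (trans (cong suc size≡) (sym size⁺))) s)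
   from : Adm U S a → Compat U S⁺
   from (adm p rm) = compat (uc cl cr) room⁺
     where
     A<X : length A < gt a X
     A<X = subst (_< gt a X) (gt-all a A>a) (AL p)
     room⁺ : size S⁺ < length (flat U)
     room⁺ = ≤-trans (s≤s (≤-trans (≤-reflexive size⁺) (≤-trans A<X (gt-len a X)))) (≤-trans (s≤s (m≤m+n _ (length (I U)))) (≤-reflexive (sym (len-XY X (I U)))))
     cl : ∀ {s} → Elem S⁺ s → L⁺.g s < gt s X
     cl {s} e with elem⁻ e
     ... | inj₁ q = subst (_< gt s X) (sym (g≡ (<⇒≤ (All.lookup A>a q)))) (CL (base p) (inj₁ q))
     ... | inj₂ refl = subst (_< gt s X) (sym (g≡ ≤-refl)) (AL p)
     cr′ : ∀ {v} → Pt X Y v → suc (h v) < length X + lt v Y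
     cr′ {v} pt with a <? v
     ... | yes q = ≤∧≢⇒< (CR (base p) pt) λ e → [ (λ { (b , b∈ , _) → contradiction (subst (b ∈_) eB b∈) λ () }) , nm ∘ proj₁ ]′ (AR p pt q (sym e))
     cr′ {v} (inj₁ v∈) | no q = <-≤-trans (s≤s (≤-<-trans (≤-reflexive (h≡ v)) A<X)) (≤-trans (drop-one v∈ (≮⇒≥ q)) (m≤m+n _ _))
       where
       drop-one : ∀ {xs v} → v ∈ xs → v ≤ a → suc (gt a xs) ≤ length xs
       drop-one {x ∷ xs} (here refl) r = s≤s (≤-trans (≤-reflexive (gt-no a xs r)) (gt-len a xs))
       drop-one {x ∷ xs} (there v∈) r with gt-view a x xs
       ... | inj₁ (_ , e) = s≤s (≤-trans (≤-reflexive e) (drop-one v∈ r))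
       ... | inj₂ (_ , e) = s≤s (≤-trans (≤-reflexive e) (≤-trans (n≤1+n _) (drop-one v∈ r)))
     cr′ {v} (inj₂ (r , r∈ , refl)) | no q = ≤-trans (s≤s (s≤s (≤-reflexive (h≡ (suc r)))))
       (≤-trans (s≤s (≤-trans A<X (gt-len a X))) (≤-trans (≤-reflexive (+-comm 1 _)) (+-monoʳ-≤ (length X) (≤-trans (s≤s z≤n) (lt-mem {u = r} r∈ ≤-refl ≤-refl)))))
     cr : ∀ {v} → Pt X Y v → L⁺.h v < length X + lt v Y
     cr {v} pt = subst (_< length X + lt v Y) (sym (h⁺≡ v)) (cr′ pt)

 -- Appending a raises h by one beyond a. AR offers no escape, since a is neither the minimum nor at
 -- most some letter of I; so admissibility excludes tightness beyond a.
 grow-up : ∀ {U D m I a} → All (_< a) (m ∷ I) → Compat U (just ⟨ D , m , I ∷ʳ a ⟩) ⇔ Adm U (just ⟨ D , m , I ⟩) a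
 grow-up {U} {D₀} {m₀} {I₀} {a} Y<a@(m<a ∷ I<a) = mk⇔ to from
   where
   S = just ⟨ D₀ , m₀ , I₀ ⟩
   X = D U
   Y = m U ∷ I U
   open Lower S
   module L⁺ = Lower (just ⟨ D₀ , m₀ , I₀ ∷ʳ a ⟩)
   h⁺-hi : ∀ {v} → a < v → L⁺.h v ≡ suc (h v)
   h⁺-hi p = trans (cong (length A +_) (lt-∷ʳ-yes I₀ p)) (+-suc _ _)
   h⁺-lo : ∀ {v} → v ≤ a → L⁺.h v ≡ h v
   h⁺-lo p = cong (length A +_) (lt-∷ʳ-no I₀ p)
   size⁺ : size (just ⟨ D₀ , m₀ , I₀ ∷ʳ a ⟩) ≡ suc (size S)
   size⁺ = trans (cong (length A +_) (len-∷ʳ I₀)) (+-suc _ _)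
   vac : ∀ {b} → b ∈ B → a < b → ⊥
   vac b∈ q = <-asym q (All.lookup I<a b∈)
   to : Compat U (just ⟨ D₀ , m₀ , I₀ ∷ʳ a ⟩) → Adm U S a
   to (compat u s) = adm (admXY (uc (λ { (inj₁ e) → CL u (inj₁ e) ; (inj₂ e) → CL u (inj₂ (∈-++⁺ˡ e)) })
       (λ {v} pt → ≤-<-trans (+-monoʳ-≤ (length A) (lt≤∷ʳ v I₀)) (CR u pt)))
       (CL u (inj₂ (∈-++⁺ʳ I₀ (here refl)))) (λ _ b∈ q → ⊥-elim (vac b∈ q))
       (λ {v} pt q e → ⊥-elim (<-irrefl (trans (h⁺-hi q) (sym e)) (CR u pt))))
       (<-trans (≤-reflexive (sym size⁺)) s)
   from : Adm U S a → Compat U (just ⟨ D₀ , m₀ , I₀ ∷ʳ a ⟩)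
   from (adm p rm) = compat (uc cl cr) room⁺
     where
     hi : ∀ {v} → Pt X Y v → a < v → suc (h v) < length X + lt v Y
     hi pt q = ≤∧≢⇒< (CR (base p) pt) λ e → [ (λ { (b , b∈ , a≤b , _) → <⇒≱ (All.lookup I<a b∈) a≤b }) , (λ { (refl , _) → <-irrefl refl m<a }) ]′ (AR p pt q (sym e))
     room⁺ : size (just ⟨ D₀ , m₀ , I₀ ∷ʳ a ⟩) < length (flat U)
     room⁺ = let d , d∈ , a<d = above X (≤-<-trans z≤n (AL p)) in
       ≤-trans (s≤s (≤-reflexive (trans size⁺ (cong (suc ∘ (length A +_)) (sym (lt-all d (All.map (λ q → <-trans q a<d) I<a)))))))
         (≤-trans (hi (inj₁ d∈) a<d) (≤-trans (+-monoʳ-≤ (length X) (lt-len d Y)) (≤-reflexive (sym (length-++ X)))))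
       where
       above : ∀ xs → 0 < gt a xs → ∃[ d ] d ∈ xs × a < d
       above (x ∷ xs) q with gt-view a x xs
       ... | inj₁ (a<x , _) = x , here refl , a<x
       ... | inj₂ (_ , e) = let d , d∈ , r = above xs (subst (0 <_) e q) in d , there d∈ , r
     cl : ∀ {s} → Elem (just ⟨ D₀ , m₀ , I₀ ∷ʳ a ⟩) s → L⁺.g s < gt s X
     cl (inj₁ e) = CL (base p) (inj₁ e)
     cl (inj₂ e) with ∈-∷ʳ⁻ I₀ e
     ... | inj₁ q = CL (base p) (inj₂ q)
     ... | inj₂ refl = AL p
     cr : ∀ {v} → Pt X Y v → L⁺.h v < length X + lt v Y
     cr {v} pt with a <? v
     ... | yes q = subst (_< length X + lt v Y) (sym (h⁺-hi q)) (hi pt q)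
     ... | no q = subst (_< length X + lt v Y) (sym (h⁺-lo (≮⇒≥ q))) (CR (base p) pt)

 compat-append : ∀ {U R a R⁺} → Append R a R⁺ → Valid R → Compat U (just R⁺) ⇔ Adm U (just R) a
 compat-append (up p) _ = grow-up p
 compat-append (down p) v = grow-down refl refl refl (All.∷ʳ⁺ (All.map (<-trans p) (D>m v)) p) λ { refl → <-irrefl refl p }

 compat-new : ∀ {U a} → Compat U (just ⟨ [] , a , [] ⟩) ⇔ Adm U nothing a
 compat-new = grow-down refl refl refl [] λ ()

 -- Nothing on the right exceeds a, so `E` holds vacuously, and a itself witnesses `In` as a letter
 -- of B or as the minimum.
 compat-kept : ∀ {U R a} → Valid R → a ∈ m R ∷ I R → All (_≤ a) (m R ∷ I R) → Compat U (just R) ⇔ Adm U (just R) a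
 compat-kept {U} {R} {a} v a∈ all≤ = mk⇔
   (λ c → adm (admXY (ucond c) (CL (ucond c) (el a∈)) (λ _ b∈ q → ⊥-elim (<⇒≱ q (All.lookup all≤ (there b∈)))) (λ _ q _ → isIn q a∈)) (shorter c))
   (λ p → compat (base (axy p)) (room p))
   where
   open Lower (just R)
   el : a ∈ m R ∷ I R → Elem (just R) a
   el (here refl) = inj₁ (∈-++⁺ʳ (D R) (here refl))
   el (there p) = inj₂ p
   isIn : ∀ {v} → a < v → a ∈ m R ∷ I R → In a v
   isIn q (here refl) = inj₂ (refl , λ b∈ r → ⊥-elim (<⇒≱ r (All.lookup all≤ (there b∈))))
   isIn q (there p) = inj₁ (a , p , ≤-refl , q)

 low : List Row → Maybe Row
 low [] = nothing
 low (r ∷ _) = just r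

 data Tab : List Row → Set where
   [] : Tab []
   add : ∀ {R t} → Valid R → Compat R (low t) → Tab t → Tab (R ∷ t)

 low-valid : ∀ {t} → Tab t → ValidLow (low t)
 low-valid [] = tt
 low-valid (add v _ _) = v

 -- Inserting a into t gives t′, whose corner in row i was added (true) or was there before (false).
 data Ins : List Row → ℕ → List Row → ℕ → Bool → Set where
   new : ∀ {a} → Ins [] a (⟨ [] , a , [] ⟩ ∷ []) 0 true
   app : ∀ {R a R⁺ t} → Append R a R⁺ → Ins (R ∷ t) a (R⁺ ∷ t) 0 true
   keep : ∀ {R a t} → Kept R (low t) a → Ins (R ∷ t) a (R ∷ t) 0 false
   bump : ∀ {R a R′ y t t′ i f} → Step (low t) R′ y R a → Ins t y t′ i f → Ins (R ∷ t) a (R′ ∷ t′) (suc i) f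

 -- Stated for every row U, so that one equivalence both puts R′ on top of the changed lower rows
 -- and, read backwards, yields the admissibility with which a step can be undone.
 ins-compat : ∀ {t a t′ i f} → Tab t → Ins t a t′ i f → ∀ {U} → Compat U (low t′) ⇔ Adm U (low t) a
 ins-compat _ new = compat-new
 ins-compat (add v _ _) (app p) = compat-append p v
 ins-compat (add v _ _) (keep (a∈ , all≤ , _)) = compat-kept v a∈ all≤
 ins-compat (add _ _ T) (bump st _) {U} = Through.through (low-valid T) st U

 ins-tab : ∀ {t a t′ i f} → Tab t → Ins t a t′ i f → Tab t′
 ins-tab [] new = add (valid [] [] [] []) (compat (uc (λ { (inj₁ ()) ; (inj₂ ()) }) (λ { (inj₂ (r , here refl , refl)) → ≤-reflexive (sym (lt-yes (suc r) [] ≤-refl)) })) (s≤s z≤n)) []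
 ins-tab (add v c T) (app p) = add (valid-append p v) (append-compat p c) T
 ins-tab T@(add _ _ _) (keep _) = T
 ins-tab (add _ _ T) (bump st p) = add (Step.valid′ st) (Equivalence.from (ins-compat T p) (Step.admits st)) (ins-tab T p)

 insert : ∀ t a → Tab t → ∃[ t′ ] ∃[ i ] ∃[ f ] Ins t a t′ i f
 insert [] a _ = _ , _ , _ , new
 insert (R ∷ t) a (add v c T) with classify a v c
 ... | inj₂ (inj₁ k) = _ , _ , _ , keep k
 ... | inj₂ (inj₂ (_ , p)) = _ , _ , _ , app p
 ... | inj₁ nt with forward (low-valid T) v c nt
 ... | R′ , y , st with insert t y T
 ... | t′ , i , f , p = _ , _ , _ , bump st p

 append-unique : ∀ {R a R₁ R₂} → Valid R → Append R a R₁ → Append R a R₂ → R₁ ≡ R₂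
 append-unique v p q = flat-injective (valid-append p v) (valid-append q v) (trans (flat-append p) (sym (flat-append q)))

 ins-functional : ∀ {t a t₁ i₁ f₁ t₂ i₂ f₂} → Tab t → Ins t a t₁ i₁ f₁ → Ins t a t₂ i₂ f₂ → t₁ ≡ t₂ × i₁ ≡ i₂ × f₁ ≡ f₂
 ins-functional _ new new = refl , refl , refl
 ins-functional (add v _ _) (app p) (app q) = cong (_∷ _) (append-unique v p q) , refl , refl
 ins-functional _ (app p) (keep (a∈ , _)) = ⊥-elim (append-∉ p a∈)
 ins-functional {R ∷ t} _ (app p) (bump st _) = ⊥-elim (append-not-nonterminal {S = low t} p (Step.nonterm st))
 ins-functional _ (keep (a∈ , _)) (app p) = ⊥-elim (append-∉ p a∈)
 ins-functional _ (keep _) (keep _) = refl , refl , refl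
 ins-functional {R ∷ t} _ (keep k) (bump st _) = ⊥-elim (kept-not-nonterminal {R} {low t} k (Step.nonterm st))
 ins-functional {R ∷ t} _ (bump st _) (app p) = ⊥-elim (append-not-nonterminal {S = low t} p (Step.nonterm st))
 ins-functional {R ∷ t} _ (bump st _) (keep k) = ⊥-elim (kept-not-nonterminal {R} {low t} k (Step.nonterm st))
 ins-functional (add _ _ T) (bump st p) (bump st′ q) with forward-unique (low-valid T) st st′
 ... | refl , refl with ins-functional T p q
 ... | refl , refl , refl = refl , refl , refl

 append-injective : ∀ {R₁ a₁ R₂ a₂ R⁺} → Valid R⁺ → Append R₁ a₁ R⁺ → Append R₂ a₂ R⁺ → R₁ ≡ R₂ × a₁ ≡ a₂
 append-injective {R₁} {R₂ = R₂} v p q with ∷ʳ-injective (flat R₁) (flat R₂) (trans (sym (flat-append p)) (flat-append q))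
 ... | e , f = flat-injective (valid-remove p v) (valid-remove q v) e , f

 no-append-unit : ∀ {R a b} → ¬ Append R a ⟨ [] , b , [] ⟩
 no-append-unit {R} p = <⇒≱ (s≤s (len≥1 R)) (≤-reflexive (sym (length-append p)))

 ins-injective : ∀ {t′ t₁ a₁ t₂ a₂ i f} → Tab t₁ → Tab t₂ → Ins t₁ a₁ t′ i f → Ins t₂ a₂ t′ i f → t₁ ≡ t₂ × a₁ ≡ a₂
 ins-injective _ _ new new = refl , refl
 ins-injective _ _ new (app p) = ⊥-elim (no-append-unit p)
 ins-injective _ _ (app p) new = ⊥-elim (no-append-unit p)
 ins-injective (add v _ _) _ (app p) (app q) with append-injective (valid-append p v) p q
 ... | refl , refl = refl , refl
 ins-injective (add v _ _) _ (keep (a∈ , all≤ , _)) (keep (b∈ , all≤′ , _)) = refl , ≤-antisym (All.lookup all≤′ a∈) (All.lookup all≤ b∈)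
 ins-injective (add _ _ T) (add _ _ T′) (bump st p) (bump st′ q) with ins-injective T T′ p q
 ... | refl , refl with backward-unique st st′
 ... | refl , refl = refl , refl

 shape : List Row → List ℕ
 shape = map (length ∘ flat)

 top : List ℕ → ℕ
 top [] = 0
 top (l ∷ _) = l

 -- A last row of one box disappears altogether, which needs its own constructor; in `end` the
 -- shortened row has to stay longer than the next one.
 data Rem : List ℕ → ℕ → List ℕ → Set where
   only : Rem (1 ∷ []) 0 []
   end : ∀ {l μ} → top μ < l → Rem (suc l ∷ μ) 0 (l ∷ μ)
   next : ∀ {l μ i ν} → Rem μ i ν → Rem (l ∷ μ) (suc i) (l ∷ ν)

 -- n is the shape after the insertion and the last index the shape before it.
 data Corner (n : List ℕ) (i : ℕ) : Bool → List ℕ → Set where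
   added : ∀ {ν} → Rem n i ν → Corner n i true ν
   kept : ∀ {ν} → Rem n i ν → Corner n i false n

 size-low : ∀ t → size (low t) ≡ top (shape t)
 size-low [] = refl
 size-low (R ∷ t) = size-flat R

 lift-corner : ∀ {l μ i f ν} → Corner μ i f ν → Corner (l ∷ μ) (suc i) f (l ∷ ν)
 lift-corner (added r) = added (next r)
 lift-corner (kept r) = kept (next r)

 step-length : ∀ {S R′ y R a} → Step S R′ y R a → length (flat R′) ≡ length (flat R)
 step-length (step K e _ _ _ _ md _ _ _) = trans (cong (length ∘ flat) e) (trans (cong length (flat-rowOf K)) (sym (len-mode K md)))

 ins-shape : ∀ {t a t′ i f} → Tab t → Ins t a t′ i f → Corner (shape t′) i f (shape t)
 ins-shape _ new = added only
 ins-shape {R ∷ t} (add _ c _) (app p) = subst (λ w → Corner (w ∷ shape t) 0 true (length (flat R) ∷ shape t)) (sym (length-append p))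
   (added (end (subst (_< length (flat R)) (size-low t) (shorter c))))
 ins-shape {R ∷ t} (add _ c _) (keep (_ , _ , k)) = by (length (flat R)) refl k
   where
   by : ∀ l → length (flat R) ≡ l → suc (size (low t)) < length (flat R) ⊎ length (flat R) ≡ 1 → Corner (length (flat R) ∷ shape t) 0 false (length (flat R) ∷ shape t)
   by l e (inj₁ p) = subst (λ w → Corner (w ∷ shape t) 0 false (w ∷ shape t)) (sym (trans e (sym (suc-pred-of l (subst (suc (size (low t)) <_) e p)))))
     (kept (end (subst (_< pred l) (size-low t) (s≤s⁻¹ (≤-trans (subst (suc (size (low t)) <_) e p) (≤-reflexive (sym (suc-pred-of l (subst (suc (size (low t)) <_) e p)))))))))
     where suc-pred-of : ∀ l {k} → k < l → suc (pred l) ≡ l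
           suc-pred-of (suc l) _ = refl
   by l e (inj₂ p) = lone t (shorter c)
     where
     lone : ∀ u → size (low u) < length (flat R) → Corner (length (flat R) ∷ shape u) 0 false (length (flat R) ∷ shape u)
     lone [] _ = subst (λ w → Corner (w ∷ []) 0 false (w ∷ [])) (sym p) (kept only)
     lone (Q ∷ _) s = ⊥-elim (<⇒≱ s (≤-trans (≤-reflexive p) (≤-trans (len≥1 Q) (≤-reflexive (sym (size-flat Q))))))
 ins-shape {R ∷ t} (add _ _ T) (bump {R′ = R′} {t′ = t′} {i} {f} st p) = subst (λ w → Corner (w ∷ shape t′) (suc i) f (length (flat R) ∷ shape t)) (sym (step-length st)) (lift-corner (ins-shape T p))

 unit-shape : ∀ R t → shape (R ∷ t) ≡ 1 ∷ [] → ∃[ n ] R ≡ ⟨ [] , n , [] ⟩ × t ≡ []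
 unit-shape ⟨ [] , n , [] ⟩ [] _ = n , refl , refl
 unit-shape ⟨ d ∷ E , n , J ⟩ [] e = ⊥-elim (<⇒≱ (s≤s (≤-trans (s≤s z≤n) (≤-reflexive (sym (len-XY E J))))) (≤-reflexive (∷-injectiveˡ e)))

 greatest : ∀ {z Z} → Asc (z ∷ Z) → ∃[ a ] a ∈ z ∷ Z × All (_≤ a) (z ∷ Z)
 greatest {z} {[]} _ = z , here refl , ≤-refl ∷ []
 greatest {z} {w ∷ Z} (p ∷ q) with greatest q
 ... | a , a∈ , al = a , there a∈ , <⇒≤ (All.lookup p a∈) ∷ al

 -- The insertion is undone from the marked corner upwards. The letter recovered from the lower rows
 -- is admissible for the row above by `ins-compat`, so `backward` applies to it.
 extract : ∀ t′ {i f ν} → Tab t′ → Corner (shape t′) i f ν → ∃[ t ] ∃[ a ] Tab t × Ins t a t′ i f × shape t ≡ ν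
 extract [] _ (added ())
 extract [] _ (kept ())
 extract (R ∷ t) {i} {f} T@(add v c T₀) cr = by i f (shape (R ∷ t)) refl cr
   where
   deeper : ∀ {l μ i f ν} → l ∷ μ ≡ shape (R ∷ t) → Corner μ i f ν → ∃[ u ] ∃[ a ] Tab u × Ins u a (R ∷ t) (suc i) f × shape u ≡ l ∷ ν
   deeper {i = i} {f} {ν} e cr with extract t T₀ (subst (λ w → Corner w i f ν) (∷-injectiveʳ e) cr)
   ... | u , y , U , p , e′ with backward (low-valid U) v (Equivalence.to (ins-compat U p) c)
   ... | Q , a , st = Q ∷ u , a , add (Step.validR st) (Step.compatR st) U , bump st p , cong₂ _∷_ (trans (sym (step-length st)) (sym (∷-injectiveˡ e))) e′
   lastly : ∀ {μ} → suc (size (low t)) < length (flat R) ⊎ length (flat R) ≡ 1 → μ ≡ shape (R ∷ t) → ∃[ u ] ∃[ a ] Tab u × Ins u a (R ∷ t) 0 false × shape u ≡ μ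
   lastly k e = let a , a∈ , al = greatest (asc-mI v) in R ∷ t , a , T , keep (a∈ , al , k) , sym e
   by : ∀ i f μ {ν} → μ ≡ shape (R ∷ t) → Corner μ i f ν → ∃[ u ] ∃[ a ] Tab u × Ins u a (R ∷ t) i f × shape u ≡ ν
   by .0 _ _ e (added only) with unit-shape R t (sym e)
   ... | n , refl , refl = [] , n , [] , new , refl
   by .0 _ _ e (added (end {l} {μ} p)) with remove-last R v (subst (1 <_) (∷-injectiveˡ e) (s≤s (≤-<-trans z≤n p)))
   ... | Q , a , ap = Q ∷ t , a , add (valid-remove ap v) (remove-compat (low-valid T₀) ap (valid-remove ap v) c room′) T₀ , app ap , cong₂ _∷_ len (sym (∷-injectiveʳ e))
     where
     len : length (flat Q) ≡ l
     len = suc-injective (trans (sym (length-append ap)) (sym (∷-injectiveˡ e)))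
     room′ : size (low t) < length (flat Q)
     room′ = subst₂ _<_ (trans (cong top (∷-injectiveʳ e)) (sym (size-low t))) (sym len) p
   by .(suc _) _ _ e (added (next r)) = deeper e (added r)
   by .(suc _) _ _ e (kept (next r)) = deeper e (kept r)
   by .0 _ _ e (kept only) = lastly (inj₂ (sym (∷-injectiveˡ e))) e
   by .0 _ _ e (kept (end {l} {μ} p)) = lastly (inj₁ (subst₂ _<_ (cong suc (trans (cong top (∷-injectiveʳ e)) (sym (size-low t)))) (∷-injectiveˡ e) (s≤s p))) e

 reading : List Row → List ℕ
 reading [] = []
 reading (R ∷ t) = reading t ++ flat R

 -- A kept letter repeats the last letter of the word and is idempotent. For a bump, the relation of
 -- the step involves the next row only, and the rows further down are a common left factor.
 ins-reading : ∀ {t a t′ i f} → Tab t → Ins t a t′ i f → reading t ++ a ∷ [] ≈ reading t′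
 ins-reading _ new = ≈-refl
 ins-reading {R ∷ t} {a} _ (app p) = ≈-reflexive (trans (++-assoc (reading t) (flat R) (a ∷ [])) (cong (reading t ++_) (sym (flat-append p))))
 ins-reading {R ∷ t} {a} (add v _ _) (keep (a∈ , al , _)) = ≈-trans (≈-reflexive (++-assoc (reading t) (flat R) (a ∷ []))) (++-cong {as = reading t} ≈-refl (ends (D R) (asc-mI v) a∈ al))
   where
   ends : ∀ E {Z} → Asc Z → a ∈ Z → All (_≤ a) Z → (E ++ Z) ++ a ∷ [] ≈ E ++ Z
   ends E {Z} az a∈ al with asc-split az a∈
   ... | P , [] , refl , _ , _ = ≈-trans (≈-reflexive (trans (++-assoc E (P ++ a ∷ []) (a ∷ [])) (trans (cong (E ++_) (++-assoc P (a ∷ []) (a ∷ []))) (sym (++-assoc E P _)))))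
         (≈-trans (++-cong {as = E ++ P} ≈-refl (idem a)) (≈-reflexive (++-assoc E P _)))
   ... | P , q ∷ Q , refl , _ , (a<q ∷ _) = ⊥-elim (<⇒≱ a<q (All.lookup al (∈-++⁺ʳ P (there (here refl)))))
 ins-reading {R ∷ t} {a} (add _ _ T) (bump {R′ = R′} {y} {t′ = t′} st p) =
   ≈-trans (≈-reflexive (++-assoc (reading t) (flat R) (a ∷ [])))
   (≈-trans (≈-sym (under t (Step⇒≈ (low-valid T) st)))
   (≈-trans (≈-reflexive (sym (++-assoc (reading t) (y ∷ []) (flat R′)))) (++-cong (ins-reading T p) ≈-refl)))
   where
   under : ∀ t {p q} → word (low t) ++ p ≈ word (low t) ++ q → reading t ++ p ≈ reading t ++ q
   under [] e = e
   under (Q ∷ t) {p} {q} e = ≈-trans (≈-reflexive (++-assoc (reading t) (flat Q) p)) (≈-trans (++-cong {as = reading t} ≈-refl e) (≈-reflexive (sym (++-assoc (reading t) (flat Q) q))))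

 -- The record of an insertion: marked corners, the latest first, down to the empty shape.
 data Code : List ℕ → List (ℕ × Bool) → Set where
   [] : Code [] []
   _∷_ : ∀ {μ ν i f c} → Corner μ i f ν → Code ν c → Code μ ((i , f) ∷ c)

 -- Words are read from right to left, so that inserting a further letter is consing.
 data Run : List ℕ → List Row → List (ℕ × Bool) → Set where
   [] : Run [] [] []
   _∷_ : ∀ {w t c a t′ i f} → Ins t a t′ i f → Run w t c → Run (a ∷ w) t′ ((i , f) ∷ c)

 run-tab : ∀ {w t c} → Run w t c → Tab t
 run-tab [] = []
 run-tab (p ∷ r) = ins-tab (run-tab r) p

 run-code : ∀ {w t c} → Run w t c → Code (shape t) c
 run-code [] = []
 run-code (p ∷ r) = ins-shape (run-tab r) p ∷ run-code r

 run-length : ∀ {w t c} → Run w t c → length c ≡ length w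
 run-length [] = refl
 run-length (_ ∷ r) = cong suc (run-length r)

 run-total : ∀ w → ∃[ t ] ∃[ c ] Run w t c
 run-total [] = [] , [] , []
 run-total (a ∷ w) with run-total w
 ... | t , c , r with insert t a (run-tab r)
 ... | t′ , i , f , p = t′ , (i , f) ∷ c , p ∷ r

 run-functional : ∀ {w t₁ c₁ t₂ c₂} → Run w t₁ c₁ → Run w t₂ c₂ → t₁ ≡ t₂ × c₁ ≡ c₂
 run-functional [] [] = refl , refl
 run-functional (p ∷ r) (q ∷ s) with run-functional r s
 ... | refl , refl with ins-functional (run-tab r) p q
 ... | refl , refl , refl = refl , refl

 run-injective : ∀ {w₁ w₂ t c} → Run w₁ t c → Run w₂ t c → w₁ ≡ w₂
 run-injective [] [] = refl
 run-injective (p ∷ r) (q ∷ s) with ins-injective (run-tab r) (run-tab s) p q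
 ... | refl , refl = cong (_ ∷_) (run-injective r s)

 run-onto : ∀ {t c} → Tab t → Code (shape t) c → ∃[ w ] Run w t c
 run-onto {t} T cd = by T refl cd
   where
   by : ∀ {t μ c} → Tab t → μ ≡ shape t → Code μ c → ∃[ w ] Run w t c
   by {[]} T e [] = [] , []
   by {t} T refl (cr ∷ cd) with extract t T cr
   ... | u , a , U , p , e with by U (sym e) cd
   ... | w , r = a ∷ w , p ∷ r

 run-reading : ∀ {w t c} → Run w t c → reverse w ≈ reading t
 run-reading [] = ≈-refl
 run-reading {a ∷ w} (p ∷ r) = ≈-trans (≈-reflexive (unfold-reverse a w)) (≈-trans (++-cong (run-reading r) ≈-refl) (ins-reading (run-tab r) p))

-- Strict decomposition tableaux as stacks of compatible rows

module Fillings where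

 open Rows
 open Compatibility
 open Reverse using (len-XY; asc-mI)
 open Transfer using (flat-injective; size-flat)
 open Insertion using (Tab; []; add; reading)
 open import Data.Fin as Fin using (Fin; zero; suc; toℕ)
 open import Data.List using (tabulate; lookup; concat; reverse)
 open import Data.List.Properties using (length-tabulate; tabulate-lookup; unfold-reverse; concat-++; ++-identityʳ)
 open import Data.List.Relation.Unary.Linked using (Linked; []; [-]; _∷_)

 data At {A : Set} : List A → ℕ → A → Set where
   here : ∀ {x xs} → At (x ∷ xs) 0 x
   there : ∀ {x y xs p} → At xs p x → At (y ∷ xs) (suc p) x

 module _ {A : Set} where

   at-functional : ∀ {xs : List A} {p x y} → At xs p x → At xs p y → x ≡ y
   at-functional here here = refl
   at-functional (there a) (there b) = at-functional a b

   at-exists : ∀ (xs : List A) p → p < length xs → ∃[ x ] At xs p x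
   at-exists (x ∷ xs) zero _ = x , here
   at-exists (x ∷ xs) (suc p) (s≤s q) = let y , a = at-exists xs p q in y , there a

   at-length : ∀ {xs : List A} {p x} → At xs p x → p < length xs
   at-length here = z<s
   at-length (there a) = s<s (at-length a)

   at-++ʳ : ∀ (xs : List A) {ys p x} → At ys p x → At (xs ++ ys) (length xs + p) x
   at-++ʳ [] a = a
   at-++ʳ (x ∷ xs) a = there (at-++ʳ xs a)

   at-tabulate⁺ : ∀ {k} (f : Fin k → A) i → At (tabulate f) (toℕ i) (f i)
   at-tabulate⁺ f zero = here
   at-tabulate⁺ f (suc i) = there (at-tabulate⁺ (f ∘ suc) i)

   at-tabulate⁻ : ∀ {k} (f : Fin k → A) {p x} → At (tabulate f) p x → ∃[ i ] toℕ i ≡ p × f i ≡ x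
   at-tabulate⁻ {suc k} f here = zero , refl , refl
   at-tabulate⁻ {suc k} f (there a) = let i , e , e′ = at-tabulate⁻ (f ∘ suc) a in suc i , cong suc e , e′

 gt-< : ∀ {v xs} → v ∈ xs → gt v xs < length xs
 gt-< {v} {x ∷ xs} (here refl) = s≤s (≤-trans (≤-reflexive (gt-no v xs ≤-refl)) (gt-len v xs))
 gt-< {v} {x ∷ xs} (there v∈) with gt-view v x xs
 ... | inj₁ (_ , e) = s≤s (≤-trans (≤-reflexive e) (gt-< v∈))
 ... | inj₂ (_ , e) = s≤s (≤-trans (≤-reflexive e) (<⇒≤ (gt-< v∈)))

 at-desc : ∀ {X Y x} → Desc X → x ∈ X → At (X ++ Y) (gt x X) x
 at-desc {x ∷ X} {Y} (p ∷ d) (here refl) = subst (λ n → At (x ∷ X ++ Y) n x) (sym (gt-none x {x ∷ X} (≤-refl ∷ All.map <⇒≤ p))) here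
 at-desc {u ∷ X} {Y} {x} (p ∷ d) (there x∈) = subst (λ n → At (u ∷ X ++ Y) n x) (sym (gt-yes x X (All.lookup p x∈))) (there (at-desc d x∈))

 at-asc : ∀ {Y y} → Asc Y → y ∈ Y → At Y (lt y Y) y
 at-asc {y ∷ Y} (p ∷ d) (here refl) = subst (λ n → At (y ∷ Y) n y) (sym (lt-none y {y ∷ Y} (≤-refl ∷ All.map <⇒≤ p))) here
 at-asc {u ∷ Y} {y} (p ∷ d) (there y∈) = subst (λ n → At (u ∷ Y) n y) (sym (lt-yes y Y (All.lookup p y∈))) (there (at-asc d y∈))

 at-∈ : ∀ {xs : List ℕ} {p x} → At xs p x → x ∈ xs
 at-∈ here = here refl
 at-∈ (there a) = there (at-∈ a)

 at-split : ∀ {A : Set} (X : List A) {Y p x} → At (X ++ Y) p x → At X p x ⊎ ∃[ k ] p ≡ length X + k × At Y k x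
 at-split [] a = inj₂ (_ , refl , a)
 at-split (x ∷ X) here = inj₁ here
 at-split (x ∷ X) (there a) with at-split X a
 ... | inj₁ b = inj₁ (there b)
 ... | inj₂ (k , e , b) = inj₂ (k , cong suc e , b)

 desc-index : ∀ {X x p} → Desc X → At X p x → gt x X ≡ p
 desc-index {x ∷ X} (q ∷ d) here = gt-none x (≤-refl ∷ All.map <⇒≤ q)
 desc-index {u ∷ X} {x} (q ∷ d) (there a) = trans (gt-yes x X (All.lookup q (at-∈ a))) (cong suc (desc-index d a))

 asc-index : ∀ {Y y p} → Asc Y → At Y p y → lt y Y ≡ p
 asc-index {y ∷ Y} (q ∷ d) here = lt-none y (≤-refl ∷ All.map <⇒≤ q)
 asc-index {u ∷ Y} {y} (q ∷ d) (there a) = trans (lt-yes y Y (All.lookup q (at-∈ a))) (cong suc (asc-index d a))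

 at-word : ∀ {X Y p x} → Desc X → Asc Y → At (X ++ Y) p x → (x ∈ X × gt x X ≡ p) ⊎ (x ∈ Y × length X + lt x Y ≡ p)
 at-word {X} dX aY a with at-split X a
 ... | inj₁ b = inj₁ (at-∈ b , desc-index dX b)
 ... | inj₂ (k , e , b) = inj₂ (at-∈ b , trans (cong (length X +_) (asc-index aY b)) (sym e))

 -- The forbidden patterns in terms of offsets. Each row of a shifted diagram begins one column
 -- later, so offset p of the lower row stands below offset p + 1 of the upper one.
 record Avoid (rs ss : List ℕ) : Set where
   field
     av-i : ∀ {r p s} → At rs 0 r → At ss p s → ¬ r ≤ s
     av-ii : ∀ {p p′ r s s′} → p < p′ → At rs (suc p) r → At ss p s → At ss p′ s′ → ¬ (r ≤ s′ × s′ < s)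
     av-iii : ∀ {p p′ r₀ r s s′} → p < p′ → At rs p r₀ → At rs (suc p) r → At ss p s → At ss p′ s′ → ¬ (r₀ < r × s < s′ × s′ ≤ r)
     av-iv : ∀ {p p′ r′ r s} → p′ ≤ p → At rs p′ r′ → At rs (suc p) r → At ss p s → ¬ (s < r′ × r′ ≤ r)
     av-v : ∀ {p r₀ r s} → At rs p r₀ → At rs (suc p) r → At ss p s → ¬ (s ≤ r₀ × r₀ < r)

 module Avoidance {R Q : Row} (vR : Valid R) (vQ : Valid Q) (sh : size (just Q) < length (flat R)) where
   open LowerV (just Q) vQ

   X Y : List ℕ
   X = D R
   Y = m R ∷ I R

   aY : Asc Y
   aY = asc-mI vR

   H : ℕ → ℕ
   H v = length X + lt v Y

   flatQ : flat Q ≡ A ++ B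
   flatQ = sym (++-assoc (D Q) (m Q ∷ []) (I Q))

   at-Q : ∀ {p s} → At (flat Q) p s → (s ∈ A × g s ≡ p) ⊎ (s ∈ B × h s ≡ p)
   at-Q {p} {s} a = at-word descA ascB (subst (λ w → At w p s) flatQ a)

   at-R : ∀ {p r} → At (flat R) p r → (r ∈ X × gt r X ≡ p) ⊎ (r ∈ Y × H r ≡ p)
   at-R = at-word (desc vR) aY

   at-A : ∀ {s} → s ∈ A → At (flat Q) (g s) s
   at-A {s} s∈ = subst (λ w → At w (g s) s) (sym flatQ) (at-desc descA s∈)

   at-B : ∀ {s} → s ∈ B → At (flat Q) (h s) s
   at-B {s} s∈ = subst (λ w → At w (h s) s) (sym flatQ) (at-++ʳ A (at-asc ascB s∈))

   sizeQ : length (flat Q) ≡ size (just Q)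
   sizeQ = sym (size-flat Q)

   in-R : ∀ p → p < length (flat Q) → ∃[ r ] At (flat R) p r × ∃[ r⁺ ] At (flat R) (suc p) r⁺
   in-R p q = let l = ≤-trans (s≤s q) (≤-trans (≤-reflexive (cong suc sizeQ)) sh)
                  r , a = at-exists (flat R) p (<⇒≤ l)
                  r⁺ , b = at-exists (flat R) (suc p) l in r , a , r⁺ , b

   lt-< : ∀ {u v} xs → lt u xs < lt v xs → u < v
   lt-< xs p = ≰⇒> λ q → <⇒≱ p (lt-mono xs q)

   ascends : ∀ {p r r⁺} → length X ≤ p → At (flat R) p r → At (flat R) (suc p) r⁺ → r < r⁺
   ascends {p} {r} {r⁺} l a b with at-R a | at-R b
   ... | inj₁ (r∈ , e) | _ = ⊥-elim (<⇒≱ (subst (_< length X) e (gt-< r∈)) l)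
   ... | inj₂ _ | inj₁ (r∈ , e) = ⊥-elim (<⇒≱ (subst (_< length X) e (gt-< r∈)) (m≤n⇒m≤1+n l))
   ... | inj₂ (_ , e) | inj₂ (_ , e′) = lt-< Y (+-cancelˡ-< (length X) _ _ (≤-reflexive (trans (cong suc e) (sym e′))))

   A≤Q : length A ≤ length (flat Q)
   A≤Q = ≤-trans (m≤m+n _ _) (≤-reflexive (sym sizeQ))

   module Forward (av : Avoid (flat R) (flat Q)) where
     open Avoid av

     -- In the first position this is pattern (i). Otherwise the letter of A just before position
     -- `g s` exceeds s, and an upper letter at most s would complete pattern (ii).
     bigger : ∀ {s} → Elem (just Q) s → ∃[ r ] At (flat R) (g s) r × s < r
     bigger {s} el with g s in eq | in-R (g s) (<-≤-trans (g<A el) A≤Q)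
     ... | zero | r , a , _ = r , a , ≰⇒> λ r≤s → [ (λ s∈ → av-i a (at-A s∈) r≤s) , (λ s∈ → av-i a (at-B s∈) r≤s) ]′ el
     ... | suc p | r , a , _ with g-sel {p} {s} (≤-reflexive (sym eq))
     ... | b , b∈ , s<b , e = r , a , ≰⇒> λ r≤s → [ (λ s∈ → av-ii (≤-reflexive (sym eq)) a below (at-A s∈) (r≤s , s<b)) ,
               (λ s∈ → av-ii (<-≤-trans (<⇒≤ (subst (_< length A) eq (g<A el))) (A≤h s)) a below (at-B s∈) (r≤s , s<b)) ]′ el
       where below = subst (λ n → At (flat Q) n b) e (at-A b∈)

     -- The upper letter in position `g s` exceeds s by `bigger`. Were it on the increasing side,
     -- the letter of A below its right neighbour would form pattern (v).
     cl : ∀ {s} → Elem (just Q) s → g s < gt s X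
     cl {s} el with bigger el | at-exists (flat Q) (g s) (<-≤-trans (g<A el) A≤Q)
     ... | r , a , s<r | b , ab with at-Q ab
     ... | inj₂ (_ , e) = ⊥-elim (<⇒≱ (g<A el) (≤-trans (A≤h b) (≤-reflexive e)))
     ... | inj₁ (b∈ , e) with at-R a
     ... | inj₁ (r∈ , f) = subst (_< gt s X) f (gt-mem r∈ s<r ≤-refl)
     ... | inj₂ (_ , f) with bigger (inj₁ b∈) | in-R (g s) (<-≤-trans (g<A el) A≤Q)
     ... | r′ , a′ , b<r′ | r₀ , a₀ , r⁺ , a⁺ = ⊥-elim (av-v a a⁺ ab
                   (<⇒≤ (subst (b <_) (at-functional (subst (λ n → At (flat R) n r′) e a′) a) b<r′) , ascends (≤-trans (m≤m+n _ _) (≤-reflexive f)) a a⁺))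

     A≤X : length A ≤ length X
     A≤X = ≤-trans (≤-reflexive (sym (min-g refl))) (≤-trans (cl (inj₁ (min∈ refl))) (gt-len _ X))

     -- If h is too large at `suc r`, a letter of B that is at most r stands below the right
     -- neighbour of r, which is pattern (v). If it is too large at a letter v of X, the letter of Q
     -- in position H v - 1 is below v and its upper neighbour is at least v, which is pattern (iv).
     cr : ∀ {v} → Pt X Y v → h v < H v
     cr {v} pt = ≰⇒> (nope pt)
       where
       nope : ∀ {v} → Pt X Y v → ¬ H v ≤ h v
       nope (inj₂ (r , r∈ , refl)) le with at-exists (flat Q) (H r) P<l | in-R (H r) P<l
         where
         P<h : H r < h (suc r)
         P<h = <-≤-trans (+-monoʳ-< (length X) (lt-mem r∈ ≤-refl ≤-refl)) le
         P<l : H r < length (flat Q)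
         P<l = <-≤-trans P<h (≤-trans (h≤size (suc r)) (≤-reflexive (sym sizeQ)))
       ... | s , as | r₀ , a₀ , r⁺ , a⁺ with at-Q as
       ... | inj₁ (s∈ , e) = <⇒≱ (g<A (inj₁ s∈)) (≤-trans A≤X (≤-trans (m≤m+n _ _) (≤-reflexive (sym e))))
       ... | inj₂ (s∈ , e) = av-v at-r a⁺ as (s≤s⁻¹ (lt-< B (+-cancelˡ-< (length A) _ _ (≤-<-trans (≤-reflexive e) P<h))) , ascends (m≤m+n _ _) at-r a⁺)
         where
         at-r : At (flat R) (H r) r
         at-r = at-++ʳ X (at-asc aY r∈)
         P<h : H r < h (suc r)
         P<h = <-≤-trans (+-monoʳ-< (length X) (lt-mem r∈ ≤-refl ≤-refl)) le
       nope {v} (inj₁ v∈) le = by (H v) refl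
         where
         by : ∀ Q₀ → H v ≡ Q₀ → ⊥
         by zero e = <⇒≱ (≤-<-trans z≤n (gt-< v∈)) (≤-trans (m≤m+n _ _) (≤-reflexive e))
         by (suc q) e with at-exists (flat Q) q q<l | in-R q q<l
           where
           q<l : q < length (flat Q)
           q<l = ≤-trans (≤-reflexive (sym e)) (≤-trans le (≤-trans (h≤size v) (≤-reflexive (sym sizeQ))))
         ... | s , as | _ , _ , r , ar = av-iv (s≤s⁻¹ (≤-trans (gt-< v∈) (≤-trans (m≤m+n _ _) (≤-reflexive e)))) (at-desc (desc vR) v∈) ar as (s<v (at-Q as) , v≤r (at-R ar))
           where
           s<v : (s ∈ A × g s ≡ q) ⊎ (s ∈ B × h s ≡ q) → s < v
           s<v (inj₂ (_ , f)) = lt-< B (+-cancelˡ-< (length A) _ _ (≤-trans (≤-reflexive (trans (cong suc f) (sym e))) le))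
           s<v (inj₁ (s∈ , f)) = ≰⇒> λ v≤s → <⇒≱ (≤-<-trans (gt-anti X v≤s) (gt-< v∈)) (≤-trans (≤-trans (m≤m+n _ (lt v Y)) (≤-reflexive (trans e (cong suc (sym f))))) (cl (inj₁ s∈)))
           v≤r : (r ∈ X × gt r X ≡ suc q) ⊎ (r ∈ Y × H r ≡ suc q) → v ≤ r
           v≤r (inj₁ (r∈ , f)) = ⊥-elim (<⇒≱ (gt-< r∈) (≤-trans (m≤m+n _ _) (≤-reflexive (trans e (sym f)))))
           v≤r (inj₂ (r∈ , f)) = ≮⇒≥ λ r<v → <-irrefl (trans f (sym e)) (+-monoʳ-< (length X) (lt-mem r∈ ≤-refl r<v))

   module Backward (u : UC X Y (just Q)) where

     A≤X : length A ≤ length X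
     A≤X = ≤-trans (≤-reflexive (sym (min-g refl))) (≤-trans (CL u (inj₁ (min∈ refl))) (gt-len _ X))

     elem : ∀ {p s} → At (flat Q) p s → Elem (just Q) s
     elem a = [ (λ { (q , _) → inj₁ q }) , (λ { (q , _) → inj₂ q }) ]′ (at-Q a)

     gt-at : ∀ {p r t} → At (flat R) p r → p < gt t X → t < r
     gt-at {t = t} a l with at-R a
     ... | inj₁ (_ , e) = ≰⇒> λ r≤t → <⇒≱ l (≤-trans (gt-anti X r≤t) (≤-reflexive e))
     ... | inj₂ (_ , e) = ⊥-elim (<⇒≱ l (≤-trans (gt-len t X) (≤-trans (m≤m+n _ _) (≤-reflexive e))))

     at-h : ∀ {p s v} → At (flat Q) p s → s < v → p < h v
     at-h {v = v} a s<v with at-Q a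
     ... | inj₁ (s∈ , e) = <-≤-trans (subst (_< length A) e (g<A (inj₁ s∈))) (A≤h v)
     ... | inj₂ (s∈ , e) = subst (_< h v) e (h-mem s∈ ≤-refl s<v)

     H-suc : ∀ {r} → r ∈ Y → H (suc r) ≤ suc (H r)
     H-suc r∈ = ≤-trans (+-monoʳ-≤ (length X) (lt-suc aY)) (≤-reflexive (+-suc _ _))

     in-Y : ∀ {p r r⁺} → At (flat R) p r → At (flat R) (suc p) r⁺ → r < r⁺ → r⁺ ∈ Y × H r⁺ ≡ suc p
     in-Y a b l with at-R b
     ... | inj₂ q = q
     ... | inj₁ (r⁺∈ , e) with at-R a
     ... | inj₁ (_ , f) = ⊥-elim (<⇒≱ (≤-reflexive (trans (cong suc f) (sym e))) (gt-anti X (<⇒≤ l)))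
     ... | inj₂ (_ , f) = ⊥-elim (<⇒≱ (gt-< r⁺∈) (≤-trans (≤-trans (m≤m+n _ _) (≤-reflexive f)) (≤-trans (n≤1+n _) (≤-reflexive (sym e)))))

     in-Y₀ : ∀ {p r r⁺} → At (flat R) p r → At (flat R) (suc p) r⁺ → r < r⁺ → r ∈ Y × H r ≡ p
     in-Y₀ {p} a b l with at-R a
     ... | inj₂ q = q
     ... | inj₁ (r∈ , f) with at-R b
     ... | inj₁ (_ , e) = ⊥-elim (<⇒≱ (≤-reflexive (trans (cong suc f) (sym e))) (gt-anti X (<⇒≤ l)))
     ... | inj₂ (r⁺∈ , e) = by r⁺∈
       where
       r>m : m R < _
       r>m = All.lookup (D>m vR) r∈
       by : _ ∈ Y → _
       by (here refl) = ⊥-elim (<-asym l r>m)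
       by (there q) = ⊥-elim (<⇒≱ (gt-< r∈) (≤-trans X≤p (≤-reflexive (sym f))))
         where
         X≤p : length X ≤ p
         X≤p = s≤s⁻¹ (≤-trans (≤-trans (≤-reflexive (+-comm 1 _)) (+-monoʳ-≤ (length X) (≤-trans (s≤s z≤n) (lt-mem {u = m R} (here refl) ≤-refl (All.lookup (I>m vR) q))))) (≤-reflexive e))

     avoid : Avoid (flat R) (flat Q)
     avoid = record
       { av-i = λ a b r≤s → <⇒≱ (gt-at a (≤-<-trans z≤n (CL u (elem b)))) r≤s
       ; av-ii = λ { l a b c (r≤s′ , s′<s) → <⇒≱ (gt-at a (≤-<-trans (deep l b c s′<s) (CL u (elem c)))) r≤s′ }
       ; av-iii = λ { l a a⁺ b c (r<r⁺ , s<s′ , s′≤r) → three l (in-Y a a⁺ r<r⁺) b c s<s′ s′≤r }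
       ; av-iv = λ { l a a⁺ b (s<r′ , r′≤r) → four l (at-R a) (at-R a⁺) b s<r′ r′≤r }
       ; av-v = λ { a a⁺ b (s≤r , r<r⁺) → let r∈ , e = in-Y₀ a a⁺ r<r⁺ in
           <⇒≱ (CR u (inj₂ (_ , r∈ , refl))) (≤-trans (H-suc r∈) (≤-trans (≤-reflexive (cong suc e)) (at-h b (s≤s s≤r)))) }
       }
       where
       deep : ∀ {p p′ s s′} → p < p′ → At (flat Q) p s → At (flat Q) p′ s′ → s′ < s → p < g s′
       deep {p} {p′} {s} {s′} l b c s′<s with at-Q b
       ... | inj₁ (s∈ , e) = subst (_< g s′) e (gt-mem s∈ s′<s ≤-refl)
       ... | inj₂ (s∈ , e) with at-Q c
       ... | inj₁ (s′∈ , f) = ⊥-elim (<⇒≱ (≤-<-trans (≤-trans (A≤h s) (≤-reflexive e)) l) (≤-trans (≤-reflexive (sym f)) (<⇒≤ (g<A (inj₁ s′∈)))))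
       ... | inj₂ (_ , f) = ⊥-elim (<⇒≱ l (≤-trans (≤-reflexive (sym f)) (≤-trans (h-mono (<⇒≤ s′<s)) (≤-reflexive e))))
       three : ∀ {p p′ r s s′} → p < p′ → r ∈ Y × H r ≡ suc p → At (flat Q) p s → At (flat Q) p′ s′ → s < s′ → s′ ≤ r → ⊥
       three {r = r} l (r∈ , e) b c s<s′ s′≤r = <⇒≱ (CR u (inj₂ (_ , r∈ , refl))) (≤-trans (H-suc r∈) (≤-trans (≤-reflexive (cong suc e)) (≤-trans (s≤s l) (at-h c (s≤s s′≤r)))))
       four : ∀ {p p′ r′ r s} → p′ ≤ p → (r′ ∈ X × gt r′ X ≡ p′) ⊎ (r′ ∈ Y × H r′ ≡ p′) → (r ∈ X × gt r X ≡ suc p) ⊎ (r ∈ Y × H r ≡ suc p) →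
              At (flat Q) p s → s < r′ → r′ ≤ r → ⊥
       four l (inj₂ (r′∈ , e)) _ b s<r′ _ = <⇒≱ (CR u (inj₂ (_ , r′∈ , refl))) (≤-trans (H-suc r′∈) (≤-trans (≤-reflexive (cong suc e)) (≤-trans (s≤s l) (at-h b (m<n⇒m<1+n s<r′)))))
       four l (inj₁ (r′∈ , e)) (inj₁ (_ , f)) b _ r′≤r = <⇒≱ (s≤s l) (≤-trans (≤-reflexive (sym f)) (≤-trans (gt-anti X r′≤r) (≤-reflexive e)))
       four l (inj₁ (r′∈ , e)) (inj₂ (_ , f)) b s<r′ r′≤r = <⇒≱ (CR u (inj₁ r′∈)) (≤-trans (≤-trans (+-monoʳ-≤ (length X) (lt-mono Y r′≤r)) (≤-reflexive f)) (at-h b s<r′))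

 compat⇔avoid : ∀ {R Q} → Valid R → Valid Q → size (just Q) < length (flat R) → Compat R (just Q) ⇔ Avoid (flat R) (flat Q)
 compat⇔avoid vR vQ sh = mk⇔ (λ c → Avoidance.Backward.avoid vR vQ sh (ucond c)) (λ av → compat (uc (Avoidance.Forward.cl vR vQ sh av) (Avoidance.Forward.cr vR vQ sh av)) sh)

 tabulate-asc : ∀ {k} (f : Fin k → ℕ) → (∀ {a b} → a Fin.< b → f a < f b) → Asc (tabulate f)
 tabulate-asc {zero} f p = []
 tabulate-asc {suc k} f p = All.tabulate⁺ (λ i → p (s≤s z≤n)) ∷ tabulate-asc (f ∘ suc) (λ q → p (s≤s q))

 asc-tabulate : ∀ {k} (f : Fin k → ℕ) → Asc (tabulate f) → ∀ {a b} → a Fin.< b → f a < f b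
 asc-tabulate {suc k} f (p ∷ _) {zero} {suc b} _ = All.tabulate⁻ p b
 asc-tabulate {suc k} f (_ ∷ q) {suc a} {suc b} (s≤s l) = asc-tabulate (f ∘ suc) q l

 unimodal-row : ∀ {k} (f : Fin k → ℕ) → Unimodal f → ∃[ R ] tabulate f ≡ flat R × Valid R
 unimodal-row f (j , d , a) = let R , e , v , _ = go f j d a in R , e , v
   where
   -- The last conclusion traces the decreasing run back to arguments up to j, so that f at zero is
   -- known to exceed it when put in front.
   go : ∀ {k} (f : Fin k → ℕ) (j : Fin k) → (∀ {a b} → a Fin.< b → b Fin.≤ j → f a > f b) → (∀ {a b} → j Fin.≤ a → a Fin.< b → f a < f b) →
        ∃[ R ] tabulate f ≡ flat R × Valid R × All (λ x → ∃[ b ] b Fin.≤ j × x ≡ f b) (D R ∷ʳ m R)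
   go f zero d a = ⟨ [] , f zero , tabulate (f ∘ suc) ⟩ , refl , valid [] [] (tabulate-asc (f ∘ suc) (λ l → a z≤n (s≤s l))) (All.tabulate⁺ (λ i → a z≤n (s≤s z≤n))) ,
                   (zero , z≤n , refl) ∷ []
   go f (suc j) d a with go (f ∘ suc) j (λ l q → d (s≤s l) (s≤s q)) (λ q l → a (s≤s q) (s≤s l))
   ... | ⟨ D₀ , m₀ , I₀ ⟩ , e , valid dd dm ai im , al = ⟨ f zero ∷ D₀ , m₀ , I₀ ⟩ , cong (f zero ∷_) e ,
         valid (All.++⁻ˡ D₀ smaller ∷ dd) (All.lookup smaller (∈-++⁺ʳ D₀ (here refl)) ∷ dm) ai im ,
         (zero , z≤n , refl) ∷ All.map (λ { (b , q , refl) → suc b , s≤s q , refl }) al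
     where
     smaller : All (_< f zero) (D₀ ∷ʳ m₀)
     smaller = All.map (λ { (b , q , refl) → d (s≤s z≤n) (s≤s q) }) al

 row-unimodal : ∀ D₀ {m₀ I₀} → Valid ⟨ D₀ , m₀ , I₀ ⟩ → ∀ {k} (f : Fin k → ℕ) → tabulate f ≡ D₀ ++ m₀ ∷ I₀ → Unimodal f
 row-unimodal [] v {suc k} f e = zero , (λ { {a} {zero} () _ ; {a} {suc b} _ () }) , λ _ l → asc-tabulate f (subst Asc (sym e) (asc-mI v)) l
 row-unimodal (d ∷ D₀) (valid (d> ∷ dd) (d>m ∷ dm) ai im) {suc k} f e with row-unimodal D₀ (valid dd dm ai im) (f ∘ suc) (∷-injectiveʳ e)
 row-unimodal (d ∷ D₀) {m₀} {I₀} (valid (d> ∷ dd) (d>m ∷ dm) ai im) {suc (suc k)} f e | j , de , as = suc j , desc′ , λ { {suc a} {suc b} (s≤s q) (s≤s l) → as q l }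
   where
   head> : ∀ D₁ {u us} → All (_< d) D₁ → u ∷ us ≡ D₁ ++ m₀ ∷ I₀ → u < d
   head> [] _ refl = d>m
   head> (_ ∷ _) (p ∷ _) refl = p
   first : f (suc zero) < f zero
   first = subst (f (suc zero) <_) (sym (∷-injectiveˡ e)) (head> D₀ d> (∷-injectiveʳ e))
   desc′ : ∀ {a b} → a Fin.< b → b Fin.≤ suc j → f a > f b
   desc′ {zero} {suc zero} _ _ = first
   desc′ {zero} {suc (suc b)} _ (s≤s q) = <-trans (de (s≤s z≤n) q) first
   desc′ {suc a} {suc b} (s≤s l) (s≤s q) = de l q

 rowsOf : ∀ {μ} {A : Set} → Filling A μ → List (List A)
 rowsOf T = tabulate λ i → tabulate λ p → T (cell i p)

 lengths : ∀ {A : Set} → List (List A) → List ℕ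
 lengths = map length

 rowsOf-lengths : ∀ {μ} {A : Set} (T : Filling A μ) → lengths (rowsOf T) ≡ μ
 rowsOf-lengths {[]} T = refl
 rowsOf-lengths {l ∷ μ} T = cong₂ _∷_ (length-tabulate (λ p → T (cell zero p))) (rowsOf-lengths {μ} (λ { (cell i p) → T (cell (suc i) p) }))

 entry : ∀ {A : Set} (L : List (List A)) (i : Fin (length (lengths L))) → Fin (lookup (lengths L) i) → A
 entry (xs ∷ L) zero p = lookup xs p
 entry (xs ∷ L) (suc i) p = entry L i p

 fillOf : ∀ {A : Set} (L : List (List A)) → Filling A (lengths L)
 fillOf L (cell i p) = entry L i p

 rowsOf-fillOf : ∀ {A : Set} (L : List (List A)) → rowsOf (fillOf L) ≡ L
 rowsOf-fillOf [] = refl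
 rowsOf-fillOf (xs ∷ L) = cong₂ _∷_ (tabulate-lookup xs) (rowsOf-fillOf L)

 tabulate-injective : ∀ {A : Set} {k} {f g : Fin k → A} → tabulate f ≡ tabulate g → ∀ i → f i ≡ g i
 tabulate-injective e zero = ∷-injectiveˡ e
 tabulate-injective e (suc i) = tabulate-injective (∷-injectiveʳ e) i

 module Entries {A : Set} {μ : List ℕ} (T : Filling A μ) where

   private L = rowsOf T

   entry⁻ : ∀ {i j x} → T [ i , j ]= x → ∃[ k ] ∃[ p ] ∃[ xs ] i ≡ suc k × j ≡ suc k + p × At L k xs × At xs p x
   entry⁻ (cell i p , refl , refl , refl) = toℕ i , toℕ p , _ , refl , refl , at-tabulate⁺ (λ i → tabulate λ p → T (cell i p)) i , at-tabulate⁺ (λ p → T (cell i p)) p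

   entry⁺ : ∀ {k p xs x j} → At L k xs → At xs p x → j ≡ suc k + p → T [ suc k , j ]= x
   entry⁺ a b e with at-tabulate⁻ (λ i → tabulate λ p → T (cell i p)) a
   ... | i , refl , refl with at-tabulate⁻ (λ p → T (cell i p)) b
   ... | p , refl , refl = cell i p , refl , sym e , refl

 module _ {μ : List ℕ} (T : Filling ℕ μ) where
   open Entries T
   private L = rowsOf T

   sdt-avoid : IsSDT μ T → ∀ {k rs ss} → At L k rs → At L (suc k) ss → Avoid rs ss
   sdt-avoid t {k} a b = record
     { av-i = λ r s q → IsSDT.avoids-i t (entry⁺ a r (sym (+-identityʳ _))) (entry⁺ b s refl) q
     ; av-ii = λ {p} l r s s′ → IsSDT.avoids-ii t (s≤s (s≤s (+-monoʳ-< k l))) (entry⁺ a r (up p)) (entry⁺ b s refl) (entry⁺ b s′ refl)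
     ; av-iii = λ {p} l r₀ r s s′ → IsSDT.avoids-iii t (s≤s (s≤s (+-monoʳ-< k l))) (entry⁺ a r₀ refl) (entry⁺ a r (up p)) (entry⁺ b s refl) (entry⁺ b s′ refl)
     ; av-iv = λ {p} {p′} l r′ r s → IsSDT.avoids-iv t (s≤s (s≤s (+-monoʳ-≤ k l))) (entry⁺ a r′ refl) (entry⁺ a r (up p)) (entry⁺ b s refl)
     ; av-v = λ {p} r₀ r s → IsSDT.avoids-v t (entry⁺ a r₀ refl) (entry⁺ a r (up p)) (entry⁺ b s refl)
     }
     where
     up : ∀ p → suc (suc k) + p ≡ suc k + suc p
     up p = sym (+-suc (suc k) p)

   avoid-sdt : (∀ i → Unimodal (λ p → T (cell i p))) → (∀ {k rs ss} → At L k rs → At L (suc k) ss → Avoid rs ss) → IsSDT μ T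
   avoid-sdt uni av = record { unimodal = uni ; avoids-i = i′ ; avoids-ii = ii′ ; avoids-iii = iii′ ; avoids-iv = iv′ ; avoids-v = v′ }
     where
     down : ∀ {k p p₂} → suc k + p ≡ suc (suc k) + p₂ → p ≡ suc p₂
     down {k} {p} {p₂} e = +-cancelˡ-≡ (suc k) p (suc p₂) (trans e (sym (+-suc (suc k) p₂)))
     move : ∀ {xs : List ℕ} {p q x} → At xs p x → p ≡ q → At xs q x
     move a refl = a
     i′ : ∀ {i j r s} → T [ i , i ]= r → T [ suc i , j ]= s → ¬ (s ≥ r)
     i′ r s q with entry⁻ r | entry⁻ s
     ... | k , p , xs , refl , e , a , x | .(suc k) , p₂ , ys , refl , e₂ , b , y =
           Avoid.av-i (av a b) (move x (sym (+-cancelˡ-≡ (suc k) 0 p (trans (+-identityʳ _) e)))) y q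
     ii′ : ∀ {i j j′ r s s′} → j < j′ → T [ i , j ]= r → T [ suc i , j ]= s → T [ suc i , j′ ]= s′ → ¬ (r ≤ s′ × s′ < s)
     ii′ l r s s′ with entry⁻ r | entry⁻ s | entry⁻ s′
     ... | k , p , xs , refl , e , a , x | .(suc k) , p₂ , ys , refl , e₂ , b , y | .(suc k) , p₃ , zs , refl , e₃ , c , z with at-functional b c
     ... | refl = Avoid.av-ii (av a b) (+-cancelˡ-< (suc (suc k)) p₂ p₃ (subst₂ _<_ e₂ e₃ l)) (move x (down {k} (trans (sym e) e₂))) y z
     iii′ : ∀ {i j j′ r₀ r s s′} → j < j′ → T [ i , pred j ]= r₀ → T [ i , j ]= r → T [ suc i , j ]= s → T [ suc i , j′ ]= s′ → ¬ (r₀ < r × s < s′ × s′ ≤ r)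
     iii′ l r₀ r s s′ with entry⁻ r₀ | entry⁻ r | entry⁻ s | entry⁻ s′
     ... | k₀ , p₀ , ws , e₀ , f₀ , a₀ , w | k , p , xs , refl , e , a , x | .(suc k) , p₂ , ys , refl , e₂ , b , y | .(suc k) , p₃ , zs , refl , e₃ , c , z with suc-injective e₀
     ... | refl with at-functional b c | at-functional a a₀
     ... | refl | refl = Avoid.av-iii (av a b) (+-cancelˡ-< (suc (suc k)) p₂ p₃ (subst₂ _<_ e₂ e₃ l))
                 (move w (sym (+-cancelˡ-≡ (suc k) p₂ p₀ (trans (sym (cong pred e₂)) f₀)))) (move x (down {k} (trans (sym e) e₂))) y z
     iv′ : ∀ {i j j′ r r′ s} → j′ < j → T [ i , j′ ]= r′ → T [ i , j ]= r → T [ suc i , j ]= s → ¬ (s < r′ × r′ ≤ r)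
     iv′ l r′ r s with entry⁻ r′ | entry⁻ r | entry⁻ s
     ... | k₀ , p₀ , ws , e₀ , f₀ , a₀ , w | k , p , xs , refl , e , a , x | .(suc k) , p₂ , ys , refl , e₂ , b , y with suc-injective e₀
     ... | refl with at-functional a a₀
     ... | refl = Avoid.av-iv (av a b) (+-cancelˡ-≤ (suc k) p₀ p₂ (s≤s⁻¹ (subst₂ _<_ f₀ e₂ l))) w (move x (down {k} (trans (sym e) e₂))) y
     v′ : ∀ {i j r₀ r s} → T [ i , pred j ]= r₀ → T [ i , j ]= r → T [ suc i , j ]= s → ¬ (s ≤ r₀ × r₀ < r)
     v′ r₀ r s with entry⁻ r₀ | entry⁻ r | entry⁻ s
     ... | k₀ , p₀ , ws , e₀ , f₀ , a₀ , w | k , p , xs , refl , e , a , x | .(suc k) , p₂ , ys , refl , e₂ , b , y with suc-injective e₀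
     ... | refl with at-functional a a₀
     ... | refl = Avoid.av-v (av a b) (move w (sym (+-cancelˡ-≡ (suc k) p₂ p₀ (trans (sym (cong pred e₂)) f₀)))) (move x (down {k} (trans (sym e) e₂))) y

 rows-tab : ∀ L → (∀ {k xs} → At L k xs → ∃[ R ] xs ≡ flat R × Valid R) → (∀ {k rs ss} → At L k rs → At L (suc k) ss → Avoid rs ss) →
            Linked _>_ (lengths L) → ∃[ t ] L ≡ map flat t × Tab t
 rows-tab [] _ _ _ = [] , refl , []
 rows-tab (xs ∷ L) rw av dec with rw here | rows-tab L (λ a → rw (there a)) (λ a b → av (there a) (there b)) (tail dec)
   where
   tail : ∀ {x xs} → Linked _>_ (x ∷ xs) → Linked _>_ xs
   tail [-] = []
   tail (_ ∷ l) = l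
 ... | R , refl , vR | [] , refl , [] = R ∷ [] , refl , add vR (compat (uc (λ { (inj₁ ()) ; (inj₂ ()) }) (λ { pt → positive pt })) (≤-trans (s≤s z≤n) (≤-reflexive (sym (len-XY (D R) (I R)))))) []
   where
   positive : ∀ {v} → Pt (D R) (m R ∷ I R) v → 0 < length (D R) + lt v (m R ∷ I R)
   positive (inj₁ v∈) = ≤-trans (≤-<-trans z≤n (gt-< v∈)) (m≤m+n _ _)
   positive (inj₂ (r , r∈ , refl)) = ≤-trans (≤-<-trans z≤n (lt-mem {u = r} r∈ ≤-refl ≤-refl)) (m≤n+m _ _)
 rows-tab (xs ∷ L) rw av (l ∷ _) | R , refl , vR | Q ∷ t , refl , T@(add vQ _ _) = R ∷ Q ∷ t , refl ,
   add vR (Equivalence.from (compat⇔avoid vR vQ (subst (_< length (flat R)) (sym (size-flat Q)) l)) (av here (there here))) T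

 tab-avoid : ∀ {t} → Tab t → ∀ {k rs ss} → At (map flat t) k rs → At (map flat t) (suc k) ss → Avoid rs ss
 tab-avoid (add v c (add v′ _ _)) here (there here) = Equivalence.to (compat⇔avoid v v′ (shorter c)) c
 tab-avoid (add _ _ T) (there a) (there b) = tab-avoid T a b

 tab-row : ∀ {t} → Tab t → ∀ {k xs} → At (map flat t) k xs → ∃[ R ] xs ≡ flat R × Valid R
 tab-row (add {R} v _ _) here = R , refl , v
 tab-row (add _ _ T) (there a) = tab-row T a

 sdt⇒tab : ∀ {μ} (T : Filling ℕ μ) → Linked _>_ μ → IsSDT μ T → ∃[ t ] rowsOf T ≡ map flat t × Tab t
 sdt⇒tab {μ} T dec t = rows-tab (rowsOf T) rw (sdt-avoid T t) (subst (Linked _>_) (sym (rowsOf-lengths T)) dec)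
   where
   rw : ∀ {k xs} → At (rowsOf T) k xs → ∃[ R ] xs ≡ flat R × Valid R
   rw a with at-tabulate⁻ (λ i → tabulate λ p → T (cell i p)) a
   ... | i , _ , refl = unimodal-row (λ p → T (cell i p)) (IsSDT.unimodal t i)

 tab⇒sdt : ∀ {μ t} (T : Filling ℕ μ) → rowsOf T ≡ map flat t → Tab t → IsSDT μ T
 tab⇒sdt {μ} {t} T e tab = avoid-sdt T uni (λ {k} {rs} {ss} a b → tab-avoid tab (subst (λ w → At w k rs) e a) (subst (λ w → At w (suc k) ss) e b))
   where
   uni : ∀ i → Unimodal (λ p → T (cell i p))
   uni i with tab-row tab (subst (λ w → At w (toℕ i) _) e (at-tabulate⁺ (λ i → tabulate λ p → T (cell i p)) i))
   ... | R , f , v = row-unimodal (D R) v (λ p → T (cell i p)) f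

 concat-rows : ∀ t → concat (reverse (map flat t)) ≡ reading t
 concat-rows [] = refl
 concat-rows (R ∷ t) = trans (cong concat (unfold-reverse (flat R) (map flat t))) (trans (sym (concat-++ (reverse (map flat t)) (flat R ∷ [])))
   (cong₂ _++_ (concat-rows t) (++-identityʳ (flat R))))

 flats-injective : ∀ {t u} → Tab t → Tab u → map flat t ≡ map flat u → t ≡ u
 flats-injective [] [] _ = refl
 flats-injective (add v _ T) (add v′ _ U) e = cong₂ _∷_ (flat-injective v v′ (∷-injectiveˡ e)) (flats-injective T U (∷-injectiveʳ e))

-- Set-valued tableaux as sequences of corners

module SetValued where

 open Cardinality
 open Insertion using (Rem; only; end; next; added; kept; Code; []; _∷_; top)
 open Fillings using (At; here; there; at-functional; tabulate-injective)
 open import Data.Bool using (Bool; true; false)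
 import Data.Bool as Bool
 open import Data.Fin as Fin using (Fin; zero; suc; toℕ; fromℕ<; opposite)
 open import Data.Fin.Properties as Fin using (toℕ-injective; toℕ-fromℕ<; toℕ<n; opposite-involutive; opposite-prop)
 open import Data.Fin.Subset using (Subset) renaming (_∈_ to _∈ˢ_)
 open import Data.Fin.Subset.Properties using (⊆-antisym)
 open import Data.List using (tabulate; lookup; filter; upTo; cartesianProduct)
 open import Data.List.Properties using (tabulate-lookup; tabulate-cong; length-tabulate)
 open import Data.List.Membership.Propositional.Properties using (∈-filter⁺; ∈-filter⁻; ∈-cartesianProduct⁺; ∈-upTo⁺; ∈-tabulate⁺; ∈-tabulate⁻; ∈-lookup)
 open import Data.List.Relation.Unary.Linked using ([]; [-]; _∷_)
 open import Data.List.Relation.Unary.Unique.Propositional using (Unique)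
 import Data.List.Relation.Unary.Unique.Propositional.Properties as Unique
 open import Data.Nat.Properties hiding (_≟_; _<?_)
 import Data.Product.Properties as Product
 open import Data.Vec as Vec using (Vec)
 import Data.Vec.Properties as Vec
 open import Relation.Nullary.Decidable using (map′; dec-true; dec-false)

 Pos : Set
 Pos = ℕ × ℕ

 _≟ᵖ_ : (c d : Pos) → Dec (c ≡ d)
 _≟ᵖ_ = Product.≡-dec _≟_ _≟_

 open DecMem _≟ᵖ_ using (_∈?_)

 -- Succ c d: the cell d is the right or the lower neighbour of c; cells are given by row and offset, counted from 0.
 data Succ : Pos → Pos → Set where
   right : ∀ {k p} → Succ (k , p) (k , suc p)
   below : ∀ {k p} → Succ (k , suc p) (suc k , p)

 -- Positivity of the last part is the case of an empty tail, whose `top` is 0.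
 data StrictD : List ℕ → Set where
   [] : StrictD []
   _∷_ : ∀ {l μ} → top μ < l → StrictD μ → StrictD (l ∷ μ)

 strict⇒D : ∀ {μ} → Strict μ → StrictD μ
 strict⇒D {[]} _ = []
 strict⇒D {l ∷ []} (_ , p ∷ _) = p ∷ []
 strict⇒D {l ∷ k ∷ μ} (q ∷ qs , _ ∷ ps) = q ∷ strict⇒D (qs , ps)

 D⇒strict : ∀ {μ} → StrictD μ → Strict μ
 D⇒strict [] = [] , []
 D⇒strict (p ∷ []) = [-] , p ∷ []
 D⇒strict (p ∷ d@(q ∷ _)) = let l , a = D⇒strict d in p ∷ l , ≤-<-trans z≤n p ∷ a

 In : List ℕ → Pos → Set
 In μ (k , p) = ∃[ l ] At μ k l × p < l

 rem-functional : ∀ {μ i ν ν′} → Rem μ i ν → Rem μ i ν′ → ν ≡ ν′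
 rem-functional only only = refl
 rem-functional only (end ())
 rem-functional (end ()) only
 rem-functional (end _) (end _) = refl
 rem-functional (next r) (next r′) = cong (_ ∷_) (rem-functional r r′)

 rem? : ∀ μ i → Dec (∃[ ν ] Rem μ i ν)
 rem? [] i = no λ { (_ , ()) }
 rem? (zero ∷ μ) zero = no λ { (_ , ()) }
 rem? (suc l ∷ μ) zero with top μ <? l
 ... | yes p = yes (_ , end p)
 ... | no n = unit l μ n
   where
   unit : ∀ l μ → ¬ top μ < l → Dec (∃[ ν ] Rem (suc l ∷ μ) 0 ν)
   unit zero [] _ = yes (_ , only)
   unit zero (_ ∷ _) n = no λ { (_ , end q) → n q }
   unit (suc l) μ n = no λ { (_ , end q) → n q }
 rem? (l ∷ μ) (suc i) = map′ (λ { (ν , r) → l ∷ ν , next r }) (λ { (_ , next r) → _ , r }) (rem? μ i)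

 rem-sum : ∀ {μ i ν} → Rem μ i ν → sum μ ≡ suc (sum ν)
 rem-sum only = refl
 rem-sum (end _) = refl
 rem-sum (next {l} r) = trans (cong (l +_) (rem-sum r)) (+-suc l _)

 rem-top : ∀ {μ i ν} → Rem μ i ν → top ν ≤ top μ
 rem-top only = z≤n
 rem-top (end _) = n≤1+n _
 rem-top (next _) = ≤-refl

 rem-strict : ∀ {μ i ν} → Rem μ i ν → StrictD μ → StrictD ν
 rem-strict only _ = []
 rem-strict (end p) (_ ∷ d) = p ∷ d
 rem-strict (next r) (q ∷ d) = ≤-<-trans (rem-top r) q ∷ rem-strict r d

 rem-row : ∀ {μ i ν} → Rem μ i ν → i < length μ
 rem-row only = z<s
 rem-row (end _) = z<s
 rem-row (next r) = s<s (rem-row r)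

 rem-length : ∀ {μ i ν} → Rem μ i ν → length ν ≤ length μ
 rem-length only = z≤n
 rem-length (end _) = ≤-refl
 rem-length (next r) = s≤s (rem-length r)

 rem-at : ∀ {μ i ν} → Rem μ i ν → ∃[ p ] At μ i (suc p)
 rem-at only = 0 , here
 rem-at (end {l} _) = l , here
 rem-at (next r) = let p , a = rem-at r in p , there a

 top-in : ∀ {μ p l} → At μ 0 l → p < l → p < top μ
 top-in here q = q

 rem-succ : ∀ {μ i ν p d} → Rem μ i ν → At μ i (suc p) → Succ (i , p) d → ¬ In μ d
 rem-succ r a right (l , b , q) with at-functional a b
 ... | refl = <-irrefl refl q
 rem-succ (end t) here below (l , there b , q) = <⇒≱ (top-in b q) (s≤s⁻¹ t)
 rem-succ (next r) (there a) below (l , there b , q) = rem-succ r a below (l , b , q)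

 rem-in : ∀ {μ i ν p} → Rem μ i ν → At μ i (suc p) → ∀ {d} → In μ d ⇔ (d ≡ (i , p) ⊎ In ν d)
 rem-in only here = mk⇔ (λ { (_ , here , s≤s z≤n) → inj₁ refl }) (λ { (inj₁ refl) → _ , here , ≤-refl ; (inj₂ (_ , () , _)) })
 rem-in {p = p} (end t) here = mk⇔ f g
   where
   f : ∀ {d} → In _ d → d ≡ (0 , p) ⊎ In _ d
   f (_ , here , s≤s q) with m≤n⇒m<n∨m≡n q
   ... | inj₁ l = inj₂ (_ , here , l)
   ... | inj₂ refl = inj₁ refl
   f (l , there b , q) = inj₂ (l , there b , q)
   g : ∀ {d} → d ≡ (0 , p) ⊎ In _ d → In _ d
   g (inj₁ refl) = _ , here , ≤-refl
   g (inj₂ (_ , here , q)) = _ , here , m<n⇒m<1+n q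
   g (inj₂ (l , there b , q)) = l , there b , q
 rem-in {i = suc i} {p = p} (next {l} {μ} {i} {ν} r) (there a) = mk⇔ f g
   where
   open module E {d} = Equivalence (rem-in r a {d})
   f : ∀ {d} → In (l ∷ μ) d → d ≡ (suc i , p) ⊎ In (l ∷ ν) d
   f (_ , here , q) = inj₂ (_ , here , q)
   f {suc k , j} (_ , there b , q) with E.to (_ , b , q)
   ... | inj₁ refl = inj₁ refl
   ... | inj₂ (_ , b′ , q′) = inj₂ (_ , there b′ , q′)
   g : ∀ {d} → d ≡ (suc i , p) ⊎ In (l ∷ ν) d → In (l ∷ μ) d
   g (inj₁ refl) = let _ , b , q = E.from (inj₁ refl) in _ , there b , q
   g (inj₂ (_ , here , q)) = _ , here , q
   g {suc k , j} (inj₂ (_ , there b , q)) = let _ , b′ , q′ = E.from (inj₂ (_ , b , q)) in _ , there b′ , q′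

 rem-not-in : ∀ {μ i ν p} → Rem μ i ν → At μ i (suc p) → ¬ In ν (i , p)
 rem-not-in only here (_ , () , _)
 rem-not-in (end _) here (_ , here , q) = <-irrefl refl q
 rem-not-in (next r) (there a) (_ , there b , q) = rem-not-in r a (_ , b , q)

 last-box : ∀ p {μ} → top μ < suc p → StrictD μ → (∀ {d} → Succ (0 , p) d → ¬ In (suc p ∷ μ) d) → ∃[ ν ] Rem (suc p ∷ μ) 0 ν
 last-box zero {[]} _ _ _ = _ , only
 last-box zero {zero ∷ μ} _ (() ∷ _) _
 last-box zero {suc k ∷ μ} (s≤s ()) _ _
 last-box (suc p) {[]} _ _ _ = _ , end z<s
 last-box (suc p) {k ∷ μ} _ _ n = _ , end (≰⇒> λ q → n below (k , there here , q))

 corner-rem : ∀ {μ k p} → StrictD μ → In μ (k , p) → (∀ {d} → Succ (k , p) d → ¬ In μ d) → ∃[ ν ] Rem μ k ν × At μ k (suc p)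
 corner-rem {l ∷ μ} {zero} {p} (t ∷ s) (_ , here , q) n with ≤-antisym q (≮⇒≥ λ q′ → n right (_ , here , q′))
 ... | refl = let ν , r = last-box p t s n in ν , r , here
 corner-rem {l ∷ μ} {suc k} {p} (t ∷ s) (_ , there a , q) n with corner-rem s (_ , a , q) (λ { right (_ , b , r) → n right (_ , there b , r) ; below (_ , b , r) → n below (_ , there b , r) })
 ... | ν , r , b = l ∷ ν , next r , there b

 -- The list holds the cells of n, n - 1, ..., 1. A later entry belongs to a smaller number, so it
 -- must not be the right or lower neighbour of an earlier one.
 Ord : List Pos → Set
 Ord = AllPairs (λ c d → ¬ Succ c d)

 Occ : List ℕ → List Pos → Set
 Occ μ ps = ∀ {d} → d ∈ ps ⇔ In μ d

 fresh : Pos → List Pos → Bool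
 fresh c ps = Bool.not (does (c ∈? ps))

 -- The cells of n, n - 1, … determine a sequence of corners; a corner is added when its cell was empty before.
 enc : List Pos → List (ℕ × Bool)
 enc [] = []
 enc (c ∷ ps) = (proj₁ c , fresh c ps) ∷ enc ps

 fresh-no : ∀ {c ps} → c ∈ ps → fresh c ps ≡ false
 fresh-no {c} {ps} p = cong Bool.not (dec-true (c ∈? ps) p)

 fresh-yes : ∀ {c ps} → ¬ c ∈ ps → fresh c ps ≡ true
 fresh-yes {c} {ps} p = cong Bool.not (dec-false (c ∈? ps) p)

 succ-irrefl : ∀ {c} → ¬ Succ c c
 succ-irrefl ()

 record Last (μ : List ℕ) (k p : ℕ) (ps : List Pos) : Set where
   constructor lastly
   field
     ν : List ℕ
     rem : Rem μ k ν
     at : At μ k (suc p)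
     rest : ((k , p) ∈ ps × Occ μ ps) ⊎ (¬ (k , p) ∈ ps × Occ ν ps)

 -- A right or lower neighbour would have to hold a larger number, so the cell of the largest number
 -- is a corner. It stays in the shape of the rest exactly if smaller numbers occupy it as well.
 last-of : ∀ {μ k p ps} → StrictD μ → Ord ((k , p) ∷ ps) → Occ μ ((k , p) ∷ ps) → Last μ k p ps
 last-of {μ} {k} {p} {ps} s (o ∷ _) occ with corner-rem s (Equivalence.to occ (here refl)) no-succ
   where
   no-succ : ∀ {d} → Succ (k , p) d → ¬ In μ d
   no-succ q i with Equivalence.from occ i
   ... | here refl = succ-irrefl q
   ... | there d∈ = All.lookup o d∈ q
 ... | ν , r , a with (k , p) ∈? ps
 ... | yes c∈ = lastly ν r a (inj₁ (c∈ , mk⇔ (λ d∈ → Equivalence.to occ (there d∈)) λ i → shrink (Equivalence.from occ i)))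
   where
   shrink : ∀ {d} → d ∈ (k , p) ∷ ps → d ∈ ps
   shrink (here refl) = c∈
   shrink (there d∈) = d∈
 ... | no c∉ = lastly ν r a (inj₂ (c∉ , mk⇔ (λ d∈ → old d∈ (Equivalence.to (rem-in r a) (Equivalence.to occ (there d∈)))) λ i → back i (Equivalence.from occ (Equivalence.from (rem-in r a) (inj₂ i)))))
   where
   old : ∀ {d} → d ∈ ps → d ≡ (k , p) ⊎ In ν d → In ν d
   old d∈ (inj₁ refl) = ⊥-elim (c∉ d∈)
   old d∈ (inj₂ i) = i
   back : ∀ {d} → In ν d → d ∈ (k , p) ∷ ps → d ∈ ps
   back i (here refl) = ⊥-elim (rem-not-in r a i)
   back i (there d∈) = d∈

 empty-shape : ∀ {μ} → StrictD μ → Occ μ [] → μ ≡ []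
 empty-shape [] _ = refl
 empty-shape {l ∷ μ} (t ∷ _) occ = ⊥-elim (none (Equivalence.from occ (l , here , ≤-<-trans z≤n t)))
   where
   none : ¬ (0 , 0) ∈ []
   none ()

 enc-code : ∀ {μ ps} → StrictD μ → Ord ps → Occ μ ps → Code μ (enc ps)
 enc-code {ps = []} s _ occ with empty-shape s occ
 ... | refl = []
 enc-code {μ} {(k , p) ∷ ps} s o@(_ ∷ o′) occ with last-of s o occ
 ... | lastly ν r a (inj₁ (c∈ , occ′)) = subst (λ f → Code μ ((k , f) ∷ enc ps)) (sym (fresh-no c∈)) (kept r ∷ enc-code s o′ occ′)
 ... | lastly ν r a (inj₂ (c∉ , occ′)) = subst (λ f → Code μ ((k , f) ∷ enc ps)) (sym (fresh-yes c∉)) (added r ∷ enc-code (rem-strict r s) o′ occ′)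

 -- A strict shape has at most one corner in each row, so the row index determines the cell; the bit
 -- then determines the shape left for the remaining numbers.
 enc-injective : ∀ {μ ps qs} → StrictD μ → Ord ps → Occ μ ps → Ord qs → Occ μ qs → enc ps ≡ enc qs → ps ≡ qs
 enc-injective {ps = []} {[]} _ _ _ _ _ _ = refl
 enc-injective {ps = (k , p) ∷ ps} {(j , q) ∷ qs} s o@(_ ∷ o₁) occ o′@(_ ∷ o₂) occ′ e with cong proj₁ (∷-injectiveˡ e) | cong proj₂ (∷-injectiveˡ e)
 ... | refl | f with last-of s o occ | last-of s o′ occ′
 ... | lastly ν r a x | lastly ν′ r′ a′ x′ with rem-functional r r′ | at-functional a a′
 ... | refl | refl = cong ((k , p) ∷_) (by x x′)
   where
   by : ((k , p) ∈ ps × Occ _ ps) ⊎ (¬ (k , p) ∈ ps × Occ ν ps) → ((k , p) ∈ qs × Occ _ qs) ⊎ (¬ (k , p) ∈ qs × Occ ν qs) → ps ≡ qs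
   by (inj₁ (_ , u)) (inj₁ (_ , v)) = enc-injective s o₁ u o₂ v (∷-injectiveʳ e)
   by (inj₂ (_ , u)) (inj₂ (_ , v)) = enc-injective (rem-strict r s) o₁ u o₂ v (∷-injectiveʳ e)
   by (inj₁ (u , _)) (inj₂ (v , _)) = contradiction (trans (sym (fresh-no u)) (trans f (fresh-yes v))) λ ()
   by (inj₂ (u , _)) (inj₁ (v , _)) = contradiction (trans (sym (fresh-yes u)) (trans f (fresh-no v))) λ ()

 enc-onto : ∀ {μ c} → StrictD μ → Code μ c → ∃[ ps ] Ord ps × Occ μ ps × enc ps ≡ c
 enc-onto _ [] = [] , [] , mk⇔ (λ ()) (λ { (_ , () , _) }) , refl
 enc-onto s (_∷_ {i = k} (kept r) cd) with enc-onto s cd | rem-at r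
 ... | ps , o , occ , e | p , a = (k , p) ∷ ps , All.tabulate (λ d∈ q → rem-succ r a q (Equivalence.to occ d∈)) ∷ o ,
       mk⇔ (λ { (here refl) → suc p , a , ≤-refl ; (there d∈) → Equivalence.to occ d∈ }) (λ i → there (Equivalence.from occ i)) ,
       cong₂ _∷_ (cong (k ,_) (fresh-no (Equivalence.from occ (suc p , a , ≤-refl)))) e
 enc-onto s (_∷_ {i = k} (added r) cd) with enc-onto (rem-strict r s) cd | rem-at r
 ... | ps , o , occ , e | p , a = (k , p) ∷ ps , All.tabulate (λ d∈ q → rem-succ r a q (Equivalence.from (rem-in r a) (inj₂ (Equivalence.to occ d∈)))) ∷ o ,
       mk⇔ (λ { (here refl) → suc p , a , ≤-refl ; (there d∈) → Equivalence.from (rem-in r a) (inj₂ (Equivalence.to occ d∈)) })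
           (λ i → [ (λ { refl → here refl }) , (λ j → there (Equivalence.from occ j)) ]′ (Equivalence.to (rem-in r a) i)) ,
       cong₂ _∷_ (cong (k ,_) (fresh-yes (λ c∈ → rem-not-in r a (Equivalence.to occ c∈)))) e

 enc-length : ∀ ps → length (enc ps) ≡ length ps
 enc-length [] = refl
 enc-length (_ ∷ ps) = cong suc (enc-length ps)

 code? : ∀ μ c → Dec (Code μ c)
 code? [] [] = yes []
 code? (_ ∷ _) [] = no λ ()
 code? μ ((i , f) ∷ c) with rem? μ i
 ... | no n = no λ { (added r ∷ _) → n (_ , r) ; (kept r ∷ _) → n (_ , r) }
 code? μ ((i , true) ∷ c) | yes (ν , r) = map′ (added r ∷_) (λ { (added r′ ∷ cd) → subst (λ w → Code w c) (rem-functional r′ r) cd }) (code? ν c)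
 code? μ ((i , false) ∷ c) | yes (ν , r) = map′ (kept r ∷_) (λ { (kept _ ∷ cd) → cd }) (code? μ c)

 letters : ℕ → List (ℕ × Bool)
 letters N = cartesianProduct (upTo N) (true ∷ false ∷ [])

 codes : ℕ → List ℕ → List (List (ℕ × Bool))
 codes n μ = filter (code? μ) (words (letters (length μ)) n)

 codes-unique : ∀ n μ → Unique (codes n μ)
 codes-unique n μ = Unique.filter⁺ (code? μ) (words-unique (Unique.cartesianProduct⁺ (Unique.upTo⁺ (length μ)) (((λ ()) ∷ []) ∷ [] ∷ [])) n)

 code-letters : ∀ {μ c N} → length μ ≤ N → Code μ c → All (_∈ letters N) c
 code-letters _ [] = []
 code-letters l (added r ∷ cd) = ∈-cartesianProduct⁺ (∈-upTo⁺ (<-≤-trans (rem-row r) l)) (here refl) ∷ code-letters (≤-trans (rem-length r) l) cd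
 code-letters l (kept r ∷ cd) = ∈-cartesianProduct⁺ (∈-upTo⁺ (<-≤-trans (rem-row r) l)) (there (here refl)) ∷ code-letters l cd

 ∈-codes : ∀ {n μ c} → c ∈ codes n μ ⇔ (Code μ c × length c ≡ n)
 ∈-codes {n} {μ} {c} = mk⇔ (λ p → let q , r = ∈-filter⁻ (code? μ) {xs = words (letters (length μ)) n} p in r , ∈-words⁻ n q)
                           (λ { (cd , refl) → ∈-filter⁺ (code? μ) (∈-words⁺ (code-letters ≤-refl cd)) cd })

 code-size : ∀ {μ c} → Code μ c → sum μ ≤ length c
 code-size [] = z≤n
 code-size (added r ∷ cd) = ≤-trans (≤-reflexive (rem-sum r)) (s≤s (code-size cd))
 code-size (kept r ∷ cd) = ≤-trans (code-size cd) (n≤1+n _)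

 rem-exists : ∀ {l μ} → StrictD (l ∷ μ) → ∃[ i ] ∃[ ν ] Rem (l ∷ μ) i ν
 rem-exists {zero} {[]} (() ∷ _)
 rem-exists {suc zero} {[]} _ = _ , _ , only
 rem-exists {suc (suc l)} {[]} _ = _ , _ , end z<s
 rem-exists {l} {_ ∷ _} (_ ∷ s) = let i , ν , r = rem-exists s in _ , _ , next r

 -- Removing corners one at a time shows that every strict shape can be filled with one number in
 -- each cell. This supplies a word for every tableau.
 full-code : ∀ k {μ} → sum μ ≡ k → StrictD μ → ∃[ c ] Code μ c × length c ≡ sum μ
 full-code k {[]} _ _ = [] , [] , refl
 full-code k {l ∷ μ} e s with rem-exists s
 full-code zero {l ∷ μ} e s | _ , _ , r = contradiction (trans (sym (rem-sum r)) e) λ ()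
 full-code (suc k) {l ∷ μ} e s | i , ν , r with full-code k (suc-injective (trans (sym (rem-sum r)) e)) (rem-strict r s)
 ... | c , cd , f = (i , true) ∷ c , added r ∷ cd , trans (cong suc f) (sym (rem-sum r))

 coord : ∀ {μ} → Cell μ → Pos
 coord (cell i p) = toℕ i , toℕ p

 coord-injective : ∀ {μ} {c d : Cell μ} → coord c ≡ coord d → c ≡ d
 coord-injective {c = cell i p} {cell j q} e with toℕ-injective {i = i} {j} (cong proj₁ e)
 ... | refl with toℕ-injective {i = p} {q} (cong proj₂ e)
 ... | refl = refl

 at-fin : ∀ (μ : List ℕ) i → At μ (toℕ i) (lookup μ i)
 at-fin (_ ∷ μ) zero = here
 at-fin (_ ∷ μ) (suc i) = there (at-fin μ i)

 fin-at : ∀ {μ : List ℕ} {k l} → At μ k l → ∃[ i ] toℕ i ≡ k × lookup μ i ≡ l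
 fin-at here = zero , refl , refl
 fin-at (there a) = let i , e , f = fin-at a in suc i , cong suc e , f

 coord-in : ∀ {μ} (c : Cell μ) → In μ (coord c)
 coord-in {μ} (cell i p) = lookup μ i , at-fin μ i , toℕ<n p

 cell-at : ∀ {μ d} → In μ d → ∃[ c ] coord {μ} c ≡ d
 cell-at (l , a , q) with fin-at a
 ... | i , refl , refl = cell i (fromℕ< q) , cong (toℕ i ,_) (toℕ-fromℕ< q)

 opposite-< : ∀ {n} {i j : Fin n} → i Fin.< j → opposite j Fin.< opposite i
 opposite-< {n} {i} {j} p = subst₂ _<_ (sym (opposite-prop j)) (sym (opposite-prop i)) (∸-monoʳ-< (s≤s p) (toℕ<n j))

 ∈-subset : ∀ {n} {P : Fin n → Set} (P? : ∀ x → Dec (P x)) {x} → x ∈ˢ Vec.tabulate (does ∘ P?) ⇔ P x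
 ∈-subset P? {x} = mk⇔ (λ p → fromTrue (P? x) (trans (sym (Vec.lookup∘tabulate (does ∘ P?) x)) (Vec.[]=⇒lookup p)))
                       (λ p → Vec.lookup⇒[]= x _ (trans (Vec.lookup∘tabulate (does ∘ P?) x) (dec-true (P? x) p)))
   where
   fromTrue : ∀ {A : Set} (d : Dec A) → does d ≡ true → A
   fromTrue (yes a) _ = a

 module _ {n : ℕ} {μ : List ℕ} where

   module Positions {T : Filling (Subset n) μ} (is : IsShSet n μ T) where
     open IsShSet is

     loc : Fin n → Cell μ
     loc x = proj₁ (covers x)

     ∈T : ∀ {x c} → x ∈ˢ T c ⇔ coord (loc x) ≡ coord c
     ∈T {x} {c} = mk⇔ (λ p → cong coord (disjoint (proj₂ (covers x)) p)) (λ e → subst (λ w → x ∈ˢ T w) (coord-injective {c = loc x} {c} e) (proj₂ (covers x)))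

     -- `opposite` puts the largest number first, the order in which corners are removed.
     pls : List Pos
     pls = tabulate (coord ∘ loc ∘ opposite)

     occ : Occ μ pls
     occ {d} = mk⇔ to from
       where
       to : d ∈ pls → In μ d
       to p with ∈-tabulate⁻ {f = coord ∘ loc ∘ opposite} p
       ... | i , refl = coord-in (loc (opposite i))
       from : In μ d → d ∈ pls
       from i with cell-at {μ} i
       ... | c , refl with nonempty c
       ... | x , x∈ = subst (_∈ pls) (trans (cong (coord ∘ loc) (opposite-involutive x)) (Equivalence.to ∈T x∈)) (∈-tabulate⁺ {f = coord ∘ loc ∘ opposite} (opposite x))

     neighbours : ∀ c d {u v} → coord c ≡ u → coord d ≡ v → Succ u v → T c ≺ T d
     neighbours c d f e (right {k} {p}) {x} {y} x∈ y∈ = rows {i = suc k} {j = suc k + p} (c , cong (suc ∘ proj₁) f , cong (λ z → suc (proj₁ z + proj₂ z)) f , refl)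
       (d , cong (suc ∘ proj₁) e , trans (cong (λ z → suc (proj₁ z + proj₂ z)) e) (+-suc (suc k) p) , refl) x∈ y∈
     neighbours c d f e (below {k} {p}) {x} {y} x∈ y∈ = columns {i = suc k} {j = suc k + suc p} (c , cong (suc ∘ proj₁) f , cong (λ z → suc (proj₁ z + proj₂ z)) f , refl)
       (d , cong (suc ∘ proj₁) e , trans (cong (λ z → suc (proj₁ z + proj₂ z)) e) (sym (+-suc (suc k) p)) , refl) x∈ y∈

     ord : Ord pls
     ord = AllPairs.tabulate⁺-< λ {i} {j} i<j q → <-asym (opposite-< i<j)
       (neighbours (loc (opposite i)) (loc (opposite j)) refl refl q (proj₂ (covers (opposite i))) (proj₂ (covers (opposite j))))

     encoding : List (ℕ × Bool)
     encoding = enc pls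

     encoding-length : length encoding ≡ n
     encoding-length = trans (enc-length pls) (length-tabulate (coord ∘ loc ∘ opposite))

 allpairs-lookup : ∀ {A : Set} {R : A → A → Set} {xs : List A} → AllPairs R xs → ∀ {i j} → i Fin.< j → R (lookup xs i) (lookup xs j)
 allpairs-lookup (p ∷ _) {zero} {suc j} _ = All.lookup p (∈-lookup j)
 allpairs-lookup (_ ∷ q) {suc i} {suc j} (s≤s l) = allpairs-lookup q l

 module FromPositions {μ : List ℕ} (ps : List Pos) (o : Ord ps) (occ : Occ μ ps) where

   n : ℕ
   n = length ps

   f : Fin n → Pos
   f x = lookup ps (opposite x)

   T : Filling (Subset n) μ
   T c = Vec.tabulate (λ x → does (f x ≟ᵖ coord c))

   ∈T : ∀ {x} c → x ∈ˢ T c ⇔ f x ≡ coord c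
   ∈T c = ∈-subset (λ x → f x ≟ᵖ coord c)

   in-ps : ∀ {d} → d ∈ ps → ∃[ x ] f x ≡ d
   in-ps p with fin-of p
     where
     fin-of : ∀ {d qs} → d ∈ qs → ∃[ i ] lookup qs i ≡ d
     fin-of (here refl) = zero , refl
     fin-of (there p) = let i , e = fin-of p in suc i , e
   ... | i , e = opposite i , trans (cong (lookup ps) (opposite-involutive i)) e

   increasing : ∀ c d → Succ (coord c) (coord d) → T c ≺ T d
   increasing c d q {x} {y} x∈ y∈ = by (Fin.<-cmp x y)
     where
     fx = Equivalence.to (∈T c) x∈
     fy = Equivalence.to (∈T d) y∈
     by : Tri (x Fin.< y) (x ≡ y) (y Fin.< x) → x Fin.< y
     by (tri< p _ _) = p
     by (tri≈ _ refl _) = ⊥-elim (succ-irrefl (subst (Succ (coord c)) (trans (sym fy) fx) q))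
     by (tri> _ _ p) = ⊥-elim (allpairs-lookup o (opposite-< p) (subst₂ Succ (sym fx) (sym fy) q))

   isShSet : IsShSet n μ T
   isShSet = record
     { nonempty = λ c → let x , e = in-ps (Equivalence.from occ (coord-in c)) in x , Equivalence.from (∈T c) e
     ; covers = λ x → let c , e = cell-at {μ} (Equivalence.to occ (∈-lookup {xs = ps} (opposite x))) in c , Equivalence.from (∈T c) (sym e)
     ; disjoint = λ {x} {c} {d} p q → coord-injective {c = c} {d} (trans (sym (Equivalence.to (∈T c) p)) (Equivalence.to (∈T d) q))
     ; columns = cols
     ; rows = rws
     }
     where
     cols : ∀ {i j A B} → T [ i , j ]= A → T [ suc i , j ]= B → A ≺ B
     cols (c@(cell i p) , refl , refl , refl) (d@(cell i′ p′) , e , f , refl) = increasing c d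
       (subst₂ (λ u w → Succ (toℕ i , u) (w , toℕ p′)) (sym p≡) (sym k≡) below)
       where
       k≡ : toℕ i′ ≡ suc (toℕ i)
       k≡ = suc-injective e
       p≡ : toℕ p ≡ suc (toℕ p′)
       p≡ = +-cancelˡ-≡ (suc (toℕ i)) _ _ (trans (sym f) (trans (cong (λ z → suc z + toℕ p′) k≡) (sym (+-suc (suc (toℕ i)) (toℕ p′)))))
     rws : ∀ {i j A B} → T [ i , j ]= A → T [ i , suc j ]= B → A ≺ B
     rws (c@(cell i p) , refl , refl , refl) (d@(cell i′ p′) , e , f , refl) = increasing c d
       (subst₂ (λ u w → Succ (toℕ i , toℕ p) (u , w)) (sym k≡) (sym p≡) right)
       where
       k≡ : toℕ i′ ≡ toℕ i
       k≡ = suc-injective e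
       p≡ : toℕ p′ ≡ suc (toℕ p)
       p≡ = +-cancelˡ-≡ (suc (toℕ i)) _ _ (trans (cong (λ z → suc z + toℕ p′) (sym k≡)) (trans f (sym (+-suc (suc (toℕ i)) (toℕ p)))))

   same-positions : Positions.pls isShSet ≡ ps
   same-positions = trans (tabulate-cong λ i → trans (sym (Equivalence.to (∈T (loc (opposite i))) (proj₂ (IsShSet.covers isShSet (opposite i))))) (cong (lookup ps) (opposite-involutive i)))
     (tabulate-lookup ps)
     where open Positions isShSet using (loc)

 shSet-card : ∀ n μ → Strict μ → HasCard (ShSet n μ) (length (codes n μ))
 shSet-card n μ st = hasCard (ShSet n μ) (λ { (T , is) → Positions.encoding is }) (codes n μ) (codes-unique n μ)
   (λ {x} {y} → cg {x} {y}) (λ {x} {y} → inj {x} {y})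
   (λ { (T , is) → Equivalence.from ∈-codes (enc-code sμ (Positions.ord is) (Positions.occ is) , Positions.encoding-length is) })
   onto
   where
   sμ : StrictD μ
   sμ = strict⇒D st
   ShT : ℕ → Set
   ShT k = Σ (Filling (Subset k) μ) (IsShSet k μ)
   code : ∀ {k} → ShT k → List (ℕ × Bool)
   code x = Positions.encoding (proj₂ x)
   cg : ∀ {x y : ShT n} → (∀ c → proj₁ x c ≡ proj₁ y c) → Positions.encoding (proj₂ x) ≡ Positions.encoding (proj₂ y)
   cg {T , is} {T′ , is′} e = cong enc (tabulate-cong λ i → sym (Equivalence.to (Positions.∈T is′) (subst (opposite i ∈ˢ_) (e _) (proj₂ (IsShSet.covers is (opposite i))))))
   inj : ∀ {x y : ShT n} → Positions.encoding (proj₂ x) ≡ Positions.encoding (proj₂ y) → ∀ c → proj₁ x c ≡ proj₁ y c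
   inj {T , is} {T′ , is′} e c = ⊆-antisym (λ {x} p → Equivalence.from (Positions.∈T is′) (trans (sym (same x)) (Equivalence.to (Positions.∈T is) p)))
                                           (λ {x} p → Equivalence.from (Positions.∈T is) (trans (same x) (Equivalence.to (Positions.∈T is′) p)))
     where
     same : ∀ x → coord (Positions.loc is x) ≡ coord (Positions.loc is′ x)
     same x = subst (λ w → coord (Positions.loc is w) ≡ coord (Positions.loc is′ w)) (opposite-involutive x)
       (tabulate-injective (enc-injective sμ (Positions.ord is) (Positions.occ is) (Positions.ord is′) (Positions.occ is′) e) (opposite x))
   onto : ∀ {c} → c ∈ codes n μ → Σ (ShT n) λ x → code x ≡ c
   onto {c} c∈ with Equivalence.to (∈-codes {n}) c∈
   ... | cd , l with enc-onto sμ cd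
   ... | ps , o , occ , refl = by n (trans (sym (enc-length ps)) l)
     where
     -- n is generalised so that it can be identified with the length of the list, which is the
     -- number of entries of the constructed filling.
     by : ∀ k → length ps ≡ k → Σ (ShT k) λ x → code x ≡ enc ps
     by k refl = (FromPositions.T ps o occ , FromPositions.isShSet ps o occ) , cong enc (FromPositions.same-positions ps o occ)

-- The expansion of the number of 0-Hecke expressions

open Rows
open Compatibility
open Cardinality
open Hyperoctahedral using (module Element)
open Insertion
open Fillings
open SetValued using (StrictD; []; _∷_; D⇒strict; codes; codes-unique; ∈-codes; code-size; full-code; shSet-card)
open import Data.Bool using (Bool)
open import Data.List using (filter; reverse; deduplicate; upTo; concat)
open import Data.List.Properties using (≡-dec; length-reverse; reverse-involutive; tabulate-cong; map-∘)
open import Data.List.Membership.Propositional.Properties using (∈-filter⁺; ∈-filter⁻; ∈-map⁺; ∈-map⁻; ∈-upTo⁺; ∈-deduplicate⁺; ∈-deduplicate⁻)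
open import Data.List.Relation.Unary.Unique.Propositional using (Unique)
import Data.List.Relation.Unary.Unique.Propositional.Properties as Unique
open import Data.List.Relation.Unary.Unique.DecPropositional.Properties using (deduplicate-!)
open import Data.Vec using (Vec; []; _∷_; toList; fromList)
open import Data.Vec.Properties using (toList∘fromList; length-toList)

toList-injective : ∀ {A : Set} {n} {u v : Vec A n} → toList u ≡ toList v → u ≡ v
toList-injective {u = []} {[]} _ = refl
toList-injective {u = x ∷ u} {y ∷ v} e = cong₂ _∷_ (∷-injectiveˡ e) (toList-injective (∷-injectiveʳ e))

shape-strict : ∀ {t} → Tab t → StrictD (shape t)
shape-strict [] = []
shape-strict {R ∷ t} (add _ c T) = subst (_< length (flat R)) (size-low t) (shorter c) ∷ shape-strict T

lengths-flat : ∀ t → lengths (map flat t) ≡ shape t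
lengths-flat t = sym (map-∘ t)

_≟ᴸ_ : (L M : List (List ℕ)) → Dec (L ≡ M)
_≟ᴸ_ = ≡-dec (≡-dec _≟_)

module Expansion {m : ℕ} (w : SignedPermutation m) where
  open Element w using (hecke?; hecke-letters)

  hecke-≈ : ∀ {as bs} → as ≈ bs → HeckeExpression w bs → HeckeExpression w as
  hecke-≈ e (cs , r , f) = cs , r , ≈-trans e f

  heckeWords : ℕ → List (List ℕ)
  heckeWords k = filter hecke? (words (upTo m) k)

  ∈-heckeWords : ∀ {k v} → v ∈ heckeWords k ⇔ (HeckeExpression w v × length v ≡ k)
  ∈-heckeWords {k} {v} = mk⇔ (λ p → let q , r = ∈-filter⁻ hecke? {xs = words (upTo m) k} p in r , ∈-words⁻ k q)
                             (λ { (h , refl) → ∈-filter⁺ hecke? (∈-words⁺ (All.map ∈-upTo⁺ (hecke-letters h))) h })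

  heckeWords-unique : ∀ k → Unique (heckeWords k)
  heckeWords-unique k = Unique.filter⁺ hecke? (words-unique (Unique.upTo⁺ m) k)

  𝓗-card : ∀ n → HasCard (𝓗 n w) (length (heckeWords n))
  𝓗-card n = hasCard (𝓗 n w) (λ { (v , _) → toList v }) (heckeWords n) (heckeWords-unique n) (cong toList) toList-injective
    (λ { (v , h) → Equivalence.from ∈-heckeWords (h , length-toList v) }) onto
    where
    onto : ∀ {v} → v ∈ heckeWords n → Σ (Σ (Vec ℕ n) (HeckeExpression w ∘ toList)) λ x → toList (proj₁ x) ≡ v
    onto {v} v∈ with Equivalence.to (∈-heckeWords {n}) v∈
    ... | h , refl = (fromList v , subst (HeckeExpression w) (sym (toList∘fromList v)) h) , toList∘fromList v

  P-rows : List ℕ → List (List ℕ)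
  P-rows v = map flat (proj₁ (run-total (reverse v)))

  -- Every tableau of shape μ arises from a word of length |μ|, by adding all its boxes.
  tableaux : List ℕ → List (List (List ℕ))
  tableaux μ = filter (λ L → ≡-dec _≟_ (lengths L) μ) (deduplicate _≟ᴸ_ (map P-rows (heckeWords (sum μ))))

  tableaux-unique : ∀ μ → Unique (tableaux μ)
  tableaux-unique μ = Unique.filter⁺ _ (deduplicate-! _≟ᴸ_ (map P-rows (heckeWords (sum μ))))

  IsTableau : List (List ℕ) → Set
  IsTableau L = ∃[ t ] L ≡ map flat t × Tab t × HeckeExpression w (reading t)

  ∈-tableaux⁻ : ∀ {μ L} → L ∈ tableaux μ → IsTableau L × lengths L ≡ μ
  ∈-tableaux⁻ {μ} p with ∈-filter⁻ (λ L → ≡-dec _≟_ (lengths L) μ) {xs = deduplicate _≟ᴸ_ (map P-rows (heckeWords (sum μ)))} p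
  ... | q , e with ∈-map⁻ P-rows (∈-deduplicate⁻ _≟ᴸ_ (map P-rows (heckeWords (sum μ))) q)
  ... | v , v∈ , refl = let t , c , r = run-total (reverse v) in
          (t , refl , run-tab r , hecke-≈ (≈-trans (≈-sym (run-reading r)) (subst (reverse (reverse v) ≈_) (reverse-involutive v) ≈-refl)) (proj₁ (Equivalence.to (∈-heckeWords {sum μ}) v∈))) , e

  -- `full-code` gives the shape a record in which every corner is added. Undoing the insertions
  -- along it yields a word of length |μ|, and the reading word of the tableau puts it into the same
  -- 0-Hecke class.
  ∈-tableaux⁺ : ∀ {L} → IsTableau L → L ∈ tableaux (lengths L)
  ∈-tableaux⁺ (t , refl , T , h) with full-code (sum (shape t)) refl (shape-strict T)
  ... | c , cd , len with run-onto T cd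
  ... | v , r = ∈-filter⁺ (λ L → ≡-dec _≟_ (lengths L) (lengths (map flat t))) (∈-deduplicate⁺ _≟ᴸ_ (subst (_∈ map P-rows words′) rows≡ (∈-map⁺ P-rows v∈))) refl
    where
    words′ = heckeWords (sum (lengths (map flat t)))
    rows≡ : P-rows (reverse v) ≡ map flat t
    rows≡ with run-total (reverse (reverse v))
    ... | u , d , s with subst (λ z → Run z u d) (reverse-involutive v) s
    ... | s′ = cong (map flat) (proj₁ (run-functional s′ r))
    v∈ : reverse v ∈ words′
    v∈ = Equivalence.from ∈-heckeWords (hecke-≈ (run-reading r) h , trans (length-reverse v) (trans (sym (run-length r)) (trans len (cong sum (sym (lengths-flat t))))))

  SDT-card : ∀ μ → Strict μ → HasCard (SDT w μ) (length (tableaux μ))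
  SDT-card μ st = hasCard (SDT w μ) (λ { (T , _) → rowsOf T }) (tableaux μ) (tableaux-unique μ)
    (λ e → tabulate-cong λ i → tabulate-cong λ p → e (cell i p))
    (λ e → λ { (cell i p) → tabulate-injective (tabulate-injective e i) p })
    mem onto
    where
    mem : ∀ (x : Σ (Filling ℕ μ) (λ T → IsSDT μ T × HeckeExpression w (readingWord T))) → rowsOf (proj₁ x) ∈ tableaux μ
    mem (T , is , h) with sdt⇒tab T (proj₁ st) is
    ... | t , e , tab = subst (λ z → rowsOf T ∈ tableaux z) (rowsOf-lengths T)
          (∈-tableaux⁺ (t , e , tab , subst (HeckeExpression w) (trans (cong (concat ∘ reverse) e) (concat-rows t)) h))
    onto : ∀ {L} → L ∈ tableaux μ → Σ (Σ (Filling ℕ μ) (λ T → IsSDT μ T × HeckeExpression w (readingWord T))) λ x → rowsOf (proj₁ x) ≡ L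
    onto {L} L∈ with ∈-tableaux⁻ {μ} L∈
    ... | (t , e , tab , h) , refl = (fillOf L , tab⇒sdt (fillOf L) (trans (rowsOf-fillOf L) e) tab ,
          subst (HeckeExpression w) (sym (trans (cong (concat ∘ reverse) (trans (rowsOf-fillOf L) e)) (concat-rows t))) h) , rowsOf-fillOf L

  module _ (n : ℕ) where

    targets : List (List (List ℕ) × List (ℕ × Bool))
    targets = pairs tableaux (codes n) (strictPartitions≤ n)

    -- A word is related to its insertion tableau and its record of corners; it is reversed because
    -- a run takes its word from right to left.
    Corr : List ℕ → List (List ℕ) × List (ℕ × Bool) → Set
    Corr v (L , c) = ∃[ t ] Run (reverse v) t c × L ≡ map flat t

    total : ∀ {v} → v ∈ heckeWords n → ∃[ y ] y ∈ targets × Corr v y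
    total {v} v∈ with run-total (reverse v) | Equivalence.to (∈-heckeWords {n}) v∈
    ... | t , c , r | h , len = (map flat t , c) , ∈-pairs⁺ tableaux (codes n)
            (Equivalence.from (∈-strictPartitions≤ n (shape t)) (D⇒strict (shape-strict (run-tab r)) , ≤-trans (code-size (run-code r)) (≤-reflexive clen)))
            (subst (λ z → map flat t ∈ tableaux z) (lengths-flat t)
              (∈-tableaux⁺ (t , refl , run-tab r , hecke-≈ (≈-trans (≈-sym (run-reading r)) (subst (reverse (reverse v) ≈_) (reverse-involutive v) ≈-refl)) h)))
            (Equivalence.from ∈-codes (run-code r , clen)) , t , r , refl
      where
      clen : length c ≡ n
      clen = trans (run-length r) (trans (length-reverse v) len)

    onto : ∀ {y} → y ∈ targets → ∃[ v ] v ∈ heckeWords n × Corr v y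
    onto {L , c} y∈ with ∈-pairs⁻ tableaux (codes n) (strictPartitions≤ n) y∈
    ... | μ , _ , L∈ , c∈ with ∈-tableaux⁻ {μ} L∈ | Equivalence.to (∈-codes {n}) c∈
    ... | (t , refl , T , h) , refl | cd , len with run-onto T (subst (λ z → Code z c) (lengths-flat t) cd)
    ... | v , r = reverse v , Equivalence.from ∈-heckeWords (hecke-≈ (run-reading r) h , trans (length-reverse v) (trans (sym (run-length r)) len)) ,
              t , subst (λ z → Run z t c) (sym (reverse-involutive v)) r , refl

    injective : ∀ {v v′ y} → Corr v y → Corr v′ y → v ≡ v′
    injective {v} {v′} (t , r , e) (t′ , r′ , e′) with flats-injective (run-tab r) (run-tab r′) (trans (sym e) e′)
    ... | refl = trans (sym (reverse-involutive v)) (trans (cong reverse (run-injective r r′)) (reverse-involutive v′))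

    functional : ∀ {v y y′} → Corr v y → Corr v y′ → y ≡ y′
    functional (t , r , refl) (t′ , r′ , refl) with run-functional r r′
    ... | refl , refl = refl

    expansion : length (heckeWords n) ≡ sum (map (λ μ → length (tableaux μ) * length (codes n μ)) (strictPartitions≤ n))
    expansion = trans (length-≡ Corr (heckeWords-unique n)
        -- The shape can be read off from a tableau, so the blocks for different partitions are
        -- disjoint.
        (pairs-unique tableaux (codes n) tableaux-unique (codes-unique n) (λ {μ} {ν} p q → trans (sym (proj₂ (∈-tableaux⁻ {μ} p))) (proj₂ (∈-tableaux⁻ {ν} q))) (strictPartitions≤-unique n))
        total onto (λ {v} {v′} {y} → injective {v} {v′} {y}) (λ {v} {y} {y′} → functional {v} {y} {y′}))
      (length-pairs tableaux (codes n) (strictPartitions≤ n))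

corollary1p2 : ∀ {m} (w : SignedPermutation m) (n : ℕ) →
  Σ ℕ λ h → Σ (List ℕ → ℕ) λ a → Σ (List ℕ → ℕ) λ g →
    HasCard (𝓗 n w) h
    × (∀ μ → Strict μ → HasCard (SDT w μ) (a μ))
    × (∀ μ → Strict μ → HasCard (ShSet n μ) (g μ))
    × h ≡ sum (map (λ μ → a μ * g μ) (strictPartitions≤ n))
corollary1p2 w n = length (E.heckeWords n) , length ∘ E.tableaux , length ∘ codes n ,
  E.𝓗-card n , E.SDT-card , shSet-card n , E.expansion n
  where module E = Expansion w
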